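{- Let $\rho = \sqrt{\sqrt{2}+1}$. The Multicut on Trees (MCT) problem is solvable in time $O^{*}(\rho^{k})$; that is, there is an algorithm that, given an instance $(T,R,k)$ of MCT, correctly decides whether it is a yes-instance in time $\rho^{k}\cdot p(N)$, up to a constant factor, where $N$ is the size of the input instance and $p$ is a fixed polynomial.
   Context: Multicut on Trees (MCT). Given: a tree $T$ (a finite connected acyclic undirected graph), a set $R=\{(u_1,v_1),\ldots,(u_r,v_r)\}$ of pairs of vertices of $T$ (called requests), and a non-negative integer $k$ (the parameter). Question: is there a set $E'\subseteq E(T)$ with $|E'|\le k$ such that for every $i=1,\ldots,r$ there is no path between $u_i$ and $v_i$ in the graph $T-E'=(V(T),E(T)\setminus E')$? An instance is a yes-instance if the answer is yes. The notation $O^{*}(f(k))$ suppresses any factor polynomial in the input length. -}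

module Defs where

open import Algebra.Definitions.RawSemiring using () renaming (_^_ to pow)
open import Data.Bool.Base using (Bool; true; false)
open import Data.Fin.Base as Fin using (Fin; toℕ)
import Data.Fin.Properties as Finₚ
open import Data.Integer.Base using (+_)
open import Data.List.Base using (List; []; _∷_; foldr; filter; length)
open import Data.List.Membership.Propositional using (_∈_)
import Data.List.Membership.DecPropositional as DecMembership
open import Data.List.Relation.Binary.Subset.Propositional using (_⊆_)
open import Data.List.Relation.Unary.All using (All)
import Data.List.Relation.Unary.All.Properties as Allₚ
open import Data.List.Relation.Unary.Unique.Propositional using (Unique)
import Data.List.Relation.Unary.Unique.Propositional.Properties as Uniqueₚ
open import Data.Nat.Base as ℕ using (ℕ; zero; suc; NonZero)
open import Data.Nat.Binary.Base as ℕᵇ using (ℕᵇ; 2[1+_]; 1+[2_])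
open import Data.Product.Base using (_×_; _,_; uncurry; ∃-syntax)
import Data.Product.Properties as Productₚ
open import Data.Rational.Base as ℚ using (ℚ; 0ℚ; 1ℚ)
open import Data.Sum.Base using (_⊎_)
open import Data.Vec.Base as Vec using (Vec; []; _∷_)
open import Relation.Binary.Definitions using (DecidableEquality)
open import Relation.Nullary.Decidable.Core using (¬?)
open import Relation.Nullary.Negation.Core using (¬_)

Edge : ℕ → Set
Edge n = Fin n × Fin n

_≟ᵉ_ : ∀ {n} → DecidableEquality (Edge n)
_≟ᵉ_ = Productₚ.≡-dec Finₚ._≟_ Finₚ._≟_

-- Finite simple undirected graphs. The unordered edge {u,v} is listed
-- once, as (u , v) with u < v, so a duplicate-free list of edges is a
-- set of edges and its length is the cardinality.

record Graph : Set where
  field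
    order   : ℕ
    edges   : List (Edge order)
    ordered : All (uncurry Fin._<_) edges
    unique  : Unique edges

open Graph public

Vertex : Graph → Set
Vertex G = Fin (order G)

Adj : (G : Graph) → Vertex G → Vertex G → Set
Adj G u v = (u , v) ∈ edges G ⊎ (v , u) ∈ edges G

data Walk (G : Graph) : Vertex G → Vertex G → Set where
  stop : ∀ {u} → Walk G u u
  step : ∀ {u v w} → Adj G u v → Walk G v w → Walk G u w

vertices : ∀ {G u v} → Walk G u v → List (Vertex G)
vertices {u = u} stop       = u ∷ []
vertices {u = u} (step _ w) = u ∷ vertices w

Path : (G : Graph) → Vertex G → Vertex G → Set
Path G u v = ∃[ w ] Unique (vertices {G} {u} {v} w)

Connected : Graph → Set
Connected G = NonZero (order G) × (∀ u v → Path G u v)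

-- A cycle is a path on at least three vertices together with an edge
-- joining its two ends.

Cycle : Graph → Set
Cycle G = ∃[ u ] ∃[ v ] ∃[ w ]
  (Unique (vertices {G} {u} {v} w) × 3 ℕ.≤ length (vertices w) × Adj G v u)

record IsTree (G : Graph) : Set where
  field
    connected : Connected G
    acyclic   : ¬ Cycle G

_−_ : (G : Graph) → List (Edge (order G)) → Graph
G − E' = record
  { order   = order G
  ; edges   = filter kept? (edges G)
  ; ordered = Allₚ.filter⁺ kept? (ordered G)
  ; unique  = Uniqueₚ.filter⁺ kept? (unique G)
  }
  where
  open DecMembership _≟ᵉ_ using (_∈?_)
  kept? = λ e → ¬? (e ∈? E')

record Instance : Set where
  field
    T        : Graph
    isTree   : IsTree T
    R        : List (Vertex T × Vertex T)
    R-unique : Unique R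
    k        : ℕ

open Instance public

YesInstance : Instance → Set
YesInstance I = ∃[ E' ]
  ( Unique E'
  × E' ⊆ edges (T I)
  × length E' ℕ.≤ k I
  × (∀ u v → (u , v) ∈ R I → ¬ Path (T I − E') u v))

-- Model of computation: first-order, call-by-value recursive programs on
-- binary trees (S-expressions with the single atom nil). Each rule of
-- the evaluation relation is charged one unit of time. The program is
-- fixed and values are shared pointers, so each rule is O(1) steps of a
-- RAM or pointer machine: there is no unit-cost operation on large data
-- (no tree equality test, no arithmetic).

infixr 5 _∙_

data Val : Set where
  nil : Val
  _∙_ : Val → Val → Val

‖_‖ : Val → ℕ
‖ nil ‖   = 1
‖ a ∙ b ‖ = suc (‖ a ‖ ℕ.+ ‖ b ‖)

-- Expressions over functions of arities `ar` with `n` free variables.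
-- The second branch of `match` binds the two components of a pair (the
-- left one as variable 0); the body of `bind` binds one value.

data Exp {m} (ar : Vec ℕ m) (n : ℕ) : Set where
  var   : Fin n → Exp ar n
  nil   : Exp ar n
  cons  : Exp ar n → Exp ar n → Exp ar n
  bind  : Exp ar n → Exp ar (suc n) → Exp ar n
  match : Exp ar n → Exp ar n → Exp ar (suc (suc n)) → Exp ar n
  call  : (f : Fin m) → Vec (Exp ar n) (Vec.lookup ar f) → Exp ar n

record Program : Set where
  field
    {#functions} : ℕ
    arities      : Vec ℕ #functions
    body         : (f : Fin #functions) → Exp arities (Vec.lookup arities f)
    main         : Exp arities 1

module Evaluation (P : Program) where
  open Program P

  infix 4 _⊢_⇓_⟨_⟩ _⊢_⇓*_⟨_⟩

  mutual
    data _⊢_⇓_⟨_⟩ {n} (γ : Vec Val n) : Exp arities n → Val → ℕ → Set where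

      var : ∀ i → γ ⊢ var i ⇓ Vec.lookup γ i ⟨ 1 ⟩

      nil : γ ⊢ nil ⇓ nil ⟨ 1 ⟩

      cons : ∀ {e₁ e₂ a b s t} →
             γ ⊢ e₁ ⇓ a ⟨ s ⟩ → γ ⊢ e₂ ⇓ b ⟨ t ⟩ →
             γ ⊢ cons e₁ e₂ ⇓ a ∙ b ⟨ suc (s ℕ.+ t) ⟩

      bind : ∀ {e₁ e₂ a b s t} →
             γ ⊢ e₁ ⇓ a ⟨ s ⟩ → a ∷ γ ⊢ e₂ ⇓ b ⟨ t ⟩ →
             γ ⊢ bind e₁ e₂ ⇓ b ⟨ suc (s ℕ.+ t) ⟩

      match-nil : ∀ {e e₁ e₂ c s t} →
                  γ ⊢ e ⇓ nil ⟨ s ⟩ → γ ⊢ e₁ ⇓ c ⟨ t ⟩ →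
                  γ ⊢ match e e₁ e₂ ⇓ c ⟨ suc (s ℕ.+ t) ⟩

      match-∙ : ∀ {e e₁ e₂ a b c s t} →
                γ ⊢ e ⇓ a ∙ b ⟨ s ⟩ → a ∷ b ∷ γ ⊢ e₂ ⇓ c ⟨ t ⟩ →
                γ ⊢ match e e₁ e₂ ⇓ c ⟨ suc (s ℕ.+ t) ⟩

      call : ∀ {f es vs c s t} →
             γ ⊢ es ⇓* vs ⟨ s ⟩ → vs ⊢ body f ⇓ c ⟨ t ⟩ →
             γ ⊢ call f es ⇓ c ⟨ suc (s ℕ.+ t) ⟩

    data _⊢_⇓*_⟨_⟩ {n} (γ : Vec Val n) :
         ∀ {l} → Vec (Exp arities n) l → Vec Val l → ℕ → Set where

      [] : γ ⊢ [] ⇓* [] ⟨ 0 ⟩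

      _∷_ : ∀ {l e v s t} {es : Vec (Exp arities n) l} {vs : Vec Val l} →
            γ ⊢ e ⇓ v ⟨ s ⟩ → γ ⊢ es ⇓* vs ⟨ t ⟩ →
            γ ⊢ e ∷ es ⇓* v ∷ vs ⟨ s ℕ.+ t ⟩

-- P halts on input x with output v after exactly t steps. Evaluation is
-- deterministic, so v and t are determined by P and x.

Runs : Program → Val → Val → ℕ → Set
Runs P x v t = x ∷ [] ⊢ Program.main P ⇓ v ⟨ t ⟩
  where open Evaluation P

-- Numbers, including k, are written in binary.

encodeBool : Bool → Val
encodeBool false = nil
encodeBool true  = nil ∙ nil

encodeℕᵇ : ℕᵇ → Val
encodeℕᵇ ℕᵇ.zero  = nil
encodeℕᵇ 2[1+ x ] = encodeBool false ∙ encodeℕᵇ x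
encodeℕᵇ 1+[2 x ] = encodeBool true ∙ encodeℕᵇ x

encodeℕ : ℕ → Val
encodeℕ n = encodeℕᵇ (ℕᵇ.fromℕ n)

encodePair : ∀ {n} → Fin n × Fin n → Val
encodePair (u , v) = encodeℕ (toℕ u) ∙ encodeℕ (toℕ v)

encodePairs : ∀ {n} → List (Fin n × Fin n) → Val
encodePairs = foldr (λ e v → encodePair e ∙ v) nil

encode : Instance → Val
encode I = encodeℕ (order (T I)) ∙ encodePairs (edges (T I))
         ∙ encodePairs (R I) ∙ encodeℕ (k I)

size : Instance → ℕ
size I = ‖ encode I ‖

-- Coefficients are listed from the constant term upwards.

Polynomial : Set
Polynomial = List ℕ

eval : Polynomial → ℕ → ℕ
eval p x = foldr (λ a y → a ℕ.+ x ℕ.* y) 0 p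

-- A real number is given by the set of all rationals strictly above it.

Upper : Set₁
Upper = ℚ → Set

rational : ℚ → Upper
rational a q = a ℚ.< q

_⊕_ : Upper → ℚ → Upper
(x ⊕ a) q = x (q ℚ.- a)

-- For x ≥ 0:  √x < q  iff  0 < q and x < q².

√_ : Upper → Upper
(√ x) q = 0ℚ ℚ.< q × x (q ℚ.* q)

ρ : Upper
ρ = √ ((√ rational (1ℚ ℚ.+ 1ℚ)) ⊕ 1ℚ)

fromℕ : ℕ → ℚ
fromℕ n = + n ℚ./ 1

_^_ : ℚ → ℕ → ℚ
_^_ = pow ℚ.+-*-rawSemiring

-- t ≤ x^k · c for a real x ≥ 0. As q ↦ q^k · c is continuous and monotone
-- on q ≥ 0, and x is the infimum of the rationals above it, this holds iff
-- t ≤ q^k · c for every rational q > x.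

_≤_↑_·_ : ℕ → Upper → ℕ → ℕ → Set
t ≤ x ↑ k · c = ∀ q → x q → fromℕ t ℚ.≤ (q ^ k) ℚ.* fromℕ c

{-# OPTIONS --safe #-}

module Submission where

-- Root the tree, and let m(v) be the least number of edges of the subtree T(v)
-- below v that separate the requests inside of T(v). An optimal multicut may be
-- assumed to remove exactly m(v) edges of T(v) or the edge above v: if it
-- removes more, replace them by a minimum choice and the edge above v. So all
-- that matters about T(v) is which sets can be the component of v, the piece,
-- after removing m(v) edges. For small m(v) these are at most m(v) + 1 options;
-- otherwise they are described by families of pairs of pieces, where one of each
-- pair is alive and any selection of pairwise compatible alive pieces is allowed.
-- Whether there is one is a 2-SAT question, answered by resolution.
--
-- At a node, m(v) is the sum over the children plus the least d for which the
-- following succeeds: select a family of, or cut off, each child with families,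
-- and select an independent set of options in the graph of conflicts such that
-- only as many options are cut off as the budget allows. The search branches on
-- a vertex with at least three neighbours, on cycles it branches once, and a
-- vertex with a single neighbour yields a free choice between the two, that is a
-- pair of a family. So f(n) = f(n-1) + f(n-3) leaves for n cuts, which grows more
-- slowly than (31/20)^n. That a subtree has at most (31/20)^m - 20/31 families
-- pays for the choice of cutting it off. Since ρ² = 1 + √2, every rational q > ρ
-- exceeds 31/20.

open import Data.Bool.Base using (Bool; true; false; if_then_else_; _∧_; _∨_)
import Data.Bool.Properties as Boolₚ
open import Data.Empty using (⊥; ⊥-elim)
open import Data.Fin.Base as Fin using (Fin; toℕ)
import Data.Fin.Properties as Finₚ
open import Data.List.Base as List using (List; []; _∷_; _++_; length; foldr; concatMap; concat)
import Data.List.Membership.DecPropositional as DecMembership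
open import Data.List.Membership.Propositional using (_∈_; find; lose)
import Data.List.Membership.Propositional.Properties as ∈ₚ
import Data.List.Properties as Listₚ
open import Data.List.Relation.Binary.Permutation.Propositional using (_↭_; ↭-sym; ↭-trans; ↭-refl; prep; ↭-reflexive)
import Data.List.Relation.Binary.Permutation.Propositional.Properties as Permₚ
open import Data.List.Relation.Unary.All as All using (All; []; _∷_)
import Data.List.Relation.Unary.All.Properties as Allₚ
open import Data.List.Relation.Unary.AllPairs as AllPairs using (AllPairs; []; _∷_)
open import Data.List.Relation.Unary.Any using (Any; here; there)
import Data.List.Relation.Unary.Any.Properties as Anyₚ
open import Data.List.Relation.Unary.Unique.Propositional using (Unique)
import Data.List.Relation.Unary.Unique.Propositional.Properties as Uniqueₚ
open import Data.Maybe.Base using (Maybe; just; nothing; zipWith)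
open import Data.Nat.Base using (ℕ; zero; suc; _+_; _*_; z≤n; s≤s; _∸_; pred; _≤′_; ≤′-refl; ≤′-step; NonZero; >-nonZero; _⊓_) renaming (_≤_ to _≤ₙ_; _^_ to _**_; _<_ to _<ₙ_)
import Data.Nat.Binary.Base as ℕᵇ
import Data.Nat.Binary.Properties as ℕᵇₚ
open import Data.Nat.DivMod using (_/_; m/n*n≤m; m*n/n≡m; /-monoˡ-≤)
import Data.Nat.Properties as ℕₚ
open import Data.Nat.Tactic.RingSolver using (solve-∀)
open import Data.Product.Base using (_×_; _,_; proj₁; proj₂; Σ-syntax; ∃-syntax; uncurry)
open import Data.Rational.Base as ℚ using (ℚ; 0ℚ; 1ℚ; toℚᵘ)
import Data.Rational.Properties as ℚₚ
open import Data.Sum.Base using (_⊎_; inj₁; inj₂; swap)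
open import Data.Unit.Base using (⊤; tt)
open import Defs
open import Relation.Binary.PropositionalEquality using (_≡_; refl; sym; trans; cong; cong₂; subst; _≢_)
open import Relation.Nullary.Decidable.Core using (from-no; yes; no; ¬?)
open import Relation.Nullary.Negation.Core using (¬_)
open import Relation.Nullary.Reflects using (Reflects; ofʸ; ofⁿ)

open ℕₚ using (≤-refl; ≤-trans; +-mono-≤; *-mono-≤; m≤m+n; m≤n+m)

-- The growth rate

-- The budget argument rests on the number of options. All options of a child contain its root, so
-- at most one is alive; a child with minimum m and at most m + 1 options adds at most m to the
-- number of options to be discarded at its parent. So the search there has a budget of at most the
-- parent's own minimum, which pays for its f(n) leaves. Families multiply instead: a child with N
-- families and minimum m turns a count g(c) into N g(c) + g(c - 1). If N ≤ β^m - 1/β and g(c) ≤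
-- β^c, this is at most β^(m+c). For m ≤ 1 not even N = 1 meets the bound, and for m = 2 only N ≤ 1
-- does, which is why small minima are turned into options. The value 31/20 lies between the real
-- root 1.4656 of x³ = x² + 1 and ρ = 1.5538. It has to stay clear of the former, since the first
-- values of f and the term 1/β use up part of the gap. Time is counted in the given machine model
-- by way of an interpreter for a first-order language with folds. Polynomial parts are certified by
-- mere composition; only the folds over configurations, bases and families carry the exponential
-- weight.

module _ where

  open import Data.Integer.Base as ℤ using (+_)
  import Data.Integer.Properties as ℤₚ
  open import Data.Rational.Unnormalised.Base as ℚᵘ using (mkℚᵘ; *≡*; *≤*)
  import Data.Rational.Unnormalised.Properties as ℚᵘₚ

  unit-fraction : ∀ n → toℚᵘ (fromℕ n) ℚᵘ.≃ mkℚᵘ (+ n) 0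
  unit-fraction n = ℚₚ.toℚᵘ-fromℚᵘ (mkℚᵘ (+ n) 0)

  fromℕ-* : ∀ m n → fromℕ (m * n) ≡ fromℕ m ℚ.* fromℕ n
  fromℕ-* m n = ℚₚ.toℚᵘ-injective (ℚᵘₚ.≃-trans (unit-fraction (m * n)) (ℚᵘₚ.≃-trans (*≡* (cong (ℤ._* + 1) (ℤₚ.pos-* m n)))
    (ℚᵘₚ.≃-trans (ℚᵘₚ.*-cong (ℚᵘₚ.≃-sym (unit-fraction m)) (ℚᵘₚ.≃-sym (unit-fraction n))) (ℚᵘₚ.≃-sym (ℚₚ.toℚᵘ-homo-* (fromℕ m) (fromℕ n))))))

  fromℕ-mono : ∀ {m n} → m ≤ₙ n → fromℕ m ℚ.≤ fromℕ n
  fromℕ-mono {m} {n} le = ℚₚ.toℚᵘ-cancel-≤ (ℚᵘₚ.≤-respˡ-≃ (ℚᵘₚ.≃-sym (unit-fraction m)) (ℚᵘₚ.≤-respʳ-≃ (ℚᵘₚ.≃-sym (unit-fraction n))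
    (*≤* (ℤₚ.*-monoʳ-≤-nonNeg (+ 1) (ℤ.+≤+ le)))))

  square-mono : ∀ {x y} → 0ℚ ℚ.< x → x ℚ.< y → x ℚ.* x ℚ.< y ℚ.* y
  square-mono {x} {y} 0<x x<y = ℚₚ.<-trans (ℚₚ.*-monoʳ-<-pos x {{ℚ.positive 0<x}} x<y) (ℚₚ.*-monoˡ-<-pos y {{ℚ.positive (ℚₚ.<-trans 0<x x<y)}} x<y)

  opaque
    base : ℚ
    base = + 31 ℚ./ 20

    -- base² - 1 < √2, hence base < ρ.

    base-small : ¬ (1ℚ ℚ.+ 1ℚ ℚ.< (base ℚ.* base ℚ.- 1ℚ) ℚ.* (base ℚ.* base ℚ.- 1ℚ))
    base-small = from-no ((1ℚ ℚ.+ 1ℚ) ℚₚ.<? (base ℚ.* base ℚ.- 1ℚ) ℚ.* (base ℚ.* base ℚ.- 1ℚ))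

    base-scaled : fromℕ 20 ℚ.* base ≡ fromℕ 31
    base-scaled = refl

  -- Contrapositive: were `q` smaller than `base`, squaring twice would carry `2 < (q² - 1)²` over
  -- to `base`, against `base-small`. Clearing the denominator 20 lets all later estimates compare
  -- natural numbers.
  ρ-lower : ∀ {q} → ρ q → fromℕ 31 ℚ.≤ fromℕ 20 ℚ.* q
  ρ-lower {q} (0<q , 0<p , 2<p²) = subst (ℚ._≤ fromℕ 20 ℚ.* q) base-scaled (ℚₚ.*-monoˡ-≤-nonNeg (fromℕ 20) (ℚₚ.≮⇒≥ {q} {base} λ q< →
    base-small (ℚₚ.<-trans 2<p² (square-mono 0<p (ℚₚ.+-monoˡ-< (ℚ.- 1ℚ) (square-mono 0<q q<))))))

  -- Induction on `k` with `t` and `c` varying: each step moves one factor 20 into `t` and one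
  -- factor 31 into `c`, and `31 ≤ 20 q` trades the latter for a factor `q`.
  power-bound : ∀ {q} → 0ℚ ℚ.≤ q → fromℕ 31 ℚ.≤ fromℕ 20 ℚ.* q → ∀ k {t c} → 20 ** k * t ≤ₙ 31 ** k * c → fromℕ t ℚ.≤ (q ^ k) ℚ.* fromℕ c
  power-bound {q} 0≤q h zero {t} {c} le = subst (fromℕ t ℚ.≤_) (sym (ℚₚ.*-identityˡ (fromℕ c)))
    (fromℕ-mono (ℕₚ.≤-trans (ℕₚ.≤-reflexive (sym (ℕₚ.*-identityˡ t))) (ℕₚ.≤-trans le (ℕₚ.≤-reflexive (ℕₚ.*-identityˡ c)))))
  power-bound {q} 0≤q h (suc k) {t} {c} le = ℚₚ.*-cancelˡ-≤-pos (fromℕ 20) (begin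
    fromℕ 20 ℚ.* fromℕ t                        ≡⟨ sym (fromℕ-* 20 t) ⟩
    fromℕ (20 * t)                              ≤⟨ power-bound 0≤q h k shifted ⟩
    (q ^ k) ℚ.* fromℕ (31 * c)                  ≡⟨ cong ((q ^ k) ℚ.*_) (fromℕ-* 31 c) ⟩
    (q ^ k) ℚ.* (fromℕ 31 ℚ.* fromℕ c)          ≤⟨ ℚₚ.*-monoˡ-≤-nonNeg (q ^ k) {{ℚ.nonNegative (power-nonneg k)}}
                                                    (ℚₚ.*-monoʳ-≤-nonNeg (fromℕ c) {{ℚ.nonNegative (fromℕ-mono {0} {c} z≤n)}} h) ⟩
    (q ^ k) ℚ.* ((fromℕ 20 ℚ.* q) ℚ.* fromℕ c)  ≡⟨ rearrange (q ^ k) (fromℕ 20) q (fromℕ c) ⟩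
    fromℕ 20 ℚ.* ((q ^ suc k) ℚ.* fromℕ c)      ∎)
    where
    open ℚₚ.≤-Reasoning
    power-nonneg : ∀ k → 0ℚ ℚ.≤ (q ^ k)
    power-nonneg zero    = ℚₚ.<⇒≤ (ℚₚ.positive⁻¹ 1ℚ)
    power-nonneg (suc k) = subst (ℚ._≤ (q ^ suc k)) (ℚₚ.*-zeroʳ q) (ℚₚ.*-monoˡ-≤-nonNeg q {{ℚ.nonNegative 0≤q}} (power-nonneg k))
    shifted : 20 ** k * (20 * t) ≤ₙ 31 ** k * (31 * c)
    shifted = ℕₚ.≤-trans (ℕₚ.≤-reflexive (trans (sym (ℕₚ.*-assoc (20 ** k) 20 t)) (cong (_* t) (ℕₚ.*-comm (20 ** k) 20))))
      (ℕₚ.≤-trans le (ℕₚ.≤-reflexive (trans (cong (_* c) (ℕₚ.*-comm 31 (31 ** k))) (ℕₚ.*-assoc (31 ** k) 31 c))))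
    rearrange : ∀ a b c d → a ℚ.* ((b ℚ.* c) ℚ.* d) ≡ b ℚ.* ((c ℚ.* a) ℚ.* d)
    rearrange a b c d = trans (cong (a ℚ.*_) (ℚₚ.*-assoc b c d)) (trans (sym (ℚₚ.*-assoc a b (c ℚ.* d))) (trans (cong (ℚ._* (c ℚ.* d)) (ℚₚ.*-comm a b))
      (trans (ℚₚ.*-assoc b a (c ℚ.* d)) (cong (b ℚ.*_) (trans (sym (ℚₚ.*-assoc a c d)) (cong (ℚ._* d) (ℚₚ.*-comm a c)))))))

-- An interpreter and its simulation of terms

module Interpreter where

  open import Data.Fin using () renaming (#_ to ♯_)
  open import Data.Fin.Base using (Fin; zero; suc)
  open import Data.Vec.Base using (Vec; []; _∷_)

  -- Everything is computed by one fixed program, an interpreter for a typed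
  -- first-order language whose only recursion is the right fold over lists.

  infixr 6 _⊗_
  infixr 9 _∘ₜ_

  data Ty : Set where
    val bool unit : Ty
    list     : Ty → Ty
    _⊗_   : Ty → Ty → Ty

  El : Ty → Set
  El val       = Val
  El bool       = Bool
  El unit       = ⊤
  El (list a)   = List (El a)
  El (a ⊗ b) = El a × El b

  enc : ∀ τ → El τ → Val
  enc val x             = x
  enc bool x             = encodeBool x
  enc unit _             = nil
  enc (list a) []        = nil
  enc (list a) (x ∷ xs)  = enc a x ∙ enc (list a) xs
  enc (a ⊗ b) (x , y) = enc a x ∙ enc b y

  _==ᵛ_ : Val → Val → Bool
  nil     ==ᵛ nil     = true
  nil     ==ᵛ (_ ∙ _) = false
  (_ ∙ _) ==ᵛ nil     = false
  (a ∙ b) ==ᵛ (c ∙ d) = if a ==ᵛ c then b ==ᵛ d else false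

  -- Comparing encodings lets a single untyped routine decide equality at every type.
  eqb : ∀ {τ} → El τ → El τ → Bool
  eqb {τ} x y = enc τ x ==ᵛ enc τ y

  -- Point-free: the single argument is the environment, and folds and case distinctions pass it to
  -- their step as the last component. So no closures are needed.
  data Tm : Ty → Ty → Set where
    idₜ   : ∀ {a} → Tm a a
    _∘ₜ_  : ∀ {a b c} → Tm b c → Tm a b → Tm a c
    ⟪_,_⟫ : ∀ {a b c} → Tm a b → Tm a c → Tm a (b ⊗ c)
    fstₜ  : ∀ {a b} → Tm (a ⊗ b) a
    sndₜ  : ∀ {a b} → Tm (a ⊗ b) b
    unitₜ : ∀ {a} → Tm a unit
    boolₜ : ∀ {a} → Bool → Tm a bool
    nilₜ  : ∀ {a b} → Tm a (list b)
    emptyₜ : ∀ {a} → Tm a val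
    consₜ : ∀ {a b} → Tm a b → Tm a (list b) → Tm a (list b)
    ifₜ   : ∀ {a b} → Tm a bool → Tm a b → Tm a b → Tm a b
    caseₜ : ∀ {a b c} → Tm a (list b) → Tm a c → Tm (b ⊗ list b ⊗ a) c → Tm a c
    eqₜ   : ∀ {a b} → Tm a b → Tm a b → Tm a bool
    foldₜ : ∀ {a b c} → Tm a (list b) → Tm a c → Tm (b ⊗ c ⊗ a) c → Tm a c

  caseL : ∀ {A C : Set} → List A → C → (A → List A → C) → C
  caseL []       z s = z
  caseL (a ∷ as) z s = s a as

  ⟦_⟧ : ∀ {a b} → Tm a b → El a → El b
  ⟦ idₜ ⟧ x           = x
  ⟦ g ∘ₜ f ⟧ x        = ⟦ g ⟧ (⟦ f ⟧ x)
  ⟦ ⟪ f , g ⟫ ⟧ x     = ⟦ f ⟧ x , ⟦ g ⟧ x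
  ⟦ fstₜ ⟧ x          = proj₁ x
  ⟦ sndₜ ⟧ x          = proj₂ x
  ⟦ unitₜ ⟧ x         = tt
  ⟦ boolₜ b ⟧ x       = b
  ⟦ nilₜ ⟧ x          = []
  ⟦ emptyₜ ⟧ x        = nil
  ⟦ consₜ f g ⟧ x     = ⟦ f ⟧ x ∷ ⟦ g ⟧ x
  ⟦ ifₜ c f g ⟧ x     = if ⟦ c ⟧ x then ⟦ f ⟧ x else ⟦ g ⟧ x
  ⟦ caseₜ l z s ⟧ x   = caseL (⟦ l ⟧ x) (⟦ z ⟧ x) (λ a as → ⟦ s ⟧ (a , as , x))
  ⟦ eqₜ {b = b} f g ⟧ x = eqb {b} (⟦ f ⟧ x) (⟦ g ⟧ x)
  ⟦ foldₜ l z s ⟧ x   = List.foldr (λ a acc → ⟦ s ⟧ (a , acc , x)) (⟦ z ⟧ x) (⟦ l ⟧ x)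

  tag : ℕ → Val
  tag zero    = nil
  tag (suc n) = nil ∙ tag n

  -- Types are erased, so `unitₜ`, `nilₜ`, `emptyₜ` and `false` share one code. A conditional
  -- becomes a case distinction on the encoded Boolean; its positive branch first drops the two
  -- components of `nil ∙ nil` from the environment.
  ⌜_⌝ : ∀ {a b} → Tm a b → Val
  ⌜ idₜ ⌝         = tag 0 ∙ nil
  ⌜ g ∘ₜ f ⌝      = tag 5 ∙ ⌜ g ⌝ ∙ ⌜ f ⌝
  ⌜ ⟪ f , g ⟫ ⌝   = tag 4 ∙ ⌜ f ⌝ ∙ ⌜ g ⌝
  ⌜ fstₜ ⌝        = tag 1 ∙ nil
  ⌜ sndₜ ⌝        = tag 2 ∙ nil
  ⌜ unitₜ ⌝       = tag 3 ∙ nil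
  ⌜ boolₜ false ⌝ = tag 3 ∙ nil
  ⌜ boolₜ true ⌝  = tag 4 ∙ (tag 3 ∙ nil) ∙ tag 3 ∙ nil
  ⌜ nilₜ ⌝        = tag 3 ∙ nil
  ⌜ emptyₜ ⌝      = tag 3 ∙ nil
  ⌜ consₜ f g ⌝   = tag 4 ∙ ⌜ f ⌝ ∙ ⌜ g ⌝
  ⌜ ifₜ c f g ⌝   = tag 6 ∙ ⌜ c ⌝ ∙ ⌜ g ⌝ ∙ tag 5 ∙ ⌜ f ⌝ ∙ tag 5 ∙ (tag 2 ∙ nil) ∙ tag 2 ∙ nil
  ⌜ caseₜ l z s ⌝ = tag 6 ∙ ⌜ l ⌝ ∙ ⌜ z ⌝ ∙ ⌜ s ⌝
  ⌜ eqₜ f g ⌝     = tag 5 ∙ (tag 8 ∙ nil) ∙ tag 4 ∙ ⌜ f ⌝ ∙ ⌜ g ⌝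
  ⌜ foldₜ l z s ⌝ = tag 7 ∙ ⌜ l ⌝ ∙ ⌜ z ⌝ ∙ ⌜ s ⌝

  ars : Vec ℕ 3
  ars = 2 ∷ 4 ∷ 2 ∷ []

  pattern apF = zero
  pattern frF = suc zero
  pattern eqF = suc (suc zero)

  quoteV : ∀ {n} → Val → Exp ars n
  quoteV nil     = nil
  quoteV (a ∙ b) = cons (quoteV a) (quoteV b)

  trueE : ∀ {n} → Exp ars n
  trueE = cons nil nil

  -- The unary tag is peeled off by nested matches. Each of them binds two variables, so the index
  -- of the input grows by two per level; the nil branches treat the tags 0 to 7, and the innermost
  -- branch treats tag 8.
  apBody : Exp ars 2
  apBody =
    match (var (♯ 0)) nil
    (match (var (♯ 0)) (var (♯ 3))
    (match (var (♯ 1)) (match (var (♯ 5)) nil (var (♯ 0)))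
    (match (var (♯ 1)) (match (var (♯ 7)) nil (var (♯ 1)))
    (match (var (♯ 1)) nil
    (match (var (♯ 1)) (match (var (♯ 9)) nil
        (cons (call apF (var (♯ 0) ∷ var (♯ 13) ∷ [])) (call apF (var (♯ 1) ∷ var (♯ 13) ∷ []))))
    (match (var (♯ 1)) (match (var (♯ 11)) nil
        (call apF (var (♯ 0) ∷ call apF (var (♯ 1) ∷ var (♯ 15) ∷ []) ∷ [])))
    (match (var (♯ 1)) (match (var (♯ 13)) nil (match (var (♯ 1)) nil
        (match (call apF (var (♯ 2) ∷ var (♯ 19) ∷ []))
               (call apF (var (♯ 0) ∷ var (♯ 19) ∷ []))
               (call apF (var (♯ 3) ∷ cons (var (♯ 0)) (cons (var (♯ 1)) (var (♯ 21))) ∷ [])))))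
    (match (var (♯ 1)) (match (var (♯ 15)) nil (match (var (♯ 1)) nil
        (call frF (call apF (var (♯ 2) ∷ var (♯ 21) ∷ []) ∷ call apF (var (♯ 0) ∷ var (♯ 21) ∷ [])
                   ∷ var (♯ 1) ∷ var (♯ 21) ∷ []))))
    (match (var (♯ 19)) nil (call eqF (var (♯ 0) ∷ var (♯ 1) ∷ [])))))))))))

  frBody : Exp ars 4
  frBody = match (var (♯ 0)) (var (♯ 1))
    (call apF (var (♯ 4) ∷ cons (var (♯ 0))
      (cons (call frF (var (♯ 1) ∷ var (♯ 3) ∷ var (♯ 4) ∷ var (♯ 5) ∷ [])) (var (♯ 5))) ∷ []))

  eqBody : Exp ars 2
  eqBody = match (var (♯ 0)) (match (var (♯ 1)) trueE nil)
    (match (var (♯ 3)) nil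
      (match (call eqF (var (♯ 2) ∷ var (♯ 0) ∷ [])) nil (call eqF (var (♯ 5) ∷ var (♯ 3) ∷ []))))

  interpreter : Val → Program
  interpreter c = record
    { arities = ars
    ; body    = λ { apF → apBody ; frF → frBody ; eqF → eqBody }
    ; main    = call apF (quoteV c ∷ var (♯ 0) ∷ [])
    }

  module Simulation (code : Val) where

    open Evaluation (interpreter code)

    eq-run : ∀ x y → Σ[ n ∈ ℕ ] (x ∷ y ∷ [] ⊢ eqBody ⇓ encodeBool (x ==ᵛ y) ⟨ n ⟩)
    eq-run nil nil = _ , match-nil (var _) (match-nil (var _) (cons nil nil))
    eq-run nil (c ∙ d) = _ , match-nil (var _) (match-∙ (var _) nil)
    eq-run (a ∙ b) nil = _ , match-∙ (var _) (match-nil (var _) nil)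
    eq-run (a ∙ b) (c ∙ d) with a ==ᵛ c | eq-run a c
    ... | false | _ , r = _ , match-∙ (var _) (match-∙ (var _) (match-nil (call (var _ ∷ var _ ∷ []) r) nil))
    ... | true  | _ , r = _ , match-∙ (var _) (match-∙ (var _) (match-∙ (call (var _ ∷ var _ ∷ []) r)
                                (call (var _ ∷ var _ ∷ []) (proj₂ (eq-run b d)))))

    Runs-ap : ∀ {a b} → Tm a b → El a → Set
    Runs-ap {a} {b} t x = Σ[ n ∈ ℕ ] (⌜ t ⌝ ∷ enc a x ∷ [] ⊢ apBody ⇓ enc b (⟦ t ⟧ x) ⟨ n ⟩)

    pair-run : ∀ {f g : Val} {x u v : Val} {m n} →
               f ∷ x ∷ [] ⊢ apBody ⇓ u ⟨ m ⟩ → g ∷ x ∷ [] ⊢ apBody ⇓ v ⟨ n ⟩ →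
               Σ[ k ∈ ℕ ] ((tag 4 ∙ f ∙ g) ∷ x ∷ [] ⊢ apBody ⇓ u ∙ v ⟨ k ⟩)
    pair-run r s = _ , match-∙ (var _) (match-∙ (var _) (match-∙ (var _) (match-∙ (var _) (match-∙ (var _)
      (match-nil (var _) (match-∙ (var _) (cons (call (var _ ∷ var _ ∷ []) r) (call (var _ ∷ var _ ∷ []) s))))))))

    nil-run : ∀ {x : Val} → Σ[ k ∈ ℕ ] ((tag 3 ∙ nil) ∷ x ∷ [] ⊢ apBody ⇓ nil ⟨ k ⟩)
    nil-run = _ , match-∙ (var _) (match-∙ (var _) (match-∙ (var _) (match-∙ (var _) (match-nil (var _) nil))))

    comp-run : ∀ {f g : Val} {x u v : Val} {m n} →
               f ∷ x ∷ [] ⊢ apBody ⇓ u ⟨ m ⟩ → g ∷ u ∷ [] ⊢ apBody ⇓ v ⟨ n ⟩ →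
               Σ[ k ∈ ℕ ] ((tag 5 ∙ g ∙ f) ∷ x ∷ [] ⊢ apBody ⇓ v ⟨ k ⟩)
    comp-run r s = _ , match-∙ (var _) (match-∙ (var _) (match-∙ (var _) (match-∙ (var _) (match-∙ (var _)
      (match-∙ (var _) (match-nil (var _) (match-∙ (var _)
        (call (var _ ∷ call (var _ ∷ var _ ∷ []) r ∷ []) s))))))))

    snd-run : ∀ {u v : Val} → Σ[ k ∈ ℕ ] ((tag 2 ∙ nil) ∷ (u ∙ v) ∷ [] ⊢ apBody ⇓ v ⟨ k ⟩)
    snd-run = _ , match-∙ (var _) (match-∙ (var _) (match-∙ (var _) (match-nil (var _) (match-∙ (var _) (var _)))))

    case-nil-run : ∀ {l z s x u : Val} {m n} →
               l ∷ x ∷ [] ⊢ apBody ⇓ nil ⟨ m ⟩ → z ∷ x ∷ [] ⊢ apBody ⇓ u ⟨ n ⟩ →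
               Σ[ k ∈ ℕ ] ((tag 6 ∙ l ∙ z ∙ s) ∷ x ∷ [] ⊢ apBody ⇓ u ⟨ k ⟩)
    case-nil-run r q = _ , match-∙ (var _) (match-∙ (var _) (match-∙ (var _) (match-∙ (var _) (match-∙ (var _)
      (match-∙ (var _) (match-∙ (var _) (match-nil (var _) (match-∙ (var _) (match-∙ (var _)
        (match-nil (call (var _ ∷ var _ ∷ []) r) (call (var _ ∷ var _ ∷ []) q)))))))))))

    case-∙-run : ∀ {l z s x h t u : Val} {m n} →
               l ∷ x ∷ [] ⊢ apBody ⇓ h ∙ t ⟨ m ⟩ → s ∷ (h ∙ t ∙ x) ∷ [] ⊢ apBody ⇓ u ⟨ n ⟩ →
               Σ[ k ∈ ℕ ] ((tag 6 ∙ l ∙ z ∙ s) ∷ x ∷ [] ⊢ apBody ⇓ u ⟨ k ⟩)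
    case-∙-run r q = _ , match-∙ (var _) (match-∙ (var _) (match-∙ (var _) (match-∙ (var _) (match-∙ (var _)
      (match-∙ (var _) (match-∙ (var _) (match-nil (var _) (match-∙ (var _) (match-∙ (var _)
        (match-∙ (call (var _ ∷ var _ ∷ []) r)
          (call (var _ ∷ cons (var _) (cons (var _) (var _)) ∷ []) q)))))))))))

    mutual
      run : ∀ {a b} (t : Tm a b) (x : El a) → Runs-ap t x
      run idₜ x = _ , match-∙ (var _) (match-nil (var _) (var _))
      run (g ∘ₜ f) x = comp-run (proj₂ (run f x)) (proj₂ (run g (⟦ f ⟧ x)))
      run ⟪ f , g ⟫ x = pair-run (proj₂ (run f x)) (proj₂ (run g x))
      run fstₜ x = _ , match-∙ (var _) (match-∙ (var _) (match-nil (var _) (match-∙ (var _) (var _))))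
      run sndₜ x = snd-run
      run unitₜ x = nil-run
      run (boolₜ false) x = nil-run
      run (boolₜ true) x = pair-run (proj₂ nil-run) (proj₂ nil-run)
      run nilₜ x = nil-run
      run emptyₜ x = nil-run
      run (consₜ f g) x = pair-run (proj₂ (run f x)) (proj₂ (run g x))
      run (ifₜ c f g) x with ⟦ c ⟧ x | run c x
      ... | false | _ , r = case-nil-run r (proj₂ (run g x))
      ... | true  | _ , r = case-∙-run r (proj₂ (comp-run (proj₂ (comp-run (proj₂ snd-run) (proj₂ snd-run)))
                                                          (proj₂ (run f x))))
      run (caseₜ l z s) x with ⟦ l ⟧ x | run l x
      ... | []     | _ , r = case-nil-run r (proj₂ (run z x))
      ... | a ∷ as | _ , r = case-∙-run r (proj₂ (run s (a , as , x)))
      run (eqₜ f g) x = comp-run (proj₂ (pair-run (proj₂ (run f x)) (proj₂ (run g x)))) (proj₂ (eq-ap _ _))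
      run (foldₜ l z s) x = _ , match-∙ (var _) (match-∙ (var _) (match-∙ (var _) (match-∙ (var _) (match-∙ (var _)
        (match-∙ (var _) (match-∙ (var _) (match-∙ (var _) (match-nil (var _) (match-∙ (var _) (match-∙ (var _)
          (call (call (var _ ∷ var _ ∷ []) (proj₂ (run l x)) ∷ call (var _ ∷ var _ ∷ []) (proj₂ (run z x))
                 ∷ var _ ∷ var _ ∷ [])
            (proj₂ (fold-run s (⟦ z ⟧ x) x (⟦ l ⟧ x))))))))))))))

      eq-ap : ∀ u v → Σ[ k ∈ ℕ ] ((tag 8 ∙ nil) ∷ (u ∙ v) ∷ [] ⊢ apBody ⇓ encodeBool (u ==ᵛ v) ⟨ k ⟩)
      eq-ap u v = _ , match-∙ (var _) (match-∙ (var _) (match-∙ (var _) (match-∙ (var _) (match-∙ (var _)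
        (match-∙ (var _) (match-∙ (var _) (match-∙ (var _) (match-∙ (var _) (match-∙ (var _)
          (call (var _ ∷ var _ ∷ []) (proj₂ (eq-run u v))))))))))))

      fold-run : ∀ {a b c} (s : Tm (b ⊗ c ⊗ a) c) (z : El c) (x : El a) (l : List (El b)) →
                 Σ[ k ∈ ℕ ] (enc (list b) l ∷ enc c z ∷ ⌜ s ⌝ ∷ enc a x ∷ [] ⊢ frBody ⇓
                              enc c (List.foldr (λ u acc → ⟦ s ⟧ (u , acc , x)) z l) ⟨ k ⟩)
      fold-run s z x [] = _ , match-nil (var _) (var _)
      fold-run s z x (u ∷ l) = _ , match-∙ (var _) (call (var _ ∷ cons (var _)
        (cons (call (var _ ∷ var _ ∷ var _ ∷ var _ ∷ []) (proj₂ (fold-run s z x l))) (var _)) ∷ [])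
        (proj₂ (run s (u , _ , x))))

    cost : ∀ {a b} → Tm a b → El a → ℕ
    cost t x = proj₁ (run t x)

    fold-cost : ∀ {a b c} → Tm (b ⊗ c ⊗ a) c → El c → El a → List (El b) → ℕ
    fold-cost s z x l = proj₁ (fold-run s z x l)

open Interpreter

-- Compositional upper bounds on the running time of the interpreter

open ℕₚ.≤-Reasoning hiding (stop; start)

sz : ∀ τ → El τ → ℕ
sz τ x = ‖ enc τ x ‖

-- The constants leave room for the dispatch of the interpreter on the tag.

mutual
  bd : ∀ {a b} → Tm a b → El a → ℕ
  bd idₜ x = 60
  bd (g ∘ₜ f) x = 60 + (bd f x + bd g (⟦ f ⟧ x))
  bd ⟪ f , g ⟫ x = 60 + (bd f x + bd g x)
  bd fstₜ x = 60
  bd sndₜ x = 60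
  bd unitₜ x = 60
  bd (boolₜ b) x = 180
  bd nilₜ x = 60
  bd emptyₜ x = 60
  bd (consₜ f g) x = 60 + (bd f x + bd g x)
  bd (ifₜ c f g) x = 240 + (bd c x + (if ⟦ c ⟧ x then bd f x else bd g x))
  bd (caseₜ l z s) x = 60 + (bd l x + case-bd z s x (⟦ l ⟧ x))
  bd (eqₜ {b = b} f g) x = 180 + (bd f x + bd g x + 20 * sz b (⟦ f ⟧ x))
  bd (foldₜ l z s) x = 60 + (bd l x + bd z x + fold-bd s (⟦ z ⟧ x) x (⟦ l ⟧ x))

  case-bd : ∀ {a b c} → Tm a c → Tm (b ⊗ list b ⊗ a) c → El a → List (El b) → ℕ
  case-bd z s x []       = bd z x
  case-bd z s x (u ∷ us) = bd s (u , us , x)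

  fold-bd : ∀ {a b c} → Tm (b ⊗ c ⊗ a) c → El c → El a → List (El b) → ℕ
  fold-bd s z x []      = 60
  fold-bd s z x (u ∷ l) =
    60 + (fold-bd s z x l + bd s (u , foldr (λ v acc → ⟦ s ⟧ (v , acc , x)) z l , x))

module _ (code : Val) where

  open Simulation code

  private
    slack : ∀ {x y} d → x + d ≡ y → x ≤ₙ y
    slack {x} d eq = subst (x ≤ₙ_) eq (m≤m+n x d)

  pair≤ : ∀ m n → 18 + (m + (3 + n)) ≤ₙ 60 + (m + n)
  pair≤ m n = slack 39 (solve-eq m n) where
    solve-eq : ∀ m n → 18 + (m + (3 + n)) + 39 ≡ 60 + (m + n)
    solve-eq = solve-∀

  comp≤ : ∀ m n → 21 + ((m + 0) + n) ≤ₙ 60 + (m + n)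
  comp≤ m n = slack 39 (solve-eq m n) where
    solve-eq : ∀ m n → 21 + ((m + 0) + n) + 39 ≡ 60 + (m + n)
    solve-eq = solve-∀

  case-nil≤ : ∀ m n → 24 + (m + (3 + n)) ≤ₙ 60 + (m + n)
  case-nil≤ m n = slack 33 (solve-eq m n) where
    solve-eq : ∀ m n → 24 + (m + (3 + n)) + 33 ≡ 60 + (m + n)
    solve-eq = solve-∀

  case-∙≤ : ∀ m n → 24 + (m + (7 + n)) ≤ₙ 60 + (m + n)
  case-∙≤ m n = slack 29 (solve-eq m n) where
    solve-eq : ∀ m n → 24 + (m + (7 + n)) + 29 ≡ 60 + (m + n)
    solve-eq = solve-∀

  fold≤ : ∀ l z f → 26 + ((l + (3 + (z + 2))) + f) ≤ₙ 60 + (l + z + f)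
  fold≤ l z f = slack 29 (solve-eq l z f) where
    solve-eq : ∀ l z f → 26 + ((l + (3 + (z + 2))) + f) + 29 ≡ 60 + (l + z + f)
    solve-eq = solve-∀

  fold-step≤ : ∀ f s → 12 + (((f + 1) + 0) + s) ≤ₙ 60 + (f + s)
  fold-step≤ f s = slack 47 (solve-eq f s) where
    solve-eq : ∀ f s → 12 + (((f + 1) + 0) + s) + 47 ≡ 60 + (f + s)
    solve-eq = solve-∀

  -- The comparison descends in both trees at once and stops at the first difference, so the size of
  -- either tree alone bounds it.
  eq-cost : ∀ x y → proj₁ (eq-run x y) ≤ₙ 20 * ‖ x ‖
  eq-cost nil nil = s≤s (s≤s (s≤s (s≤s (s≤s (s≤s (s≤s z≤n))))))
  eq-cost nil (c ∙ d) = s≤s (s≤s (s≤s (s≤s (s≤s z≤n))))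
  eq-cost (a ∙ b) nil = begin
    5                  ≤⟨ s≤s (s≤s (s≤s (s≤s (s≤s z≤n)))) ⟩
    20 * 1             ≤⟨ ℕₚ.*-monoʳ-≤ 20 (s≤s z≤n) ⟩
    20 * ‖ a ∙ b ‖     ∎
  eq-cost (a ∙ b) (c ∙ d) with a ==ᵛ c | eq-run a c | eq-cost a c
  ... | false | m , r | h = begin
    8 + (m + 1)                  ≤⟨ ℕₚ.+-monoʳ-≤ 8 (ℕₚ.+-monoˡ-≤ 1 h) ⟩
    8 + (20 * ‖ a ‖ + 1)         ≤⟨ slack (11 + 20 * ‖ b ‖) (solve-eq ‖ a ‖ ‖ b ‖) ⟩
    20 * ‖ a ∙ b ‖               ∎
    where
    solve-eq : ∀ p q → 8 + (20 * p + 1) + (11 + 20 * q) ≡ 20 * suc (p + q)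
    solve-eq = solve-∀
  ... | true | m , r | h = begin
    8 + (m + (3 + proj₁ (eq-run b d))) ≤⟨ ℕₚ.+-monoʳ-≤ 8 (+-mono-≤ h (ℕₚ.+-monoʳ-≤ 3 (eq-cost b d))) ⟩
    8 + (20 * ‖ a ‖ + (3 + 20 * ‖ b ‖)) ≤⟨ slack 9 (solve-eq ‖ a ‖ ‖ b ‖) ⟩
    20 * ‖ a ∙ b ‖               ∎
    where
    solve-eq : ∀ p q → 8 + (20 * p + (3 + 20 * q)) + 9 ≡ 20 * suc (p + q)
    solve-eq = solve-∀

  mutual
    cost≤bd : ∀ {a b} (t : Tm a b) (x : El a) → cost t x ≤ₙ bd t x
    cost≤bd idₜ x = ℕₚ.m≤m+n 5 55
    cost≤bd (g ∘ₜ f) x = ≤-trans (comp≤ (cost f x) (cost g _)) (ℕₚ.+-monoʳ-≤ 60 (+-mono-≤ (cost≤bd f x) (cost≤bd g _)))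
    cost≤bd ⟪ f , g ⟫ x = ≤-trans (pair≤ (cost f x) (cost g x)) (ℕₚ.+-monoʳ-≤ 60 (+-mono-≤ (cost≤bd f x) (cost≤bd g x)))
    cost≤bd fstₜ x = ℕₚ.m≤m+n 9 51
    cost≤bd sndₜ x = ℕₚ.m≤m+n 11 49
    cost≤bd unitₜ x = ℕₚ.m≤m+n 11 49
    cost≤bd (boolₜ false) x = ℕₚ.m≤m+n 11 169
    cost≤bd (boolₜ true) x = ℕₚ.m≤m+n 43 137
    cost≤bd nilₜ x = ℕₚ.m≤m+n 11 49
    cost≤bd emptyₜ x = ℕₚ.m≤m+n 11 49
    cost≤bd (consₜ f g) x = ≤-trans (pair≤ (cost f x) (cost g x)) (ℕₚ.+-monoʳ-≤ 60 (+-mono-≤ (cost≤bd f x) (cost≤bd g x)))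
    cost≤bd (ifₜ c f g) x with ⟦ c ⟧ x | run c x | cost≤bd c x
    ... | false | _ | h = ≤-trans (case-nil≤ _ _) (+-mono-≤ (ℕₚ.m≤m+n 60 180) (+-mono-≤ h (cost≤bd g x)))
    ... | true  | m , _ | h = begin
      24 + (m + (7 + _)) ≤⟨ case-∙≤ m _ ⟩
      60 + (m + _) ≤⟨ ℕₚ.+-monoʳ-≤ 60 (+-mono-≤ h (comp≤ 43 (cost f x))) ⟩
      60 + (bd c x + (60 + (43 + cost f x))) ≤⟨ ℕₚ.+-monoʳ-≤ 60 (ℕₚ.+-monoʳ-≤ (bd c x) (ℕₚ.+-monoʳ-≤ 103 (cost≤bd f x))) ⟩
      60 + (bd c x + (103 + bd f x)) ≤⟨ slack 77 (solve-eq (bd c x) (bd f x)) ⟩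
      240 + (bd c x + bd f x) ∎
      where
      solve-eq : ∀ p q → 60 + (p + (103 + q)) + 77 ≡ 240 + (p + q)
      solve-eq = solve-∀
    cost≤bd (caseₜ l z s) x with ⟦ l ⟧ x | run l x | cost≤bd l x
    ... | []     | _ | h = ≤-trans (case-nil≤ _ _) (ℕₚ.+-monoʳ-≤ 60 (+-mono-≤ h (cost≤bd z x)))
    ... | u ∷ us | _ | h = ≤-trans (case-∙≤ _ _) (ℕₚ.+-monoʳ-≤ 60 (+-mono-≤ h (cost≤bd s _)))
    cost≤bd (eqₜ {b = b} f g) x = begin
      _ ≤⟨ comp≤ (proj₁ (pair-run (proj₂ (run f x)) (proj₂ (run g x)))) (proj₁ (eq-ap (enc b (⟦ f ⟧ x)) (enc b (⟦ g ⟧ x)))) ⟩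
      _ ≤⟨ ℕₚ.+-monoʳ-≤ 60 (+-mono-≤ (≤-trans (pair≤ (cost f x) (cost g x)) (ℕₚ.+-monoʳ-≤ 60 (+-mono-≤ (cost≤bd f x) (cost≤bd g x))))
                    (ℕₚ.+-monoʳ-≤ 23 (eq-cost (enc b (⟦ f ⟧ x)) (enc b (⟦ g ⟧ x))))) ⟩
      60 + ((60 + (bd f x + bd g x)) + (23 + 20 * sz b (⟦ f ⟧ x))) ≤⟨ slack 37 (solve-eq (bd f x) (bd g x) (sz b (⟦ f ⟧ x))) ⟩
      180 + (bd f x + bd g x + 20 * sz b (⟦ f ⟧ x)) ∎
      where
      solve-eq : ∀ p q r → 60 + ((60 + (p + q)) + (23 + 20 * r)) + 37 ≡ 180 + (p + q + 20 * r)
      solve-eq = solve-∀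
    cost≤bd (foldₜ l z s) x = ≤-trans (fold≤ (cost l x) (cost z x) (fold-cost s (⟦ z ⟧ x) x (⟦ l ⟧ x)))
      (ℕₚ.+-monoʳ-≤ 60 (+-mono-≤ (+-mono-≤ (cost≤bd l x) (cost≤bd z x)) (fold-cost≤ s _ x (⟦ l ⟧ x))))

    fold-cost≤ : ∀ {a b c} (s : Tm (b ⊗ c ⊗ a) c) (z : El c) (x : El a) (l : List (El b)) →
                 fold-cost s z x l ≤ₙ fold-bd s z x l
    fold-cost≤ s z x [] = ℕₚ.m≤m+n 3 57
    fold-cost≤ s z x (u ∷ l) = ≤-trans (fold-step≤ (fold-cost s z x l) (cost s _)) (ℕₚ.+-monoʳ-≤ 60 (+-mono-≤ (fold-cost≤ s z x l) (cost≤bd s _)))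

-- Terms running in polynomial time

-- Powers of 1 + size are closed under sums, products and composition and, the base being at least
-- 2, absorb constants. So no coefficients have to be tracked.
PB : ∀ a → (El a → ℕ) → Set
PB a f = Σ[ e ∈ ℕ ] (∀ x → f x ≤ₙ suc (sz a x) ** e)

1≤‖‖ : ∀ v → 1 ≤ₙ ‖ v ‖
1≤‖‖ nil     = ≤-refl
1≤‖‖ (a ∙ b) = s≤s z≤n

1≤n^ : ∀ n e → 1 ≤ₙ suc n ** e
1≤n^ n zero    = ≤-refl
1≤n^ n (suc e) = *-mono-≤ {1} {suc n} (s≤s z≤n) (1≤n^ n e)

n≤2^n : ∀ n → n ≤ₙ 2 ** n
n≤2^n zero    = z≤n
n≤2^n (suc n) = begin
  1 + n               ≤⟨ +-mono-≤ (1≤n^ 1 n) (n≤2^n n) ⟩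
  2 ** n + 2 ** n     ≡⟨ cong (2 ** n +_) (sym (ℕₚ.+-identityʳ _)) ⟩
  2 ** suc n          ∎

module _ {a : Ty} where

  pb-mono : ∀ {f g : El a → ℕ} → (∀ x → f x ≤ₙ g x) → PB a g → PB a f
  pb-mono le (e , h) = e , λ x → ≤-trans (le x) (h x)

  pb-const : ∀ k → PB a (λ _ → k)
  pb-const k = k , λ x → ≤-trans (n≤2^n k) (ℕₚ.^-monoˡ-≤ k (s≤s (1≤‖‖ (enc a x))))

  pb-sz : PB a (sz a)
  pb-sz = 1 , λ x → ≤-trans (ℕₚ.n≤1+n _) (ℕₚ.≤-reflexive (sym (ℕₚ.*-identityʳ _)))

  double≤ : ∀ (x : El a) e → suc (sz a x) ** e + suc (sz a x) ** e ≤ₙ suc (sz a x) ** suc e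
  double≤ x e = begin
    N ** e + N ** e ≡⟨ cong (N ** e +_) (sym (ℕₚ.+-identityʳ _)) ⟩
    2 * N ** e      ≤⟨ ℕₚ.*-monoˡ-≤ (N ** e) (s≤s (1≤‖‖ (enc a x))) ⟩
    N * N ** e      ∎
    where
    N = suc (sz a x)

  pb-+ : ∀ {f g : El a → ℕ} → PB a f → PB a g → PB a (λ x → f x + g x)
  pb-+ (d , p) (e , q) = suc (d + e) , λ x → begin
    _                                                     ≤⟨ +-mono-≤ (p x) (q x) ⟩
    suc (sz a x) ** d + suc (sz a x) ** e                 ≤⟨ +-mono-≤ (ℕₚ.^-monoʳ-≤ (suc (sz a x)) (m≤m+n d e)) (ℕₚ.^-monoʳ-≤ (suc (sz a x)) (m≤n+m e d)) ⟩
    suc (sz a x) ** (d + e) + suc (sz a x) ** (d + e)     ≤⟨ double≤ x (d + e) ⟩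
    suc (sz a x) ** suc (d + e)                           ∎

  pb-* : ∀ {f g : El a → ℕ} → PB a f → PB a g → PB a (λ x → f x * g x)
  pb-* (d , p) (e , q) = d + e , λ x → begin
    _                                         ≤⟨ *-mono-≤ (p x) (q x) ⟩
    suc (sz a x) ** d * suc (sz a x) ** e     ≡⟨ sym (ℕₚ.^-distribˡ-+-* (suc (sz a x)) d e) ⟩
    suc (sz a x) ** (d + e)                   ∎

  pb-^ : ∀ {f : El a → ℕ} → PB a f → ∀ e → PB a (λ x → suc (f x) ** e)
  pb-^ (d , p) e = suc d * e , λ x → begin
    _                                 ≤⟨ ℕₚ.^-monoˡ-≤ e (begin
        1 + _                                             ≤⟨ +-mono-≤ (1≤n^ (sz a x) d) (p x) ⟩
        suc (sz a x) ** d + suc (sz a x) ** d             ≤⟨ double≤ x d ⟩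
        suc (sz a x) ** suc d                             ∎) ⟩
    (suc (sz a x) ** suc d) ** e      ≡⟨ ℕₚ.^-*-assoc (suc (sz a x)) (suc d) e ⟩
    suc (sz a x) ** (suc d * e)       ∎

  pb-∘ : ∀ {b} {g : El b → ℕ} {h : El a → El b} → PB b g → PB a (λ x → sz b (h x)) → PB a (λ x → g (h x))
  pb-∘ {h = h} (e , q) p = pb-mono (λ x → q (h x)) (pb-^ p e)

-- The size of the output is recorded because the time of a composition depends on it.
record Poly (a b : Ty) : Set where
  field
    tm    : Tm a b
    time  : PB a (bd tm)
    space : PB a (λ x → sz b (⟦ tm ⟧ x))

open Poly public

infixr 9 _⊙_

⟦_⟧ₚ : ∀ {a b} → Poly a b → El a → El b
⟦ p ⟧ₚ = ⟦ tm p ⟧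

idₚ : ∀ {a} → Poly a a
idₚ = record { tm = idₜ ; time = pb-const 60 ; space = pb-sz }

_⊙_ : ∀ {a b c} → Poly b c → Poly a b → Poly a c
g ⊙ f = record
  { tm    = tm g ∘ₜ tm f
  ; time  = pb-+ (pb-const 60) (pb-+ (time f) (pb-∘ (time g) (space f)))
  ; space = pb-∘ (space g) (space f)
  }

⟨_,_⟩ₚ : ∀ {a b c} → Poly a b → Poly a c → Poly a (b ⊗ c)
⟨ f , g ⟩ₚ = record
  { tm    = ⟪ tm f , tm g ⟫
  ; time  = pb-+ (pb-const 60) (pb-+ (time f) (time g))
  ; space = pb-+ (pb-const 1) (pb-+ (space f) (space g))
  }

fstₚ : ∀ {a b} → Poly (a ⊗ b) a
fstₚ = record { tm = fstₜ ; time = pb-const 60 ; space = pb-mono (λ x → ≤-trans (m≤m+n _ _) (ℕₚ.n≤1+n _)) pb-sz }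

sndₚ : ∀ {a b} → Poly (a ⊗ b) b
sndₚ = record { tm = sndₜ ; time = pb-const 60 ; space = pb-mono (λ x → ≤-trans (m≤n+m _ _) (ℕₚ.n≤1+n _)) pb-sz }

unitₚ : ∀ {a} → Poly a unit
unitₚ = record { tm = unitₜ ; time = pb-const 60 ; space = pb-const 1 }

boolₚ : ∀ {a} → Bool → Poly a bool
boolₚ b = record { tm = boolₜ b ; time = pb-const 180 ; space = pb-const ‖ encodeBool b ‖ }

nilₚ : ∀ {a b} → Poly a (list b)
nilₚ = record { tm = nilₜ ; time = pb-const 60 ; space = pb-const 1 }

emptyₚ : ∀ {a} → Poly a val
emptyₚ = record { tm = emptyₜ ; time = pb-const 60 ; space = pb-const 1 }

consₚ : ∀ {a b} → Poly a b → Poly a (list b) → Poly a (list b)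
consₚ f g = record
  { tm    = consₜ (tm f) (tm g)
  ; time  = pb-+ (pb-const 60) (pb-+ (time f) (time g))
  ; space = pb-+ (pb-const 1) (pb-+ (space f) (space g))
  }

if-mono : ∀ (b : Bool) {m n : ℕ} → (if b then m else n) ≤ₙ m + n
if-mono true  = m≤m+n _ _
if-mono false = m≤n+m _ _

ifₚ : ∀ {a b} → Poly a bool → Poly a b → Poly a b → Poly a b
ifₚ {a} {b} c f g = record
  { tm    = ifₜ (tm c) (tm f) (tm g)
  ; time  = pb-+ (pb-const 240) (pb-+ (time c)
              (pb-mono (λ x → if-mono (⟦ c ⟧ₚ x)) (pb-+ (time f) (time g))))
  ; space = pb-mono bound (pb-+ (space f) (space g))
  }
  where
  bound : ∀ x → sz b (if ⟦ c ⟧ₚ x then ⟦ f ⟧ₚ x else ⟦ g ⟧ₚ x) ≤ₙ sz b (⟦ f ⟧ₚ x) + sz b (⟦ g ⟧ₚ x)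
  bound x with ⟦ c ⟧ₚ x
  ... | true  = m≤m+n _ _
  ... | false = m≤n+m _ _

caseₚ : ∀ {a b c} → Poly a (list b) → Poly a c → Poly (b ⊗ list b ⊗ a) c → Poly a c
caseₚ {a} {b} {c} l z s = record
  { tm    = caseₜ (tm l) (tm z) (tm s)
  ; time  = pb-+ (pb-const 60) (pb-+ (time l) (pb-mono bound-t (pb-+ (time z) (size-s (proj₁ (time s))))))
  ; space = pb-mono bound-s (pb-+ (space z) (size-s (proj₁ (space s))))
  }
  where
  size-s : ∀ e → PB a (λ x → suc (1 + (sz (list b) (⟦ l ⟧ₚ x) + sz a x)) ** e)
  size-s e = pb-^ (pb-+ (pb-const 1) (pb-+ (space l) pb-sz)) e
  arg≤ : ∀ u us x → suc (sz (b ⊗ list b ⊗ a) (u , us , x)) ≤ₙ suc (1 + (sz (list b) (u ∷ us) + sz a x))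
  arg≤ u us x = s≤s (s≤s (ℕₚ.≤-reflexive (eq (sz b u) (sz (list b) us) (sz a x)))) where
    eq : ∀ p q r → p + (1 + (q + r)) ≡ 1 + (p + q) + r
    eq = solve-∀
  bound-t : ∀ x → case-bd (tm z) (tm s) x (⟦ l ⟧ₚ x) ≤ₙ
                  bd (tm z) x + suc (1 + (sz (list b) (⟦ l ⟧ₚ x) + sz a x)) ** proj₁ (time s)
  bound-t x with ⟦ l ⟧ₚ x
  ... | []     = m≤m+n _ _
  ... | u ∷ us = ≤-trans (≤-trans (proj₂ (time s) _) (ℕₚ.^-monoˡ-≤ (proj₁ (time s)) (arg≤ u us x))) (m≤n+m _ _)
  bound-s : ∀ x → sz c (⟦ caseₜ (tm l) (tm z) (tm s) ⟧ x) ≤ₙ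
                  sz c (⟦ z ⟧ₚ x) + suc (1 + (sz (list b) (⟦ l ⟧ₚ x) + sz a x)) ** proj₁ (space s)
  bound-s x with ⟦ l ⟧ₚ x
  ... | []     = m≤m+n _ _
  ... | u ∷ us = ≤-trans (≤-trans (proj₂ (space s) _) (ℕₚ.^-monoˡ-≤ (proj₁ (space s)) (arg≤ u us x))) (m≤n+m _ _)

bool-size : ∀ b → ‖ encodeBool b ‖ ≤ₙ 3
bool-size true  = ≤-refl
bool-size false = s≤s z≤n

eqₚ : ∀ {a b} → Poly a b → Poly a b → Poly a bool
eqₚ {a} {b} f g = record
  { tm    = eqₜ (tm f) (tm g)
  ; time  = pb-+ (pb-const 180) (pb-+ (pb-+ (time f) (time g)) (pb-* (pb-const 20) (space f)))
  ; space = pb-mono (λ x → bool-size _) (pb-const 3)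
  }

length≤sz : ∀ {a} (l : List (El a)) → length l ≤ₙ sz (list a) l
length≤sz []      = z≤n
length≤sz {a} (x ∷ l) = s≤s (≤-trans (length≤sz {a} l) (m≤n+m _ _))

fold-bd≤ : ∀ {a b c} (s : Tm (b ⊗ c ⊗ a) c) (z : El c) (x : El a) (l : List (El b)) (k : ℕ) →
           (∀ u l′ → sz (list b) (u ∷ l′) ≤ₙ sz (list b) l →
              bd s (u , foldr (λ v acc → ⟦ s ⟧ (v , acc , x)) z l′ , x) ≤ₙ k) →
           fold-bd s z x l ≤ₙ 60 + length l * (60 + k)
fold-bd≤ s z x [] k h = ≤-refl
fold-bd≤ {b = b} s z x (u ∷ l) k h = begin
  60 + (fold-bd s z x l + _)               ≤⟨ ℕₚ.+-monoʳ-≤ 60 (+-mono-≤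
       (fold-bd≤ s z x l k (λ v l′ le → h v l′ (≤-trans le (≤-trans (m≤n+m _ _) (ℕₚ.n≤1+n _))))) (h u l ≤-refl)) ⟩
  60 + (60 + length l * (60 + k) + k)      ≡⟨ eq (length l * (60 + k)) k ⟩
  60 + (60 + k + length l * (60 + k))      ∎
  where
  eq : ∀ p k → 60 + (60 + p + k) ≡ 60 + (60 + k + p)
  eq = solve-∀

-- Iterating a polynomial step may make the accumulator grow exponentially, so a polynomial bound
-- `m` on all intermediate accumulators is demanded. It is asked for every list no larger than the
-- given one; this covers the suffixes that occur and permits an induction.
foldₚ : ∀ {a b c} (l : Poly a (list b)) (z : Poly a c) (s : Poly (b ⊗ c ⊗ a) c) →
        {m : El a → ℕ} → PB a m →
        (∀ x l′ → sz (list b) l′ ≤ₙ sz (list b) (⟦ l ⟧ₚ x) →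
           sz c (foldr (λ v acc → ⟦ s ⟧ₚ (v , acc , x)) (⟦ z ⟧ₚ x) l′) ≤ₙ m x) →
        Poly a c
foldₚ {a} {b} {c} l z s {m} pm inv = record
  { tm    = foldₜ (tm l) (tm z) (tm s)
  ; time  = pb-+ (pb-const 60) (pb-+ (pb-+ (time l) (time z))
              (pb-mono (λ x → ≤-trans (fold-bd≤ (tm s) _ x (⟦ l ⟧ₚ x) (K x) (λ u l′ le → step≤ x u l′ le))
                                (ℕₚ.+-monoʳ-≤ 60 (ℕₚ.*-monoˡ-≤ (60 + K x) (length≤sz {b} (⟦ l ⟧ₚ x)))))
                 (pb-+ (pb-const 60) (pb-* (space l) (pb-+ (pb-const 60) (pb-^ args (proj₁ (time s))))))))
  ; space = pb-mono (λ x → inv x (⟦ l ⟧ₚ x) ≤-refl) pm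
  }
  where
  A : El a → ℕ
  A x = 2 + (sz (list b) (⟦ l ⟧ₚ x) + (m x + sz a x))
  args : PB a A
  args = pb-+ (pb-const 2) (pb-+ (space l) (pb-+ pm pb-sz))
  K : El a → ℕ
  K x = suc (A x) ** proj₁ (time s)
  step≤ : ∀ x u l′ → sz (list b) (u ∷ l′) ≤ₙ sz (list b) (⟦ l ⟧ₚ x) →
          bd (tm s) (u , foldr (λ v acc → ⟦ s ⟧ₚ (v , acc , x)) (⟦ z ⟧ₚ x) l′ , x) ≤ₙ K x
  step≤ x u l′ le = ≤-trans (proj₂ (time s) _) (ℕₚ.^-monoˡ-≤ (proj₁ (time s)) (s≤s (begin
    suc (sz b u + suc (_ + sz a x)) ≡⟨ cong suc (ℕₚ.+-suc _ _) ⟩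
    2 + (sz b u + (_ + sz a x))     ≤⟨ ℕₚ.+-monoʳ-≤ 2 (+-mono-≤ (≤-trans (≤-trans (m≤m+n (sz b u) (sz (list b) l′)) (ℕₚ.n≤1+n _)) le)
                                         (ℕₚ.+-monoˡ-≤ (sz a x) (inv x l′ (≤-trans (≤-trans (m≤n+m _ _) (ℕₚ.n≤1+n _)) le)))) ⟩
    A x ∎)))

-- The environment of a fold step consists of the current element, the
-- accumulator and the environment of the fold.

v₀ : ∀ {a b} → Poly (a ⊗ b) a
v₀ = fstₚ

v₁ : ∀ {a b c} → Poly (a ⊗ b ⊗ c) b
v₁ = fstₚ ⊙ sndₚ

v₂ : ∀ {a b c d} → Poly (a ⊗ b ⊗ c ⊗ d) c
v₂ = fstₚ ⊙ sndₚ ⊙ sndₚ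

appendₜ : ∀ {a b} → Tm a (list b) → Tm a (list b) → Tm a (list b)
appendₜ f g = foldₜ f g (consₜ fstₜ (fstₜ ∘ₜ sndₜ))

sz-append : ∀ {b} (xs ys : List (El b)) → sz (list b) (foldr _∷_ ys xs) ≤ₙ sz (list b) xs + sz (list b) ys
sz-append {b} []       ys = ℕₚ.n≤1+n _
sz-append {b} (x ∷ xs) ys = s≤s (≤-trans (ℕₚ.+-monoʳ-≤ (sz b x) (sz-append {b} xs ys)) (ℕₚ.≤-reflexive (sym (ℕₚ.+-assoc (sz b x) _ _))))

appendₚ : ∀ {a b} → Poly a (list b) → Poly a (list b) → Poly a (list b)
appendₚ {a} {b} f g = foldₚ f g (consₚ v₀ v₁) (pb-+ (space f) (space g))
  (λ x l′ le → ≤-trans (sz-append {b} l′ (⟦ g ⟧ₚ x)) (ℕₚ.+-monoˡ-≤ _ le))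

anyₚ : ∀ {a b} → Poly a (list b) → Poly (b ⊗ a) bool → Poly a bool
anyₚ l p = foldₚ l (boolₚ false) (ifₚ (p ⊙ ⟨ v₀ , sndₚ ⊙ sndₚ ⟩ₚ) (boolₚ true) v₁)
  (pb-const 3) (λ x l′ _ → bool-size _)

filterₚ : ∀ {a b} → Poly a (list b) → Poly (b ⊗ a) bool → Poly a (list b)
filterₚ {a} {b} l p = foldₚ l nilₚ (ifₚ (p ⊙ ⟨ v₀ , sndₚ ⊙ sndₚ ⟩ₚ) (consₚ v₀ v₁) v₁)
  (space l) (λ x l′ → ≤-trans (small x l′))
  where
  small : ∀ x l′ → sz (list b) (foldr (λ v acc → if ⟦ p ⟧ₚ (v , x) then v ∷ acc else acc) [] l′) ≤ₙ sz (list b) l′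
  small x [] = ≤-refl
  small x (u ∷ l′) with ⟦ p ⟧ₚ (u , x)
  ... | true  = s≤s (ℕₚ.+-monoʳ-≤ (sz b u) (small x l′))
  ... | false = ≤-trans (small x l′) (≤-trans (m≤n+m _ _) (ℕₚ.n≤1+n _))

mapₚ : ∀ {a b c} → Poly a (list b) → Poly (b ⊗ a) c → Poly a (list c)
mapₚ {a} {b} {c} l f = foldₚ l nilₚ (consₚ (f ⊙ ⟨ v₀ , sndₚ ⊙ sndₚ ⟩ₚ) v₁) bound
  (λ x l′ le → ≤-trans (small x l′ le) (ℕₚ.+-monoʳ-≤ 1 (ℕₚ.*-monoˡ-≤ (suc (K x)) (≤-trans (length≤sz {b} l′) le))))
  where
  K : El a → ℕ
  K x = suc (1 + (sz (list b) (⟦ l ⟧ₚ x) + sz a x)) ** proj₁ (space f)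
  bound : PB a (λ x → 1 + sz (list b) (⟦ l ⟧ₚ x) * suc (K x))
  bound = pb-+ (pb-const 1) (pb-* (space l) (pb-+ (pb-const 1) (pb-^ (pb-+ (pb-const 1) (pb-+ (space l) pb-sz)) (proj₁ (space f)))))
  small : ∀ x l′ → sz (list b) l′ ≤ₙ sz (list b) (⟦ l ⟧ₚ x) →
          sz (list c) (foldr (λ v acc → ⟦ f ⟧ₚ (v , x) ∷ acc) [] l′) ≤ₙ 1 + length l′ * suc (K x)
  small x [] le = ≤-refl
  small x (u ∷ l′) le = begin
    suc (sz c (⟦ f ⟧ₚ (u , x)) + _)     ≤⟨ s≤s (+-mono-≤ fu (small x l′ (≤-trans (≤-trans (m≤n+m _ _) (ℕₚ.n≤1+n _)) le))) ⟩
    suc (K x + suc (length l′ * suc (K x))) ≡⟨ cong suc (ℕₚ.+-suc (K x) _) ⟩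
    1 + length (u ∷ l′) * suc (K x) ∎
    where
    fu : sz c (⟦ f ⟧ₚ (u , x)) ≤ₙ K x
    fu = ≤-trans (proj₂ (space f) _) (ℕₚ.^-monoˡ-≤ (proj₁ (space f)) (s≤s (s≤s (ℕₚ.+-monoˡ-≤ (sz a x)
           (≤-trans (≤-trans (m≤m+n (sz b u) (sz (list b) l′)) (ℕₚ.n≤1+n _)) le)))))

concatMapₚ : ∀ {a b c} → Poly a (list b) → Poly (b ⊗ a) (list c) → Poly a (list c)
concatMapₚ {a} {b} {c} l f = foldₚ l nilₚ (appendₚ (f ⊙ ⟨ v₀ , sndₚ ⊙ sndₚ ⟩ₚ) v₁) bound
  (λ x l′ le → ≤-trans (small x l′ le) (ℕₚ.+-monoʳ-≤ 1 (ℕₚ.*-monoˡ-≤ (K x) (≤-trans (length≤sz {b} l′) le))))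
  where
  K : El a → ℕ
  K x = suc (1 + (sz (list b) (⟦ l ⟧ₚ x) + sz a x)) ** proj₁ (space f)
  bound : PB a (λ x → 1 + sz (list b) (⟦ l ⟧ₚ x) * K x)
  bound = pb-+ (pb-const 1) (pb-* (space l) (pb-^ (pb-+ (pb-const 1) (pb-+ (space l) pb-sz)) (proj₁ (space f))))
  small : ∀ x l′ → sz (list b) l′ ≤ₙ sz (list b) (⟦ l ⟧ₚ x) →
          sz (list c) (foldr (λ v acc → foldr _∷_ acc (⟦ f ⟧ₚ (v , x))) [] l′) ≤ₙ 1 + length l′ * K x
  small x [] le = ≤-refl
  small x (u ∷ l′) le = begin
    _                                   ≤⟨ sz-append {c} (⟦ f ⟧ₚ (u , x)) _ ⟩
    sz (list c) (⟦ f ⟧ₚ (u , x)) + _       ≤⟨ +-mono-≤ fu (small x l′ (≤-trans (≤-trans (m≤n+m _ _) (ℕₚ.n≤1+n _)) le)) ⟩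
    K x + suc (length l′ * K x)         ≡⟨ ℕₚ.+-suc (K x) _ ⟩
    1 + length (u ∷ l′) * K x ∎
    where
    fu : sz (list c) (⟦ f ⟧ₚ (u , x)) ≤ₙ K x
    fu = ≤-trans (proj₂ (space f) _) (ℕₚ.^-monoˡ-≤ (proj₁ (space f)) (s≤s (s≤s (ℕₚ.+-monoˡ-≤ (sz a x)
           (≤-trans (≤-trans (m≤m+n (sz b u) (sz (list b) l′)) (ℕₚ.n≤1+n _)) le)))))

-- Two-satisfiability by resolution

Item : Set
Item = List Val

Family : Set
Family = List (Item × Item)

Rel : Set
Rel = Item → Item → Bool

Symm : Rel → Set
Symm r = ∀ c d → r c d ≡ r d c

-- From every pair (a , b) of a family one of the two items is to be selected;
-- r c d forbids to select both c and d, r c [] forbids c, and r [] [] signals a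
-- contradiction.

excl : Rel → Item → Item → Item → Bool
excl r a c d = r a [] ∨ (r a c ∨ r a d)

-- Eliminates the choice between a and b: c and d become incompatible if together they exclude both.
-- The resolvent of two clauses with at most two literals again has at most two, so a binary
-- relation on items suffices throughout.
resolve : Item × Item → Rel → Rel
resolve (a , b) r c d = r c d ∨ (excl r a c d ∧ excl r b c d)

data Sel : Family → List Item → Set where
  []    : Sel [] []
  left  : ∀ {a b φ σ} → Sel φ σ → Sel ((a , b) ∷ φ) (a ∷ σ)
  right : ∀ {a b φ σ} → Sel φ σ → Sel ((a , b) ∷ φ) (b ∷ σ)

record Clean (r : Rel) (σ : List Item) : Set where
  constructor clean
  field
    top   : r [] [] ≡ false
    units : All (λ c → r c [] ≡ false) σ
    pairs : AllPairs (λ c d → r c d ≡ false) σ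

open Clean public

∨-falseˡ : ∀ {x y} → x ∨ y ≡ false → x ≡ false
∨-falseˡ {false} _ = refl

∨-falseʳ : ∀ {x y} → x ∨ y ≡ false → y ≡ false
∨-falseʳ {false} e = e

∨-false : ∀ {x y} → x ≡ false → y ≡ false → x ∨ y ≡ false
∨-false refl refl = refl

excl-sym : ∀ r a c d → excl r a c d ≡ excl r a d c
excl-sym r a c d = cong (r a [] ∨_) (Boolₚ.∨-comm (r a c) (r a d))

resolve-sym : ∀ {r} p → Symm r → Symm (resolve p r)
resolve-sym {r} (a , b) s c d = cong₂ _∨_ (s c d) (cong₂ _∧_ (excl-sym r a c d) (excl-sym r b c d))

allPairs-↭ : ∀ {A : Set} {P : A → A → Set} → (∀ {x y} → P x y → P y x) →
             ∀ {xs ys} → xs ↭ ys → AllPairs P xs → AllPairs P ys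
allPairs-↭ s _↭_.refl q = q
allPairs-↭ s (_↭_.prep x p) (a ∷ q) = Permₚ.All-resp-↭ p a ∷ allPairs-↭ s p q
allPairs-↭ s (_↭_.swap x y p) ((xy ∷ a) ∷ b ∷ q) =
  (s xy ∷ Permₚ.All-resp-↭ p b) ∷ Permₚ.All-resp-↭ p a ∷ allPairs-↭ s p q
allPairs-↭ s (_↭_.trans p p′) q = allPairs-↭ s p′ (allPairs-↭ s p q)

clean-↭ : ∀ {r σ τ} → Symm r → σ ↭ τ → Clean r σ → Clean r τ
clean-↭ s p (clean t u q) = clean t (Permₚ.All-resp-↭ p u) (allPairs-↭ (λ {c} {d} e → trans (s d c) e) p q)

∧-falseˡ : ∀ {x} y → x ≡ false → x ∧ y ≡ false
∧-falseˡ y refl = refl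

∧-falseʳ : ∀ x {y} → y ≡ false → x ∧ y ≡ false
∧-falseʳ x refl = Boolₚ.∧-zeroʳ x

module _ {r : Rel} (a b : Item) where

  private
    r′ = resolve (a , b) r

  -- Here `e` is the selected one of a and b, and `kill` says that a conflict added by the
  -- resolution would need `e` to be excluded too.
  clean-resolve : ∀ {e σ} → (∀ c d → excl r e c d ≡ false → excl r a c d ∧ excl r b c d ≡ false) →
                  Clean r (e ∷ σ) → Clean r′ σ
  clean-resolve {e} kill (clean t (ue ∷ u) (pe ∷ p)) = clean
    (∨-false t (kill _ _ (∨-false ue (∨-false ue ue))))
    (All.zipWith (λ (uc , ec) → ∨-false uc (kill _ _ (∨-false ue (∨-false ec ue)))) (u , pe))
    (go pe p)
    where
    go : ∀ {σ} → All (λ c → r e c ≡ false) σ → AllPairs (λ c d → r c d ≡ false) σ →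
         AllPairs (λ c d → r′ c d ≡ false) σ
    go [] [] = []
    go (ec ∷ es) (cd ∷ ps) =
      All.zipWith (λ (f , ed) → ∨-false f (kill _ _ (∨-false ue (∨-false ec ed)))) (cd , es) ∷ go es ps

  apart-or-clash : ∀ e σ → All (λ c → r e c ≡ false) σ ⊎ Any (λ c → r e c ≡ true) σ
  apart-or-clash e [] = inj₁ []
  apart-or-clash e (c ∷ σ) with r e c in eq | apart-or-clash e σ
  ... | true  | _      = inj₂ (here eq)
  ... | false | inj₁ h = inj₁ (eq ∷ h)
  ... | false | inj₂ h = inj₂ (there h)

  clean-unresolve : ∀ {σ} → Clean r′ σ → Clean r σ
  clean-unresolve (clean t u p) = clean (∨-falseˡ t) (All.map ∨-falseˡ u) (AllPairs.map ∨-falseˡ p)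

  resolve-clash : ∀ {c d} → r′ c d ≡ false → excl r a c d ≡ true → excl r b c d ≡ true → ∀ {X : Set} → X
  resolve-clash e p q with ∨-falseʳ e
  ... | e′ with () ← trans (sym e′) (cong₂ _∧_ p q)

  ∨-true₁ : ∀ e c d → r e c ≡ true → excl r e c d ≡ true
  ∨-true₁ e c d h with r e []
  ... | true  = refl
  ... | false rewrite h = refl

  ∨-true₂ : ∀ e c d → r e d ≡ true → excl r e c d ≡ true
  ∨-true₂ e c d h = trans (excl-sym r e c d) (∨-true₁ e d c h)

  ∨-true₀ : ∀ e c d → r e [] ≡ true → excl r e c d ≡ true
  ∨-true₀ e c d h rewrite h = refl

  unit-clash : ∀ {σ} → All (λ c → r′ c [] ≡ false) σ → Any (λ c → r a c ≡ true) σ → r b [] ≡ true →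
               ∀ {X : Set} → X
  unit-clash (u ∷ us) (here e) f = resolve-clash u (∨-true₁ _ _ _ e) (∨-true₀ _ _ _ f)
  unit-clash (u ∷ us) (there e) f = unit-clash us e f

  unit-clash′ : ∀ {σ} → All (λ c → r′ c [] ≡ false) σ → Any (λ c → r b c ≡ true) σ → r a [] ≡ true →
               ∀ {X : Set} → X
  unit-clash′ (u ∷ us) (here e) f = resolve-clash u (∨-true₀ _ _ _ f) (∨-true₁ _ _ _ e)
  unit-clash′ (u ∷ us) (there e) f = unit-clash′ us e f

  one-clash : ∀ {σ c} → All (λ d → r′ c d ≡ false) σ → r a c ≡ true → Any (λ d → r b d ≡ true) σ →
              ∀ {X : Set} → X
  one-clash (e ∷ es) p (here q) = resolve-clash e (∨-true₁ _ _ _ p) (∨-true₂ _ _ _ q)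
  one-clash (e ∷ es) p (there q) = one-clash es p q

  one-clash′ : ∀ {σ c} → All (λ d → r′ c d ≡ false) σ → r b c ≡ true → Any (λ d → r a d ≡ true) σ →
              ∀ {X : Set} → X
  one-clash′ (e ∷ es) p (here q) = resolve-clash e (∨-true₂ _ _ _ q) (∨-true₁ _ _ _ p)
  one-clash′ (e ∷ es) p (there q) = one-clash′ es p q

  pair-clash : ∀ {σ} → All (λ c → r′ c [] ≡ false) σ → AllPairs (λ c d → r′ c d ≡ false) σ →
               Any (λ c → r a c ≡ true) σ → Any (λ c → r b c ≡ true) σ → ∀ {X : Set} → X
  pair-clash (u ∷ us) (q ∷ qs) (here e) (here f) = resolve-clash u (∨-true₁ _ _ _ e) (∨-true₁ _ _ _ f)
  pair-clash (u ∷ us) (q ∷ qs) (here e) (there f) = one-clash q e f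
  pair-clash (u ∷ us) (q ∷ qs) (there e) (here f) = one-clash′ q f e
  pair-clash (u ∷ us) (q ∷ qs) (there e) (there f) = pair-clash us qs e f

  -- If neither a nor b can be added, each of them clashes with a member of σ or is forbidden
  -- outright. The two culprits together violate a resolvent, which gives four contradictory cases.
  -- That two culprits suffice is what makes the test polynomial.
  resolve-clean : ∀ {σ} → Symm r → Clean r′ σ → Clean r (a ∷ σ) ⊎ Clean r (b ∷ σ)
  resolve-clean {σ} s cl@(clean t u p) with apart-or-clash a ([] ∷ σ) | apart-or-clash b ([] ∷ σ)
  ... | inj₁ (e ∷ es) | _ = inj₁ (clean (top (clean-unresolve cl)) (e ∷ units (clean-unresolve cl)) (es ∷ pairs (clean-unresolve cl)))
  ... | inj₂ _ | inj₁ (e ∷ es) = inj₂ (clean (top (clean-unresolve cl)) (e ∷ units (clean-unresolve cl)) (es ∷ pairs (clean-unresolve cl)))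
  ... | inj₂ (here e)  | inj₂ (here f)  = resolve-clash t (∨-true₀ _ _ _ e) (∨-true₀ _ _ _ f)
  ... | inj₂ (there e) | inj₂ (here f)  = unit-clash u e f
  ... | inj₂ (here e)  | inj₂ (there f) = unit-clash′ u f e
  ... | inj₂ (there e) | inj₂ (there f) = pair-clash u p e f

resolveAll : Rel → Family → Rel
resolveAll r = foldr resolve r

resolveAll-sym : ∀ {r} φ → Symm r → Symm (resolveAll r φ)
resolveAll-sym []      s = s
resolveAll-sym (p ∷ φ) s = resolve-sym p (resolveAll-sym φ s)

resolveAll-sound : ∀ {r} φ {σ} → Symm r → Clean (resolveAll r φ) σ → ∃[ τ ] (Sel φ τ × Clean r (τ ++ σ))
resolveAll-sound []      s c = [] , [] , c
resolveAll-sound {r} ((a , b) ∷ φ) {σ} s c with resolve-clean a b (resolveAll-sym φ s) c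
... | inj₁ c′ = let τ , sel , c″ = resolveAll-sound φ s c′ in
                a ∷ τ , left sel , clean-↭ s (Permₚ.shift a τ σ) c″
... | inj₂ c′ = let τ , sel , c″ = resolveAll-sound φ s c′ in
                b ∷ τ , right sel , clean-↭ s (Permₚ.shift b τ σ) c″

resolveAll-complete : ∀ {r φ τ σ} → Symm r → Sel φ τ → Clean r (τ ++ σ) → Clean (resolveAll r φ) σ
resolveAll-complete s [] c = c
resolveAll-complete {σ = σ} s (left {a} {b} {σ = τ} sel) c =
  clean-resolve a b (λ _ _ → ∧-falseˡ _) (resolveAll-complete s sel (clean-↭ s (↭-sym (Permₚ.shift a τ σ)) c))
resolveAll-complete {σ = σ} s (right {a} {b} {σ = τ} sel) c =
  clean-resolve a b (λ _ _ → ∧-falseʳ _) (resolveAll-complete s sel (clean-↭ s (↭-sym (Permₚ.shift b τ σ)) c))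

-- The search for independent sets of options

notB : Bool → Bool
notB b = if b then false else true

filterB : ∀ {A : Set} → (A → Bool) → List A → List A
filterB p = foldr (λ v acc → if p v then v ∷ acc else acc) []

concatMapB : ∀ {A C : Set} → (A → List C) → List A → List C
concatMapB f = foldr (λ v acc → foldr _∷_ acc (f v)) []

mapB : ∀ {A C : Set} → (A → C) → List A → List C
mapB f = foldr (λ v acc → f v ∷ acc) []

pickStep : ∀ {A : Set} → A → List A × List (A × List A) → List A × List (A × List A)
pickStep x (xs , ps) = x ∷ xs , (x , xs) ∷ mapB (λ q → proj₁ q , x ∷ proj₂ q) ps

-- The list itself is rebuilt alongside, as the step of a right fold does not see the tail.
picks′ : ∀ {A : Set} → List A → List A × List (A × List A)
picks′ = foldr pickStep ([] , [])

picks : ∀ {A : Set} → List A → List (A × List A)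
picks l = proj₂ (picks′ l)

isNil isOne isBig : ∀ {A : Set} → List A → Bool
isNil l = caseL l true (λ _ _ → false)
isOne l = caseL l false (λ _ l′ → isNil l′)
isBig l = caseL l false (λ _ l′ → caseL l′ false (λ _ l″ → caseL l″ false (λ _ _ → true)))

Num : Set
Num = List ⊤

decr : ∀ {A : Set} → Num → (Num → List A) → List A
decr c f = caseL c [] (λ _ c′ → f c′)

-- The empty list stands for a negative difference, that is an exceeded budget.
minus : ∀ {A : Set} → Num → List A → List Num
minus c = foldr (λ _ acc → caseL acc [] (λ c′ _ → decr c′ (λ c″ → c″ ∷ []))) (c ∷ [])

-- A configuration (todo , out , c) of the search for independent sets: the
-- undecided items, the pairs emitted so far and the number of items that
-- are still to be cut off.

Config : Set
Config = List Item × Family × Num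

module _ (r : Rel) where

  nbs non : Item × List Item → List Item
  nbs (x , rest) = filterB (r x) rest
  non (x , rest) = filterB (λ y → notB (r x y)) rest

  -- A minimum solution cuts off exactly one of a vertex and its single neighbour w, and the choice
  -- is left open. Conflicts of w with items outside of the pair are ignored here; the
  -- satisfiability test of the finished family takes care of them.
  pairAt : Family → Num → Item × List Item → List Config
  pairAt out c p = caseL (nbs p) [] (λ w _ → decr c (λ c′ → (non p , (proj₁ p , w) ∷ out , c′) ∷ []))

  -- Used right after a vertex is cut off. On a cycle this leaves a vertex of degree one, and
  -- settling its pair in the same step charges the branch with two cuts instead of one.
  pairOr : Config → List Config
  pairOr (todo , out , c) = caseL (filterB (λ p → isOne (nbs p)) (picks todo)) ((todo , out , c) ∷ [])
    (λ p _ → pairAt out c p)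

  keepAt : Family → Num → Item × List Item → List Config
  keepAt out c p = caseL (minus c (nbs p)) [] (λ c′ _ → (non p , (proj₁ p , proj₁ p) ∷ out , c′) ∷ [])

  branch : Family → Num → Item × List Item → List Config
  branch out c p = foldr _∷_ (keepAt out c p) (decr c (λ c′ → pairOr (proj₂ p , out , c′)))

  -- The order matters for the count: isolated vertices come first, then vertices of degree one,
  -- then those of degree at least three. The concatenation in `step₃` falls back on an arbitrary
  -- vertex only when all degrees are two.
  step₃ step₂ step₁ : Config → List Config
  step₃ (todo , out , c) = caseL (foldr _∷_ (picks todo) (filterB (λ p → isBig (nbs p)) (picks todo)))
    (caseL c ((todo , out , c) ∷ []) (λ _ _ → [])) (λ p _ → branch out c p)
  step₂ (todo , out , c) = caseL (filterB (λ p → isOne (nbs p)) (picks todo)) (step₃ (todo , out , c))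
    (λ p _ → pairAt out c p)
  step₁ (todo , out , c) = caseL (filterB (λ p → isNil (nbs p)) (picks todo)) (step₂ (todo , out , c))
    (λ p _ → (proj₂ p , (proj₁ p , proj₁ p) ∷ out , c) ∷ [])
  opaque
    step₀ : Config → List Config
    step₀ (todo , out , c) = caseL (filterB (λ p → r (proj₁ p) []) (picks todo)) (step₁ (todo , out , c))
      (λ p _ → decr c (λ c′ → (proj₂ p , out , c′) ∷ []))

-- Lists, picks and permutations

caseL-elim : ∀ {A C : Set} (P : C → Set) (l : List A) {z s} →
             (l ≡ [] → P z) → (∀ x xs → l ≡ x ∷ xs → P (s x xs)) → P (caseL l z s)
caseL-elim P []       f g = f refl
caseL-elim P (x ∷ xs) f g = g x xs refl

filterB-⊆ : ∀ {A : Set} (p : A → Bool) l {x} → x ∈ filterB p l → x ∈ l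
filterB-⊆ p (y ∷ l) i with p y
filterB-⊆ p (y ∷ l) (here e)  | true  = here e
filterB-⊆ p (y ∷ l) (there i) | true  = there (filterB-⊆ p l i)
filterB-⊆ p (y ∷ l) i         | false = there (filterB-⊆ p l i)

picks′-fst : ∀ {A : Set} (l : List A) → proj₁ (picks′ l) ≡ l
picks′-fst []      = refl
picks′-fst (x ∷ l) = cong (x ∷_) (picks′-fst l)

mapB≡ : ∀ {A C : Set} (f : A → C) l → mapB f l ≡ List.map f l
mapB≡ f []      = refl
mapB≡ f (x ∷ l) = cong (f x ∷_) (mapB≡ f l)

picks-∷ : ∀ {A : Set} (x : A) l → picks (x ∷ l) ≡ (x , l) ∷ List.map (λ q → proj₁ q , x ∷ proj₂ q) (picks l)
picks-∷ x l rewrite picks′-fst l = cong ((x , l) ∷_) (mapB≡ _ (picks l))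

picks-↭ : ∀ {A : Set} (l : List A) → All (λ p → l ↭ proj₁ p ∷ proj₂ p) (picks l)
picks-↭ [] = []
picks-↭ (x ∷ l) rewrite picks-∷ x l = ↭-refl ∷ Allₚ.map⁺ (All.map
  (λ {p} h → ↭-trans (prep x h) (_↭_.swap x (proj₁ p) ↭-refl)) (picks-↭ l))

∈-picks : ∀ {A : Set} {x : A} {l} → x ∈ l → ∃[ rest ] (x , rest) ∈ picks l
∈-picks {l = y ∷ l} (here refl) rewrite picks-∷ y l = l , here refl
∈-picks {l = y ∷ l} (there i) with ∈-picks i
... | rest , j rewrite picks-∷ y l = y ∷ rest , there (∈ₚ.∈-map⁺ _ j)

filterB-head : ∀ {A : Set} (p : A → Bool) l {x xs} → filterB p l ≡ x ∷ xs → x ∈ l × p x ≡ true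
filterB-head p (y ∷ l) eq with p y in e
filterB-head p (y ∷ l) refl | true = here refl , e
... | false = let i , h = filterB-head p l eq in there i , h

filterB-none : ∀ {A : Set} (p : A → Bool) l → filterB p l ≡ [] → All (λ x → p x ≡ false) l
filterB-none p [] eq = []
filterB-none p (y ∷ l) eq with p y in e
filterB-none p (y ∷ l) () | true
... | false = e ∷ filterB-none p l eq

filterB-all : ∀ {A : Set} (p : A → Bool) l → All (λ x → p x ≡ true) (filterB p l)
filterB-all p [] = []
filterB-all p (y ∷ l) with p y in e
... | true  = e ∷ filterB-all p l
... | false = filterB-all p l

filterB-split : ∀ {A : Set} (p : A → Bool) l → l ↭ filterB p l ++ filterB (λ x → notB (p x)) l
filterB-split p [] = ↭-refl
filterB-split p (y ∷ l) with p y
... | true  = prep y (filterB-split p l)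
... | false = ↭-trans (prep y (filterB-split p l)) (↭-sym (Permₚ.shift y (filterB p l) _))

filterB-↭ : ∀ {A : Set} (p : A → Bool) {l l′} → l ↭ l′ → filterB p l ↭ filterB p l′
filterB-↭ p _↭_.refl = ↭-refl
filterB-↭ p (_↭_.prep x h) with p x
... | true  = prep x (filterB-↭ p h)
... | false = filterB-↭ p h
filterB-↭ p (_↭_.swap x y h) with p x | p y
... | true  | true  = _↭_.swap x y (filterB-↭ p h)
... | true  | false = prep x (filterB-↭ p h)
... | false | true  = prep y (filterB-↭ p h)
... | false | false = filterB-↭ p h
filterB-↭ p (_↭_.trans h h′) = ↭-trans (filterB-↭ p h) (filterB-↭ p h′)

foldr-∷ : ∀ {A : Set} (xs ys : List A) → foldr _∷_ ys xs ≡ xs ++ ys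
foldr-∷ []       ys = refl
foldr-∷ (x ∷ xs) ys = cong (x ∷_) (foldr-∷ xs ys)

minus-length : ∀ {A : Set} (c : Num) (l : List A) {c′ cs} → minus c l ≡ c′ ∷ cs → length c ≡ length l + length c′
minus-length c [] refl = refl
minus-length c (x ∷ l) eq with minus c l in e
minus-length c (x ∷ l) refl | (_ ∷ c′) ∷ _ = trans (minus-length c l e) (ℕₚ.+-suc (length l) _)

minus-defined : ∀ {A : Set} (c : Num) (l : List A) → length l ≤ₙ length c → ∃[ c′ ] minus c l ≡ c′ ∷ []
minus-defined c [] h = c , refl
minus-defined c (x ∷ l) h with minus-defined c l (ℕₚ.≤-trans (ℕₚ.n≤1+n _) h)
... | [] , e = ⊥-elim (ℕₚ.<-irrefl (sym (trans (minus-length c l e) (ℕₚ.+-identityʳ _))) h)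
... | (_ ∷ c′) , e rewrite e = c′ , refl

split-∷ : ∀ {A : Set} {x : A} {rest} U {K} → x ∷ rest ↭ U ++ K →
          (∃[ U′ ] (U ↭ x ∷ U′ × rest ↭ U′ ++ K)) ⊎ (∃[ K′ ] (K ↭ x ∷ K′ × rest ↭ U ++ K′))
split-∷ {x = x} U {K} h with ∈ₚ.∈-++⁻ U (Permₚ.∈-resp-↭ h (here refl))
... | inj₁ i with ∈ₚ.∈-∃++ i
...   | as , bs , refl = inj₁ (as ++ bs , Permₚ.shift x as bs ,
        Permₚ.drop-∷ (↭-trans h (Permₚ.++⁺ʳ K (Permₚ.shift x as bs))))
split-∷ {x = x} U {K} h | inj₂ i with ∈ₚ.∈-∃++ i
...   | as , bs , refl = inj₂ (as ++ bs , Permₚ.shift x as bs ,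
        Permₚ.drop-∷ (↭-trans h (↭-trans (Permₚ.++⁺ˡ U (Permₚ.shift x as bs)) (Permₚ.shift x U (as ++ bs)))))

true≢false : ∀ {b} → b ≡ true → b ≡ false → ⊥
true≢false refl ()

not-true : ∀ {b} → notB b ≡ true → b ≡ false
not-true {false} _ = refl

isNil-true : ∀ {A : Set} {l : List A} → isNil l ≡ true → l ≡ []
isNil-true {l = []} _ = refl

isOne-true : ∀ {A : Set} {l : List A} → isOne l ≡ true → ∃[ w ] l ≡ w ∷ []
isOne-true {l = w ∷ []} _ = w , refl

picked : ∀ (q : Item × List Item → Bool) todo {p ps} → filterB q (picks todo) ≡ p ∷ ps →
         todo ↭ proj₁ p ∷ proj₂ p × q p ≡ true
picked q todo e = let i , h = filterB-head q (picks todo) e in All.lookup (picks-↭ todo) i , h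

-- Completeness: minimum solutions survive every step

module Search (r : Rel) (symm : Symm r) where

  Free : Item → Set
  Free x = r x [] ≡ false

  Ind : List Item → Set
  Ind U = All Free U × AllPairs (λ x y → r x y ≡ false) U

  ind-↭ : ∀ {U U′} → U ↭ U′ → Ind U → Ind U′
  ind-↭ p (u , q) = Permₚ.All-resp-↭ p u , allPairs-↭ (λ {x} {y} e → trans (symm y x) e) p q

  -- Minimality belongs to the invariant because isolated vertices and pairs are treated greedily,
  -- which is right for minimum solutions only.
  MinCut : List Item → ℕ → Set
  MinCut todo c = ∀ U K → todo ↭ U ++ K → Ind U → c ≤ₙ length K

  record Has (κ : Config) (σ : List Item) : Set where
    constructor has
    field
      {τ U K} : List Item
      sel   : Sel (proj₁ (proj₂ κ)) τ
      split : proj₁ κ ↭ U ++ K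
      ind   : Ind U
      cuts  : length K ≡ length (proj₂ (proj₂ κ))
      min   : MinCut (proj₁ κ) (length (proj₂ (proj₂ κ)))
      perm  : τ ++ U ↭ σ

  non-false : ∀ x rest → All (λ y → r x y ≡ false) (non r (x , rest))
  non-false x rest = All.map not-true (filterB-all _ rest)

  non-ind : ∀ {x rest U K} → Free x → non r (x , rest) ↭ U ++ K → Ind U → Ind (x ∷ U)
  non-ind {x} {rest} {U} free p (u , q) =
    free ∷ u , Allₚ.++⁻ˡ U (Permₚ.All-resp-↭ p (non-false x rest)) ∷ q

  has-cut : ∀ {todo out c σ x rest τ U K} → todo ↭ x ∷ rest → Sel out τ → Ind U → length (x ∷ K) ≡ length c →
            rest ↭ U ++ K → MinCut todo (length c) → τ ++ U ↭ σ →
            ∃[ c′ ] (c ≡ tt ∷ c′ × Has (rest , out , c′) σ)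
  has-cut {c = tt ∷ c′} {x = x} p sel ind cuts split min perm = c′ , refl , record
    { sel = sel ; split = split ; ind = ind ; cuts = ℕₚ.suc-injective cuts ; perm = perm
    ; min = λ U K q i → ℕₚ.≤-pred (min U (x ∷ K) (↭-trans p (↭-trans (prep x q) (↭-sym (Permₚ.shift x U K)))) i) }

  drop-nbs : ∀ {x} N {M U K} → N ++ M ↭ U ++ K → All (λ y → r x y ≡ true) N → All (λ y → r x y ≡ false) U →
             ∃[ K′ ] (K ↭ N ++ K′ × M ↭ U ++ K′)
  drop-nbs [] {K = K} p _ _ = K , ↭-refl , p
  drop-nbs (y ∷ N) {U = U} p (e ∷ es) f with split-∷ U p
  ... | inj₁ (U′ , q , _) with Permₚ.All-resp-↭ q f
  ...   | e′ ∷ _ = ⊥-elim (true≢false e e′)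
  drop-nbs (y ∷ N) {U = U} p (e ∷ es) f | inj₂ (K′ , q , p′) =
    let K″ , q′ , p″ = drop-nbs N p′ es f in K″ , ↭-trans q (prep y q′) , p″

  nbs-split : ∀ x rest → rest ↭ nbs r (x , rest) ++ non r (x , rest)
  nbs-split x rest = filterB-split (r x) rest

  has-keep : ∀ {todo out c σ x rest τ U K} → todo ↭ x ∷ rest → Free x → Sel out τ → Ind (x ∷ U) →
             length K ≡ length c → rest ↭ U ++ K → MinCut todo (length c) → τ ++ x ∷ U ↭ σ →
             Any (λ κ → Has κ σ) (keepAt r out c (x , rest))
  has-keep {c = c} {x = x} {rest} {τ} {U} {K} p free sel ind@(_ ∷ u , f ∷ q) cuts split min perm
    with drop-nbs (nbs r (x , rest)) (↭-trans (↭-sym (nbs-split x rest)) split) (filterB-all _ rest) f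
  ... | K′ , K≈ , non≈ with minus-defined c (nbs r (x , rest))
           (ℕₚ.≤-trans (ℕₚ.m≤m+n _ (length K′)) (ℕₚ.≤-reflexive (trans (sym (Listₚ.length-++ (nbs r (x , rest)))) (trans (sym (Permₚ.↭-length K≈)) cuts))))
  ...   | c′ , e rewrite e = here (record
          { sel = left sel ; split = non≈ ; ind = u , q
          ; cuts = ℕₚ.+-cancelˡ-≡ N _ _ (trans (sym (Listₚ.length-++ (nbs r (x , rest)))) (trans (sym (Permₚ.↭-length K≈)) (trans cuts c≡)))
          ; min = λ U₂ K₂ p₂ i₂ → ℕₚ.+-cancelˡ-≤ N _ _ (subst (_≤ₙ N + length K₂) c≡
              (subst (length c ≤ₙ_) (Listₚ.length-++ (nbs r (x , rest)))
                (min (x ∷ U₂) (nbs r (x , rest) ++ K₂) (↭-trans p (prep x (↭-trans (nbs-split x rest)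
                   (↭-trans (Permₚ.++⁺ˡ (nbs r (x , rest)) p₂) (Permₚ.shifts (nbs r (x , rest)) U₂)))))
                  (non-ind {rest = rest} {K = K₂} free p₂ i₂))))
          ; perm = ↭-trans (↭-sym (Permₚ.shift x τ U)) perm })
    where
    N = length (nbs r (x , rest))
    c≡ = minus-length c (nbs r (x , rest)) e

  -- Keeping both x and w is a conflict, and cutting both contradicts minimality since x could be
  -- taken back. In the remaining cases the side selected from the new pair records which of the two
  -- is kept.
  has-pair : ∀ {todo out c σ x rest} → todo ↭ x ∷ rest → Free x → isOne (nbs r (x , rest)) ≡ true →
             Has (todo , out , c) σ → Any (λ κ → Has κ σ) (pairAt r out c (x , rest))
  has-pair {out = out} {c = c} {σ} {x} {rest} p free one (has {τ} {U} {K} sel split ind cuts min perm) with isOne-true one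
  ... | w , e = subst (λ l → Any (λ κ → Has κ σ) (caseL l [] (λ w _ → emit w c))) (sym e) (go c cuts min)
    where
    emit : Item → Num → List Config
    emit w c = decr c (λ c′ → (non r (x , rest) , (x , w) ∷ out , c′) ∷ [])
    rest≈ : rest ↭ w ∷ non r (x , rest)
    rest≈ = subst (λ l → rest ↭ l ++ non r (x , rest)) e (nbs-split x rest)
    rxw : r x w ≡ true
    rxw with subst (All (λ y → r x y ≡ true)) e (filterB-all _ rest)
    ... | h ∷ _ = h
    go : ∀ c → length K ≡ length c → MinCut _ (length c) → Any (λ κ → Has κ σ) (emit w c)
    go c cuts min with split-∷ U (↭-trans (↭-sym p) split)
    ... | inj₁ (U′ , qU , split′) with split-∷ U′ (↭-trans (↭-sym rest≈) split′)
    ...   | inj₁ (U″ , qU′ , _) with ind-↭ qU ind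
    ...     | _ , f ∷ _ with Permₚ.All-resp-↭ qU′ f
    ...       | f′ ∷ _ = ⊥-elim (true≢false rxw f′)
    go c cuts min | inj₁ (U′ , qU , split′) | inj₂ (K′ , qK , split″) with c | trans (sym (Permₚ.↭-length qK)) cuts | ind-↭ qU ind
    ... | tt ∷ c′ | cuts′ | _ ∷ u , _ ∷ q = here (record
          { sel = left sel ; split = split″ ; ind = u , q ; cuts = ℕₚ.suc-injective cuts′
          ; min = min-non min ; perm = ↭-trans (↭-sym (Permₚ.shift x τ U′)) (↭-trans (Permₚ.++⁺ˡ τ (↭-sym qU)) perm) })
      where
      min-non : MinCut _ (suc (length c′)) → MinCut (non r (x , rest)) (length c′)
      min-non m U₂ K₂ p₂ i₂ = ℕₚ.≤-pred (m (x ∷ U₂) (w ∷ K₂)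
        (↭-trans p (prep x (↭-trans rest≈ (↭-trans (prep w p₂) (↭-sym (Permₚ.shift w U₂ K₂))))))
        (non-ind {rest = rest} {K = K₂} free p₂ i₂))
    go c cuts min | inj₂ (K′ , qK , split′) with split-∷ U (↭-trans (↭-sym rest≈) split′)
    go c cuts min | inj₂ (K′ , qK , split′) | inj₂ (K″ , qK′ , split″) = ⊥-elim (ℕₚ.<-irrefl (trans (sym cuts) (Permₚ.↭-length qK))
      (s≤s (min (x ∷ U) K′ (↭-trans p (prep x split′)) (non-ind {rest = rest} {K = K″} free split″ ind))))
    go c cuts min | inj₂ (K′ , qK , split′) | inj₁ (U′ , qU , split″) with c | trans (sym (Permₚ.↭-length qK)) cuts | ind-↭ qU ind
    ... | tt ∷ c′ | cuts′ | _ ∷ u , _ ∷ q = here (record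
          { sel = right sel ; split = split″ ; ind = u , q ; cuts = ℕₚ.suc-injective cuts′
          ; min = min-non min ; perm = ↭-trans (↭-sym (Permₚ.shift w τ U′)) (↭-trans (Permₚ.++⁺ˡ τ (↭-sym qU)) perm) })
      where
      min-non : MinCut _ (suc (length c′)) → MinCut (non r (x , rest)) (length c′)
      min-non m U₂ K₂ p₂ i₂ = ℕₚ.≤-pred (m (x ∷ U₂) (w ∷ K₂)
        (↭-trans p (prep x (↭-trans rest≈ (↭-trans (prep w p₂) (↭-sym (Permₚ.shift w U₂ K₂))))))
        (non-ind {rest = rest} {K = K₂} free p₂ i₂))

  picks-free : ∀ {todo} → filterB (λ p → r (proj₁ p) []) (picks todo) ≡ [] → All Free todo
  picks-free {todo} e = All.tabulate λ i →
    let _ , j = ∈-picks i in All.lookup (filterB-none _ (picks todo) e) j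

  free-head : ∀ {todo x rest} → All Free todo → todo ↭ x ∷ rest → Free x
  free-head f p with Permₚ.All-resp-↭ p f
  ... | h ∷ _ = h

  free-tail : ∀ {todo x rest} → All Free todo → todo ↭ x ∷ rest → All Free rest
  free-tail f p with Permₚ.All-resp-↭ p f
  ... | _ ∷ h = h

  has-or : ∀ {todo out c σ} → All Free todo → Has (todo , out , c) σ →
           Any (λ κ → Has κ σ) (pairOr r (todo , out , c))
  has-or {todo} {σ = σ} free h = caseL-elim (Any (λ κ → Has κ σ)) (filterB _ (picks todo))
    (λ _ → here h)
    (λ p _ e → let s , one = picked _ todo e in has-pair s (free-head free s) one h)

  has-branch : ∀ {todo out c σ x rest} → All Free todo → todo ↭ x ∷ rest → Has (todo , out , c) σ →
               Any (λ κ → Has κ σ) (branch r out c (x , rest))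
  has-branch {out = out} {c} {σ} {x} {rest} free p (has {τ} {U} {K} sel split ind cuts min perm) =
    subst (Any _) (sym (foldr-∷ (decr c _) (keepAt r out c (x , rest)))) go
    where
    go : Any (λ κ → Has κ σ) (decr c (λ c′ → pairOr r (rest , out , c′)) ++ keepAt r out c (x , rest))
    go with split-∷ U (↭-trans (↭-sym p) split)
    ... | inj₁ (U′ , qU , split′) = Anyₚ.++⁺ʳ _
          (has-keep p (free-head free p) sel (ind-↭ qU ind) cuts split′ min (↭-trans (Permₚ.++⁺ˡ τ (↭-sym qU)) perm))
    ... | inj₂ (K′ , qK , split′) with has-cut {c = c} p sel ind (trans (sym (Permₚ.↭-length qK)) cuts) split′ min perm
    ...   | c′ , refl , h = Anyₚ.++⁺ˡ (has-or (free-tail free p) h)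

  has-stop : ∀ {out c σ} todo → Has (todo , out , c) σ →
             foldr _∷_ (picks todo) (filterB (λ p → isBig (nbs r p)) (picks todo)) ≡ [] →
             Any (λ κ → Has κ σ) (caseL c ((todo , out , c) ∷ []) (λ _ _ → []))
  has-stop {c = c} [] (has {U = U} {K} sel split ind cuts min perm) e
    with ℕₚ.n≤0⇒n≡0 (ℕₚ.≤-trans (ℕₚ.m≤n+m (length K) (length U))
           (ℕₚ.≤-reflexive (trans (sym (Listₚ.length-++ U)) (sym (Permₚ.↭-length split)))))
  ... | K≡0 with c | trans (sym cuts) K≡0
  ...   | [] | _ = here (has sel split ind K≡0 (λ _ _ _ _ → z≤n) perm)
  has-stop (x ∷ todo) h e
    with Listₚ.++-conicalʳ (filterB (λ p → isBig (nbs r p)) (picks (x ∷ todo))) _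
           (trans (sym (foldr-∷ (filterB (λ p → isBig (nbs r p)) (picks (x ∷ todo))) _)) e)
  ... | ()

  has-step₃ : ∀ {todo out c σ} → All Free todo → Has (todo , out , c) σ →
              Any (λ κ → Has κ σ) (step₃ r (todo , out , c))
  has-step₃ {todo} {out} {c} {σ} free h = caseL-elim (Any (λ κ → Has κ σ)) (foldr _∷_ (picks todo) bigs) (has-stop todo h) go
    where
    bigs = filterB (λ p → isBig (nbs r p)) (picks todo)
    go : ∀ p ps → foldr _∷_ (picks todo) bigs ≡ p ∷ ps → Any (λ κ → Has κ σ) (branch r out c p)
    go p ps e = has-branch free (All.lookup (picks-↭ todo) mem) h
      where
      mem : p ∈ picks todo
      mem with ∈ₚ.∈-++⁻ bigs (subst (p ∈_) (trans (sym e) (foldr-∷ bigs _)) (here refl))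
      ... | inj₂ i = i
      ... | inj₁ i = filterB-⊆ _ (picks todo) i

  has-step₂ : ∀ {todo out c σ} → All Free todo → Has (todo , out , c) σ →
              Any (λ κ → Has κ σ) (step₂ r (todo , out , c))
  has-step₂ {todo} {σ = σ} free h = caseL-elim (Any (λ κ → Has κ σ)) (filterB _ (picks todo))
    (λ _ → has-step₃ free h)
    (λ p _ e → let s , one = picked _ todo e in has-pair s (free-head free s) one h)

  -- Cutting off a vertex without neighbours would contradict minimality.
  has-lone : ∀ {todo out c σ x rest} → Free x → todo ↭ x ∷ rest → nbs r (x , rest) ≡ [] → Has (todo , out , c) σ →
             Has (rest , (x , x) ∷ out , c) σ
  has-lone {c = c} {x = x} {rest} free p e (has {τ} {U} {K} sel split ind cuts min perm)
    with split-∷ U (↭-trans (↭-sym p) split)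
  ... | inj₁ (U′ , qU , split′) = let u , q = ind-↭ qU ind in record
        { sel = left sel ; split = split′ ; ind = All.tail u , AllPairs.tail q ; cuts = cuts
        ; min = λ U₂ K₂ p₂ i₂ → min (x ∷ U₂) K₂ (↭-trans p (prep x p₂)) (lone-ind p₂ i₂)
        ; perm = ↭-trans (↭-sym (Permₚ.shift x τ U′)) (↭-trans (Permₚ.++⁺ˡ τ (↭-sym qU)) perm) }
    where
    lone-ind : ∀ {U₂ K₂} → rest ↭ U₂ ++ K₂ → Ind U₂ → Ind (x ∷ U₂)
    lone-ind {U₂} p₂ (u , q) = free ∷ u , Allₚ.++⁻ˡ U₂ (Permₚ.All-resp-↭ p₂ (filterB-none _ rest e)) ∷ q
  ... | inj₂ (K′ , qK , split′) = ⊥-elim (ℕₚ.<-irrefl (trans (sym cuts) (Permₚ.↭-length qK))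
        (s≤s (min (x ∷ U) K′ (↭-trans p (prep x split′))
          (free ∷ proj₁ ind , Allₚ.++⁻ˡ U (Permₚ.All-resp-↭ split′ (filterB-none _ rest e)) ∷ proj₂ ind))))

  has-step₁ : ∀ {todo out c σ} → All Free todo → Has (todo , out , c) σ →
              Any (λ κ → Has κ σ) (step₁ r (todo , out , c))
  has-step₁ {todo} {σ = σ} free h = caseL-elim (Any (λ κ → Has κ σ)) (filterB _ (picks todo))
    (λ _ → has-step₂ free h)
    (λ p _ e → let s , nl = picked _ todo e in here (has-lone (free-head free s) s (isNil-true nl) h))

  opaque
    unfolding step₀

    has-step : ∀ {κ σ} → Has κ σ → Any (λ κ′ → Has κ′ σ) (step₀ r κ)
    has-step {todo , out , c} {σ} h@(has {τ} {U} {K} sel split ind cuts min perm) =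
      caseL-elim (Any (λ κ → Has κ σ)) (filterB _ (picks todo)) (λ e → has-step₁ (picks-free e) h) cut
      where
      cut : ∀ p ps → filterB (λ p → r (proj₁ p) []) (picks todo) ≡ p ∷ ps →
            Any (λ κ → Has κ σ) (decr c (λ c′ → (proj₂ p , out , c′) ∷ []))
      cut (x , rest) _ e with picked _ todo e
      ... | s , loop with split-∷ U (↭-trans (↭-sym s) split)
      ...   | inj₁ (U′ , qU , _) = ⊥-elim (true≢false loop (All.head (proj₁ (ind-↭ qU ind))))
      ...   | inj₂ (K′ , qK , split′) with has-cut {c = c} s sel ind (trans (sym (Permₚ.↭-length qK)) cuts) split′ min perm
      ...     | c′ , refl , h′ = here h′

-- Soundness: whatever completes a later configuration completes the initial one

todoₖ : Config → List Item
todoₖ κ = proj₁ κ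

outₖ : Config → Family
outₖ κ = proj₁ (proj₂ κ)

cutsₖ : Config → ℕ
cutsₖ κ = length (proj₂ (proj₂ κ))

-- Every way of completing the configuration κ′ is one of completing κ.

record Origin (κ κ′ : Config) : Set where
  constructor origin
  field
    pull : ∀ {τ′ U′ K′} → Sel (outₖ κ′) τ′ → todoₖ κ′ ↭ U′ ++ K′ →
           ∃[ τ ] ∃[ U ] ∃[ K ] (Sel (outₖ κ) τ × todoₖ κ ↭ U ++ K × τ ++ U ↭ τ′ ++ U′
             × length K + cutsₖ κ′ ≡ length K′ + cutsₖ κ)

open Origin public

origin-refl : ∀ {κ} → Origin κ κ
origin-refl = origin λ s p → _ , _ , _ , s , p , ↭-refl , refl

origin-trans : ∀ {κ κ′ κ″} → Origin κ κ′ → Origin κ′ κ″ → Origin κ κ″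
origin-trans {κ} {κ′} {κ″} o o′ = origin λ {τ″} {U″} {K″} s p →
  let τ′ , U′ , K′ , s′ , p′ , q′ , e′ = pull o′ s p
      τ , U , K , s″ , p″ , q″ , e″ = pull o s′ p′
  in τ , U , K , s″ , p″ , ↭-trans q″ q′ ,
     ℕₚ.+-cancelʳ-≡ (cutsₖ κ′) _ _ (eq (length K) (length K′) (length K″) (cutsₖ κ) (cutsₖ κ′) (cutsₖ κ″) e″ e′)
  where
  eq : ∀ k k′ k″ c c′ c″ → k + c′ ≡ k′ + c → k′ + c″ ≡ k″ + c′ → k + c″ + c′ ≡ k″ + c + c′
  eq k k′ k″ c c′ c″ e e′ = trans (r₁ k c″ c′) (trans (cong (_+ c″) e) (trans (r₁ k′ c c″) (trans (cong (_+ c) e′) (r₁ k″ c′ c))))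
    where
    r₁ : ∀ a b d → a + b + d ≡ a + d + b
    r₁ = solve-∀

origin-cut : ∀ {todo out c x rest} → todo ↭ x ∷ rest → Origin (todo , out , tt ∷ c) (rest , out , c)
origin-cut {c = c} {x} p = origin λ {τ} {U} {K} s q → τ , U , x ∷ K , s ,
  ↭-trans p (↭-trans (prep x q) (↭-sym (Permₚ.shift x U K))) , ↭-refl , sym (ℕₚ.+-suc (length K) (length c))

origin-keep : ∀ {todo out c c′ x} N M → todo ↭ x ∷ N ++ M → length c ≡ length N + length c′ →
              Origin (todo , out , c) (M , (x , x) ∷ out , c′)
origin-keep {c = c} {c′} {x} N M p e = origin λ { {x′ ∷ τ} {U} {K} s q → τ , x ∷ U , N ++ K , sel s ,
    ↭-trans p (prep x (↭-trans (Permₚ.++⁺ˡ N q) (Permₚ.shifts N U))) , perm τ U s ,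
    trans (cong (_+ length c′) (Listₚ.length-++ N)) (trans (r (length N) (length K) (length c′)) (cong (length K +_) (sym e))) }
  where
  r : ∀ n k c′ → n + k + c′ ≡ k + (n + c′)
  r = solve-∀
  sel : ∀ {x′ τ φ} → Sel ((x , x) ∷ φ) (x′ ∷ τ) → Sel φ τ
  sel (left s)  = s
  sel (right s) = s
  perm : ∀ {x′ φ} τ U → Sel ((x , x) ∷ φ) (x′ ∷ τ) → τ ++ x ∷ U ↭ (x′ ∷ τ) ++ U
  perm τ U (left s)  = Permₚ.shift x τ U
  perm τ U (right s) = Permₚ.shift x τ U

origin-pair : ∀ {todo out c x w} M → todo ↭ x ∷ w ∷ M → Origin (todo , out , tt ∷ c) (M , (x , w) ∷ out , c)
origin-pair {c = c} {x} {w} M p = origin λ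
  { {τ′} {U} {K} (left {σ = τ} s) q → τ , x ∷ U , w ∷ K , s , ↭-trans p (prep x (↭-trans (prep w q) (↭-sym (Permₚ.shift w U K)))) ,
      Permₚ.shift x τ U , sym (ℕₚ.+-suc (length K) (length c))
  ; {τ′} {U} {K} (right {σ = τ} s) q → τ , w ∷ U , x ∷ K , s ,
      ↭-trans p (↭-trans (_↭_.swap x w q) (prep w (↭-sym (Permₚ.shift x U K)))) ,
      Permₚ.shift w τ U , sym (ℕₚ.+-suc (length K) (length c)) }

-- The size of the search tree below a configuration with n items to be cut.

f : ℕ → ℕ
f 0 = 1
f 1 = 1
f 2 = 2
f (suc (suc (suc n))) = f (suc (suc n)) + f n

f-suc : ∀ n → f n ≤ₙ f (suc n)
f-suc 0 = s≤s z≤n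
f-suc 1 = s≤s z≤n
f-suc 2 = s≤s (s≤s z≤n)
f-suc (suc (suc (suc n))) = ℕₚ.m≤m+n _ _

f-mono : ∀ {m n} → m ≤ₙ n → f m ≤ₙ f n
f-mono {m} {n} le = go {m} {n} (ℕₚ.≤⇒≤′ le)
  where
  go : ∀ {m n} → m ≤′ n → f m ≤ₙ f n
  go {m} ≤′-refl = ℕₚ.≤-refl {f m}
  go {m} {suc n} (≤′-step h) = ℕₚ.≤-trans (go {m} {n} h) (f-suc n)

f-pos : ∀ n → 1 ≤ₙ f n
f-pos n = f-mono {0} {n} z≤n

-- Pays for cycles: one branch cuts a vertex and settles the pair that appears, the other one cuts
-- two neighbours, so either branch uses two cuts.
f-double : ∀ n → f n + f n ≤ₙ f (suc (suc n))
f-double 0 = s≤s (s≤s z≤n)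
f-double 1 = s≤s (s≤s z≤n)
f-double 2 = s≤s (s≤s (s≤s (s≤s z≤n)))
f-double (suc (suc (suc n))) = ℕₚ.≤-trans (ℕₚ.≤-reflexive (r (f (suc (suc n))) (f n)))
  (ℕₚ.+-mono-≤ (f-double (suc (suc n))) (f-double n))
  where
  r : ∀ a b → a + b + (a + b) ≡ a + a + (b + b)
  r = solve-∀

-- A potential: no step of the search increases it, and every configuration contributes at least 1,
-- so it bounds the number of leaves.
weight : List Config → ℕ
weight []       = 0
weight (κ ∷ κs) = f (cutsₖ κ) + weight κs

weight-++ : ∀ κs κs′ → weight (κs ++ κs′) ≡ weight κs + weight κs′
weight-++ []       κs′ = refl
weight-++ (κ ∷ κs) κs′ = trans (cong (f (cutsₖ κ) +_) (weight-++ κs κs′)) (sym (ℕₚ.+-assoc (f (cutsₖ κ)) _ _))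

length≤weight : ∀ κs → length κs ≤ₙ weight κs
length≤weight []       = z≤n
length≤weight (κ ∷ κs) = ℕₚ.+-mono-≤ (f-pos (cutsₖ κ)) (length≤weight κs)

module SearchSound (r : Rel) where

  keep-shape : ∀ out c p →
    keepAt r out c p ≡ [] ⊎ (∃[ c′ ] (length c ≡ length (nbs r p) + length c′
      × keepAt r out c p ≡ (non r p , (proj₁ p , proj₁ p) ∷ out , c′) ∷ []))
  keep-shape out c p with minus c (nbs r p) in e
  ... | []     = inj₁ refl
  ... | c′ ∷ _ = inj₂ (c′ , minus-length c (nbs r p) e , refl)

  pair-shape : ∀ out c p → pairAt r out c p ≡ [] ⊎ (∃[ w ] ∃[ ws ] ∃[ c′ ] (nbs r p ≡ w ∷ ws × c ≡ tt ∷ c′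
                 × pairAt r out c p ≡ (non r p , (proj₁ p , w) ∷ out , c′) ∷ []))
  pair-shape out c p with nbs r p | c
  ... | []     | _       = inj₁ refl
  ... | w ∷ ws | []      = inj₁ refl
  ... | w ∷ ws | tt ∷ c′ = inj₂ (w , ws , c′ , refl , refl , refl)

  Step : Config → Config → Set
  Step κ κ′ = Origin κ κ′ × length (todoₖ κ′) ≤ₙ pred (length (todoₖ κ))

  non-short : ∀ {todo} p → todo ↭ proj₁ p ∷ proj₂ p → length (non r p) ≤ₙ pred (length todo)
  non-short (x , rest) s = ℕₚ.≤-trans (ℕₚ.≤-trans (ℕₚ.m≤n+m _ (length (nbs r (x , rest))))
    (ℕₚ.≤-reflexive (trans (sym (Listₚ.length-++ (nbs r (x , rest)))) (sym (Permₚ.↭-length (filterB-split (r x) rest))))))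
    (ℕₚ.≤-reflexive (cong pred (sym (Permₚ.↭-length s))))

  pair-ok : ∀ {todo out c} p → todo ↭ proj₁ p ∷ proj₂ p → isOne (nbs r p) ≡ true →
            All (Step (todo , out , c)) (pairAt r out c p)
  pair-ok {todo} {out} {c} p@(x , rest) s one with pair-shape out c p
  ... | inj₁ e rewrite e = []
  ... | inj₂ (w , ws , c′ , e , refl , e′) rewrite e′ with isOne-true one
  ...   | w′ , e″ with trans (sym e) e″
  ...     | refl = (origin-pair _ (↭-trans s (prep x (subst (λ l → rest ↭ l ++ non r p) e (filterB-split (r x) rest)))) , non-short p s) ∷ []

  or-ok : ∀ κ → All (λ κ′ → Origin κ κ′ × length (todoₖ κ′) ≤ₙ length (todoₖ κ)) (pairOr r κ)
  or-ok (todo , out , c) = caseL-elim (All _) (filterB (λ p → isOne (nbs r p)) (picks todo))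
    (λ _ → (origin-refl , ℕₚ.≤-refl) ∷ [])
    (λ p _ e → let s , one = picked _ todo e in
       All.map (λ (o , l) → o , ℕₚ.≤-trans l (ℕₚ.pred[n]≤n)) (pair-ok p s one))

  branch-ok : ∀ {todo out c} p → todo ↭ proj₁ p ∷ proj₂ p → All (Step (todo , out , c)) (branch r out c p)
  branch-ok {todo} {out} {c} p@(x , rest) s = subst (All _) (sym (foldr-∷ (decr c _) (keepAt r out c p)))
    (Allₚ.++⁺ (cut c) keep)
    where
    cut : ∀ c → All (Step (todo , out , c)) (decr c (λ c′ → pairOr r (rest , out , c′)))
    cut []       = []
    cut (tt ∷ c) = All.map (λ (o , l) → origin-trans (origin-cut s) o ,
      ℕₚ.≤-trans l (ℕₚ.≤-reflexive (cong pred (sym (Permₚ.↭-length s))))) (or-ok (rest , out , c))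
    keep : All (Step (todo , out , c)) (keepAt r out c p)
    keep with keep-shape out c p
    ... | inj₁ e rewrite e = []
    ... | inj₂ (c′ , e , e′) rewrite e′ =
          (origin-keep (nbs r p) (non r p) (↭-trans s (prep x (filterB-split (r x) rest))) e , non-short p s) ∷ []

  opaque
    unfolding step₀

    step-ok : ∀ κ → All (Step κ) (step₀ r κ)
    step-ok (todo , out , c) = caseL-elim (All _) (filterB (λ p → r (proj₁ p) []) (picks todo)) (λ _ → ok₁)
      (λ p _ e → cut c p (proj₁ (picked _ todo e)))
      where
      cut : ∀ c p → todo ↭ proj₁ p ∷ proj₂ p → All (Step (todo , out , c)) (decr c (λ c′ → (proj₂ p , out , c′) ∷ []))
      cut []       p s = []
      cut (tt ∷ c) p s = (origin-cut s , ℕₚ.≤-reflexive (cong pred (sym (Permₚ.↭-length s)))) ∷ []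
      ok₃ : All (Step (todo , out , c)) (step₃ r (todo , out , c))
      ok₃ = caseL-elim (All _) (foldr _∷_ (picks todo) (filterB (λ p → isBig (nbs r p)) (picks todo))) (λ e → stop′ todo c e)
        (λ p _ e → branch-ok p (All.lookup (picks-↭ todo) (mem p e)))
        where
        stop′ : ∀ todo c → foldr _∷_ (picks todo) (filterB (λ p → isBig (nbs r p)) (picks todo)) ≡ [] →
                All (Step (todo , out , c)) (caseL c ((todo , out , c) ∷ []) (λ _ _ → []))
        stop′ todo (_ ∷ c) e = []
        stop′ [] [] e = (origin-refl , z≤n) ∷ []
        stop′ (x ∷ todo) [] e
          with Listₚ.++-conicalʳ (filterB (λ p → isBig (nbs r p)) (picks (x ∷ todo))) _
                 (trans (sym (foldr-∷ (filterB (λ p → isBig (nbs r p)) (picks (x ∷ todo))) _)) e)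
        ... | ()
        mem : ∀ p {ps} → foldr _∷_ (picks todo) (filterB (λ p → isBig (nbs r p)) (picks todo)) ≡ p ∷ ps → p ∈ picks todo
        mem p e with ∈ₚ.∈-++⁻ (filterB (λ p → isBig (nbs r p)) (picks todo)) (subst (p ∈_) (trans (sym e) (foldr-∷ (filterB (λ p → isBig (nbs r p)) (picks todo)) _)) (here refl))
        ... | inj₂ i = i
        ... | inj₁ i = filterB-⊆ _ (picks todo) i
      ok₂ : All (Step (todo , out , c)) (step₂ r (todo , out , c))
      ok₂ = caseL-elim (All _) (filterB (λ p → isOne (nbs r p)) (picks todo)) (λ _ → ok₃)
        (λ p _ e → let s , one = picked _ todo e in pair-ok p s one)
      ok₁ : All (Step (todo , out , c)) (step₁ r (todo , out , c))
      ok₁ = caseL-elim (All _) (filterB (λ p → isNil (nbs r p)) (picks todo)) (λ _ → ok₂)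
        (λ p _ e → let s , nl = picked _ todo e in
          (origin-keep [] (proj₂ p) s refl , ℕₚ.≤-reflexive (cong pred (sym (Permₚ.↭-length s)))) ∷ [])

-- The count is an upper bound only, as `pair` also admits equal items.
data Nt : Family → ℕ → Set where
  []  : Nt [] 0
  triv : ∀ {a φ n} → Nt φ n → Nt ((a , a) ∷ φ) n
  pair : ∀ {a b φ n} → Nt φ n → Nt ((a , b) ∷ φ) (suc n)

-- At most n pairs of the families below κ leave a choice.

record Small (n : ℕ) (κ : Config) : Set where
  constructor small
  field
    choices : ℕ
    nt      : Nt (outₖ κ) choices
    bounded : cutsₖ κ + choices ≤ₙ n

-- Tailored to give at most n + 1 options. A budget of 1 leaves one family with at most two
-- selections; a budget of 2 that splits leaves families with at most two selections and one
-- selection. A single family with budget 2 may have four selections and has to be treated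
-- differently.
data Shape : ℕ → List Config → Set where
  none : ∀ {n} → Shape n []
  one  : ∀ {n κ} → Small n κ → Shape n (κ ∷ [])
  two  : ∀ {κ κ′} → Small 1 κ → Small 0 κ′ → Shape 2 (κ ∷ κ′ ∷ [])

small-mono : ∀ {m n κ} → m ≤ₙ n → Small m κ → Small n κ
small-mono le (small j t h) = small j t (ℕₚ.≤-trans h le)

module SearchSize (r : Rel) (symm : Symm r) where

  open SearchSound r

  pair-weight : ∀ out c p → weight (pairAt r out c p) ≤ₙ f (pred (length c))
  pair-weight out c p with pair-shape out c p
  ... | inj₁ e rewrite e = z≤n
  ... | inj₂ (w , ws , c′ , _ , refl , e) rewrite e = ℕₚ.≤-reflexive (ℕₚ.+-identityʳ (f (length c′)))

  pair-weight-[] : ∀ out p → weight (pairAt r out [] p) ≡ 0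
  pair-weight-[] out p with pair-shape out [] p
  ... | inj₁ e rewrite e = refl

  or-weight : ∀ κ → weight (pairOr r κ) ≤ₙ f (cutsₖ κ)
  or-weight (todo , out , c) = caseL-elim (λ κs → weight κs ≤ₙ f (length c)) (filterB (λ p → isOne (nbs r p)) (picks todo))
    (λ _ → ℕₚ.≤-reflexive (ℕₚ.+-identityʳ (f (length c))))
    (λ p _ _ → ℕₚ.≤-trans (pair-weight out c p) (f-mono (ℕₚ.pred[n]≤n {length c})))

  or-weight-one : ∀ todo out c → filterB (λ p → isOne (nbs r p)) (picks todo) ≡ [] ⊎
    (weight (pairOr r (todo , out , c)) ≤ₙ f (pred (length c)) × (c ≡ [] → weight (pairOr r (todo , out , c)) ≡ 0))
  or-weight-one todo out c with filterB (λ p → isOne (nbs r p)) (picks todo)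
  ... | []    = inj₁ refl
  ... | p ∷ _ = inj₂ (pair-weight out c p , λ { refl → pair-weight-[] out p })

  isOne-false : ∀ {A : Set} {l : List A} → isNil l ≡ false → isOne l ≡ false → 2 ≤ₙ length l
  isOne-false {l = _ ∷ _ ∷ _} _ _ = s≤s (s≤s z≤n)

  isBig-true : ∀ {A : Set} {l : List A} → isBig l ≡ true → 3 ≤ₙ length l
  isBig-true {l = _ ∷ _ ∷ _ ∷ _} _ = s≤s (s≤s (s≤s z≤n))

  isTwo : ∀ {A : Set} {l : List A} → isNil l ≡ false → isOne l ≡ false → isBig l ≡ false → length l ≡ 2
  isTwo {l = _ ∷ _ ∷ []} _ _ _ = refl

  isOne-length : ∀ {A : Set} (l : List A) → length l ≡ 1 → isOne l ≡ true
  isOne-length (_ ∷ []) _ = refl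

  keep-weight : ∀ m out c p → m ≤ₙ length (nbs r p) →
                weight (keepAt r out c p) ≡ 0 ⊎ (∃[ n ] (length c ≡ m + n × weight (keepAt r out c p) ≤ₙ f n))
  keep-weight m out c p h with keep-shape out c p
  ... | inj₁ e rewrite e = inj₁ refl
  ... | inj₂ (c′ , e , e′) rewrite e′ = inj₂ ((length (nbs r p) ∸ m) + length c′ ,
      trans e (trans (cong (_+ length c′) (sym (ℕₚ.m+[n∸m]≡n h))) (ℕₚ.+-assoc m _ _)) ,
      ℕₚ.≤-trans (ℕₚ.≤-reflexive (ℕₚ.+-identityʳ (f (length c′)))) (f-mono (ℕₚ.m≤n+m (length c′) (length (nbs r p) ∸ m))))

  branch-weight≡ : ∀ out c p → weight (branch r out c p) ≡
                   weight (decr c (λ c′ → pairOr r (proj₂ p , out , c′))) + weight (keepAt r out c p)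
  branch-weight≡ out c p = trans (cong weight (foldr-∷ (decr c _) (keepAt r out c p)))
    (weight-++ (decr c _) (keepAt r out c p))

  -- The recurrence of `f`: cutting off the vertex costs one, keeping it costs at least three.
  big-weight : ∀ out c p → 3 ≤ₙ length (nbs r p) → weight (branch r out c p) ≤ₙ f (length c)
  big-weight out c p h = ℕₚ.≤-trans (ℕₚ.≤-reflexive (branch-weight≡ out c p)) (go c (keep-weight 3 out c p h))
    where
    go : ∀ c {k} → k ≡ 0 ⊎ (∃[ n ] (length c ≡ 3 + n × k ≤ₙ f n)) →
         weight (decr c (λ c′ → pairOr r (proj₂ p , out , c′))) + k ≤ₙ f (length c)
    go [] (inj₁ refl) = z≤n
    go [] (inj₂ (_ , () , _))
    go (tt ∷ c) (inj₁ refl) = ℕₚ.≤-trans (ℕₚ.≤-reflexive (ℕₚ.+-identityʳ _))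
      (ℕₚ.≤-trans (or-weight (proj₂ p , out , c)) (f-suc (length c)))
    go (tt ∷ c) (inj₂ (n , e , k≤)) rewrite ℕₚ.suc-injective e =
      ℕₚ.+-mono-≤ (subst (λ m → weight (pairOr r (proj₂ p , out , c)) ≤ₙ f m) (ℕₚ.suc-injective e) (or-weight (proj₂ p , out , c))) k≤

  -- Both branches lose two cuts if the deletion leaves a vertex of degree one. The first
  -- alternative is excluded by `leaf-exists` once all degrees are two.
  two-weight : ∀ out c p → length (nbs r p) ≡ 2 → filterB (λ q → isOne (nbs r q)) (picks (proj₂ p)) ≡ [] ⊎
               weight (branch r out c p) ≤ₙ f (length c)
  two-weight out c p h with or-weight-one (proj₂ p) out (List.drop 1 c)
  ... | inj₁ e = inj₁ e
  ... | inj₂ (le , z) = inj₂ (ℕₚ.≤-trans (ℕₚ.≤-reflexive (branch-weight≡ out c p)) (go c le z (keep-weight 2 out c p (ℕₚ.≤-reflexive (sym h)))))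
    where
    go : ∀ c {k} → weight (pairOr r (proj₂ p , out , List.drop 1 c)) ≤ₙ f (pred (length (List.drop 1 c))) →
         (List.drop 1 c ≡ [] → weight (pairOr r (proj₂ p , out , List.drop 1 c)) ≡ 0) →
         k ≡ 0 ⊎ (∃[ n ] (length c ≡ 2 + n × k ≤ₙ f n)) →
         weight (decr c (λ c′ → pairOr r (proj₂ p , out , c′))) + k ≤ₙ f (length c)
    go [] _ _ (inj₁ refl) = z≤n
    go [] _ _ (inj₂ (_ , () , _))
    go (tt ∷ []) _ z (inj₁ refl) rewrite z refl = z≤n
    go (tt ∷ []) _ _ (inj₂ (_ , () , _))
    go (tt ∷ tt ∷ c) le _ (inj₁ refl) = ℕₚ.≤-trans (ℕₚ.≤-reflexive (ℕₚ.+-identityʳ _))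
      (ℕₚ.≤-trans le (ℕₚ.≤-trans (f-suc (length c)) (f-suc (suc (length c)))))
    go (tt ∷ tt ∷ c) {k} le _ (inj₂ (n , e , k≤)) =
      ℕₚ.≤-trans (ℕₚ.+-mono-≤ le (subst (λ m → k ≤ₙ f m) (sym (ℕₚ.suc-injective (ℕₚ.suc-injective e))) k≤)) (f-double (length c))

  -- If all vertices have degree two, deleting one of them leaves a vertex of
  -- degree one.

  leaf-exists : ∀ todo p → p ∈ picks todo → All (λ q → length (nbs r q) ≡ 2) (picks todo) →
                filterB (λ q → isOne (nbs r q)) (picks (proj₂ p)) ≡ [] → ⊥
  leaf-exists todo (x , rest) i h e with nbs r (x , rest) in eq | All.lookup h i
  ... | [] | ()
  ... | y ∷ N | _ = true≢false
      (isOne-length (nbs r (y , rest′)) (ℕₚ.suc-injective (trans (sym (cong length pass)) (trans (sym (Permₚ.↭-length (filterB-↭ (r y) ry≈))) (All.lookup h yj)))))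
      (All.lookup (filterB-none _ (picks rest) e) yi)
    where
    y-in : y ∈ nbs r (x , rest)
    y-in = subst (y ∈_) (sym eq) (here refl)
    rxy : r x y ≡ true
    rxy = All.lookup (filterB-all (r x) rest) y-in
    y∈rest : y ∈ rest
    y∈rest = filterB-⊆ (r x) rest y-in
    rest′ = proj₁ (∈-picks y∈rest)
    yi = proj₂ (∈-picks y∈rest)
    todo≈ : todo ↭ x ∷ rest
    todo≈ = All.lookup (picks-↭ todo) i
    y∈todo : y ∈ todo
    y∈todo = Permₚ.∈-resp-↭ (↭-sym todo≈) (there y∈rest)
    ry = proj₁ (∈-picks y∈todo)
    yj = proj₂ (∈-picks y∈todo)
    ry≈ : ry ↭ x ∷ rest′
    ry≈ = Permₚ.drop-∷ (↭-trans (↭-sym (All.lookup (picks-↭ todo) yj))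
            (↭-trans todo≈ (↭-trans (prep x (All.lookup (picks-↭ rest) yi)) (_↭_.swap x y ↭-refl))))
    pass : filterB (r y) (x ∷ rest′) ≡ x ∷ nbs r (y , rest′)
    pass rewrite trans (symm y x) rxy = refl

  opaque
    unfolding step₀

    step-weight : ∀ κ → weight (step₀ r κ) ≤ₙ f (cutsₖ κ)
    step-weight (todo , out , c) = caseL-elim Ok (filterB (λ p → r (proj₁ p) []) (picks todo)) (λ _ → w₁) (λ p _ _ → cut c p)
      where
      Ok : List Config → Set
      Ok κs = weight κs ≤ₙ f (length c)
      cut : ∀ c (p : Item × List Item) → weight (decr c (λ c′ → (proj₂ p , out , c′) ∷ [])) ≤ₙ f (length c)
      cut [] p = z≤n
      cut (tt ∷ c) p = ℕₚ.≤-trans (ℕₚ.≤-reflexive (ℕₚ.+-identityʳ _)) (f-suc (length c))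
      bigs : List (Item × List Item)
      bigs = filterB (λ p → isBig (nbs r p)) (picks todo)
      w₃ : All (λ p → isNil (nbs r p) ≡ false) (picks todo) → All (λ p → isOne (nbs r p) ≡ false) (picks todo) →
           Ok (step₃ r (todo , out , c))
      w₃ h₀ h₁ = caseL-elim Ok (foldr _∷_ (picks todo) bigs) (λ _ → idle c) choose
        where
        idle : ∀ c → weight (caseL c ((todo , out , c) ∷ []) (λ _ _ → [])) ≤ₙ f (length c)
        idle []      = s≤s z≤n
        idle (_ ∷ _) = z≤n
        choose : ∀ p ps → foldr _∷_ (picks todo) bigs ≡ p ∷ ps → Ok (branch r out c p)
        choose p ps e with bigs in be
        choose p ps refl | q ∷ qs = big-weight out c q (isBig-true {l = nbs r q} (proj₂ (filterB-head _ (picks todo) be)))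
        ... | [] with All.zipWith (λ {q} (a , b , d) → isTwo {l = nbs r q} a b d) (h₀ , All.zipWith (λ x → x) (h₁ , filterB-none _ (picks todo) be))
        ...   | twos with subst (p ∈_) (sym e) (here refl)
        ...     | i with two-weight out c p (All.lookup twos i)
        ...       | inj₂ ok = ok
        ...       | inj₁ ¬leaf = ⊥-elim (leaf-exists todo p i twos ¬leaf)
      w₂ : All (λ p → isNil (nbs r p) ≡ false) (picks todo) → Ok (step₂ r (todo , out , c))
      w₂ h₀ = caseL-elim Ok (filterB (λ p → isOne (nbs r p)) (picks todo)) (λ e → w₃ h₀ (filterB-none _ (picks todo) e))
        (λ p _ _ → ℕₚ.≤-trans (pair-weight out c p) (f-mono (ℕₚ.pred[n]≤n {length c})))
      w₁ : Ok (step₁ r (todo , out , c))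
      w₁ = caseL-elim Ok (filterB (λ p → isNil (nbs r p)) (picks todo)) (λ e → w₂ (filterB-none _ (picks todo) e))
        (λ p _ _ → ℕₚ.≤-reflexive (ℕₚ.+-identityʳ (f (length c))))

  Single : ℕ → List Config → Set
  Single n κs = κs ≡ [] ⊎ (∃[ κ ] (κs ≡ κ ∷ [] × Small n κ))

  single-shape : ∀ {n κs} → Single n κs → Shape n κs
  single-shape (inj₁ refl) = none
  single-shape (inj₂ (_ , refl , s)) = one s

  pair-single : ∀ {n todo out c} p → Small n (todo , out , c) → Single n (pairAt r out c p)
  pair-single {out = out} {c} p (small j t h) with pair-shape out c p
  ... | inj₁ e = inj₁ e
  ... | inj₂ (w , ws , c′ , _ , refl , e) = inj₂ (_ , e , small (suc j) (pair t) (ℕₚ.≤-trans (ℕₚ.≤-reflexive (ℕₚ.+-suc (length c′) j)) h))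

  or-single : ∀ {n} κ → Small n κ → Single n (pairOr r κ)
  or-single {n} κ@(todo , out , c) s = caseL-elim (Single n) (filterB (λ p → isOne (nbs r p)) (picks todo))
    (λ _ → inj₂ (_ , refl , s)) (λ p _ _ → pair-single p s)

  -- With a budget of at most 2, keeping a vertex with two neighbours spends all of it, so that
  -- branch has no choice left; in the other branch cuts and choices add up to at most one.
  branch-shape : ∀ {n todo out c} p → n ≤ₙ 2 → 2 ≤ₙ length (nbs r p) → Small n (todo , out , c) →
                 Shape n (branch r out c p)
  branch-shape {n} {todo} {out} {c} p n≤2 two≤ (small j t h) =
    subst (Shape n) (sym (foldr-∷ (decr c _) (keepAt r out c p))) (go c h (keep-shape out c p))
    where
    big : ∀ m {k : ℕ} → suc m ≡ length (nbs r p) + k → 1 ≤ₙ m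
    big m {k} e = ℕₚ.≤-pred (ℕₚ.≤-trans two≤ (ℕₚ.≤-trans (ℕₚ.m≤m+n _ k) (ℕₚ.≤-reflexive (sym e))))
    go : ∀ c {κs} → length c + j ≤ₙ n → κs ≡ [] ⊎ (∃[ c′ ] (length c ≡ length (nbs r p) + length c′
             × κs ≡ (non r p , (proj₁ p , proj₁ p) ∷ out , c′) ∷ [])) →
         Shape n (decr c (λ c′ → pairOr r (proj₂ p , out , c′)) ++ κs)
    go [] h (inj₁ refl) = none
    go [] h (inj₂ (c′ , e , _)) with ℕₚ.≤-trans two≤ (ℕₚ.≤-trans (ℕₚ.m≤m+n _ (length c′)) (ℕₚ.≤-reflexive (sym e)))
    ... | ()
    go (tt ∷ c) h (inj₁ refl) = subst (Shape n) (sym (Listₚ.++-identityʳ _))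
      (single-shape (or-single (proj₂ p , out , c) (small j t (ℕₚ.≤-trans (ℕₚ.n≤1+n _) h))))
    go (tt ∷ c) h (inj₂ (c′ , e , refl)) = both (length c) (length c′) n e n≤2 h
      where
      small-or : ∀ {k} → length c + j ≤ₙ k → Single k (pairOr r (proj₂ p , out , c))
      small-or h = or-single (proj₂ p , out , c) (small j t h)
      both : ∀ m m′ n → suc m ≡ length (nbs r p) + m′ → n ≤ₙ 2 → suc (length c) + j ≤ₙ n →
             Shape n (pairOr r (proj₂ p , out , c) ++ (non r p , (proj₁ p , proj₁ p) ∷ out , c′) ∷ [])
      both _ _ 0 _ _ ()
      both _ _ 1 _ _ (s≤s h) with ℕₚ.≤-trans (big (length c) e) (ℕₚ.≤-trans (ℕₚ.m≤m+n (length c) j) h)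
      ... | ()
      both _ _ 2 _ _ (s≤s h) = join (small-or h)
        where
        small-c′ : Small 0 (non r p , (proj₁ p , proj₁ p) ∷ out , c′)
        small-c′ = small j (triv t) (ℕₚ.+-cancelˡ-≤ 2 _ _ (ℕₚ.≤-trans (ℕₚ.≤-reflexive (sym (ℕₚ.+-assoc 2 (length c′) j)))
          (ℕₚ.≤-trans (ℕₚ.+-monoˡ-≤ j (ℕₚ.≤-trans (ℕₚ.+-monoˡ-≤ (length c′) two≤) (ℕₚ.≤-reflexive (sym e)))) (s≤s h))))
        join : ∀ {κs} → Single 1 κs → Shape 2 (κs ++ (non r p , (proj₁ p , proj₁ p) ∷ out , c′) ∷ [])
        join (inj₁ refl)           = one (small-mono z≤n small-c′)
        join (inj₂ (_ , refl , s)) = two s small-c′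
      both _ _ (suc (suc (suc n))) _ (s≤s (s≤s ())) _

  opaque
    unfolding step₀

    step-shape : ∀ {n} κ → n ≤ₙ 2 → Small n κ → Shape n (step₀ r κ)
    step-shape {n} κ@(todo , out , c) n≤2 s@(small j t h) = caseL-elim (Shape n) (filterB (λ p → r (proj₁ p) []) (picks todo)) (λ _ → s₁)
      (λ p _ _ → cut c p h)
      where
      cut : ∀ c (p : Item × List Item) → length c + j ≤ₙ n → Shape n (decr c (λ c′ → (proj₂ p , out , c′) ∷ []))
      cut [] p h = none
      cut (tt ∷ c) p h = one (small j t (ℕₚ.≤-trans (ℕₚ.n≤1+n _) h))
      bigs : List (Item × List Item)
      bigs = filterB (λ p → isBig (nbs r p)) (picks todo)
      idle : ∀ c → length c + j ≤ₙ n → Shape n (caseL c ((todo , out , c) ∷ []) (λ _ _ → []))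
      idle []      h = one (small j t h)
      idle (_ ∷ _) h = none
      s₃ : All (λ p → isNil (nbs r p) ≡ false) (picks todo) → All (λ p → isOne (nbs r p) ≡ false) (picks todo) →
           Shape n (step₃ r κ)
      s₃ h₀ h₁ = caseL-elim (Shape n) (foldr _∷_ (picks todo) bigs) (λ _ → idle c h) λ p ps e →
        let i = mem p e in branch-shape p n≤2 (isOne-false {l = nbs r p} (All.lookup h₀ i) (All.lookup h₁ i)) s
        where
        mem : ∀ p {ps} → foldr _∷_ (picks todo) bigs ≡ p ∷ ps → p ∈ picks todo
        mem p e with ∈ₚ.∈-++⁻ bigs (subst (p ∈_) (trans (sym e) (foldr-∷ bigs _)) (here refl))
        ... | inj₂ i = i
        ... | inj₁ i = filterB-⊆ _ (picks todo) i
      s₂ : All (λ p → isNil (nbs r p) ≡ false) (picks todo) → Shape n (step₂ r κ)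
      s₂ h₀ = caseL-elim (Shape n) (filterB (λ p → isOne (nbs r p)) (picks todo)) (λ e → s₃ h₀ (filterB-none _ (picks todo) e))
        (λ p _ _ → single-shape (pair-single p s))
      s₁ : Shape n (step₁ r κ)
      s₁ = caseL-elim (Shape n) (filterB (λ p → isNil (nbs r p)) (picks todo)) (λ e → s₂ (filterB-none _ (picks todo) e))
        (λ p _ _ → one (small j (triv t) h))

rounds : Rel → List Item → List Config → List Config
rounds r fuel κs = foldr (λ _ K → concatMapB (step₀ r) K) κs fuel

-- Each step disposes of an item, so the initial items serve as the number of rounds.
search : Rel → Config → List Config
search r κ = rounds r (todoₖ κ) (κ ∷ [])

module Rounds (r : Rel) (symm : Symm r) where

  open Search r symm
  open SearchSound r
  open SearchSize r symm

  Reached : Config → ℕ → Config → Set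
  Reached κ n κ′ = Origin κ κ′ × length (todoₖ κ′) ≤ₙ length (todoₖ κ) ∸ n

  concat-reached : ∀ {κ n} κs → All (Reached κ n) κs → All (Reached κ (suc n)) (concatMapB (step₀ r) κs)
  concat-reached [] [] = []
  concat-reached {κ} {n} (κ′ ∷ κs) ((o , l) ∷ h) = subst (All _) (sym (foldr-∷ (step₀ r κ′) _)) (Allₚ.++⁺
    (All.map (λ (o′ , l′) → origin-trans o o′ ,
       ℕₚ.≤-trans l′ (ℕₚ.≤-trans (ℕₚ.pred-mono-≤ l) (ℕₚ.≤-reflexive (ℕₚ.pred[m∸n]≡m∸[1+n] (length (todoₖ κ)) n))))
       (step-ok κ′)) (concat-reached κs h))

  rounds-reached : ∀ κ fuel → All (Reached κ (length fuel)) (rounds r fuel (κ ∷ []))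
  rounds-reached κ []         = (origin-refl , ℕₚ.≤-refl) ∷ []
  rounds-reached κ (_ ∷ fuel) = concat-reached (rounds r fuel (κ ∷ [])) (rounds-reached κ fuel)

  search-sound : ∀ κ → All (Origin κ) (search r κ)
  search-sound κ = All.map proj₁ (rounds-reached κ (todoₖ κ))

  concat-has : ∀ {σ} κs → Any (λ κ → Has κ σ) κs → Any (λ κ → Has κ σ) (concatMapB (step₀ r) κs)
  concat-has (κ ∷ κs) h = subst (Any _) (sym (foldr-∷ (step₀ r κ) _)) (go h)
    where
    go : ∀ {σ} → Any (λ κ → Has κ σ) (κ ∷ κs) → Any (λ κ → Has κ σ) (step₀ r κ ++ concatMapB (step₀ r) κs)
    go (here p)  = Anyₚ.++⁺ˡ (has-step p)
    go (there p) = Anyₚ.++⁺ʳ _ (concat-has κs p)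

  rounds-has : ∀ {κ σ} fuel → Has κ σ → Any (λ κ → Has κ σ) (rounds r fuel (κ ∷ []))
  rounds-has []         h = here h
  rounds-has {κ} (_ ∷ fuel) h = concat-has (rounds r fuel (κ ∷ [])) (rounds-has fuel h)

  Done : List Item → Config → Set
  Done σ (todo , out , c) = todo ≡ [] × c ≡ [] × (∃[ τ ] (Sel out τ × τ ↭ σ))

  search-complete : ∀ {κ σ} → Has κ σ → Any (Done σ) (search r κ)
  search-complete {κ} {σ} h = done (search r κ) (rounds-reached κ (todoₖ κ)) (rounds-has (todoₖ κ) h)
    where
    fin : ∀ κ′ → Reached κ (length (todoₖ κ)) κ′ → Has κ′ σ → Done σ κ′
    fin (todo , out , c) (_ , l) (has {τ} {U} {K} sel split ind cuts min perm)
      with todo | ℕₚ.≤-trans l (ℕₚ.≤-reflexive (ℕₚ.n∸n≡0 (length (todoₖ κ))))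
    ... | [] | _ with U | K | Permₚ.↭-length split | c | cuts
    ...   | [] | [] | _ | [] | _ = refl , refl , τ , sel , ↭-trans (↭-reflexive (sym (Listₚ.++-identityʳ τ))) perm
    done : ∀ κs → All (Reached κ (length (todoₖ κ))) κs → Any (λ κ → Has κ σ) κs → Any (Done σ) κs
    done (κ′ ∷ κs) (a ∷ as) (here h)  = here (fin κ′ a h)
    done (κ′ ∷ κs) (a ∷ as) (there h) = there (done κs as h)

  rounds-weight : ∀ κ fuel → weight (rounds r fuel (κ ∷ [])) ≤ₙ f (cutsₖ κ)
  rounds-weight κ []         = ℕₚ.≤-reflexive (ℕₚ.+-identityʳ (f (cutsₖ κ)))
  rounds-weight κ (_ ∷ fuel) = ℕₚ.≤-trans (go (rounds r fuel (κ ∷ []))) (rounds-weight κ fuel)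
    where
    go : ∀ κs → weight (concatMapB (step₀ r) κs) ≤ₙ weight κs
    go [] = z≤n
    go (κ ∷ κs) = ℕₚ.≤-trans (ℕₚ.≤-reflexive (trans (cong weight (foldr-∷ (step₀ r κ) _)) (weight-++ (step₀ r κ) _)))
      (ℕₚ.+-mono-≤ (step-weight κ) (go κs))

  rounds-shape : ∀ {n κ} fuel → n ≤ₙ 2 → Small n κ → Shape n (rounds r fuel (κ ∷ []))
  rounds-shape []         n≤2 s = one s
  rounds-shape {n} {κ} (_ ∷ fuel) n≤2 s = go n≤2 (rounds-shape {n} {κ} fuel n≤2 s)
    where
    one-step : ∀ {m} κ → m ≤ₙ 2 → Small m κ → Shape m (concatMapB (step₀ r) (κ ∷ []))
    one-step κ m≤2 s = subst (Shape _) (sym (trans (foldr-∷ (step₀ r κ) []) (Listₚ.++-identityʳ _))) (step-shape κ m≤2 s)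
    mono : ∀ {m n κs} → m ≤ₙ n → m ≤ₙ 1 → Shape m κs → Shape n κs
    mono le _ none = none
    mono le _ (one s) = one (small-mono le s)
    mono le (s≤s ()) (two _ _)
    both : ∀ {κs κs′} → Shape 1 κs → Shape 0 κs′ → Shape 2 (κs ++ κs′)
    both none s = mono z≤n z≤n s
    both (one s) none = one (small-mono (s≤s z≤n) s)
    both (one s) (one s′) = two s s′
    go : ∀ {n κs} → n ≤ₙ 2 → Shape n κs → Shape n (concatMapB (step₀ r) κs)
    go n≤2 none = none
    go n≤2 (one {κ = κ} s) = one-step κ n≤2 s
    go n≤2 (two {κ} {κ′} s s′) = subst (Shape 2) (sym (trans (foldr-∷ (step₀ r κ) _)
        (cong (step₀ r κ ++_) (trans (foldr-∷ (step₀ r κ′) []) (Listₚ.++-identityʳ _)))))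
      (both (step-shape κ (s≤s z≤n) s) (step-shape κ′ z≤n s′))

-- Bounds on the number of families

-- With β = 31/20, these say n ≤ β ^ m and n ≤ β ^ m − 1/β. The weaker bound
-- suffices for the theorem since β < ρ; the stronger one pays for cutting off
-- a subtree, in which case the branching inside of it is not needed.

abstract

  Weak Strong : ℕ → ℕ → Set
  Weak   m n = 20 ** m * n ≤ₙ 31 ** m
  Strong m n = 31 * (20 ** m * n) + 20 * 20 ** m ≤ₙ 31 * 31 ** m

  strong⇒weak : ∀ m {n} → Strong m n → Weak m n
  strong⇒weak m h = ℕₚ.*-cancelˡ-≤ 31 (ℕₚ.≤-trans (ℕₚ.m≤m+n _ _) h)

  weak-mono : ∀ m {n n′} → n ≤ₙ n′ → Weak m n′ → Weak m n
  weak-mono m le h = ℕₚ.≤-trans (ℕₚ.*-monoʳ-≤ (20 ** m) le) h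

  strong-mono : ∀ m {n n′} → n ≤ₙ n′ → Strong m n′ → Strong m n
  strong-mono m le h = ℕₚ.≤-trans (ℕₚ.+-monoˡ-≤ _ (ℕₚ.*-monoʳ-≤ 31 (ℕₚ.*-monoʳ-≤ (20 ** m) le))) h

  slack : ∀ {x y} d → x + d ≡ y → x ≤ₙ y
  slack {x} d eq = subst (x ≤ₙ_) eq (ℕₚ.m≤m+n x d)

  weak-suc : ∀ m {n} → Weak m n → Weak (suc m) n
  weak-suc m {n} h = ℕₚ.≤-trans (ℕₚ.≤-reflexive (ℕₚ.*-assoc 20 (20 ** m) n))
    (ℕₚ.≤-trans (ℕₚ.*-monoʳ-≤ 20 h) (ℕₚ.*-monoˡ-≤ (31 ** m) (ℕₚ.m≤m+n 20 11)))

  strong-suc : ∀ m {n} → Strong m n → Strong (suc m) n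
  strong-suc m {n} h = ℕₚ.≤-trans (ℕₚ.≤-reflexive (eq 20 31 (20 ** m) n)) (ℕₚ.≤-trans (ℕₚ.*-monoʳ-≤ 20 h)
    (ℕₚ.*-monoˡ-≤ (31 * 31 ** m) (ℕₚ.m≤m+n 20 11)))
    where
    eq : ∀ t s a n → s * (t * a * n) + t * (t * a) ≡ t * (s * (a * n) + t * a)
    eq = solve-∀

  weak-+ : ∀ m d {n} → Weak m n → Weak (d + m) n
  weak-+ m zero    h = h
  weak-+ m (suc d) h = weak-suc (d + m) (weak-+ m d h)

  strong-+ : ∀ m d {n} → Strong m n → Strong (d + m) n
  strong-+ m zero    h = h
  strong-+ m (suc d) h = strong-suc (d + m) (strong-+ m d h)

  private
    -- The numerical comparison inside is β³ ≥ β² + 1, the inequality belonging to the recurrence of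
    -- `f`.
    strong-step : ∀ a A p q →
      31 * (20 * (20 * a) * p) + 20 * (20 * (20 * a)) ≤ₙ 31 * (31 * (31 * A)) → 31 * (a * q) + 20 * a ≤ₙ 31 * A →
      31 * (20 * (20 * (20 * a)) * (p + q)) + 20 * (20 * (20 * (20 * a))) ≤ₙ 31 * (31 * (31 * (31 * A)))
    strong-step a A p q h₁ h₂ = begin
      31 * (20 * (20 * (20 * a)) * (p + q)) + 20 * (20 * (20 * (20 * a)))
        ≤⟨ slack (20 * (20 * (20 * (20 * a)))) (eq 20 31 a p q) ⟩
      20 * (31 * (20 * (20 * a) * p) + 20 * (20 * (20 * a))) + 20 * (20 * (20 * (31 * (a * q) + 20 * a)))
        ≤⟨ ℕₚ.+-mono-≤ (ℕₚ.*-monoʳ-≤ 20 h₁) (ℕₚ.*-monoʳ-≤ 20 (ℕₚ.*-monoʳ-≤ 20 (ℕₚ.*-monoʳ-≤ 20 h₂))) ⟩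
      20 * (31 * (31 * (31 * A))) + 20 * (20 * (20 * (31 * A)))
        ≡⟨ eq′ 20 31 A ⟩
      (20 * (31 * (31 * 31)) + 20 * (20 * (20 * 31))) * A
        ≤⟨ ℕₚ.*-monoˡ-≤ A (ℕₚ.≤ᵇ⇒≤ (20 * (31 * (31 * 31)) + 20 * (20 * (20 * 31))) (31 * (31 * (31 * 31))) _) ⟩
      (31 * (31 * (31 * 31))) * A
        ≡⟨ eq″ 31 A ⟩
      31 * (31 * (31 * (31 * A))) ∎
      where
      open ℕₚ.≤-Reasoning
      eq : ∀ t s a p q → s * (t * (t * (t * a)) * (p + q)) + t * (t * (t * (t * a))) + t * (t * (t * (t * a)))
         ≡ t * (s * (t * (t * a) * p) + t * (t * (t * a))) + t * (t * (t * (s * (a * q) + t * a)))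
      eq = solve-∀
      eq′ : ∀ t s A → t * (s * (s * (s * A))) + t * (t * (t * (s * A))) ≡ (t * (s * (s * s)) + t * (t * (t * s))) * A
      eq′ = solve-∀
      eq″ : ∀ s A → (s * (s * (s * s))) * A ≡ s * (s * (s * (s * A)))
      eq″ = solve-∀

  -- The index starts at 3 because the values 1, 1, 2 exceed β^n - 1/β for n = 0, 1, 2.
  f-strong : ∀ n → Strong (3 + n) (f (3 + n))
  f-strong 0 = ℕₚ.≤ᵇ⇒≤ _ _ _
  f-strong 1 = ℕₚ.≤ᵇ⇒≤ _ _ _
  f-strong 2 = ℕₚ.≤ᵇ⇒≤ _ _ _
  f-strong (suc (suc (suc n))) =
    strong-step (20 ** (3 + n)) (31 ** (3 + n)) (f (5 + n)) (f (3 + n)) (f-strong (suc (suc n))) (f-strong n)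

  f-weak : ∀ n → Weak n (f n)
  f-weak 0 = ℕₚ.≤ᵇ⇒≤ _ _ _
  f-weak 1 = ℕₚ.≤ᵇ⇒≤ _ _ _
  f-weak 2 = ℕₚ.≤ᵇ⇒≤ _ _ _
  f-weak (suc (suc (suc n))) = strong⇒weak (3 + n) (f-strong n)

  private
    -- From p + 1/β ≤ β^(n+1) and q ≤ β^n follows k p + q ≤ (k + 1/β) β^(n+1) - k/β: the term 1/β in
    -- the bound for k absorbs q. The rest is at most β^(m+n+1) - 1/β since k ≥ 1, so the strong
    -- bound reproduces itself. Here `a`, `A` and `b`, `B` are the powers of 20 and 31.
    combine : ∀ a A b B p q k → 1 ≤ₙ k →
      31 * (a * k) + 20 * a ≤ₙ 31 * A → 31 * (20 * b * p) + 20 * (20 * b) ≤ₙ 31 * (31 * B) → b * q ≤ₙ B →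
      31 * (a * (20 * b) * (k * p + q)) + 20 * (a * (20 * b)) ≤ₙ 31 * (A * (31 * B))
    combine a A b B p q (suc k) _ h h₁ h₀ = begin
      31 * (a * (20 * b) * (suc k * p + q)) + 20 * (a * (20 * b))
        ≤⟨ slack (a * k * (20 * (20 * b))) (eq 20 31 a b p q k) ⟩
      a * suc k * (31 * (20 * b * p) + 20 * (20 * b)) + 31 * 20 * a * (b * q)
        ≤⟨ ℕₚ.+-mono-≤ (ℕₚ.*-monoʳ-≤ (a * suc k) h₁) (ℕₚ.*-monoʳ-≤ (31 * 20 * a) h₀) ⟩
      a * suc k * (31 * (31 * B)) + 31 * 20 * a * B
        ≡⟨ eq′ 20 31 a B k ⟩
      31 * B * (31 * (a * suc k) + 20 * a)
        ≤⟨ ℕₚ.*-monoʳ-≤ (31 * B) h ⟩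
      31 * B * (31 * A)
        ≡⟨ eq″ 31 A B ⟩
      31 * (A * (31 * B)) ∎
      where
      open ℕₚ.≤-Reasoning
      eq : ∀ t s a b p q k → s * (a * (t * b) * (suc k * p + q)) + t * (a * (t * b)) + a * k * (t * (t * b))
         ≡ a * suc k * (s * (t * b * p) + t * (t * b)) + s * t * a * (b * q)
      eq = solve-∀
      eq′ : ∀ t s a B k → a * suc k * (s * (s * B)) + s * t * a * B ≡ s * B * (s * (a * suc k) + t * a)
      eq′ = solve-∀
      eq″ : ∀ s A B → s * B * (s * A) ≡ s * (A * (s * B))
      eq″ = solve-∀

    combine₀ : ∀ a A b B p k → 1 ≤ₙ p →
      31 * (a * k) + 20 * a ≤ₙ 31 * A → b * p ≤ₙ B →
      31 * (a * b * (k * p)) + 20 * (a * b) ≤ₙ 31 * (A * B)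
    combine₀ a A b B (suc p) k _ h h₁ = begin
      31 * (a * b * (k * suc p)) + 20 * (a * b)  ≤⟨ slack (20 * a * b * p) (eq 20 31 a b p k) ⟩
      (31 * (a * k) + 20 * a) * (b * suc p)      ≤⟨ ℕₚ.*-mono-≤ h h₁ ⟩
      31 * A * B                                 ≡⟨ ℕₚ.*-assoc 31 A B ⟩
      31 * (A * B)                               ∎
      where
      open ℕₚ.≤-Reasoning
      eq : ∀ t s a b p k → s * (a * b * (k * suc p)) + t * (a * b) + t * a * b * p ≡ (s * (a * k) + t * a) * (b * suc p)
      eq = solve-∀

    single₁ : ∀ a A k → a + a ≤ₙ A → 31 * (a * k) + 20 * a ≤ₙ 31 * A →
      31 * (a * 20 * (k * 1 + 1)) + 20 * (a * 20) ≤ₙ 31 * (A * 31)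
    single₁ a A k h₀ h = begin
      31 * (a * 20 * (k * 1 + 1)) + 20 * (a * 20)          ≡⟨ eq 10 31 a k ⟩
      20 * (31 * (a * k) + 20 * a) + 31 * 10 * (a + a)     ≤⟨ ℕₚ.+-mono-≤ (ℕₚ.*-monoʳ-≤ 20 h) (ℕₚ.*-monoʳ-≤ (31 * 10) h₀) ⟩
      20 * (31 * A) + 31 * 10 * A                          ≡⟨ eq′ 20 31 10 A ⟩
      (20 * 31 + 31 * 10) * A                              ≤⟨ ℕₚ.*-monoˡ-≤ A (ℕₚ.≤ᵇ⇒≤ (20 * 31 + 31 * 10) (31 * 31) _) ⟩
      31 * 31 * A                                          ≡⟨ eq″ 31 A ⟩
      31 * (A * 31)                                        ∎
      where
      open ℕₚ.≤-Reasoning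
      eq : ∀ u s a k → s * (a * (u + u) * (k * 1 + 1)) + (u + u) * (a * (u + u)) ≡ (u + u) * (s * (a * k) + (u + u) * a) + s * u * (a + a)
      eq = solve-∀
      eq′ : ∀ t s u A → t * (s * A) + s * u * A ≡ (t * s + s * u) * A
      eq′ = solve-∀
      eq″ : ∀ s A → s * s * A ≡ s * (A * s)
      eq″ = solve-∀

    single₂ : ∀ a A k → a ≤ₙ A → 31 * (a * k) + 20 * a ≤ₙ 31 * A →
      31 * (a * (20 * 20) * (k * 2 + 1)) + 20 * (a * (20 * 20)) ≤ₙ 31 * (A * (31 * 31))
    single₂ a A k h₀ h = begin
      31 * (a * (20 * 20) * (k * 2 + 1)) + 20 * (a * (20 * 20))              ≡⟨ eq 20 11 a k ⟩
      2 * (20 * (20 * (31 * (a * k) + 20 * a))) + 20 * 20 * 11 * a           ≤⟨ ℕₚ.+-mono-≤ (ℕₚ.*-monoʳ-≤ 2 (ℕₚ.*-monoʳ-≤ 20 (ℕₚ.*-monoʳ-≤ 20 h))) (ℕₚ.*-monoʳ-≤ (20 * 20 * 11) h₀) ⟩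
      2 * (20 * (20 * (31 * A))) + 20 * 20 * 11 * A                          ≡⟨ eq′ 20 31 11 A ⟩
      (2 * (20 * (20 * 31)) + 20 * 20 * 11) * A                              ≤⟨ ℕₚ.*-monoˡ-≤ A (ℕₚ.≤ᵇ⇒≤ (2 * (20 * (20 * 31)) + 20 * 20 * 11) (31 * (31 * 31)) _) ⟩
      31 * (31 * 31) * A                                                     ≡⟨ eq″ 31 A ⟩
      31 * (A * (31 * 31))                                                   ∎
      where
      open ℕₚ.≤-Reasoning
      eq : ∀ t v a k → (t + v) * (a * (t * t) * (k * 2 + 1)) + t * (a * (t * t))
         ≡ 2 * (t * (t * ((t + v) * (a * k) + t * a))) + t * t * v * a
      eq = solve-∀
      eq′ : ∀ t s v A → 2 * (t * (t * (s * A))) + t * t * v * A ≡ (2 * (t * (t * s)) + t * t * v) * A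
      eq′ = solve-∀
      eq″ : ∀ s A → s * (s * s) * A ≡ s * (A * (s * s))
      eq″ = solve-∀

    rebase : ∀ m n {k} → 31 * (20 ** m * 20 ** n * k) + 20 * (20 ** m * 20 ** n) ≤ₙ 31 * (31 ** m * 31 ** n) → Strong (m + n) k
    rebase m n {k} h rewrite ℕₚ.^-distribˡ-+-* 20 m n | ℕₚ.^-distribˡ-+-* 31 m n = h

    20^≤31^ : ∀ m → 20 ** m ≤ₙ 31 ** m
    20^≤31^ m = ℕₚ.^-monoˡ-≤ m (ℕₚ.m≤m+n 20 11)

    double^ : ∀ m → 2 ≤ₙ m → 20 ** m + 20 ** m ≤ₙ 31 ** m
    double^ 1 (s≤s ())
    double^ (suc (suc m)) _ = begin
      20 * (20 * 20 ** m) + 20 * (20 * 20 ** m)  ≡⟨ eq 20 (20 ** m) ⟩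
      (20 * 20 + 20 * 20) * 20 ** m              ≤⟨ ℕₚ.*-mono-≤ (ℕₚ.≤ᵇ⇒≤ (20 * 20 + 20 * 20) (31 * 31) _) (20^≤31^ m) ⟩
      31 * 31 * 31 ** m                          ≡⟨ ℕₚ.*-assoc 31 31 (31 ** m) ⟩
      31 * (31 * 31 ** m)                        ∎
      where
      open ℕₚ.≤-Reasoning
      eq : ∀ t a → t * (t * a) + t * (t * a) ≡ (t * t + t * t) * a
      eq = solve-∀

  extend-strong : ∀ m n {k p q} → 1 ≤ₙ k → Strong m k → Strong (suc n) p → Weak n q → Strong (m + suc n) (k * p + q)
  extend-strong m n {k} {p} {q} 1≤k h h₁ h₀ = rebase m (suc n) (combine (20 ** m) (31 ** m) (20 ** n) (31 ** n) p q k 1≤k h h₁ h₀)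

  extend-strong₀ : ∀ m n {k p} → 1 ≤ₙ p → Strong m k → Weak n p → Strong (m + n) (k * p)
  extend-strong₀ m n {k} {p} 1≤p h h₁ = rebase m n (combine₀ (20 ** m) (31 ** m) (20 ** n) (31 ** n) p k 1≤p h h₁)

  -- The values f(1) and f(2) miss the strong bound, so one and two cuts are computed directly. For
  -- one cut the estimate k + 1 needs β^m ≥ 2, whence the hypothesis on m.
  extend-single : ∀ m c {k} → 2 ≤ₙ m → 1 ≤ₙ k → Strong m k → Strong (m + suc c) (k * f (suc c) + f c)
  extend-single m 0 {k} 2≤m 1≤k h = rebase m 1 (single₁ (20 ** m) (31 ** m) k (double^ m 2≤m) h)
  extend-single m 1 {k} 2≤m 1≤k h = rebase m 2 (single₂ (20 ** m) (31 ** m) k (20^≤31^ m) h)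
  extend-single m (suc (suc c)) {k} 2≤m 1≤k h = extend-strong m (2 + c) {k} {f (3 + c)} {f (2 + c)} 1≤k h (f-strong c) (f-weak (2 + c))

  strong₂ : ∀ {n} → Strong 2 n → n ≤ₙ 1
  strong₂ {0} h = z≤n
  strong₂ {1} h = s≤s z≤n
  -- 29791 = 31 · 31² is less than 32800 = 31 · 20² · 2 + 20 · 20².
  strong₂ {suc (suc n)} h = ⊥-elim (ℕₚ.<⇒≱ (ℕₚ.≤ᵇ⇒≤ 29792 32800 _) (strong-mono 2 {2} {suc (suc n)} (s≤s (s≤s z≤n)) h))

  strong₂-one : Strong 2 1
  strong₂-one = ℕₚ.≤ᵇ⇒≤ _ _ _

  weak-elim : ∀ m {n} → Weak m n → 20 ** m * n ≤ₙ 31 ** m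
  weak-elim m h = h

  weak-zero : ∀ {n} → n ≤ₙ 1 → Weak 0 n
  weak-zero {n} h = ℕₚ.≤-trans (ℕₚ.≤-reflexive (ℕₚ.+-identityʳ n)) h

-- Compatibility of pieces

itemT pairT famT numT reqT cfgT resT : Ty
itemT = list val
pairT = itemT ⊗ itemT
famT  = list pairT
numT  = list unit
reqT  = list (val ⊗ val)
cfgT  = list itemT ⊗ famT ⊗ numT
resT  = numT ⊗ list itemT ⊗ list famT

Req : Set
Req = List (Val × Val)

memB : ∀ τ → El τ → List (El τ) → Bool
memB τ x = foldr (λ y acc → if eqb {τ} x y then true else acc) false

anyB : ∀ {A : Set} → (A → Bool) → List A → Bool
anyB p = foldr (λ v acc → if p v then true else acc) false

nubB : ∀ τ → List (El τ) → List (El τ)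
nubB τ = foldr (λ x acc → if memB τ x acc then acc else x ∷ acc) []

badV : Req → Val → Val → Bool
badV R x y = if eqb {val} x y then true
  else (if memB (val ⊗ val) (x , y) R then true else memB (val ⊗ val) (y , x) R)

-- Two alive pieces are incompatible if they share a vertex or if a request
-- joins them.

bad : Req → Rel
bad R c d = anyB (λ x → anyB (λ y → badV R x y) d) c

-- The head `[]` is the dummy item through which forbidden items and the contradiction are
-- expressed.
universe : Family → List Item → List Item
universe φ l = [] ∷ foldr (λ p acc → proj₁ p ∷ proj₂ p ∷ acc) l φ

grid : List Item → List (Item × Item)
grid us = concatMapB (λ c → mapB (λ d → c , d) us) us

look : List (Item × Item) → Rel
look t c d = memB pairT (c , d) t

exclT : List (Item × Item) → Item → Item × Item → Bool
exclT t a q = if look t a [] then true else (if look t a (proj₁ q) then true else look t a (proj₂ q))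

-- Evaluated as a function, `resolveAll` queries the preceding relation several times per pair and
-- takes time exponential in the length of the family. Tabulating each relation on a finite grid
-- makes it polynomial.
tableStep : List (Item × Item) → Item × Item → List (Item × Item) → List (Item × Item)
tableStep uu p t = filterB (λ q → if memB pairT q t then true
  else (if exclT t (proj₁ p) q then exclT t (proj₂ p) q else false)) uu

opaque
  tableOn : Req → Family → List (Item × Item) → List (Item × Item)
  tableOn R φ uu = foldr (tableStep uu) (filterB (λ q → bad R (proj₁ q) (proj₂ q)) uu) φ

table : Req → Family → List Item → List (Item × Item)
table R φ l = tableOn R φ (grid (universe φ l))

opaque
  sat : Req → Family → Bool
  sat R φ = notB (look (table R φ []) [] [])

-- A pair of equal items is a forced choice, so testing the satisfiability of these families checks
-- one particular selection.
lefts rights : Family → Family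
lefts  = mapB (λ p → proj₁ p , proj₁ p)
rights = mapB (λ p → proj₂ p , proj₂ p)

merge : Family → Item
merge φ = nubB val (concatMapB proj₁ φ)

optOf : Req → Family → List Item
optOf R φ = if sat R φ then merge φ ∷ [] else []

opaque
  -- Only the two extreme selections are considered. They are all there is for a family in which at
  -- most one pair leaves a choice.
  options : Req → List Family → List Item
  options R F = nubB itemT (concatMapB (λ φ → foldr _∷_ (optOf R (rights φ)) (optOf R (lefts φ))) F)

final : Req → Config → List Family
final R (todo , out , c) = if isNil todo then (if isNil c then (if sat R out then out ∷ [] else []) else []) else []

-- Polynomial terms for the tables and the search step

memₚ : ∀ {a b} → Poly a b → Poly a (list b) → Poly a bool
memₚ x l = anyₚ l (eqₚ (x ⊙ sndₚ) fstₚ)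

-- The usual way to meet the size condition of `foldₚ`: a step that adds an amount independent of
-- the accumulator yields at most length times that amount.
foldAddₚ : ∀ {a b c} (l : Poly a (list b)) (z : Poly a c) (s : Poly (b ⊗ c ⊗ a) c) {k : El a → ℕ} → PB a k →
           (∀ x u acc → sz b u ≤ₙ sz (list b) (⟦ l ⟧ₚ x) → sz c (⟦ s ⟧ₚ (u , acc , x)) ≤ₙ k x + sz c acc) →
           Poly a c
foldAddₚ {a} {b} {c} l z s {k} pk h = foldₚ l z s (pb-+ (pb-* (space l) pk) (space z))
  (λ x l′ le → ≤-trans (go x l′ le) (ℕₚ.+-monoˡ-≤ _ (ℕₚ.*-monoˡ-≤ (k x) (≤-trans (length≤sz {b} l′) le))))
  where
  go : ∀ x l′ → sz (list b) l′ ≤ₙ sz (list b) (⟦ l ⟧ₚ x) →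
       sz c (foldr (λ v acc → ⟦ s ⟧ₚ (v , acc , x)) (⟦ z ⟧ₚ x) l′) ≤ₙ length l′ * k x + sz c (⟦ z ⟧ₚ x)
  go x [] le = ≤-refl
  go x (u ∷ l′) le = ≤-trans (h x u _ (≤-trans (≤-trans (m≤m+n _ _) (ℕₚ.n≤1+n _)) le))
    (≤-trans (ℕₚ.+-monoʳ-≤ (k x) (go x l′ (≤-trans (≤-trans (m≤n+m _ _) (ℕₚ.n≤1+n _)) le)))
      (ℕₚ.≤-reflexive (sym (ℕₚ.+-assoc (k x) _ _))))

nubₚ : ∀ {a b} → Poly a (list b) → Poly a (list b)
nubₚ {a} {b} l = foldAddₚ l nilₚ (ifₚ (memₚ v₀ v₁) v₁ (consₚ v₀ v₁)) (pb-+ (pb-const 1) (space l)) grow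
  where
  grow : ∀ x u acc → sz b u ≤ₙ sz (list b) (⟦ l ⟧ₚ x) →
         sz (list b) (if memB b u acc then acc else u ∷ acc) ≤ₙ 1 + sz (list b) (⟦ l ⟧ₚ x) + sz (list b) acc
  grow x u acc le with memB b u acc
  ... | true  = m≤n+m _ _
  ... | false = s≤s (ℕₚ.+-monoˡ-≤ _ le)

badVₚ : Poly (val ⊗ val ⊗ reqT) bool
badVₚ = ifₚ (eqₚ v₀ v₁) (boolₚ true) (ifₚ (memₚ ⟨ v₀ , v₁ ⟩ₚ (sndₚ ⊙ sndₚ)) (boolₚ true) (memₚ ⟨ v₁ , v₀ ⟩ₚ (sndₚ ⊙ sndₚ)))

badₚ : Poly (itemT ⊗ itemT ⊗ reqT) bool
badₚ = anyₚ v₀ (anyₚ v₂ (badVₚ ⊙ ⟨ v₁ , ⟨ v₀ , sndₚ ⊙ sndₚ ⊙ sndₚ ⊙ sndₚ ⟩ₚ ⟩ₚ))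

universeₚ : Poly (famT ⊗ list itemT) (list itemT)
universeₚ = consₚ nilₚ (foldAddₚ fstₚ sndₚ (consₚ (fstₚ ⊙ v₀) (consₚ (sndₚ ⊙ v₀) v₁)) (pb-+ (pb-const 1) (space fstₚ)) grow)
  where
  eq : ∀ a b c → suc (a + suc (b + c)) ≡ 1 + suc (a + b) + c
  eq = solve-∀
  grow : ∀ x u acc → sz pairT u ≤ₙ sz famT (proj₁ x) →
         sz (list itemT) (proj₁ u ∷ proj₂ u ∷ acc) ≤ₙ 1 + sz famT (proj₁ x) + sz (list itemT) acc
  grow x u acc le = ≤-trans (ℕₚ.≤-reflexive (eq (sz itemT (proj₁ u)) (sz itemT (proj₂ u)) (sz (list itemT) acc)))
    (ℕₚ.+-monoˡ-≤ _ (s≤s le))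

gridₚ : Poly (list itemT) famT
gridₚ = concatMapₚ idₚ (mapₚ sndₚ ⟨ v₁ , v₀ ⟩ₚ)

lookₚ : ∀ {a} → Poly a famT → Poly a itemT → Poly a itemT → Poly a bool
lookₚ t c d = memₚ ⟨ c , d ⟩ₚ t

exclTₚ : Poly (famT ⊗ itemT ⊗ pairT) bool
exclTₚ = ifₚ (lookₚ v₀ v₁ nilₚ) (boolₚ true) (ifₚ (lookₚ v₀ v₁ (fstₚ ⊙ sndₚ ⊙ sndₚ)) (boolₚ true) (lookₚ v₀ v₁ (sndₚ ⊙ sndₚ ⊙ sndₚ)))

tableStepₚ : Poly (pairT ⊗ famT ⊗ famT) famT
tableStepₚ = filterₚ (sndₚ ⊙ sndₚ) (ifₚ (memₚ v₀ v₂) (boolₚ true)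
  (ifₚ (exclTₚ ⊙ ⟨ v₂ , ⟨ fstₚ ⊙ v₁ , v₀ ⟩ₚ ⟩ₚ) (exclTₚ ⊙ ⟨ v₂ , ⟨ sndₚ ⊙ v₁ , v₀ ⟩ₚ ⟩ₚ) (boolₚ false)))

sz-filterB : ∀ b (p : El b → Bool) l → sz (list b) (filterB p l) ≤ₙ sz (list b) l
sz-filterB b p [] = ≤-refl
sz-filterB b p (u ∷ l) with p u
... | true  = s≤s (ℕₚ.+-monoʳ-≤ (sz b u) (sz-filterB b p l))
... | false = ≤-trans (sz-filterB b p l) (≤-trans (m≤n+m _ _) (ℕₚ.n≤1+n _))

tableOnₚ : Poly (famT ⊗ famT ⊗ reqT) famT
tableOnₚ = foldₚ v₁ (filterₚ v₀ (badₚ ⊙ ⟨ fstₚ ⊙ v₀ , ⟨ sndₚ ⊙ v₀ , sndₚ ⊙ sndₚ ⊙ sndₚ ⟩ₚ ⟩ₚ))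
  (tableStepₚ ⊙ ⟨ v₀ , ⟨ v₁ , v₂ ⟩ₚ ⟩ₚ) (space v₀) inv
  where
  inv : ∀ x l′ → _ → sz famT (foldr (tableStep (proj₁ x)) (filterB (λ q → bad (proj₂ (proj₂ x)) (proj₁ q) (proj₂ q)) (proj₁ x)) l′) ≤ₙ sz famT (proj₁ x)
  inv x []       _ = sz-filterB pairT _ (proj₁ x)
  inv x (p ∷ l′) _ = sz-filterB pairT _ (proj₁ x)

-- The arguments of tableₚ are a family, further items and the requests.

tableₚ : Poly (famT ⊗ list itemT ⊗ reqT) famT
tableₚ = tableOnₚ ⊙ ⟨ gridₚ ⊙ universeₚ ⊙ ⟨ v₀ , v₁ ⟩ₚ , ⟨ v₀ , sndₚ ⊙ sndₚ ⟩ₚ ⟩ₚ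

opaque
  unfolding tableOn

  table-≡ : ∀ R φ l → ⟦ tableₚ ⟧ₚ (φ , l , R) ≡ table R φ l
  table-≡ R φ l = refl

notₚ : ∀ {a} → Poly a bool → Poly a bool
notₚ b = ifₚ b (boolₚ false) (boolₚ true)

satₚ : Poly (famT ⊗ reqT) bool
satₚ = notₚ (lookₚ (tableₚ ⊙ ⟨ fstₚ , ⟨ nilₚ , sndₚ ⟩ₚ ⟩ₚ) nilₚ nilₚ)

optOfₚ : Poly (famT ⊗ reqT) (list itemT)
optOfₚ = ifₚ satₚ (consₚ (nubₚ (concatMapₚ fstₚ (fstₚ ⊙ fstₚ))) nilₚ) nilₚ

optionsₚ : Poly (list famT ⊗ reqT) (list itemT)
optionsₚ = nubₚ (concatMapₚ fstₚ (appendₚ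
  (optOfₚ ⊙ ⟨ mapₚ v₀ ⟨ fstₚ ⊙ v₀ , fstₚ ⊙ v₀ ⟩ₚ , sndₚ ⊙ sndₚ ⟩ₚ)
  (optOfₚ ⊙ ⟨ mapₚ v₀ ⟨ sndₚ ⊙ v₀ , sndₚ ⊙ v₀ ⟩ₚ , sndₚ ⊙ sndₚ ⟩ₚ)))

isNilₚ isOneₚ isBigₚ : ∀ {a b} → Poly a (list b) → Poly a bool
isNilₚ l = caseₚ l (boolₚ true) (boolₚ false)
isOneₚ l = caseₚ l (boolₚ false) (isNilₚ v₁)
isBigₚ l = caseₚ l (boolₚ false) (caseₚ v₁ (boolₚ false) (caseₚ v₁ (boolₚ false) (boolₚ true)))

finalₚ : Poly (cfgT ⊗ reqT) (list famT)
finalₚ = ifₚ (isNilₚ (fstₚ ⊙ fstₚ)) (ifₚ (isNilₚ (sndₚ ⊙ sndₚ ⊙ fstₚ))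
  (ifₚ (satₚ ⊙ ⟨ fstₚ ⊙ sndₚ ⊙ fstₚ , sndₚ ⟩ₚ) (consₚ (fstₚ ⊙ sndₚ ⊙ fstₚ) nilₚ) nilₚ) nilₚ) nilₚ

pickT : Ty
pickT = itemT ⊗ list itemT

sz-const : ∀ b n (l : List (El b)) → All (λ x → sz b x ≡ n) l → sz (list b) l ≡ 1 + length l * suc n
sz-const b n []      []        = refl
sz-const b n (x ∷ l) (e ∷ es) = cong suc (trans (cong₂ _+_ e (sz-const b n l es)) (ℕₚ.+-suc n _))

module _ {b : Ty} where

  picks-sz : ∀ l → All (λ q → sz (b ⊗ list b) q ≡ sz (list b) l) (picks {El b} l) × length (picks {El b} l) ≡ length l
  picks-sz [] = [] , refl
  picks-sz (u ∷ l) rewrite picks′-fst l with picks-sz l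
  ... | h , len = refl ∷ go (picks l) h , cong suc (trans (len-map (picks l)) len)
    where
    eq : ∀ a b c → suc (b + suc (a + c)) ≡ suc (a + suc (b + c))
    eq = solve-∀
    go : ∀ ps → All (λ q → sz (b ⊗ list b) q ≡ sz (list b) l) ps →
         All (λ q → sz (b ⊗ list b) q ≡ sz (list b) (u ∷ l)) (mapB (λ q → proj₁ q , u ∷ proj₂ q) ps)
    go [] [] = []
    go (q ∷ ps) (e ∷ es) = trans (eq (sz b u) (sz b (proj₁ q)) (sz (list b) (proj₂ q))) (cong (λ n → suc (sz b u + n)) e) ∷ go ps es
    len-map : ∀ ps → length (mapB (λ (q : El b × List (El b)) → proj₁ q , u ∷ proj₂ q) ps) ≡ length ps
    len-map []       = refl
    len-map (q ∷ ps) = cong suc (len-map ps)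

picksₚ : ∀ {b} → Poly (list b) (list (b ⊗ list b))
picksₚ {b} = sndₚ ⊙ foldₚ idₚ ⟨ nilₚ , nilₚ ⟩ₚ
  ⟨ consₚ v₀ (fstₚ ⊙ v₁) , consₚ ⟨ v₀ , fstₚ ⊙ v₁ ⟩ₚ (mapₚ (sndₚ ⊙ v₁) ⟨ fstₚ ⊙ v₀ , consₚ v₁ (sndₚ ⊙ v₀) ⟩ₚ) ⟩ₚ
  (pb-+ (pb-const 1) (pb-+ pb-sz (pb-+ (pb-const 1) (pb-* pb-sz (pb-+ (pb-const 1) pb-sz))))) inv
  where
  inv : ∀ x l′ → sz (list b) l′ ≤ₙ sz (list b) x → sz (list b ⊗ list (b ⊗ list b)) (picks′ l′) ≤ₙ
        1 + (sz (list b) x + (1 + sz (list b) x * (1 + sz (list b) x)))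
  inv x l′ le = s≤s (+-mono-≤ (≤-trans (ℕₚ.≤-reflexive (cong (sz (list b)) (picks′-fst l′))) le) (begin
    sz (list (b ⊗ list b)) (picks l′)              ≡⟨ sz-const (b ⊗ list b) (sz (list b) l′) (picks l′) (proj₁ (picks-sz {b} l′)) ⟩
    1 + length (picks l′) * suc (sz (list b) l′)   ≡⟨ cong (λ n → 1 + n * suc (sz (list b) l′)) (proj₂ (picks-sz {b} l′)) ⟩
    1 + length l′ * suc (sz (list b) l′)           ≤⟨ s≤s (*-mono-≤ (≤-trans (length≤sz {b} l′) le) (s≤s le)) ⟩
    1 + sz (list b) x * (1 + sz (list b) x)        ∎))

minusₚ : ∀ {b} → Poly (numT ⊗ list b) (list numT)
minusₚ {b} = foldₚ sndₚ (consₚ fstₚ nilₚ) (caseₚ v₁ nilₚ (caseₚ v₀ nilₚ (consₚ v₁ nilₚ)))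
  (pb-+ (pb-const 2) (space fstₚ)) (λ x l′ _ → inv x l′)
  where
  inv : ∀ x (l′ : List (El b)) → sz (list numT) (minus (proj₁ x) l′) ≤ₙ 2 + sz numT (proj₁ x)
  inv x []       = ℕₚ.≤-reflexive (cong suc (ℕₚ.+-comm (sz numT (proj₁ x)) 1))
  inv x (u ∷ l′) with minus (proj₁ x) l′ | inv x l′
  ... | []             | h = s≤s z≤n
  ... | [] ∷ cs        | h = s≤s z≤n
  ... | (_ ∷ c) ∷ cs   | h = ≤-trans (s≤s (≤-trans (ℕₚ.+-monoʳ-≤ (sz numT c) (1≤‖‖ (enc (list numT) cs))) (≤-trans (m≤n+m _ 2) ≤-refl))) h

nbsₚ nonₚ : Poly (pickT ⊗ famT) (list itemT)
nbsₚ = filterₚ (sndₚ ⊙ fstₚ) (lookₚ (sndₚ ⊙ sndₚ) (fstₚ ⊙ v₁) v₀)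
nonₚ = filterₚ (sndₚ ⊙ fstₚ) (notₚ (lookₚ (sndₚ ⊙ sndₚ) (fstₚ ⊙ v₁) v₀))

-- The arguments are a pick, the family emitted so far, the remaining budget
-- and the table of conflicts.

argT : Ty
argT = pickT ⊗ famT ⊗ numT ⊗ famT

tabₚ : ∀ {a b c d} → Poly (a ⊗ b ⊗ c ⊗ d) d
tabₚ = sndₚ ⊙ sndₚ ⊙ sndₚ

nbsAtₚ nonAtₚ : Poly argT (list itemT)
nbsAtₚ = nbsₚ ⊙ ⟨ v₀ , tabₚ ⟩ₚ
nonAtₚ = nonₚ ⊙ ⟨ v₀ , tabₚ ⟩ₚ

pairAtₚ keepAtₚ : Poly argT (list cfgT)
pairAtₚ = caseₚ nbsAtₚ nilₚ (caseₚ (v₂ ⊙ sndₚ ⊙ sndₚ) nilₚ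
  (consₚ ⟨ nonAtₚ ⊙ γ , ⟨ consₚ ⟨ fstₚ ⊙ v₀ ⊙ γ , v₀ ⊙ sndₚ ⊙ sndₚ ⟩ₚ (v₁ ⊙ γ) , v₁ ⟩ₚ ⟩ₚ nilₚ))
  where
  γ : ∀ {a b c d e} → Poly (a ⊗ b ⊗ c ⊗ d ⊗ e) e
  γ = sndₚ ⊙ sndₚ ⊙ sndₚ ⊙ sndₚ
keepAtₚ = caseₚ (minusₚ ⊙ ⟨ v₂ , nbsAtₚ ⟩ₚ) nilₚ
  (consₚ ⟨ nonAtₚ ⊙ γ , ⟨ consₚ ⟨ fstₚ ⊙ v₀ ⊙ γ , fstₚ ⊙ v₀ ⊙ γ ⟩ₚ (v₁ ⊙ γ) , v₀ ⟩ₚ ⟩ₚ nilₚ)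
  where
  γ : ∀ {a b c} → Poly (a ⊗ b ⊗ c) c
  γ = sndₚ ⊙ sndₚ

picksWhere : Poly (list itemT) bool → Poly (cfgT ⊗ famT) (list pickT)
picksWhere q = filterₚ (picksₚ ⊙ fstₚ ⊙ fstₚ) (q ⊙ nbsₚ ⊙ ⟨ v₀ , sndₚ ⊙ sndₚ ⟩ₚ)

onPick : Poly argT (list cfgT) → Poly (pickT ⊗ list pickT ⊗ cfgT ⊗ famT) (list cfgT)
onPick g = g ⊙ ⟨ v₀ , ⟨ fstₚ ⊙ sndₚ ⊙ v₂ , ⟨ sndₚ ⊙ sndₚ ⊙ v₂ , tabₚ ⟩ₚ ⟩ₚ ⟩ₚ

pairOrₚ : Poly (cfgT ⊗ famT) (list cfgT)
pairOrₚ = caseₚ (picksWhere (isOneₚ idₚ)) (consₚ fstₚ nilₚ) (onPick pairAtₚ)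

branchₚ : Poly argT (list cfgT)
branchₚ = appendₚ (caseₚ v₂ nilₚ (pairOrₚ ⊙ ⟨ ⟨ sndₚ ⊙ v₀ ⊙ γ , ⟨ v₁ ⊙ γ , v₁ ⟩ₚ ⟩ₚ , tabₚ ⊙ γ ⟩ₚ)) keepAtₚ
  where
  γ : ∀ {a b c} → Poly (a ⊗ b ⊗ c) c
  γ = sndₚ ⊙ sndₚ

step₃ₚ step₂ₚ step₁ₚ step₀ₚ : Poly (cfgT ⊗ famT) (list cfgT)
step₃ₚ = caseₚ (appendₚ (picksWhere (isBigₚ idₚ)) (picksₚ ⊙ fstₚ ⊙ fstₚ))
  (caseₚ (sndₚ ⊙ sndₚ ⊙ fstₚ) (consₚ fstₚ nilₚ) nilₚ) (onPick branchₚ)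
step₂ₚ = caseₚ (picksWhere (isOneₚ idₚ)) step₃ₚ (onPick pairAtₚ)
step₁ₚ = caseₚ (picksWhere (isNilₚ idₚ)) step₂ₚ
  (consₚ ⟨ sndₚ ⊙ v₀ , ⟨ consₚ ⟨ fstₚ ⊙ v₀ , fstₚ ⊙ v₀ ⟩ₚ (fstₚ ⊙ sndₚ ⊙ v₂) , sndₚ ⊙ sndₚ ⊙ v₂ ⟩ₚ ⟩ₚ nilₚ)
step₀ₚ = caseₚ (filterₚ (picksₚ ⊙ fstₚ ⊙ fstₚ) (lookₚ (sndₚ ⊙ sndₚ) (fstₚ ⊙ v₀) nilₚ)) step₁ₚ
  (caseₚ (sndₚ ⊙ sndₚ ⊙ v₂) nilₚ (consₚ ⟨ sndₚ ⊙ v₀ ⊙ sndₚ ⊙ sndₚ , ⟨ fstₚ ⊙ sndₚ ⊙ v₂ ⊙ sndₚ ⊙ sndₚ , v₁ ⟩ₚ ⟩ₚ nilₚ))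

-- The algorithm on rooted trees

-- The result for a subtree: the least number m of edges of it that separate
-- all requests inside of it, and the possible components of its root for cuts
-- of size m. These are either listed, or they are described by families.

Res : Set
Res = Num × List Item × List Family

size# : Res → Num
size# r = proj₁ r

opts : Res → List Item
opts r = proj₁ (proj₂ r)

fams : Res → List Family
fams r = proj₂ (proj₂ r)

baseT : Ty
baseT = numT ⊗ famT

appB : ∀ {A : Set} → List A → List A → List A
appB xs ys = foldr _∷_ ys xs

-- A child with options contributes their number less one: either one option stays alive and the
-- others are discarded, or all are discarded, which costs one more and stands for cutting off the
-- child.
budget : Num → List Res → Num
budget = foldr (λ r acc → caseL (opts r) acc (λ _ os → foldr (λ _ a → tt ∷ a) acc os))

itemsOf : List Res → List Item
itemsOf = concatMapB opts

-- A child with families is cut off at the price of one unit of the budget, or one of its families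
-- joins the selection at no extra cost.
extend : List Family → List (Num × Family) → List (Num × Family)
extend F = foldr (λ κ acc → appB (decr (proj₁ κ) (λ c → (c , proj₂ κ) ∷ []))
  (foldr (λ φ a → (proj₁ κ , appB φ (proj₂ κ)) ∷ a) acc F)) []

bases : Num → Family → List Res → List (Num × Family)
bases c out = foldr (λ r K → caseL (opts r) (extend (fams r) K) (λ _ _ → K)) ((c , out) ∷ [])

roundsT : List (Item × Item) → List Item → List Config → List Config
roundsT t l K = foldr (λ _ K → concatMapB (step₀ (look t)) K) K l

opaque
  searchT : Req → List Item → Num × Family → List (Item × Item) → List Family
  searchT R l κ t = concatMapB (final R) (roundsT t l ((l , proj₂ κ , proj₁ κ) ∷ []))

  searchT-def : ∀ R l κ t → searchT R l κ t ≡ concatMapB (final R) (roundsT t l ((l , proj₂ κ , proj₁ κ) ∷ []))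
  searchT-def R l κ t = refl

searchFrom : Req → List Item → Num × Family → List Family
searchFrom R l κ = searchT R l κ (table R (proj₂ κ) l)

genFrom : Req → List Item → List (Num × Family) → List Family
genFrom R l = concatMapB (searchFrom R l)

opaque
  gen : Req → Val → List Res → Num → List Family
  gen R v rs d = genFrom R (itemsOf rs) (bases (budget d rs) ((v ∷ [] , v ∷ []) ∷ []) rs)

  gen-def : ∀ R v rs d → gen R v rs d ≡ genFrom R (itemsOf rs) (bases (budget d rs) ((v ∷ [] , v ∷ []) ∷ []) rs)
  gen-def R v rs d = refl

-- Frozen as soon as some family is found, so the surviving `d` is the least possible number of
-- additional cuts.
loopStep : Req → Val → List Res → Num × List Family → Num × List Family
loopStep R v rs s = caseL (proj₂ s)
  (caseL (gen R v rs (proj₁ s)) (tt ∷ proj₁ s , []) (λ φ φs → proj₁ s , φ ∷ φs)) (λ _ _ → s)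

loop : Req → Val → List Res → Num → Num × List Family
loop R v rs = foldr (λ _ → loopStep R v rs) ([] , [])

total : List Res → Num
total = foldr (λ r acc → appB (size# r) acc) []

dropB : Num → Num → Num
dropB n m = foldr (λ _ acc → caseL acc [] (λ _ t → t)) n m

-- True for m ≤ 1, and for m = 2 if there are at least two families. A single family with m = 2
-- stays a family: it meets the strong bound, whereas its selections may be more than three.
simpleB : Num → List Family → Bool
simpleB m F = caseL m true (λ _ m → caseL m true (λ _ m → caseL m
  (caseL F false (λ _ F → caseL F false (λ _ _ → true))) (λ _ _ → false)))

pack : Req → Num → List Family → Res
pack R m F = if simpleB m F then (m , options R F , []) else (m , [] , F)

-- The number of trials is k + 1 less the total. When all of them fail the recorded size is k + 1,
-- and when there are none it is the total, already above k. In either case it is a valid lower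
-- bound that exceeds k.
finish : Req → Num → Val → List Res → Res
finish R k v rs = packLoop (loop R v rs (dropB (tt ∷ k) (total rs)))
  where
  packLoop : Num × List Family → Res
  packLoop s = pack R (appB (total rs) (proj₁ s)) (proj₂ s)

childrenOf : Val → List (Val × Res) → List Res
childrenOf v = foldr (λ e acc → if eqb {val} v (proj₁ e) then proj₂ e ∷ acc else acc) []

othersOf : Val → List (Val × Res) → List (Val × Res)
othersOf v = foldr (λ e acc → if eqb {val} v (proj₁ e) then acc else e ∷ acc) []

-- The state lists, with their parents, the results of subtrees whose parent is still to come.
-- Parents precede children in the order, so the right fold meets a vertex after all of its
-- children.
process : Req → Num → List (Val × Val) → List (Val × Res)
process R k = foldr (λ e st → (proj₂ e , finish R k (proj₁ e) (childrenOf (proj₁ e) st)) ∷ othersOf (proj₁ e) st) []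

-- The algorithm as a term of the language

cmapₜ : ∀ {a b c e} → Poly (b ⊗ e) (list c) → Tm a (list b) → Tm a e → Tm a (list c)
cmapₜ g l e = foldₜ l nilₜ (appendₜ (tm g ∘ₜ ⟪ fstₜ , e ∘ₜ sndₜ ∘ₜ sndₜ ⟫) (fstₜ ∘ₜ sndₜ))

p₀ : ∀ {a b} → Tm (a ⊗ b) a
p₀ = fstₜ

p₁ : ∀ {a b c} → Tm (a ⊗ b ⊗ c) b
p₁ = fstₜ ∘ₜ sndₜ

p₂ : ∀ {a b c d} → Tm (a ⊗ b ⊗ c ⊗ d) c
p₂ = fstₜ ∘ₜ sndₜ ∘ₜ sndₜ

tl₁ : ∀ {a b} → Tm (a ⊗ b) b
tl₁ = sndₜ

tl₂ : ∀ {a b c} → Tm (a ⊗ b ⊗ c) c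
tl₂ = sndₜ ∘ₜ sndₜ

tl₃ : ∀ {a b c d} → Tm (a ⊗ b ⊗ c ⊗ d) d
tl₃ = sndₜ ∘ₜ sndₜ ∘ₜ sndₜ

budgetₜ : Tm (numT ⊗ list resT) numT
budgetₜ = foldₜ tl₁ p₀ (caseₜ (fstₜ ∘ₜ sndₜ ∘ₜ p₀) p₁ (foldₜ p₁ (p₁ ∘ₜ tl₂) (consₜ unitₜ p₁)))

itemsOfₜ : Tm (list resT) (list itemT)
itemsOfₜ = foldₜ idₜ nilₜ (appendₜ (fstₜ ∘ₜ sndₜ ∘ₜ p₀) p₁)

extendₜ : Tm (list famT ⊗ list baseT) (list baseT)
extendₜ = foldₜ tl₁ nilₜ (appendₜ
  (caseₜ (fstₜ ∘ₜ p₀) nilₜ (consₜ ⟪ p₁ , sndₜ ∘ₜ p₀ ∘ₜ tl₂ ⟫ nilₜ))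
  (foldₜ (fstₜ ∘ₜ tl₂) p₁ (consₜ ⟪ fstₜ ∘ₜ p₀ ∘ₜ tl₂ , appendₜ p₀ (sndₜ ∘ₜ p₀ ∘ₜ tl₂) ⟫ p₁)))

basesₜ : Tm (baseT ⊗ list resT) (list baseT)
basesₜ = foldₜ tl₁ (consₜ p₀ nilₜ)
  (caseₜ (fstₜ ∘ₜ sndₜ ∘ₜ p₀) (extendₜ ∘ₜ ⟪ sndₜ ∘ₜ sndₜ ∘ₜ p₀ , p₁ ⟫) (p₁ ∘ₜ tl₂))

searchTₜ : Tm (famT ⊗ baseT ⊗ list itemT ⊗ reqT) (list famT)
searchTₜ = cmapₜ finalₚ
  (foldₜ p₂ (consₜ ⟪ p₂ , ⟪ sndₜ ∘ₜ p₁ , fstₜ ∘ₜ p₁ ⟫ ⟫ nilₜ) (cmapₜ step₀ₚ p₁ (p₀ ∘ₜ tl₂)))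
  tl₃

searchFromₜ : Tm (baseT ⊗ list itemT ⊗ reqT) (list famT)
searchFromₜ = searchTₜ ∘ₜ ⟪ tm tableₚ ∘ₜ ⟪ sndₜ ∘ₜ p₀ , ⟪ p₁ , tl₂ ⟫ ⟫ , idₜ ⟫

genFromₜ : Tm (list baseT ⊗ list itemT ⊗ reqT) (list famT)
genFromₜ = foldₜ p₀ nilₜ (appendₜ (searchFromₜ ∘ₜ ⟪ p₀ , tl₁ ∘ₜ tl₂ ⟫) p₁)

genₜ : Tm (numT ⊗ val ⊗ list resT ⊗ reqT) (list famT)
genₜ = genFromₜ ∘ₜ ⟪ basesₜ ∘ₜ ⟪ ⟪ budgetₜ ∘ₜ ⟪ p₀ , p₂ ⟫ , consₜ ⟪ consₜ p₁ nilₜ , consₜ p₁ nilₜ ⟫ nilₜ ⟫ , p₂ ⟫ ,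
                     ⟪ itemsOfₜ ∘ₜ p₂ , tl₃ ⟫ ⟫

loopT : Ty
loopT = numT ⊗ list famT

loopStepₜ : Tm (loopT ⊗ val ⊗ list resT ⊗ reqT) loopT
loopStepₜ = caseₜ (sndₜ ∘ₜ p₀)
  (caseₜ (genₜ ∘ₜ ⟪ fstₜ ∘ₜ p₀ , tl₁ ⟫)
    ⟪ consₜ unitₜ (fstₜ ∘ₜ p₀) , nilₜ ⟫
    ⟪ fstₜ ∘ₜ p₀ ∘ₜ tl₂ , consₜ p₀ p₁ ⟫)
  (p₀ ∘ₜ tl₂)

loopₜ : Tm (numT ⊗ val ⊗ list resT ⊗ reqT) loopT
loopₜ = foldₜ p₀ ⟪ nilₜ , nilₜ ⟫ (loopStepₜ ∘ₜ ⟪ p₁ , tl₁ ∘ₜ tl₂ ⟫)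

totalₜ : Tm (list resT) numT
totalₜ = foldₜ idₜ nilₜ (appendₜ (fstₜ ∘ₜ p₀) p₁)

dropₜ : Tm (numT ⊗ numT) numT
dropₜ = foldₜ tl₁ p₀ (caseₜ p₁ nilₜ p₁)

simpleₜ : Tm (numT ⊗ list famT) bool
simpleₜ = caseₜ p₀ (boolₜ true) (caseₜ p₁ (boolₜ true) (caseₜ p₁
  (caseₜ (tl₁ ∘ₜ tl₂ ∘ₜ tl₂) (boolₜ false) (caseₜ p₁ (boolₜ false) (boolₜ true))) (boolₜ false)))

packₜ : Tm (numT ⊗ list famT ⊗ reqT) resT
packₜ = ifₜ (simpleₜ ∘ₜ ⟪ p₀ , p₁ ⟫)
  ⟪ p₀ , ⟪ tm optionsₚ ∘ₜ ⟪ p₁ , tl₂ ⟫ , nilₜ ⟫ ⟫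
  ⟪ p₀ , ⟪ nilₜ , p₁ ⟫ ⟫

finishₜ : Tm (val ⊗ list resT ⊗ numT ⊗ reqT) resT
finishₜ = (packₜ ∘ₜ ⟪ appendₜ (totalₜ ∘ₜ p₁ ∘ₜ tl₁) (fstₜ ∘ₜ p₀) , ⟪ sndₜ ∘ₜ p₀ , tl₃ ∘ₜ tl₁ ⟫ ⟫)
  ∘ₜ ⟪ loopₜ ∘ₜ ⟪ dropₜ ∘ₜ ⟪ consₜ unitₜ p₂ , totalₜ ∘ₜ p₁ ⟫ , ⟪ p₀ , ⟪ p₁ , tl₃ ⟫ ⟫ ⟫ , idₜ ⟫

childrenOfₜ : Tm (val ⊗ list (val ⊗ resT)) (list resT)
childrenOfₜ = foldₜ tl₁ nilₜ (ifₜ (eqₜ (p₀ ∘ₜ tl₂) (fstₜ ∘ₜ p₀)) (consₜ (sndₜ ∘ₜ p₀) p₁) p₁)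

othersOfₜ : Tm (val ⊗ list (val ⊗ resT)) (list (val ⊗ resT))
othersOfₜ = foldₜ tl₁ nilₜ (ifₜ (eqₜ (p₀ ∘ₜ tl₂) (fstₜ ∘ₜ p₀)) p₁ (consₜ p₀ p₁))

processₜ : Tm (list (val ⊗ val) ⊗ numT ⊗ reqT) (list (val ⊗ resT))
processₜ = foldₜ p₀ nilₜ (consₜ ⟪ sndₜ ∘ₜ p₀ ,
  finishₜ ∘ₜ ⟪ fstₜ ∘ₜ p₀ , ⟪ childrenOfₜ ∘ₜ ⟪ fstₜ ∘ₜ p₀ , p₁ ⟫ , tl₁ ∘ₜ tl₂ ⟫ ⟫ ⟫ (othersOfₜ ∘ₜ ⟪ fstₜ ∘ₜ p₀ , p₁ ⟫))

opaque
  unfolding gen searchT tableOn sat options step₀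

  finish-≡ : ∀ R k v rs → ⟦ finishₜ ⟧ (v , rs , k , R) ≡ finish R k v rs
  finish-≡ R k v rs = refl

  process-≡ : ∀ R k ord → ⟦ processₜ ⟧ (ord , k , R) ≡ process R k ord
  process-≡ R k ord = refl

-- Equality tests, conflicts and their tables

==ᵛ-true : ∀ x y → (x ==ᵛ y) ≡ true → x ≡ y
==ᵛ-true nil nil _ = refl
==ᵛ-true (a ∙ b) (c ∙ d) e with a ==ᵛ c in e′
... | true = cong₂ _∙_ (==ᵛ-true a c e′) (==ᵛ-true b d e)

==ᵛ-refl : ∀ x → (x ==ᵛ x) ≡ true
==ᵛ-refl nil = refl
==ᵛ-refl (a ∙ b) rewrite ==ᵛ-refl a = ==ᵛ-refl b

∙-inj : ∀ {a b c d} → a ∙ b ≡ c ∙ d → a ≡ c × b ≡ d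
∙-inj refl = refl , refl

enc-inj : ∀ τ {x y} → enc τ x ≡ enc τ y → x ≡ y
enc-inj val e = e
enc-inj bool {false} {false} e = refl
enc-inj bool {true} {true} e = refl
enc-inj unit e = refl
enc-inj (list τ) {[]} {[]} e = refl
enc-inj (list τ) {x ∷ xs} {y ∷ ys} e = let p , q = ∙-inj e in cong₂ _∷_ (enc-inj τ p) (enc-inj (list τ) q)
enc-inj (σ ⊗ τ) e = let p , q = ∙-inj e in cong₂ _,_ (enc-inj σ p) (enc-inj τ q)

eqb-true : ∀ τ {x y} → eqb {τ} x y ≡ true → x ≡ y
eqb-true τ {x} {y} e = enc-inj τ (==ᵛ-true (enc τ x) (enc τ y) e)

eqb-refl : ∀ τ x → eqb {τ} x x ≡ true
eqb-refl τ x = ==ᵛ-refl (enc τ x)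

anyB-true : ∀ {A : Set} {p : A → Bool} l → anyB p l ≡ true → ∃[ x ] (x ∈ l × p x ≡ true)
anyB-true {p = p} (y ∷ l) e with p y in e′
... | true  = y , here refl , e′
... | false = let x , i , h = anyB-true l e in x , there i , h

anyB-false : ∀ {A : Set} {p : A → Bool} {l} → anyB p l ≡ false → ∀ {x} → x ∈ l → p x ≡ false
anyB-false {p = p} {y ∷ l} e i with p y in e′
anyB-false {l = y ∷ l} e (here refl) | false = e′
anyB-false {l = y ∷ l} e (there i)   | false = anyB-false {l = l} e i

anyB-false⁺ : ∀ {A : Set} {p : A → Bool} l → (∀ {x} → x ∈ l → p x ≡ false) → anyB p l ≡ false
anyB-false⁺ [] h = refl
anyB-false⁺ {p = p} (y ∷ l) h rewrite h (here refl) = anyB-false⁺ l (λ i → h (there i))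

memB-true : ∀ τ {x} l → memB τ x l ≡ true → x ∈ l
memB-true τ l e = let y , i , h = anyB-true l e in subst (_∈ l) (sym (eqb-true τ h)) i

memB-∈ : ∀ τ {x l} → x ∈ l → memB τ x l ≡ true
memB-∈ τ {x} {y ∷ l} (here refl) rewrite eqb-refl τ x = refl
memB-∈ τ {x} {y ∷ l} (there i) with eqb {τ} x y
... | true  = refl
... | false = memB-∈ τ i

memB-false : ∀ τ {x l} → memB τ x l ≡ false → ¬ x ∈ l
memB-false τ e i = true≢false (memB-∈ τ i) e

memB-false⁺ : ∀ τ {x} l → ¬ x ∈ l → memB τ x l ≡ false
memB-false⁺ τ {x} l h with memB τ x l in e
... | true  = ⊥-elim (h (memB-true τ l e))
... | false = refl

Apart : Req → Val → Val → Set
Apart R x y = x ≢ y × ¬ (x , y) ∈ R × ¬ (y , x) ∈ R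

badV-false : ∀ {R x y} → badV R x y ≡ false → Apart R x y
badV-false {R} {x} {y} e with eqb {val} x y in e₁
... | false with memB (val ⊗ val) (x , y) R in e₂
...   | false = (λ { refl → true≢false (eqb-refl val x) e₁ }) , memB-false (val ⊗ val) e₂ , memB-false (val ⊗ val) e

badV-false⁺ : ∀ {R x y} → Apart R x y → badV R x y ≡ false
badV-false⁺ {R} {x} {y} (n , p , q) with eqb {val} x y in e₁
... | true = ⊥-elim (n (eqb-true val e₁))
... | false rewrite memB-false⁺ (val ⊗ val) R p = memB-false⁺ (val ⊗ val) R q

bad-false : ∀ {R c d} → bad R c d ≡ false → ∀ {x y} → x ∈ c → y ∈ d → Apart R x y
bad-false {c = c} {d} e i j = badV-false (anyB-false {l = d} (anyB-false {l = c} e i) j)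

bad-false⁺ : ∀ {R} c d → (∀ {x y} → x ∈ c → y ∈ d → Apart R x y) → bad R c d ≡ false
bad-false⁺ c d h = anyB-false⁺ c (λ i → anyB-false⁺ d (λ j → badV-false⁺ (h i j)))

bool-≡ : ∀ {a b} → (a ≡ false → b ≡ false) → (b ≡ false → a ≡ false) → a ≡ b
bool-≡ {false} {b} p q = sym (p refl)
bool-≡ {true} {true} p q = refl
bool-≡ {true} {false} p q = q refl

apart-sym : ∀ {R x y} → Apart R x y → Apart R y x
apart-sym (n , p , q) = (λ e → n (sym e)) , q , p

bad-sym : ∀ R → Symm (bad R)
bad-sym R c d = bool-≡ (λ e → bad-false⁺ d c (λ i j → apart-sym (bad-false {R} {c = c} {d} e j i)))
                       (λ e → bad-false⁺ c d (λ i j → apart-sym (bad-false {R} {c = d} {c} e j i)))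

-- The empty item conflicts with nothing, so it is free to act as the dummy: before resolution there
-- are no forbidden items.
bad-[] : ∀ R c → bad R c [] ≡ false
bad-[] R c = bad-false⁺ {R} c [] (λ _ ())

clean⁺ : ∀ {R σ} → AllPairs (λ c d → bad R c d ≡ false) σ → Clean (bad R) σ
clean⁺ {R} {σ} p = clean refl (All.tabulate (λ {c} _ → bad-[] R c)) p

mapB-∈ : ∀ {A C : Set} {f : A → C} {x l} → x ∈ l → f x ∈ mapB f l
mapB-∈ {f = f} {l = l} i = subst (_ ∈_) (sym (mapB≡ f l)) (∈ₚ.∈-map⁺ f i)

mapB-∈⁻ : ∀ {A C : Set} {f : A → C} {y l} → y ∈ mapB f l → ∃[ x ] (x ∈ l × y ≡ f x)
mapB-∈⁻ {f = f} {l = l} i = ∈ₚ.∈-map⁻ f (subst (_ ∈_) (mapB≡ f l) i)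

concatMapB-∈ : ∀ {A C : Set} {f : A → List C} {x y l} → x ∈ l → y ∈ f x → y ∈ concatMapB f l
concatMapB-∈ {f = f} {l = z ∷ l} (here refl) j = subst (_ ∈_) (sym (foldr-∷ (f z) _)) (∈ₚ.∈-++⁺ˡ j)
concatMapB-∈ {f = f} {l = z ∷ l} (there i) j =
  subst (_ ∈_) (sym (foldr-∷ (f z) _)) (∈ₚ.∈-++⁺ʳ (f z) (concatMapB-∈ {f = f} i j))

concatMapB-∈⁻ : ∀ {A C : Set} {f : A → List C} {y} l → y ∈ concatMapB f l → ∃[ x ] (x ∈ l × y ∈ f x)
concatMapB-∈⁻ {f = f} (z ∷ l) j with ∈ₚ.∈-++⁻ (f z) (subst (_ ∈_) (foldr-∷ (f z) _) j)
... | inj₁ i = z , here refl , i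
... | inj₂ i = let x , k , h = concatMapB-∈⁻ {f = f} l i in x , there k , h

filterB-∈ : ∀ {A : Set} (p : A → Bool) {x l} → x ∈ l → p x ≡ true → x ∈ filterB p l
filterB-∈ p {l = y ∷ l} (here refl) e rewrite e = here refl
filterB-∈ p {l = y ∷ l} (there i) e with p y
... | true  = there (filterB-∈ p i e)
... | false = filterB-∈ p i e

memB-filterB : ∀ τ (p : El τ → Bool) {x} l → x ∈ l → memB τ x (filterB p l) ≡ p x
memB-filterB τ p {x} l i with p x in e
... | true  = memB-∈ τ (filterB-∈ p i e)
... | false = memB-false⁺ τ (filterB p l) (λ j → true≢false (All.lookup (filterB-all p l) j) e)

∈-grid : ∀ {us c d} → c ∈ us → d ∈ us → (c , d) ∈ grid us
∈-grid {us} {c} i j = concatMapB-∈ {f = λ c → mapB (λ d → c , d) us} i (mapB-∈ {f = λ d → c , d} j)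

∈-grid⁻ : ∀ {us c d} → (c , d) ∈ grid us → c ∈ us × d ∈ us
∈-grid⁻ {us} i with concatMapB-∈⁻ {f = λ c → mapB (λ d → c , d) us} us i
... | x , j , k with mapB-∈⁻ {f = λ d → x , d} {l = us} k
...   | y , l , refl = j , l

if-∨ : ∀ a b → (if a then true else b) ≡ a ∨ b
if-∨ true  b = refl
if-∨ false b = refl

if-∧ : ∀ a b → (if a then b else false) ≡ a ∧ b
if-∧ true  b = refl
if-∧ false b = refl

Within : List Item → Family → Set
Within us = All (λ p → proj₁ p ∈ us × proj₂ p ∈ us)

module _ (R : Req) (us : List Item) (top∈ : [] ∈ us) where

  opaque
    unfolding tableOn

    -- Resolving pairs of the universe only asks for conflicts between members of the universe, so
    -- the restriction to the grid loses nothing there.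
    look-table : ∀ {φ} → Within us φ → ∀ {c d} → c ∈ us → d ∈ us →
                 look (tableOn R φ (grid us)) c d ≡ resolveAll (bad R) φ c d
    look-table [] i j = memB-filterB pairT (λ q → bad R (proj₁ q) (proj₂ q)) (grid us) (∈-grid i j)
    look-table {(a , b) ∷ φ} ((a∈ , b∈) ∷ w) {c} {d} i j =
      trans (memB-filterB pairT _ (grid us) (∈-grid i j)) (trans (if-∨ (memB pairT (c , d) t) _)
        (cong₂ _∨_ (look-table w i j) (trans (if-∧ (exclT t a (c , d)) _) (cong₂ _∧_ (ex a∈) (ex b∈)))))
      where
      t : List (Item × Item)
      t = tableOn R φ (grid us)
      ex : ∀ {e} → e ∈ us → exclT t e (c , d) ≡ excl (resolveAll (bad R) φ) e c d
      ex {e} e∈ = trans (if-∨ (look t e []) _) (cong₂ _∨_ (look-table w e∈ top∈)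
        (trans (if-∨ (look t e c) _) (cong₂ _∨_ (look-table w e∈ i) (look-table w e∈ j))))

    look-in : ∀ φ {c d} → look (tableOn R φ (grid us)) c d ≡ true → c ∈ us × d ∈ us
    look-in [] e = ∈-grid⁻ (filterB-⊆ _ (grid us) (memB-true pairT _ e))
    look-in (p ∷ φ) e = ∈-grid⁻ (filterB-⊆ _ (grid us) (memB-true pairT _ e))

  look-sym : ∀ {φ} → Within us φ → Symm (look (tableOn R φ (grid us)))
  look-sym {φ} w c d = bool-≡ (half c d) (half d c)
    where
    half : ∀ c d → look (tableOn R φ (grid us)) c d ≡ false → look (tableOn R φ (grid us)) d c ≡ false
    half c d e with look (tableOn R φ (grid us)) d c in e′
    ... | false = refl
    ... | true  = let j , i = look-in φ e′ in
      trans (sym e′) (trans (look-table w j i) (trans (resolveAll-sym φ (bad-sym R) d c) (trans (sym (look-table w i j)) e)))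

  look-clean : ∀ {φ σ} → Within us φ → All (_∈ us) σ → Clean (resolveAll (bad R) φ) σ → Clean (look (tableOn R φ (grid us))) σ
  look-clean {φ} w h (clean t u p) = clean (trans (look-table w top∈ top∈) t)
    (All.zipWith (λ (i , e) → trans (look-table w i top∈) e) (h , u)) (go h p)
    where
    go : ∀ {σ} → All (_∈ us) σ → AllPairs _ σ → AllPairs (λ c d → look (tableOn R φ (grid us)) c d ≡ false) σ
    go [] [] = []
    go (i ∷ is) (q ∷ qs) = All.zipWith (λ (j , e) → trans (look-table w i j) e) (is , q) ∷ go is qs

  look-clean⁻ : ∀ {φ σ} → Within us φ → All (_∈ us) σ → Clean (look (tableOn R φ (grid us))) σ → Clean (resolveAll (bad R) φ) σ
  look-clean⁻ {φ} w h (clean t u p) = clean (trans (sym (look-table w top∈ top∈)) t)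
    (All.zipWith (λ (i , e) → trans (sym (look-table w i top∈)) e) (h , u)) (go h p)
    where
    go : ∀ {σ} → All (_∈ us) σ → AllPairs _ σ → AllPairs (λ c d → resolveAll (bad R) φ c d ≡ false) σ
    go [] [] = []
    go (i ∷ is) (q ∷ qs) = All.zipWith (λ (j , e) → trans (sym (look-table w i j)) e) (is , q) ∷ go is qs

within-universe : ∀ φ l → Within (universe φ l) φ
within-universe φ l = All.map (λ (i , j) → there i , there j) (go φ)
  where
  go : ∀ φ → All (λ p → proj₁ p ∈ foldr (λ p acc → proj₁ p ∷ proj₂ p ∷ acc) l φ × proj₂ p ∈ foldr (λ p acc → proj₁ p ∷ proj₂ p ∷ acc) l φ) φ
  go []      = []
  go (p ∷ φ) = (here refl , there (here refl)) ∷ All.map (λ (i , j) → there (there i) , there (there j)) (go φ)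

items-universe : ∀ φ l {c} → c ∈ l → c ∈ universe φ l
items-universe φ l i = there (go φ)
  where
  go : ∀ φ → _ ∈ foldr (λ p acc → proj₁ p ∷ proj₂ p ∷ acc) l φ
  go []      = i
  go (p ∷ φ) = there (there (go φ))

look-top : ∀ R φ → look (table R φ []) [] [] ≡ resolveAll (bad R) φ [] []
look-top R φ = look-table R (universe φ []) (here refl) (within-universe φ []) (here refl) (here refl)

opaque
  unfolding sat

  sat-true : ∀ R φ {τ} → Sel φ τ → Clean (bad R) τ → sat R φ ≡ true
  sat-true R φ {τ} s c = cong notB (trans (look-top R φ)
    (Clean.top (resolveAll-complete {σ = []} (bad-sym R) s (subst (Clean (bad R)) (sym (Listₚ.++-identityʳ τ)) c))))

  sat-sound : ∀ R φ → sat R φ ≡ true → ∃[ τ ] (Sel φ τ × Clean (bad R) τ)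
  sat-sound R φ e with look (table R φ []) [] [] in e′
  ... | false = let τ , s , c = resolveAll-sound φ {[]} (bad-sym R) (clean (trans (sym (look-top R φ)) e′) [] [])
                in τ , s , subst (Clean (bad R)) (Listₚ.++-identityʳ τ) c

-- Correctness on rooted trees

data Rose : Set where
  node : Val → List Rose → Rose

root : Rose → Val
root (node v ts) = v

mutual
  verts : Rose → List Val
  verts (node v ts) = v ∷ vertsF ts

  vertsF : List Rose → List Val
  vertsF []       = []
  vertsF (t ∷ ts) = verts t ++ vertsF ts

Quiet : Req → List Val → Set
Quiet R C = ∀ {x y} → x ∈ C → y ∈ C → ¬ (x , y) ∈ R

-- Sol R t C n: some n edges of t separate all requests inside of t and leave
-- C as the component of the root.

mutual
  data Sol (R : Req) : Rose → List Val → ℕ → Set where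
    sol : ∀ {v ts C n} → SolF R ts C n → Quiet R (v ∷ C) → Sol R (node v ts) (v ∷ C) n

  data SolF (R : Req) : List Rose → List Val → ℕ → Set where
    []   : SolF R [] [] 0
    join : ∀ {t ts C D m n} → Sol R t C m → SolF R ts D n → SolF R (t ∷ ts) (C ++ D) (m + n)
    cut  : ∀ {t ts C D m n} → Sol R t C m → SolF R ts D n → SolF R (t ∷ ts) D (suc (m + n))

sol-root : ∀ {R t C n} → Sol R t C n → root t ∈ C
sol-root (sol _ _) = here refl

sol-quiet : ∀ {R t C n} → Sol R t C n → Quiet R C
sol-quiet (sol _ q) = q

mutual
  sol-verts : ∀ {R t C n} → Sol R t C n → ∀ {x} → x ∈ C → x ∈ verts t
  sol-verts (sol s q) (here e)  = here e
  sol-verts (sol s q) (there i) = there (solF-verts s i)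

  solF-verts : ∀ {R ts C n} → SolF R ts C n → ∀ {x} → x ∈ C → x ∈ vertsF ts
  solF-verts (join {C = C} s ss) i with ∈ₚ.∈-++⁻ C i
  ... | inj₁ j = ∈ₚ.∈-++⁺ˡ (sol-verts s j)
  ... | inj₂ j = ∈ₚ.∈-++⁺ʳ _ (solF-verts ss j)
  solF-verts (cut s ss) i = ∈ₚ.∈-++⁺ʳ _ (solF-verts ss i)

infix 4 _⊑_ _⊆ᵥ_

_⊆ᵥ_ : List Val → List Val → Set
C ⊆ᵥ D = ∀ x → x ∈ C → x ∈ D

_⊑_ : List Val → List Item → Set
C ⊑ σ = ∀ {x} → x ∈ C → Any (x ∈_) σ

-- Options need not be components. It is enough that each of them contains an attainable component
-- and that each attainable component contains one of them, since passing to a smaller piece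
-- preserves compatibility.
record SimpleOk (R : Req) (t : Rose) (m : ℕ) (os : List Item) : Set where
  field
    count : length os ≤ₙ suc m
    few   : m ≤ₙ 2
    sound : All (λ o → ∃[ C ] (Sol R t C m × C ⊆ᵥ o)) os
    cover : ∀ {C} → Sol R t C m → Any (λ o → o ⊆ᵥ C) os

Compatible : Req → List Item → Set
Compatible R = AllPairs (λ c d → bad R c d ≡ false)

record ComplexOk (R : Req) (t : Rose) (m : ℕ) (F : List Family) : Set where
  field
    two≤   : 2 ≤ₙ m
    strong : Strong m (length F)
    sound  : All (λ φ → ∀ {σ} → Sel φ σ → Compatible R σ → ∃[ C ] (Sol R t C m × C ⊑ σ)) F
    cover  : ∀ {C} → Sol R t C m → Any (λ φ → ∃[ σ ] (Sel φ σ × Compatible R σ × All (_⊆ᵥ C) σ)) F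

data Kind (R : Req) (t : Rose) (m : ℕ) : List Item → List Family → Set where
  simple  : ∀ {o os F} → SimpleOk R t m (o ∷ os) → Kind R t m (o ∷ os) F
  complex : ∀ {F} → ComplexOk R t m F → Kind R t m [] F

record Ok (R : Req) (t : Rose) (r : Res) : Set where
  field
    lower    : ∀ {C n} → Sol R t C n → length (size# r) ≤ₙ n
    attained : ∃[ C ] Sol R t C (length (size# r))
    kind     : Kind R t (length (size# r)) (opts r) (fams r)

data Kids (R : Req) : List Rose → List Res → Set where
  []  : Kids R [] []
  _∷_ : ∀ {t r ts rs} → Ok R t r → Kids R ts rs → Kids R (t ∷ ts) (r ∷ rs)

simples : List Res → ℕ
simples = foldr (λ r n → caseL (opts r) n (λ _ _ → suc n)) 0

split-++ : ∀ {A : Set} (os : List A) {L U K} → os ++ L ↭ U ++ K →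
  ∃[ U₁ ] ∃[ U₂ ] ∃[ K₁ ] ∃[ K₂ ] (U ↭ U₁ ++ U₂ × K ↭ K₁ ++ K₂ × os ↭ U₁ ++ K₁ × L ↭ U₂ ++ K₂)
split-++ [] {U = U} {K} p = [] , U , [] , K , ↭-refl , ↭-refl , ↭-refl , p
split-++ (o ∷ os) {U = U} p with split-∷ U p
... | inj₁ (U′ , q , p′) = let U₁ , U₂ , K₁ , K₂ , a , b , c , d = split-++ os p′ in
      o ∷ U₁ , U₂ , K₁ , K₂ , ↭-trans q (prep o a) , b , prep o c , d
... | inj₂ (K′ , q , p′) = let U₁ , U₂ , K₁ , K₂ , a , b , c , d = split-++ os p′ in
      U₁ , U₂ , o ∷ K₁ , K₂ , a , ↭-trans q (prep o b) , ↭-trans (prep o c) (↭-sym (Permₚ.shift o U₁ K₁)) , d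

allPairs-++⁻ : ∀ {A : Set} {P : A → A → Set} xs {ys} → AllPairs P (xs ++ ys) →
               AllPairs P xs × AllPairs P ys × All (λ x → All (P x) ys) xs
allPairs-++⁻ [] p = [] , p , []
allPairs-++⁻ (x ∷ xs) (a ∷ p) = let q , q′ , c = allPairs-++⁻ xs p in
  Allₚ.++⁻ˡ xs a ∷ q , q′ , Allₚ.++⁻ʳ xs a ∷ c

allPairs-++⁺ : ∀ {A : Set} {P : A → A → Set} {xs ys} → AllPairs P xs → AllPairs P ys →
               All (λ x → All (P x) ys) xs → AllPairs P (xs ++ ys)
allPairs-++⁺ [] q c = q
allPairs-++⁺ (a ∷ p) q (c ∷ cs) = Allₚ.++⁺ a c ∷ allPairs-++⁺ p q cs

compatible-↭ : ∀ {R σ τ} → σ ↭ τ → Compatible R σ → Compatible R τ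
compatible-↭ {R} = allPairs-↭ (λ {c} {d} e → trans (bad-sym R d c) e)

⊑-apart : ∀ {R C D} {σ τ : List Item} → All (λ c → All (λ d → bad R c d ≡ false) τ) σ → C ⊑ σ → D ⊑ τ →
          ∀ {x y} → x ∈ C → y ∈ D → Apart R x y
⊑-apart {R} h C⊑ D⊑ i j with All.lookupAny h (C⊑ i)
... | h′ , i′ with All.lookupAny h′ (D⊑ j)
...   | e , j′ = bad-false {R} e i′ j′

quiet-++ : ∀ {R C D} → Quiet R C → Quiet R D → (∀ {x y} → x ∈ C → y ∈ D → Apart R x y) → Quiet R (C ++ D)
quiet-++ {C = C} qC qD a i j with ∈ₚ.∈-++⁻ C i | ∈ₚ.∈-++⁻ C j
... | inj₁ i′ | inj₁ j′ = qC i′ j′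
... | inj₁ i′ | inj₂ j′ = proj₁ (proj₂ (a i′ j′))
... | inj₂ i′ | inj₁ j′ = proj₂ (proj₂ (a j′ i′))
... | inj₂ i′ | inj₂ j′ = qD i′ j′

sel-++ : ∀ φ {ψ σ} → Sel (φ ++ ψ) σ → ∃[ σ₁ ] ∃[ σ₂ ] (σ ≡ σ₁ ++ σ₂ × Sel φ σ₁ × Sel ψ σ₂)
sel-++ [] s = [] , _ , refl , [] , s
sel-++ ((a , b) ∷ φ) (left s)  = let σ₁ , σ₂ , e , s₁ , s₂ = sel-++ φ s in a ∷ σ₁ , σ₂ , cong (a ∷_) e , left s₁ , s₂
sel-++ ((a , b) ∷ φ) (right s) = let σ₁ , σ₂ , e , s₁ , s₂ = sel-++ φ s in b ∷ σ₁ , σ₂ , cong (b ∷_) e , right s₁ , s₂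

sel-++⁺ : ∀ {φ ψ σ τ} → Sel φ σ → Sel ψ τ → Sel (φ ++ ψ) (σ ++ τ)
sel-++⁺ [] t = t
sel-++⁺ (left s)  t = left (sel-++⁺ s t)
sel-++⁺ (right s) t = right (sel-++⁺ s t)

module _ {F : List Family} where

  extend-∷ : ∀ κ K → extend F (κ ∷ K) ≡ decr (proj₁ κ) (λ c → (c , proj₂ κ) ∷ []) ++ (List.map (λ φ → proj₁ κ , φ ++ proj₂ κ) F ++ extend F K)
  extend-∷ κ K = trans (foldr-∷ (decr (proj₁ κ) _) _) (cong (decr (proj₁ κ) _ ++_) (go F))
    where
    go : ∀ F′ → foldr (λ φ a → (proj₁ κ , appB φ (proj₂ κ)) ∷ a) (extend F K) F′ ≡ List.map (λ φ → proj₁ κ , φ ++ proj₂ κ) F′ ++ extend F K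
    go []       = refl
    go (φ ∷ F′) = cong₂ _∷_ (cong (proj₁ κ ,_) (foldr-∷ φ (proj₂ κ))) (go F′)

  extend-∈⁻ : ∀ {c out} K → (c , out) ∈ extend F K →
    ((tt ∷ c , out) ∈ K) ⊎ (∃[ φ ] ∃[ out′ ] (φ ∈ F × (c , out′) ∈ K × out ≡ φ ++ out′))
  extend-∈⁻ ((c₀ , o) ∷ K) i with ∈ₚ.∈-++⁻ (decr c₀ _) (subst (_ ∈_) (extend-∷ (c₀ , o) K) i)
  extend-∈⁻ ((tt ∷ c₀ , o) ∷ K) i | inj₁ (here refl) = inj₁ (here refl)
  extend-∈⁻ ((c₀ , o) ∷ K) i | inj₂ j with ∈ₚ.∈-++⁻ (List.map _ F) j
  ... | inj₁ k with ∈ₚ.∈-map⁻ _ k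
  ...   | φ , l , refl = inj₂ (φ , o , l , here refl , refl)
  extend-∈⁻ ((c₀ , o) ∷ K) i | inj₂ j | inj₂ k with extend-∈⁻ K k
  ... | inj₁ l = inj₁ (there l)
  ... | inj₂ (φ , o′ , l , m , e) = inj₂ (φ , o′ , l , there m , e)

  extend-cut : ∀ {c out K} → (tt ∷ c , out) ∈ K → (c , out) ∈ extend F K
  extend-cut {c} {out} {κ ∷ K} (here refl) = subst ((c , out) ∈_) (sym (extend-∷ κ K)) (here refl)
  extend-cut {K = κ ∷ K} (there i) = subst (_ ∈_) (sym (extend-∷ κ K))
    (∈ₚ.∈-++⁺ʳ (decr (proj₁ κ) _) (∈ₚ.∈-++⁺ʳ (List.map _ F) (extend-cut i)))

  extend-use : ∀ {φ c out K} → φ ∈ F → (c , out) ∈ K → (c , φ ++ out) ∈ extend F K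
  extend-use {K = κ ∷ K} j (here refl) = subst (_ ∈_) (sym (extend-∷ κ K))
    (∈ₚ.∈-++⁺ʳ (decr (proj₁ κ) _) (∈ₚ.∈-++⁺ˡ (∈ₚ.∈-map⁺ _ j)))
  extend-use {K = κ ∷ K} j (there i) = subst (_ ∈_) (sym (extend-∷ κ K))
    (∈ₚ.∈-++⁺ʳ (decr (proj₁ κ) _) (∈ₚ.∈-++⁺ʳ (List.map _ F) (extend-use j i)))

open Ok

budget-length : ∀ d rs → length (budget d rs) + simples rs ≡ length d + length (itemsOf rs)
budget-length d [] = refl
budget-length d ((_ , [] , _) ∷ rs) = budget-length d rs
budget-length d ((_ , o ∷ os , _) ∷ rs) = trans (ℕₚ.+-suc _ (simples rs)) (cong suc
  (trans (cong (_+ simples rs) (go os)) (trans (ℕₚ.+-assoc (length os) _ _) (trans (cong (length os +_) (budget-length d rs))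
    (trans (eq (length os) (length d) (length (itemsOf rs))) (cong (length d +_) (trans (sym (Listₚ.length-++ os)) (cong length (sym (foldr-∷ os (itemsOf rs)))))))))))
  ▸ sym (ℕₚ.+-suc (length d) _)
  where
  infixl 1 _▸_
  _▸_ : ∀ {a b c : ℕ} → a ≡ b → b ≡ c → a ≡ c
  _▸_ = trans
  go : ∀ os → length (foldr (λ _ a → tt ∷ a) (budget d rs) os) ≡ length os + length (budget d rs)
  go []       = refl
  go (_ ∷ os) = cong suc (go os)
  eq : ∀ a b c → a + (b + c) ≡ b + (a + c)
  eq = solve-∀

cross : ∀ {R} σ {τ} → Compatible R (σ ++ τ) → All (λ c → All (λ d → bad R c d ≡ false) τ) σ
cross σ p = proj₂ (proj₂ (allPairs-++⁻ σ p))

-- At most one option of a subtree is alive, as all of them contain its root.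

alive≤1 : ∀ {R t m os U} → SimpleOk R t m os → All (_∈ os) U → Compatible R U → U ≡ [] ⊎ (∃[ o ] (o ∈ os × U ≡ o ∷ []))
alive≤1 {U = []} ok _ _ = inj₁ refl
alive≤1 {U = o ∷ []} ok (i ∷ _) _ = inj₂ (o , i , refl)
alive≤1 {R} {U = o ∷ o′ ∷ U} ok (i ∷ j ∷ _) ((e ∷ _) ∷ _)
  with All.lookup (SimpleOk.sound ok) i | All.lookup (SimpleOk.sound ok) j
... | _ , s , s⊆ | _ , s′ , s′⊆ = ⊥-elim (proj₁ (bad-false {R} e (s⊆ _ (sol-root s)) (s′⊆ _ (sol-root s′))) refl)

-- In `tally` every child with options accounts for one unit, either an alive piece in U or a
-- removed edge above it; the units missing from `c′` are the edges above children with families.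
record Realized (R : Req) (ts : List Rose) (rs : List Res) (c c′ : Num) (out₀ : Family) (σ U : List Item) : Set where
  constructor realized
  field
    {σ₁ σ₀} : List Item
    split   : σ ≡ σ₁ ++ σ₀
    sel₀    : Sel out₀ σ₀
    {C}     : List Val
    {n}     : ℕ
    cuts    : SolF R ts C n
    inside  : C ⊑ σ₁ ++ U
    quiet   : Quiet R C
    tally   : n + length U + length c′ ≡ length (total rs) + length c + simples rs

size-cut : ∀ m n u c M k s → n + u + c ≡ M + k + s → suc (m + n) + u + c ≡ (m + M) + k + suc s
size-cut m n u c M k s e = trans (p m n u c) (trans (cong (λ x → suc (m + x)) e) (q m M k s))
  where
  p : ∀ m n u c → suc (m + n) + u + c ≡ suc (m + (n + u + c))
  p = solve-∀
  q : ∀ m M k s → suc (m + (M + k + s)) ≡ (m + M) + k + suc s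
  q = solve-∀

size-keep : ∀ m n u c M k s → n + u + c ≡ M + k + s → (m + n) + suc u + c ≡ (m + M) + k + suc s
size-keep m n u c M k s e = trans (p m n u c) (trans (cong (λ x → suc (m + x)) e) (q m M k s))
  where
  p : ∀ m n u c → (m + n) + suc u + c ≡ suc (m + (n + u + c))
  p = solve-∀
  q : ∀ m M k s → suc (m + (M + k + s)) ≡ (m + M) + k + suc s
  q = solve-∀

size-close : ∀ m n u c M k s → n + u + suc c ≡ M + k + s → suc (m + n) + u + c ≡ (m + M) + k + s
size-close m n u c M k s e = trans (p m n u c) (trans (cong (m +_) e) (q m M k s))
  where
  p : ∀ m n u c → suc (m + n) + u + c ≡ m + (n + u + suc c)
  p = solve-∀
  q : ∀ m M k s → m + (M + k + s) ≡ (m + M) + k + s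
  q = solve-∀

size-open : ∀ m n u c M k s → n + u + c ≡ M + k + s → (m + n) + u + c ≡ (m + M) + k + s
size-open m n u c M k s e = trans (p m n u c) (trans (cong (m +_) e) (q m M k s))
  where
  p : ∀ m n u c → (m + n) + u + c ≡ m + (n + u + c)
  p = solve-∀
  q : ∀ m M k s → m + (M + k + s) ≡ (m + M) + k + s
  q = solve-∀

total-∷ : ∀ r rs → length (total (r ∷ rs)) ≡ length (size# r) + length (total rs)
total-∷ r rs = trans (cong length (foldr-∷ (size# r) (total rs))) (Listₚ.length-++ (size# r))

⊑-++ : ∀ {C D σ} → C ⊑ σ → D ⊑ σ → C ++ D ⊑ σ
⊑-++ {C} p q i with ∈ₚ.∈-++⁻ C i
... | inj₁ j = p j
... | inj₂ j = q j

abstract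
  -- Induction on the children: an alive option or a selected family supplies a minimum solution of
  -- the child, and the child is cut off otherwise, with any minimum solution inside. The union
  -- stays quiet because components are covered by pairwise compatible pieces.
  realize : ∀ {R ts rs} c {out₀ c′ out σ U K} → Kids R ts rs → (c′ , out) ∈ bases c out₀ rs → Sel out σ →
            itemsOf rs ↭ U ++ K → Compatible R (σ ++ U) → Realized R ts rs c c′ out₀ σ U
  realize c {U = U} [] (here refl) sel p com with U | Permₚ.↭-empty-inv (↭-sym p)
  ... | [] | _ = realized {σ₁ = []} refl sel [] (λ ()) (λ ()) (sym (ℕₚ.+-identityʳ (length c)))
  realize {R} {t ∷ ts} {r@(m , o ∷ os , F) ∷ rs} c {out₀} {c′} {σ = σ} {U} {K} (ok ∷ kids) i sel p com with kind ok
  ... | simple sk with split-++ (o ∷ os) (↭-trans (↭-reflexive (cong (o ∷_) (sym (foldr-∷ os (itemsOf rs))))) p)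
  ...   | U₁ , U₂ , K₁ , K₂ , U≈ , _ , os≈ , L≈ =
          place (alive≤1 sk (All.tabulate (λ j → Permₚ.∈-resp-↭ (↭-sym os≈) (∈ₚ.∈-++⁺ˡ j))) (proj₁ (allPairs-++⁻ U₁ com′))) com′
    where
    com′ : Compatible R (U₁ ++ (σ ++ U₂))
    com′ = compatible-↭ {R} (↭-trans (Permₚ.++⁺ˡ σ U≈) (Permₚ.shifts σ U₁)) com
    into : ∀ {x} σ₁ → Any (x ∈_) (σ₁ ++ U₂) → Any (x ∈_) (σ₁ ++ U)
    into σ₁ a with Anyₚ.++⁻ σ₁ a
    ... | inj₁ b = Anyₚ.++⁺ˡ b
    ... | inj₂ b = Anyₚ.++⁺ʳ σ₁ (Permₚ.Any-resp-↭ (↭-sym U≈) (Anyₚ.++⁺ʳ U₁ b))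
    place : U₁ ≡ [] ⊎ (∃[ o′ ] (o′ ∈ o ∷ os × U₁ ≡ o′ ∷ [])) → Compatible R (U₁ ++ (σ ++ U₂)) →
            Realized R (t ∷ ts) (r ∷ rs) c c′ out₀ σ U
    place (inj₁ refl) com″ with realize c kids i sel L≈ com″
    ... | realized {σ₁} {σ₀} e s₀ {C} {n} cuts inside quiet tally = realized e s₀ (cut (proj₂ (attained ok)) cuts)
          (λ j → into σ₁ (inside j)) quiet
          (trans (cong (λ u → suc (length m + n) + u + length c′) (Permₚ.↭-length U≈))
            (trans (size-cut (length m) n (length U₂) (length c′) (length (total rs)) (length c) (simples rs) tally)
              (cong (λ M → M + length c + suc (simples rs)) (sym (total-∷ r rs)))))
    place (inj₂ (o′ , j , refl)) com″@(x ∷ com‴) with realize c kids i sel L≈ com‴ | All.lookup (SimpleOk.sound sk) j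
    ... | realized {σ₁} {σ₀} refl s₀ {C} {n} cuts inside quiet tally | Cₜ , sₜ , Cₜ⊆ = realized refl s₀ (join sₜ cuts)
          (⊑-++ (λ k → Anyₚ.++⁺ʳ σ₁ (Permₚ.Any-resp-↭ (↭-sym U≈) (here (Cₜ⊆ _ k)))) (λ k → into σ₁ (inside k)))
          (quiet-++ (sol-quiet sₜ) quiet (⊑-apart {R} {σ = o′ ∷ []} {σ₁ ++ U₂} (Allₚ.++⁺ (Allₚ.++⁻ˡ σ₁ (Allₚ.++⁻ˡ (σ₁ ++ σ₀) x)) (Allₚ.++⁻ʳ (σ₁ ++ σ₀) x) ∷ [])
             (λ k → here (Cₜ⊆ _ k)) inside))
          (trans (cong (λ u → length m + n + u + length c′) (Permₚ.↭-length U≈))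
            (trans (size-keep (length m) n (length U₂) (length c′) (length (total rs)) (length c) (simples rs) tally)
              (cong (λ M → M + length c + suc (simples rs)) (sym (total-∷ r rs)))))
  realize {R} {t ∷ ts} {r@(m , [] , F) ∷ rs} c {out₀} {c′} {out} {σ} {U} (ok ∷ kids) i sel p com with kind ok
  ... | complex ck with extend-∈⁻ (bases c out₀ rs) i
  ...   | inj₁ j with realize c kids j sel p com
  ...     | realized {σ₁} {σ₀} e s₀ {C} {n} cuts inside quiet tally = realized e s₀ (cut (proj₂ (attained ok)) cuts) inside quiet
            (trans (size-close (length m) n (length U) (length c′) (length (total rs)) (length c) (simples rs) tally)
              (cong (λ M → M + length c + simples rs) (sym (total-∷ r rs))))
  realize {R} {t ∷ ts} {r@(m , [] , F) ∷ rs} c {out₀} {c′} {out} {σ} {U} (ok ∷ kids) i sel p com | complex ck | inj₂ (φ , out′ , j , k , refl)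
    with sel-++ φ sel
  ... | σφ , σ′ , refl , sφ , s′ with realize c kids k s′ p (proj₁ (proj₂ (allPairs-++⁻ σφ com′)))
          | All.lookup (ComplexOk.sound ck) j sφ (proj₁ (allPairs-++⁻ σφ com′))
    where
    com′ : Compatible R (σφ ++ (σ′ ++ U))
    com′ = subst (Compatible R) (Listₚ.++-assoc σφ σ′ U) com
  ...   | realized {σ₁} {σ₀} refl s₀ {C} {n} cuts inside quiet tally | Cₜ , sₜ , Cₜ⊑ =
          realized (sym (Listₚ.++-assoc σφ σ₁ σ₀)) s₀ (join sₜ cuts)
            (λ {x} k → subst (Any (x ∈_)) (sym (Listₚ.++-assoc σφ σ₁ U))
               (⊑-++ {σ = σφ ++ (σ₁ ++ U)} (λ l → Anyₚ.++⁺ˡ (Cₜ⊑ l)) (λ l → Anyₚ.++⁺ʳ σφ (inside l)) k))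
            (quiet-++ (sol-quiet sₜ) quiet (⊑-apart {R} {σ = σφ} {σ₁ ++ U} (All.map (λ a → Allₚ.++⁺ (Allₚ.++⁻ˡ σ₁ (Allₚ.++⁻ˡ (σ₁ ++ σ₀) a)) (Allₚ.++⁻ʳ (σ₁ ++ σ₀) a))
                 (cross {R} σφ (subst (Compatible R) (Listₚ.++-assoc σφ (σ₁ ++ σ₀) U) com))) Cₜ⊑ inside))
            (trans (size-open (length m) n (length U) (length c′) (length (total rs)) (length c) (simples rs) tally)
              (cong (λ M → M + length c + simples rs) (sym (total-∷ r rs))))

-- What the exchange argument makes of an arbitrary solution: `b` children with families are cut
-- off, U holds the alive options, and the pieces lie inside of the original component. The tally is
-- an inequality, as the exchange may save edges.
record Normal (R : Req) (ts : List Rose) (rs : List Res) (D : List Val) (n : ℕ) : Set where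
  constructor normal
  field
    b       : ℕ
    {out₁}  : Family
    {σ₁ U K} : List Item
    based   : ∀ c c′ out₀ → length c ≡ b + length c′ → (c′ , out₁ ++ out₀) ∈ bases c out₀ rs
    sel₁    : Sel out₁ σ₁
    split   : itemsOf rs ↭ U ++ K
    compat  : Compatible R (σ₁ ++ U)
    inside  : All (_⊆ᵥ D) (σ₁ ++ U)
    tally   : length (total rs) + b + simples rs ≤ₙ n + length U
    fits    : length U ≤ₙ simples rs

num-≡ : ∀ {c c′ : Num} → length c ≡ length c′ → c ≡ c′
num-≡ {[]} {[]} _ = refl
num-≡ {tt ∷ c} {tt ∷ c′} e = cong (tt ∷_) (num-≡ (ℕₚ.suc-injective e))

across : ∀ {R C D σ τ} → Quiet R (C ++ D) → (∀ {x y} → x ∈ C → y ∈ D → x ≢ y) → All (_⊆ᵥ C) σ → All (_⊆ᵥ D) τ →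
         All (λ c → All (λ d → bad R c d ≡ false) τ) σ
across {R} {C} {D} q ne hσ hτ = All.map (λ {c} c⊆ → All.map (λ {d} d⊆ → bad-false⁺ {R} c d (λ i j →
  ne (c⊆ _ i) (d⊆ _ j) , q (∈ₚ.∈-++⁺ˡ (c⊆ _ i)) (∈ₚ.∈-++⁺ʳ C (d⊆ _ j)) , q (∈ₚ.∈-++⁺ʳ C (d⊆ _ j)) (∈ₚ.∈-++⁺ˡ (c⊆ _ i)))) hτ) hσ

disjoint : ∀ (xs : List Val) {ys} → Unique (xs ++ ys) → ∀ {x y} → x ∈ xs → y ∈ ys → x ≢ y
disjoint xs u i j = All.lookup (All.lookup (proj₂ (proj₂ (allPairs-++⁻ xs u))) i) j

grow : ∀ {C D : List Val} {σ : List Item} → (∀ {x} → x ∈ C → x ∈ D) → All (_⊆ᵥ C) σ → All (_⊆ᵥ D) σ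
grow h = All.map (λ c⊆ x i → h (c⊆ x i))

tally-cut : ∀ {m M b s n u} → M + b + s ≤ₙ n + u → m + M + b + suc s ≤ₙ suc (m + n) + u
tally-cut {m} {M} {b} {s} {n} {u} h = ℕₚ.≤-trans (ℕₚ.≤-reflexive (p m M b s)) (ℕₚ.≤-trans (ℕₚ.+-monoʳ-≤ (suc m) h) (ℕₚ.≤-reflexive (sym (ℕₚ.+-assoc (suc m) n u))))
  where
  p : ∀ m M b s → m + M + b + suc s ≡ suc m + (M + b + s)
  p = solve-∀

tally-keep : ∀ {m M b s n u} → M + b + s ≤ₙ n + u → m + M + b + suc s ≤ₙ m + n + suc u
tally-keep {m} {M} {b} {s} {n} {u} h = ℕₚ.≤-trans (tally-cut {m} h) (ℕₚ.≤-reflexive (sym (ℕₚ.+-suc (m + n) u)))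

tally-close : ∀ {m M b s n u} → M + b + s ≤ₙ n + u → m + M + suc b + s ≤ₙ suc (m + n) + u
tally-close {m} {M} {b} {s} {n} {u} h = ℕₚ.≤-trans (ℕₚ.≤-reflexive (p m M b s)) (tally-cut {m} h)
  where
  p : ∀ m M b s → m + M + suc b + s ≡ m + M + b + suc s
  p = solve-∀

tally-open : ∀ {m M b s n u} → M + b + s ≤ₙ n + u → m + M + b + s ≤ₙ m + n + u
tally-open {m} {M} {b} {s} {n} {u} h = ℕₚ.≤-trans (ℕₚ.≤-reflexive (p m M b s)) (ℕₚ.≤-trans (ℕₚ.+-monoʳ-≤ m h) (ℕₚ.≤-reflexive (sym (ℕₚ.+-assoc m n u))))
  where
  p : ∀ m M b s → m + M + b + s ≡ m + (M + b + s)
  p = solve-∀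

remove : ∀ {os : List Item} {P : Item → Set} → Any P os → ∃[ o ] ∃[ K ] (P o × os ↭ o ∷ K)
remove {o ∷ os} (here p) = o , os , p , ↭-refl
remove {x ∷ os} (there a) = let o , K , p , q = remove a in o , x ∷ K , p , ↭-trans (prep x q) (_↭_.swap x o ↭-refl)

-- The number of edges suffices for a minimum solution of the child together with the edge above it.
-- It covers a child that is cut off already as well as one that uses more than its minimum.
cut-off : ∀ {R t r ts rs D n n′} → Ok R t r → Normal R ts rs D n → suc (length (size# r) + n) ≤ₙ n′ → Normal R (t ∷ ts) (r ∷ rs) D n′
cut-off {r = r@(m , os , F)} {rs = rs} ok (normal b {out₁} {σ₁} {U} {K} based sel split compat inside tally fits) le with os | kind ok
... | o ∷ os | simple sk = normal b {K = (o ∷ os) ++ K} based sel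
      (↭-trans (↭-reflexive (foldr-∷ (o ∷ os) (itemsOf rs))) (↭-trans (Permₚ.++⁺ˡ (o ∷ os) split) (Permₚ.shifts (o ∷ os) U)))
      compat inside
      (ℕₚ.≤-trans (ℕₚ.≤-reflexive (cong (λ M → M + b + suc (simples rs)) (total-∷ r rs)))
        (ℕₚ.≤-trans (tally-cut {length m} tally) (ℕₚ.+-monoˡ-≤ (length U) le)))
      (ℕₚ.m≤n⇒m≤1+n fits)
... | [] | complex ck = normal (suc b) (λ c c′ out₀ e → extend-cut {F} (based c (tt ∷ c′) out₀ (trans e (sym (ℕₚ.+-suc b (length c′))))))
      sel split compat inside
      (ℕₚ.≤-trans (ℕₚ.≤-reflexive (cong (λ M → M + suc b + simples rs) (total-∷ r rs)))
        (ℕₚ.≤-trans (tally-close {length m} tally) (ℕₚ.+-monoˡ-≤ (length U) le)))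
      fits

normal-⊆ : ∀ {R ts rs D D′ n} → (∀ {x} → x ∈ D → x ∈ D′) → Normal R ts rs D n → Normal R ts rs D′ n
normal-⊆ h (normal b based sel split compat inside tally fits) = normal b based sel split compat (grow h inside) tally fits

abstract
  -- A joined child that uses more than its minimum pays for being cut off, which only shrinks the
  -- component. At the minimum, `cover` replaces its component by pieces inside it, and these are
  -- compatible with the rest because the subtrees are disjoint and the component is quiet.
  normalize : ∀ {R ts rs D n} → Kids R ts rs → SolF R ts D n → Unique (vertsF ts) → Quiet R D → Normal R ts rs D n
  normalize [] [] u q = normal 0 {U = []} {[]} (λ c c′ out₀ e → here (cong (_, out₀) (sym (num-≡ e)))) [] ↭-refl [] [] z≤n z≤n
  normalize {ts = t ∷ ts} {r ∷ rs} (ok ∷ kids) (cut {m = m} {n} s ss) u q =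
    cut-off ok (normalize kids ss (proj₁ (proj₂ (allPairs-++⁻ (verts t) u))) q) (s≤s (ℕₚ.+-monoˡ-≤ n (lower ok s)))
  normalize {R} {t ∷ ts} {r@(m₀ , os , F) ∷ rs} (ok ∷ kids) (join {C = C} {D} {m} {n} s ss) u q
    with normalize kids ss (proj₁ (proj₂ (allPairs-++⁻ (verts t) u))) (λ i j → q (∈ₚ.∈-++⁺ʳ C i) (∈ₚ.∈-++⁺ʳ C j))
       | ℕₚ.m≤n⇒m<n∨m≡n (lower ok s)
  ... | rest | inj₁ lt = normal-⊆ (∈ₚ.∈-++⁺ʳ C) (cut-off ok rest (ℕₚ.+-monoˡ-≤ n lt))
  ... | normal b {out₁} {σ₁} {U} {K} based sel split compat inside tally fits | inj₂ refl with os | kind ok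
  ...   | o ∷ os | simple sk with remove (SimpleOk.cover sk s)
  ...     | o′ , K′ , o′⊆ , os≈ = normal b {K = K′ ++ K} based sel
            (↭-trans (↭-reflexive (foldr-∷ (o ∷ os) (itemsOf rs)))
              (↭-trans (Permₚ.++⁺ os≈ split) (prep o′ (Permₚ.shifts K′ U))))
            (compatible-↭ {R} (↭-sym (Permₚ.shift o′ σ₁ U))
              (All.head (across {σ = o′ ∷ []} q ne (o′⊆ ∷ []) inside) ∷ compat))
            (Allₚ.++⁺ (grow (∈ₚ.∈-++⁺ʳ C) (Allₚ.++⁻ˡ σ₁ inside)) ((λ x i → ∈ₚ.∈-++⁺ˡ (o′⊆ x i)) ∷ grow (∈ₚ.∈-++⁺ʳ C) (Allₚ.++⁻ʳ σ₁ inside)))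
            (ℕₚ.≤-trans (ℕₚ.≤-reflexive (cong (λ M → M + b + suc (simples rs)) (total-∷ r rs))) (tally-keep {length m₀} tally))
            (s≤s fits)
          where
          ne : ∀ {x y} → x ∈ C → y ∈ D → x ≢ y
          ne i j = disjoint (verts t) u (sol-verts s i) (solF-verts ss j)
  normalize {R} {t ∷ ts} {r@(m₀ , os , F) ∷ rs} (ok ∷ kids) (join {C = C} {D} {m} {n} s ss) u q
    | normal b {out₁} {σ₁} {U} {K} based sel split compat inside tally fits | inj₂ refl | [] | complex ck with find (ComplexOk.cover ck s)
  ... | φ , φ∈ , σφ , sφ , cφ , inφ = normal b {φ ++ out₁} {σφ ++ σ₁}
            (λ c c′ out₀ e → subst (λ o → (c′ , o) ∈ bases c out₀ ((m₀ , [] , F) ∷ rs)) (sym (Listₚ.++-assoc φ out₁ out₀)) (extend-use φ∈ (based c c′ out₀ e)))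
            (sel-++⁺ sφ sel) split
            (subst (Compatible R) (sym (Listₚ.++-assoc σφ σ₁ U)) (allPairs-++⁺ cφ compat (across q ne inφ inside)))
            (subst (All (_⊆ᵥ (C ++ D))) (sym (Listₚ.++-assoc σφ σ₁ U)) (Allₚ.++⁺ (grow ∈ₚ.∈-++⁺ˡ inφ) (grow (∈ₚ.∈-++⁺ʳ C) inside)))
            (ℕₚ.≤-trans (ℕₚ.≤-reflexive (cong (λ M → M + b + simples rs) (total-∷ r rs))) (tally-open {length m₀} tally))
            fits
          where
          ne : ∀ {x y} → x ∈ C → y ∈ D → x ≢ y
          ne i j = disjoint (verts t) u (sol-verts s i) (solF-verts ss j)

final-∈ : ∀ R todo out c {φ} → φ ∈ final R (todo , out , c) → todo ≡ [] × c ≡ [] × sat R out ≡ true × φ ≡ out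
final-∈ R [] out [] i with sat R out in e
final-∈ R [] out [] (here refl) | true = refl , refl , refl , refl
final-∈ R [] out (x ∷ c) ()
final-∈ R (x ∷ todo) out c ()

final-done : ∀ R out → sat R out ≡ true → out ∈ final R ([] , out , [])
final-done R out e rewrite e = here refl

abstract
  searchT-∈⁻ : ∀ R l κ t {φ} → φ ∈ searchT R l κ t →
               ([] , φ , []) ∈ search (look t) (l , proj₂ κ , proj₁ κ) × sat R φ ≡ true
  searchT-∈⁻ R l κ t i with concatMapB-∈⁻ {f = final R} (search (look t) (l , proj₂ κ , proj₁ κ)) (subst (_ ∈_) (searchT-def R l κ t) i)
  ... | (todo , out , c) , j , k with final-∈ R todo out c k
  ...   | refl , refl , e , refl = j , e

  searchT-∈ : ∀ R l κ t {φ} → ([] , φ , []) ∈ search (look t) (l , proj₂ κ , proj₁ κ) → sat R φ ≡ true → φ ∈ searchT R l κ t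
  searchT-∈ R l κ t j e = subst (_ ∈_) (sym (searchT-def R l κ t)) (concatMapB-∈ {f = final R} j (final-done R _ e))

  gen-∈⁻ : ∀ R v rs d {φ} → φ ∈ gen R v rs d → ∃[ c ] ∃[ out ] ((c , out) ∈ bases (budget d rs) ((v ∷ [] , v ∷ []) ∷ []) rs
           × φ ∈ searchFrom R (itemsOf rs) (c , out))
  gen-∈⁻ R v rs d i = let κ , j , k = concatMapB-∈⁻ {f = searchFrom R (itemsOf rs)} (bases (budget d rs) ((v ∷ [] , v ∷ []) ∷ []) rs) (subst (_ ∈_) (gen-def R v rs d) i)
                      in proj₁ κ , proj₂ κ , j , k

  gen-sat : ∀ R v rs d {φ} → φ ∈ gen R v rs d → sat R φ ≡ true
  gen-sat R v rs d i = let c , out , j , k = gen-∈⁻ R v rs d i in proj₂ (searchT-∈⁻ R (itemsOf rs) (c , out) (table R out (itemsOf rs)) k)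

module Node (R : Req) (v : Val) (ts : List Rose) (rs : List Res) (kids : Kids R ts rs)
            (uniq : Unique (v ∷ vertsF ts)) (irr : ¬ (v , v) ∈ R) where

  M S N : ℕ
  M = length (total rs)
  S = simples rs
  N = length (itemsOf rs)

  out₀ : Family
  out₀ = (v ∷ [] , v ∷ []) ∷ []

  sel-out₀ : ∀ {σ} → Sel out₀ σ → σ ≡ (v ∷ []) ∷ []
  sel-out₀ (left [])  = refl
  sel-out₀ (right []) = refl

  abstract
    top-realize : ∀ d {c out τ U K} → (c , out) ∈ bases (budget d rs) out₀ rs → Sel out τ → itemsOf rs ↭ U ++ K →
      Compatible R (τ ++ U) → ∃[ C ] ∃[ n ] (Sol R (node v ts) C n × C ⊑ τ ++ U × n + length U + length c ≡ M + (length d + N))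
    top-realize d {c} {out} {τ} {U} i sel p com with realize (budget d rs) kids i sel p com
    ... | realized {σ₁} {σ₀} refl s₀ {C} {n} cuts inside quiet tally with sel-out₀ s₀
    ...   | refl = v ∷ C , n , sol cuts (quiet-++ {C = v ∷ []} q₀ quiet apart) , ins ,
            trans tally (trans (ℕₚ.+-assoc M _ S) (cong (M +_) (budget-length d rs)))
      where
      com′ : Compatible R (σ₁ ++ ((v ∷ []) ∷ U))
      com′ = subst (Compatible R) (Listₚ.++-assoc σ₁ ((v ∷ []) ∷ []) U) com
      com″ : Compatible R ((v ∷ []) ∷ (σ₁ ++ U))
      com″ = compatible-↭ {R} (Permₚ.shift (v ∷ []) σ₁ U) com′
      q₀ : Quiet R (v ∷ [])
      q₀ (here refl) (here refl) = irr
      apart : ∀ {x y} → x ∈ v ∷ [] → y ∈ C → Apart R x y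
      apart = ⊑-apart {R} {σ = (v ∷ []) ∷ []} {σ₁ ++ U} (AllPairs.head com″ ∷ []) here inside
      ins : v ∷ C ⊑ (σ₁ ++ (v ∷ []) ∷ []) ++ U
      ins {x} j = subst (Any (x ∈_)) (sym (Listₚ.++-assoc σ₁ _ U)) (Permₚ.Any-resp-↭ (↭-sym (Permₚ.shift (v ∷ []) σ₁ U)) (go j))
        where
        go : x ∈ v ∷ C → Any (x ∈_) ((v ∷ []) ∷ (σ₁ ++ U))
        go (here e)  = here (here e)
        go (there k) = there (inside k)

  us : Family → List Item
  us out = universe out (itemsOf rs)

  tab : Family → List (Item × Item)
  tab out = table R out (itemsOf rs)

  tab-sym : ∀ out → Symm (look (tab out))
  tab-sym out = look-sym R (us out) (here refl) (within-universe out (itemsOf rs))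

  abstract
    gen-sound : ∀ d {φ σ} → φ ∈ gen R v rs d → Sel φ σ → Compatible R σ →
                ∃[ C ] (Sol R (node v ts) C (M + length d) × C ⊑ σ)
    gen-sound d {φ} {σ} i sel com with gen-∈⁻ R v rs d i
    ... | c , out , j , k with searchT-∈⁻ R (itemsOf rs) (c , out) (tab out) k
    ...   | l , _ with pull (All.lookup (Rounds.search-sound (look (tab out)) (tab-sym out) (itemsOf rs , out , c)) l) sel ↭-refl
    ...     | τ , U , K , sel′ , split , perm , len with top-realize d j sel′ split
                (compatible-↭ {R} (↭-trans (↭-reflexive (sym (Listₚ.++-identityʳ σ))) (↭-sym perm)) com)
    ...       | C , n , s , ins , tally = C , subst (Sol R (node v ts) C) n≡ s ,
                (λ {x} m → subst (Any (x ∈_)) (Listₚ.++-identityʳ σ) (Permₚ.Any-resp-↭ perm (ins m)))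
      where
      N≡ : N ≡ length U + length c
      N≡ = trans (Permₚ.↭-length split) (trans (Listₚ.length-++ U) (cong (length U +_) (trans (sym (ℕₚ.+-identityʳ _)) len)))
      n≡ : n ≡ M + length d
      n≡ = ℕₚ.+-cancelʳ-≡ N n (M + length d) (trans (trans (cong (n +_) N≡) (sym (ℕₚ.+-assoc n _ _))) (trans tally (sym (ℕₚ.+-assoc M _ N))))

  ind⇒clean : ∀ {r U} → r [] [] ≡ false → All (λ x → r x [] ≡ false) U × AllPairs (λ x y → r x y ≡ false) U → Clean r U
  ind⇒clean t (u , p) = clean t u p

  abstract
    -- The normal form of the solution determines a base and an independent set of options. The
    -- search is complete only for minimum sets of cuts, so both the exact budget and minimality are
    -- derived from the minimality of `d`.
    gen-cover : ∀ d {C} → (∀ {C n} → Sol R (node v ts) C n → M + length d ≤ₙ n) → Sol R (node v ts) C (M + length d) →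
                Any (λ φ → ∃[ σ ] (Sel φ σ × Compatible R σ × All (_⊆ᵥ C) σ)) (gen R v rs d)
    gen-cover d {C} lb s@(sol {C = D} ss q) with normalize kids ss (AllPairs.tail uniq) (λ i j → q (there i) (there j))
    ... | normal b {out₁} {σ₁} {U} {K} based sel split compat inside tally fits = goal (find (Rounds.search-complete (look (tab out)) (tab-sym out) has-κ))
      where
      c₀ : ℕ
      c₀ = length (budget d rs)
      c₀≡ : c₀ + S ≡ length d + N
      c₀≡ = budget-length d rs
      N≡ : N ≡ length U + length K
      N≡ = trans (Permₚ.↭-length split) (Listₚ.length-++ U)
      bS≤ : b + S ≤ₙ length d + length U
      bS≤ = ℕₚ.+-cancelˡ-≤ M _ _ (ℕₚ.≤-trans (ℕₚ.≤-reflexive (sym (ℕₚ.+-assoc M b S))) (ℕₚ.≤-trans tally (ℕₚ.≤-reflexive (ℕₚ.+-assoc M _ _))))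
      b≤ : b ≤ₙ c₀
      b≤ = ℕₚ.+-cancelʳ-≤ S _ _ (ℕₚ.≤-trans bS≤ (ℕₚ.≤-trans (ℕₚ.+-monoʳ-≤ (length d) (ℕₚ.≤-trans (ℕₚ.m≤m+n _ (length K)) (ℕₚ.≤-reflexive (sym N≡)))) (ℕₚ.≤-reflexive (sym c₀≡))))
      c : Num
      c = List.replicate (c₀ ∸ b) tt
      c₀≡b+c : c₀ ≡ b + length c
      c₀≡b+c = trans (sym (ℕₚ.m+[n∸m]≡n b≤)) (cong (b +_) (sym (Listₚ.length-replicate (c₀ ∸ b))))
      out : Family
      out = out₁ ++ out₀
      base∈ : (c , out) ∈ bases (budget d rs) out₀ rs
      base∈ = based (budget d rs) c out₀ c₀≡b+c
      τ : List Item
      τ = σ₁ ++ (v ∷ []) ∷ []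
      selτ : Sel out τ
      selτ = sel-++⁺ sel (left [])
      τU≈ : (v ∷ []) ∷ (σ₁ ++ U) ↭ τ ++ U
      τU≈ = ↭-trans (↭-sym (Permₚ.shift (v ∷ []) σ₁ U)) (↭-reflexive (sym (Listₚ.++-assoc σ₁ _ U)))
      v# : ∀ {x y} → x ∈ v ∷ [] → y ∈ D → x ≢ y
      v# (here refl) j refl = All.lookup (AllPairs.head uniq) (solF-verts ss j) refl
      comτ : Compatible R (τ ++ U)
      comτ = compatible-↭ {R} τU≈ (All.head (across {R} {C = v ∷ []} {σ = (v ∷ []) ∷ []} q v# ((λ _ i → i) ∷ []) inside) ∷ compat)
      inτ : All (_⊆ᵥ (v ∷ D)) (τ ++ U)
      inτ = Permₚ.All-resp-↭ τU≈ ((λ { _ (here e) → here e }) ∷ grow there inside)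
      clean-U : Clean (resolveAll (bad R) out) U
      clean-U = resolveAll-complete (bad-sym R) selτ (clean⁺ {R} comτ)
      U⊆ : ∀ {U K} → itemsOf rs ↭ U ++ K → All (_∈ us out) U
      U⊆ p = All.tabulate (λ i → items-universe out (itemsOf rs) (Permₚ.∈-resp-↭ (↭-sym p) (∈ₚ.∈-++⁺ˡ i)))
      within : Within (us out) out
      within = within-universe out (itemsOf rs)
      clean-look : Clean (look (tab out)) U
      clean-look = look-clean R (us out) (here refl) within (U⊆ split) clean-U
      -- The normal form is turned back into a solution. It uses no more edges than the given one,
      -- hence exactly as many by minimality, and all inequalities become equalities.
      exact : length K ≡ length c
      exact with top-realize d base∈ selτ split comτ
      ... | C₂ , n₂ , s₂ , _ , tally₂ = ℕₚ.+-cancelˡ-≡ (b + S) _ _ (ℕₚ.+-cancelˡ-≡ M _ _ (trans (cong (M +_) (cong (_+ length K) (sym Ud≡)))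
              (trans (e₁ M (length U) (length d) (length K)) (trans (cong (λ x → M + (length d + x)) (sym N≡))
                (trans (cong (M +_) (trans (sym c₀≡) (cong (_+ S) c₀≡b+c))) (e₂ M b (length c) S))))))
        where
        e₁ : ∀ M U d K → M + (U + d + K) ≡ M + (d + (U + K))
        e₁ = solve-∀
        e₂ : ∀ M b c S → M + (b + c + S) ≡ M + (b + S + c)
        e₂ = solve-∀
        e₃ : ∀ n U c → n + U + c ≡ c + (n + U)
        e₃ = solve-∀
        e₄ : ∀ M b c S → M + (b + c + S) ≡ c + (M + b + S)
        e₄ = solve-∀
        n₂U : n₂ + length U ≡ M + b + S
        n₂U = ℕₚ.+-cancelˡ-≡ (length c) _ _ (trans (sym (e₃ n₂ (length U) (length c))) (trans tally₂
                (trans (cong (M +_) (trans (sym c₀≡) (cong (_+ S) c₀≡b+c))) (e₄ M b (length c) S))))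
        n₂≡ : n₂ ≡ M + length d
        n₂≡ = ℕₚ.≤-antisym (ℕₚ.+-cancelʳ-≤ (length U) _ _ (ℕₚ.≤-trans (ℕₚ.≤-reflexive n₂U) tally)) (lb s₂)
        Ud≡ : length U + length d ≡ b + S
        Ud≡ = ℕₚ.+-cancelˡ-≡ M _ _ (trans (e₅ M (length U) (length d)) (trans (cong (_+ length U) (sym n₂≡)) (trans n₂U (ℕₚ.+-assoc M b S))))
          where
          e₅ : ∀ M U d → M + (U + d) ≡ M + d + U
          e₅ = solve-∀
      -- An independent set in the resolved graph extends to a selection of the base family, thus to
      -- a solution, whose number of edges is bounded below by `lb`.
      min-cut : Search.MinCut (look (tab out)) (tab-sym out) (itemsOf rs) (length c)
      min-cut U₂ K₂ p₂ i₂ with resolveAll-sound out (bad-sym R)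
          (look-clean⁻ R (us out) (here refl) within (U⊆ p₂) (ind⇒clean (Clean.top clean-look) i₂))
      ... | τ₂ , sel₂ , c₂ with top-realize d base∈ sel₂ p₂ (Clean.pairs c₂)
      ...   | C₃ , n₃ , s₃ , _ , tally₃ = ℕₚ.+-cancelˡ-≤ (M + length d + length U₂) _ _ (ℕₚ.≤-trans
                (ℕₚ.+-monoˡ-≤ (length c) (ℕₚ.+-monoˡ-≤ (length U₂) (lb s₃)))
                (ℕₚ.≤-reflexive (trans tally₃ (trans (cong (λ x → M + (length d + x)) (trans (Permₚ.↭-length p₂) (Listₚ.length-++ U₂)))
                   (e₆ M (length d) (length U₂) (length K₂))))))
        where
        e₆ : ∀ M d U K → M + (d + (U + K)) ≡ M + d + U + K
        e₆ = solve-∀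
      has-κ : Search.Has (look (tab out)) (tab-sym out) (itemsOf rs , out , c) (τ ++ U)
      has-κ = Search.has selτ split (Clean.units clean-look , Clean.pairs clean-look) exact min-cut ↭-refl
      goal : ∃[ κ ] (κ ∈ search (look (tab out)) (itemsOf rs , out , c) × Rounds.Done (look (tab out)) (tab-sym out) (τ ++ U) κ) →
             Any (λ φ → ∃[ σ ] (Sel φ σ × Compatible R σ × All (_⊆ᵥ (v ∷ D)) σ)) (gen R v rs d)
      goal ((todo , φ , c′) , κ∈ , refl , refl , τ′ , sel′ , perm) = lose
        (subst (φ ∈_) (sym (gen-def R v rs d)) (concatMapB-∈ {f = searchFrom R (itemsOf rs)} base∈ (searchT-∈ R (itemsOf rs) (c , out) (tab out) κ∈
           (sat-true R φ sel′ (clean⁺ {R} com′)))))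
        (τ′ , sel′ , com′ , Permₚ.All-resp-↭ (↭-sym perm) inτ)
        where
        com′ : Compatible R τ′
        com′ = compatible-↭ {R} (↭-sym perm) comτ

-- Counting the families at a node

sumOver : (ℕ → ℕ) → List (Num × Family) → ℕ
sumOver g []      = 0
sumOver g (κ ∷ K) = g (length (proj₁ κ)) + sumOver g K

-- The effect of a child with `k` families on a bound that depends on the budget: one of its
-- families, or being cut off with one unit less.
lift : ℕ → (ℕ → ℕ) → ℕ → ℕ
lift k g zero    = k * g 0
lift k g (suc n) = k * g (suc n) + g n

sumOver-++ : ∀ g K K′ → sumOver g (K ++ K′) ≡ sumOver g K + sumOver g K′
sumOver-++ g []      K′ = refl
sumOver-++ g (κ ∷ K) K′ = trans (cong (g (length (proj₁ κ)) +_) (sumOver-++ g K K′)) (sym (ℕₚ.+-assoc (g (length (proj₁ κ))) _ _))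

sumOver-extend : ∀ g F K → sumOver g (extend F K) ≡ sumOver (lift (length F) g) K
sumOver-extend g F [] = refl
sumOver-extend g F (κ ∷ K) = trans (cong (sumOver g) (extend-∷ {F} κ K)) (trans (sumOver-++ g (decr (proj₁ κ) shut) (List.map keep F ++ extend F K))
  (trans (cong (sumOver g (decr (proj₁ κ) shut) +_) (trans (sumOver-++ g (List.map keep F) (extend F K)) (cong₂ _+_ (same (proj₁ κ) F) (sumOver-extend g F K))))
    (go (proj₁ κ))))
  where
  shut : Num → List (Num × Family)
  shut c = (c , proj₂ κ) ∷ []
  keep : Family → Num × Family
  keep φ = proj₁ κ , φ ++ proj₂ κ
  same : ∀ c F′ → sumOver g (List.map (λ φ → c , φ ++ proj₂ κ) F′) ≡ length F′ * g (length c)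
  same c []       = refl
  same c (φ ∷ F′) = cong (g (length c) +_) (same c F′)
  go : ∀ c {s} → sumOver g (decr c shut) + (length F * g (length c) + s) ≡ lift (length F) g (length c) + s
  go [] = refl
  go (tt ∷ c) {s} = eq (g (length c)) (length F * g (suc (length c))) s
    where
    eq : ∀ a b s → a + 0 + (b + s) ≡ b + a + s
    eq = solve-∀

complexes : List Res → ℕ
complexes = foldr (λ r n → caseL (opts r) (length (size# r) + n) (λ _ _ → n)) 0

transform : List Res → (ℕ → ℕ) → ℕ → ℕ
transform [] g = g
transform (r ∷ rs) g = transform rs (caseL (opts r) (lift (length (fams r)) g) (λ _ _ → g))

sumOver-bases : ∀ g c out rs → sumOver g (bases c out rs) ≡ transform rs g (length c)
sumOver-bases g c out [] = ℕₚ.+-identityʳ _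
sumOver-bases g c out ((m , [] , F) ∷ rs) = trans (sumOver-extend g F (bases c out rs)) (sumOver-bases (lift (length F) g) c out rs)
sumOver-bases g c out ((m , o ∷ os , F) ∷ rs) = sumOver-bases g c out rs

lift-pos : ∀ {k g} → 1 ≤ₙ k → (∀ n → 1 ≤ₙ g n) → ∀ n → 1 ≤ₙ lift k g n
lift-pos k≥ h zero    = ℕₚ.*-mono-≤ k≥ (h 0)
lift-pos k≥ h (suc n) = ℕₚ.≤-trans (ℕₚ.*-mono-≤ k≥ (h (suc n))) (ℕₚ.m≤m+n _ _)

fams-pos : ∀ {R t m F} → (∃[ C ] Sol R t C m) → ComplexOk R t m F → 1 ≤ₙ length F
fams-pos {F = F} (_ , s) ck with F | ComplexOk.cover ck s
... | _ ∷ _ | _ = s≤s z≤n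

strong-lift : ∀ {k g} m n → 1 ≤ₙ k → Strong m k → (∀ c → 1 ≤ₙ g c) → (∀ c → Strong (n + c) (g c)) →
              ∀ c → Strong (m + (n + c)) (lift k g c)
strong-lift {g = g} m n k≥ sk pos sg zero = extend-strong₀ m (n + 0) (pos 0) sk (strong⇒weak (n + 0) (sg 0))
strong-lift {k} {g} m n k≥ sk pos sg (suc c) = subst (λ x → Strong (m + x) (k * g (suc c) + g c)) (sym (ℕₚ.+-suc n c))
  (extend-strong m (n + c) k≥ sk (subst (λ x → Strong x (g (suc c))) (ℕₚ.+-suc n c) (sg (suc c))) (strong⇒weak (n + c) (sg c)))

transform-strong : ∀ {R ts rs g} n → Kids R ts rs → (∀ c → 1 ≤ₙ g c) → (∀ c → Strong (n + c) (g c)) →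
                   ∀ c → Strong (complexes rs + (n + c)) (transform rs g c)
transform-strong n [] pos sg c = sg c
transform-strong {rs = (m , os , F) ∷ rs} {g} n (ok ∷ kids) pos sg c with os | kind ok
... | o ∷ os′ | _ = transform-strong n kids pos sg c
... | [] | complex ck = subst (λ x → Strong x (transform rs (lift (length F) g) c)) (eq (length m) (complexes rs) n c)
      (transform-strong (length m + n) kids (lift-pos pF pos)
        (λ c → subst (λ x → Strong x (lift (length F) g c)) (sym (ℕₚ.+-assoc (length m) n c)) (strong-lift (length m) n pF (ComplexOk.strong ck) pos sg c)) c)
  where
  pF = fams-pos (attained ok) ck
  eq : ∀ m k n c → k + (m + n + c) ≡ m + k + (n + c)
  eq = solve-∀

data Mixture (rs : List Res) : Set where
  all-simple  : complexes rs ≡ 0 → (∀ c out → bases c out rs ≡ (c , out) ∷ []) → (∀ g → transform rs g ≡ g) → Mixture rs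
  has-complex : 2 ≤ₙ complexes rs → (∀ c → Strong (complexes rs + c) (transform rs f c)) → Mixture rs

abstract
  -- The first child with families acts on `f`, whose small values miss the strong bound;
  -- `extend-single` compensates for them. From then on the strong bound holds for every budget and
  -- passes to the remaining children.
  mixture : ∀ {R ts rs} → Kids R ts rs → Mixture rs
  mixture [] = all-simple refl (λ c out → refl) (λ g → refl)
  mixture {rs = (m , os , F) ∷ rs} (ok ∷ kids) with os | kind ok
  ... | o ∷ os′ | _ with mixture kids
  ...   | all-simple e b t = all-simple e b t
  ...   | has-complex h s = has-complex h s
  mixture {rs = (m , os , F) ∷ rs} (ok ∷ kids) | [] | complex ck =
    has-complex (ℕₚ.≤-trans (ComplexOk.two≤ ck) (ℕₚ.m≤m+n _ _))
      (λ c → subst (λ x → Strong x (transform rs (lift (length F) f) c)) (eq (length m) (complexes rs) c)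
        (transform-strong (length m) kids (lift-pos pF f-pos) (single ) c))
    where
    pF : 1 ≤ₙ length F
    pF = fams-pos (attained ok) ck
    eq : ∀ m k c → k + (m + c) ≡ m + k + c
    eq = solve-∀
    single : ∀ c → Strong (length m + c) (lift (length F) f c)
    single zero    = extend-strong₀ (length m) 0 (s≤s z≤n) (ComplexOk.strong ck) (f-weak 0)
    single (suc c) = extend-single (length m) c (ComplexOk.two≤ ck) pF (ComplexOk.strong ck)

-- This is where the limit of m + 1 options per child enters: the surplus over one option is paid by
-- the child's minimum.
options≤ : ∀ {R ts rs} → Kids R ts rs → length (itemsOf rs) + complexes rs ≤ₙ length (total rs) + simples rs
options≤ [] = z≤n
options≤ {rs = r@(m , os , F) ∷ rs} (ok ∷ kids) with os | kind ok
... | [] | _ = ℕₚ.≤-trans (ℕₚ.≤-trans (ℕₚ.≤-reflexive (eq (length (itemsOf rs)) (length m) (complexes rs))) (ℕₚ.+-monoʳ-≤ (length m) (options≤ kids)))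
      (ℕₚ.≤-reflexive (trans (sym (ℕₚ.+-assoc (length m) _ _)) (cong (_+ simples rs) (sym (total-∷ r rs)))))
  where
  eq : ∀ a b c → a + (b + c) ≡ b + (a + c)
  eq = solve-∀
... | o ∷ os′ | simple sk = ℕₚ.≤-trans (ℕₚ.≤-reflexive (cong (_+ complexes rs) (trans (cong length (foldr-∷ (o ∷ os′) (itemsOf rs))) (Listₚ.length-++ (o ∷ os′)))))
      (ℕₚ.≤-trans (ℕₚ.≤-reflexive (ℕₚ.+-assoc (length (o ∷ os′)) _ _)) (ℕₚ.≤-trans (ℕₚ.+-mono-≤ (SimpleOk.count sk) (options≤ kids))
        (ℕₚ.≤-reflexive (trans (eq (length m) (length (total rs)) (simples rs)) (cong (_+ suc (simples rs)) (sym (total-∷ r rs)))))))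
  where
  eq : ∀ m M s → suc m + (M + s) ≡ m + M + suc s
  eq = solve-∀

budget≤ : ∀ {R ts rs} d → Kids R ts rs → complexes rs + length (budget d rs) ≤ₙ length (total rs) + length d
budget≤ {rs = rs} d kids = ℕₚ.+-cancelʳ-≤ (simples rs) _ _ (ℕₚ.≤-trans (ℕₚ.≤-reflexive (trans (ℕₚ.+-assoc (complexes rs) _ _)
  (trans (cong (complexes rs +_) (budget-length d rs)) (eq₁ (complexes rs) (length d) (length (itemsOf rs))))))
  (ℕₚ.≤-trans (ℕₚ.+-monoʳ-≤ (length d) (options≤ kids)) (ℕₚ.≤-reflexive (eq₂ (length d) (length (total rs)) (simples rs)))))
  where
  eq₁ : ∀ a b c → a + (b + c) ≡ b + (c + a)
  eq₁ = solve-∀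
  eq₂ : ∀ a b c → a + (b + c) ≡ b + a + c
  eq₂ = solve-∀

abstract
  base-weak : ∀ {R ts rs} d out → Kids R ts rs → Weak (length (total rs) + length d) (sumOver f (bases (budget d rs) out rs))
  base-weak {rs = rs} d out kids = subst (Weak (length (total rs) + length d)) (sym (sumOver-bases f (budget d rs) out rs)) (go (mixture kids))
    where
    up : ∀ {m k} → m ≤ₙ length (total rs) + length d → Weak m k → Weak (length (total rs) + length d) k
    up {m} {k} le h = subst (λ x → Weak x k) (ℕₚ.m∸n+n≡m le) (weak-+ m (length (total rs) + length d ∸ m) h)
    go : Mixture rs → Weak (length (total rs) + length d) (transform rs f (length (budget d rs)))
    go (all-simple e _ t) rewrite t f = up (ℕₚ.≤-trans (ℕₚ.m≤n+m _ (complexes rs)) (budget≤ d kids)) (f-weak (length (budget d rs)))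
    go (has-complex _ s) = up (budget≤ d kids) (strong⇒weak (complexes rs + length (budget d rs)) (s (length (budget d rs))))

final-length : ∀ R κ → length (final R κ) ≤ₙ 1
final-length R (x ∷ todo , out , c) = z≤n
final-length R ([] , out , x ∷ c) = z≤n
final-length R ([] , out , []) with sat R out
... | true  = s≤s z≤n
... | false = z≤n

finals-length : ∀ R K → length (concatMapB (final R) K) ≤ₙ length K
finals-length R [] = z≤n
finals-length R (κ ∷ K) = ℕₚ.≤-trans (ℕₚ.≤-reflexive (trans (cong length (foldr-∷ (final R κ) _)) (Listₚ.length-++ (final R κ))))
  (ℕₚ.+-mono-≤ (final-length R κ) (finals-length R K))

abstract
  search-length : ∀ R l c out → length (searchFrom R l (c , out)) ≤ₙ f (length c)
  search-length R l c out = ℕₚ.≤-trans (ℕₚ.≤-reflexive (cong length (searchT-def R l (c , out) (table R out l)))) (ℕₚ.≤-trans (finals-length R (search (look (table R out l)) (l , out , c)))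
    (ℕₚ.≤-trans (length≤weight (search (look (table R out l)) (l , out , c)))
      (Rounds.rounds-weight (look (table R out l)) (look-sym R (universe out l) (here refl) (within-universe out l)) (l , out , c) l)))

  gen-length : ∀ R l K → length (genFrom R l K) ≤ₙ sumOver f K
  gen-length R l [] = z≤n
  gen-length R l (κ ∷ K) = ℕₚ.≤-trans (ℕₚ.≤-reflexive (trans (cong length (foldr-∷ (searchFrom R l κ) _)) (Listₚ.length-++ (searchFrom R l κ))))
    (ℕₚ.+-mono-≤ (search-length R l (proj₁ κ) (proj₂ κ)) (gen-length R l K))

-- Small minima: from families to options

unique-⊆-length : ∀ {A : Set} {xs ys : List A} → Unique xs → (∀ {x} → x ∈ xs → x ∈ ys) → length xs ≤ₙ length ys
unique-⊆-length [] h = z≤n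
unique-⊆-length {xs = x ∷ xs} {ys} (ne ∷ u) h with ∈ₚ.∈-∃++ (h (here refl))
... | as , bs , refl = ℕₚ.≤-trans (s≤s (unique-⊆-length u sub))
      (ℕₚ.≤-reflexive (trans (cong suc (Listₚ.length-++ as)) (trans (sym (ℕₚ.+-suc (length as) (length bs))) (sym (Listₚ.length-++ as)))))
  where
  sub : ∀ {y} → y ∈ xs → y ∈ as ++ bs
  sub {y} i with ∈ₚ.∈-++⁻ as (h (there i))
  ... | inj₁ j = ∈ₚ.∈-++⁺ˡ j
  ... | inj₂ (here refl) = ⊥-elim (All.lookup ne i refl)
  ... | inj₂ (there j) = ∈ₚ.∈-++⁺ʳ as j

module _ (τ : Ty) where

  nub-∈ : ∀ {x} l → x ∈ l → x ∈ nubB τ l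
  nub-∈ (y ∷ l) i with memB τ y (nubB τ l) in e
  nub-∈ (y ∷ l) (here refl) | true  = memB-true τ (nubB τ l) e
  nub-∈ (y ∷ l) (there i)   | true  = nub-∈ l i
  nub-∈ (y ∷ l) (here refl) | false = here refl
  nub-∈ (y ∷ l) (there i)   | false = there (nub-∈ l i)

  nub-∈⁻ : ∀ {x} l → x ∈ nubB τ l → x ∈ l
  nub-∈⁻ (y ∷ l) i with memB τ y (nubB τ l)
  ... | true = there (nub-∈⁻ l i)
  nub-∈⁻ (y ∷ l) (here refl) | false = here refl
  nub-∈⁻ (y ∷ l) (there i)   | false = there (nub-∈⁻ l i)

  nub-unique : ∀ l → Unique (nubB τ l)
  nub-unique [] = []
  nub-unique (y ∷ l) with memB τ y (nubB τ l) in e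
  ... | true  = nub-unique l
  ... | false = All.tabulate (λ i eq → memB-false τ e (subst (_∈ nubB τ l) (sym eq) i)) ∷ nub-unique l

merge-∈ : ∀ {x} φ → x ∈ merge φ → Any (x ∈_) (List.map proj₁ φ)
merge-∈ φ i with concatMapB-∈⁻ {f = proj₁} φ (nub-∈⁻ val _ i)
... | p , j , k = lose (∈ₚ.∈-map⁺ proj₁ j) k

merge-∈⁺ : ∀ {x} φ → Any (x ∈_) (List.map proj₁ φ) → x ∈ merge φ
merge-∈⁺ φ a with find a
... | c , j , k with ∈ₚ.∈-map⁻ proj₁ j
...   | p , l , refl = nub-∈ val _ (concatMapB-∈ {f = proj₁} l k)

lefts-items : ∀ φ → List.map proj₁ (lefts φ) ≡ List.map proj₁ φ
lefts-items []      = refl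
lefts-items (p ∷ φ) = cong (proj₁ p ∷_) (lefts-items φ)

rights-items : ∀ φ → List.map proj₁ (rights φ) ≡ List.map proj₂ φ
rights-items []      = refl
rights-items (p ∷ φ) = cong (proj₂ p ∷_) (rights-items φ)

sel-lefts⁻ : ∀ φ {τ} → Sel (lefts φ) τ → τ ≡ List.map proj₁ φ
sel-lefts⁻ [] [] = refl
sel-lefts⁻ (p ∷ φ) (left s)  = cong (proj₁ p ∷_) (sel-lefts⁻ φ s)
sel-lefts⁻ (p ∷ φ) (right s) = cong (proj₁ p ∷_) (sel-lefts⁻ φ s)

sel-rights⁻ : ∀ φ {τ} → Sel (rights φ) τ → τ ≡ List.map proj₂ φ
sel-rights⁻ [] [] = refl
sel-rights⁻ (p ∷ φ) (left s)  = cong (proj₂ p ∷_) (sel-rights⁻ φ s)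
sel-rights⁻ (p ∷ φ) (right s) = cong (proj₂ p ∷_) (sel-rights⁻ φ s)

sel-lefts : ∀ φ → Sel φ (List.map proj₁ φ) × Sel (lefts φ) (List.map proj₁ φ)
sel-lefts []      = [] , []
sel-lefts (p ∷ φ) = left (proj₁ (sel-lefts φ)) , left (proj₂ (sel-lefts φ))

sel-rights : ∀ φ → Sel φ (List.map proj₂ φ) × Sel (rights φ) (List.map proj₂ φ)
sel-rights []      = [] , []
sel-rights (p ∷ φ) = right (proj₁ (sel-rights φ)) , right (proj₂ (sel-rights φ))

nt₀-sel : ∀ {φ σ} → Nt φ 0 → Sel φ σ → σ ≡ List.map proj₁ φ × σ ≡ List.map proj₂ φ
nt₀-sel [] [] = refl , refl
nt₀-sel (triv n) (left s)  = let a , b = nt₀-sel n s in cong (_ ∷_) a , cong (_ ∷_) b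
nt₀-sel (triv n) (right s) = let a , b = nt₀-sel n s in cong (_ ∷_) a , cong (_ ∷_) b

nt₁-sel : ∀ {φ σ} → Nt φ 1 → Sel φ σ → σ ≡ List.map proj₁ φ ⊎ σ ≡ List.map proj₂ φ
nt₁-sel (triv n) (left s) with nt₁-sel n s
... | inj₁ e = inj₁ (cong (_ ∷_) e)
... | inj₂ e = inj₂ (cong (_ ∷_) e)
nt₁-sel (triv n) (right s) with nt₁-sel n s
... | inj₁ e = inj₁ (cong (_ ∷_) e)
... | inj₂ e = inj₂ (cong (_ ∷_) e)
nt₁-sel (pair n) (left s)  = inj₁ (cong (_ ∷_) (proj₁ (nt₀-sel n s)))
nt₁-sel (pair n) (right s) = inj₂ (cong (_ ∷_) (proj₂ (nt₀-sel n s)))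

nt₀-lr : ∀ {φ} → Nt φ 0 → rights φ ≡ lefts φ
nt₀-lr []       = refl
nt₀-lr (triv n) = cong (_ ∷_) (nt₀-lr n)

nt≤1-sel : ∀ {φ j σ} → Nt φ j → j ≤ₙ 1 → Sel φ σ → σ ≡ List.map proj₁ φ ⊎ σ ≡ List.map proj₂ φ
nt≤1-sel n z≤n s       = inj₁ (proj₁ (nt₀-sel n s))
nt≤1-sel n (s≤s z≤n) s = nt₁-sel n s

opaque
  unfolding options

  options-∈⁻ : ∀ R F {o} → o ∈ options R F → ∃[ φ ] (φ ∈ F × ((sat R (lefts φ) ≡ true × o ≡ merge (lefts φ))
                                                          ⊎ (sat R (rights φ) ≡ true × o ≡ merge (rights φ))))
  options-∈⁻ R F i with concatMapB-∈⁻ {f = λ φ → foldr _∷_ (optOf R (rights φ)) (optOf R (lefts φ))} F (nub-∈⁻ itemT _ i)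
  ... | φ , j , k with ∈ₚ.∈-++⁻ (optOf R (lefts φ)) (subst (_ ∈_) (foldr-∷ (optOf R (lefts φ)) _) k)
  ...   | inj₁ l = φ , j , inj₁ (one-of (lefts φ) l)
    where
    one-of : ∀ ψ {o} → o ∈ optOf R ψ → sat R ψ ≡ true × o ≡ merge ψ
    one-of ψ l with sat R ψ
    one-of ψ (here e) | true = refl , e
  ...   | inj₂ l = φ , j , inj₂ (one-of (rights φ) l)
    where
    one-of : ∀ ψ {o} → o ∈ optOf R ψ → sat R ψ ≡ true × o ≡ merge ψ
    one-of ψ l with sat R ψ
    one-of ψ (here e) | true = refl , e

  optOf-∈ : ∀ R ψ → sat R ψ ≡ true → merge ψ ∈ optOf R ψ
  optOf-∈ R ψ e rewrite e = here refl

  options-lefts : ∀ R F {φ} → φ ∈ F → sat R (lefts φ) ≡ true → merge (lefts φ) ∈ options R F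
  options-lefts R F {φ} i e = nub-∈ itemT _ (concatMapB-∈ {f = λ φ → foldr _∷_ (optOf R (rights φ)) (optOf R (lefts φ))} i
    (subst (merge (lefts φ) ∈_) (sym (foldr-∷ (optOf R (lefts φ)) _)) (∈ₚ.∈-++⁺ˡ (optOf-∈ R (lefts φ) e))))

  options-rights : ∀ R F {φ} → φ ∈ F → sat R (rights φ) ≡ true → merge (rights φ) ∈ options R F
  options-rights R F {φ} i e = nub-∈ itemT _ (concatMapB-∈ {f = λ φ → foldr _∷_ (optOf R (rights φ)) (optOf R (lefts φ))} i
    (subst (merge (rights φ) ∈_) (sym (foldr-∷ (optOf R (lefts φ)) _)) (∈ₚ.∈-++⁺ʳ (optOf R (lefts φ)) (optOf-∈ R (rights φ) e))))

opaque
  unfolding options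

  options-unique : ∀ R F → Unique (options R F)
  options-unique R F = nub-unique itemT (concatMapB (λ φ → foldr _∷_ (optOf R (rights φ)) (optOf R (lefts φ))) F)

record Few (F : List Family) (n : ℕ) : Set where
  constructor few
  field
    cands   : List Item
    count   : length cands ≤ₙ n
    covered : ∀ {φ} → φ ∈ F → (∃[ j ] (Nt φ j × j ≤ₙ 1)) × merge (lefts φ) ∈ cands × merge (rights φ) ∈ cands

finals-small : ∀ R κs {φ} → φ ∈ concatMapB (final R) κs → ∃[ c ] ∃[ todo ] (todo , φ , c) ∈ κs
finals-small R κs i with concatMapB-∈⁻ {f = final R} κs i
... | (todo , out , c) , j , k with final-∈ R todo out c k
...   | refl , refl , _ , refl = [] , [] , j

-- The last hypothesis rules out a single family with two choices, whose four selections would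
-- exceed the three candidates allowed for n = 2.
shape-few : ∀ R n κs → n ≤ₙ 2 → Shape n κs → (n ≤ₙ 1 ⊎ 2 ≤ₙ length (concatMapB (final R) κs)) →
            Few (concatMapB (final R) κs) (suc n)
shape-few R n [] le none h = few [] z≤n (λ ())
shape-few R n (κ ∷ []) le (one (small j t b)) h = go n h b
  where
  F = concatMapB (final R) (κ ∷ [])
  out≡ : ∀ {φ} → φ ∈ F → φ ≡ outₖ κ
  out≡ i with finals-small R (κ ∷ []) i
  ... | _ , _ , here refl = refl
  short : length F ≤ₙ 1
  short = finals-length R (κ ∷ [])
  go : ∀ n → n ≤ₙ 1 ⊎ 2 ≤ₙ length F → cutsₖ κ + j ≤ₙ n → Few F (suc n)
  go n (inj₂ two≤) b with ℕₚ.≤-trans two≤ short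
  ... | s≤s ()
  go 0 (inj₁ _) b with ℕₚ.n≤0⇒n≡0 (ℕₚ.≤-trans (ℕₚ.m≤n+m j (cutsₖ κ)) b)
  ... | refl = few (merge (lefts (outₖ κ)) ∷ []) (s≤s z≤n) (λ i → known (out≡ i))
    where
    known : ∀ {φ} → φ ≡ outₖ κ → (∃[ j ] (Nt φ j × j ≤ₙ 1)) × merge (lefts φ) ∈ merge (lefts (outₖ κ)) ∷ [] × merge (rights φ) ∈ merge (lefts (outₖ κ)) ∷ []
    known refl = (0 , t , z≤n) , here refl , here (cong merge (nt₀-lr t))
  go (suc n) (inj₁ le) b = few cs (s≤s (s≤s z≤n)) (λ i → known (out≡ i))
    where
    cs = merge (lefts (outₖ κ)) ∷ merge (rights (outₖ κ)) ∷ []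
    known : ∀ {φ} → φ ≡ outₖ κ → (∃[ j ] (Nt φ j × j ≤ₙ 1)) × merge (lefts φ) ∈ cs × merge (rights φ) ∈ cs
    known refl = (j , t , ℕₚ.≤-trans (ℕₚ.m≤n+m j (cutsₖ κ)) (ℕₚ.≤-trans b le)) , here refl , there (here refl)
shape-few R .2 (κ ∷ κ′ ∷ []) le (two (small j t b) (small j′ t′ b′)) h =
  few (merge (lefts (outₖ κ)) ∷ merge (rights (outₖ κ)) ∷ merge (lefts (outₖ κ′)) ∷ []) (s≤s (s≤s (s≤s z≤n))) go
  where
  go : ∀ {φ} → φ ∈ concatMapB (final R) (κ ∷ κ′ ∷ []) → (∃[ j ] (Nt φ j × j ≤ₙ 1)) × _
  go i with finals-small R (κ ∷ κ′ ∷ []) i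
  ... | _ , _ , here refl = (j , t , ℕₚ.≤-trans (ℕₚ.m≤n+m j (cutsₖ κ)) b) , here refl , there (here refl)
  ... | _ , _ , there (here refl) with ℕₚ.n≤0⇒n≡0 (ℕₚ.≤-trans (ℕₚ.m≤n+m j′ (cutsₖ κ′)) b′)
  ...   | refl = (0 , t′ , z≤n) , there (there (here refl)) , there (there (here (cong merge (nt₀-lr t′))))

few-≡ : ∀ {F F′ n} → F ≡ F′ → Few F n → Few F′ n
few-≡ refl x = x

data SimpleSpec (m : Num) (F : List Family) : Bool → Set where
  yes₁ : length m ≤ₙ 1 → SimpleSpec m F true
  yes₂ : length m ≡ 2 → 2 ≤ₙ length F → SimpleSpec m F true
  no₂  : length m ≡ 2 → length F ≤ₙ 1 → SimpleSpec m F false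
  no₃  : 3 ≤ₙ length m → SimpleSpec m F false

simple-spec : ∀ m F → SimpleSpec m F (simpleB m F)
simple-spec [] F = yes₁ z≤n
simple-spec (_ ∷ []) F = yes₁ (s≤s z≤n)
simple-spec (_ ∷ _ ∷ []) [] = no₂ refl z≤n
simple-spec (_ ∷ _ ∷ []) (_ ∷ []) = no₂ refl (s≤s z≤n)
simple-spec (_ ∷ _ ∷ []) (_ ∷ _ ∷ F) = yes₂ refl (s≤s (s≤s z≤n))
simple-spec (_ ∷ _ ∷ _ ∷ m) F = no₃ (s≤s (s≤s (s≤s z≤n)))

length-drop : ∀ n m → length (dropB n m) ≡ length n ∸ length m
length-drop n [] = refl
length-drop n (_ ∷ m) = trans (go (dropB n m)) (trans (cong pred (length-drop n m)) (ℕₚ.pred[m∸n]≡m∸[1+n] (length n) (length m)))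
  where
  go : ∀ (l : Num) → length (caseL l [] (λ _ t → t)) ≡ pred (length l)
  go []      = refl
  go (_ ∷ l) = refl

module NodeResult (R : Req) (v : Val) (ts : List Rose) (rs : List Res) (kids : Kids R ts rs)
            (uniq : Unique (v ∷ vertsF ts)) (irr : ¬ (v , v) ∈ R) where

  open Node R v ts rs kids uniq irr

  LB : Num → Set
  LB d = ∀ {C n} → Sol R (node v ts) C n → M + length d ≤ₙ n

  c₀ : Num → Num
  c₀ d = budget d rs

  gen≤ : ∀ d → length (gen R v rs d) ≤ₙ transform rs f (length (c₀ d))
  gen≤ d = ℕₚ.≤-trans (ℕₚ.≤-reflexive (cong length (gen-def R v rs d))) (ℕₚ.≤-trans (gen-length R (itemsOf rs) (bases (c₀ d) out₀ rs)) (ℕₚ.≤-reflexive (sumOver-bases f (c₀ d) out₀ rs)))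

  abstract
    -- A child with families has minimum at least 2 and uses up the whole bound. Then the strong
    -- bound for 2 leaves at most one family, against the hypothesis. So all children have options
    -- and the node is handled by a single search.
    few-gen : ∀ d → M + length d ≤ₙ 2 → M + length d ≤ₙ 1 ⊎ 2 ≤ₙ length (gen R v rs d) → Few (gen R v rs d) (suc (M + length d))
    few-gen d le h with mixture kids
    ... | has-complex h₂ s = ⊥-elim (clash h)
      where
      ≡2 : complexes rs + length (c₀ d) ≡ 2
      ≡2 = ℕₚ.≤-antisym (ℕₚ.≤-trans (budget≤ d kids) le) (ℕₚ.≤-trans h₂ (ℕₚ.m≤m+n _ _))
      clash : M + length d ≤ₙ 1 ⊎ 2 ≤ₙ length (gen R v rs d) → ⊥
      clash (inj₁ le₁) with ℕₚ.≤-trans (ℕₚ.≤-reflexive (sym ≡2)) (ℕₚ.≤-trans (budget≤ d kids) le₁)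
      ... | s≤s ()
      clash (inj₂ two≤) with ℕₚ.≤-trans two≤ (ℕₚ.≤-trans (gen≤ d) (strong₂ (subst (λ x → Strong x (transform rs f (length (c₀ d)))) ≡2 (s (length (c₀ d))))))
      ... | s≤s ()
    ... | all-simple _ b _ = few-≡ (sym gen≡) (shape-few R (M + length d) K le shape (big h))
      where
      L : List Item
      L = itemsOf rs
      t : List (Item × Item)
      t = table R out₀ L
      K : List Config
      K = search (look t) (L , out₀ , c₀ d)
      gen≡ : gen R v rs d ≡ concatMapB (final R) K
      gen≡ = trans (gen-def R v rs d) (trans (cong (genFrom R L) (b (c₀ d) out₀)) (trans (foldr-∷ (searchFrom R L (c₀ d , out₀)) [])
        (trans (Listₚ.++-identityʳ _) (searchT-def R L (c₀ d , out₀) t))))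
      big : M + length d ≤ₙ 1 ⊎ 2 ≤ₙ length (gen R v rs d) → M + length d ≤ₙ 1 ⊎ 2 ≤ₙ length (concatMapB (final R) K)
      big (inj₁ x) = inj₁ x
      big (inj₂ x) = inj₂ (subst (λ F → 2 ≤ₙ length F) gen≡ x)
      shape : Shape (M + length d) K
      shape = Rounds.rounds-shape (look t) (tab-sym out₀) {κ = L , out₀ , c₀ d} L le
        (small 0 (triv []) (ℕₚ.≤-trans (ℕₚ.≤-reflexive (ℕₚ.+-identityʳ _)) (ℕₚ.≤-trans (ℕₚ.m≤n+m _ (complexes rs)) (budget≤ d kids))))

  abstract
    options-ok : ∀ d → LB d → M + length d ≤ₙ 2 → Few (gen R v rs d) (suc (M + length d)) →
                 SimpleOk R (node v ts) (M + length d) (options R (gen R v rs d))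
    options-ok d lb le (few cs cs≤ covered) = record
      { count = ℕₚ.≤-trans (unique-⊆-length (options-unique R F) in-cands) cs≤
      ; few   = le
      ; sound = All.tabulate snd
      ; cover = cov }
      where
      F : List Family
      F = gen R v rs d
      in-cands : ∀ {o} → o ∈ options R F → o ∈ cs
      in-cands i with options-∈⁻ R F i
      ... | φ , j , inj₁ (_ , refl) = proj₁ (proj₂ (covered j))
      ... | φ , j , inj₂ (_ , refl) = proj₂ (proj₂ (covered j))
      snd : ∀ {o} → o ∈ options R F → ∃[ C ] (Sol R (node v ts) C (M + length d) × C ⊆ᵥ o)
      snd i with options-∈⁻ R F i
      ... | φ , j , inj₁ (e , refl) with sat-sound R (lefts φ) e
      ...   | τ , sel , c with sel-lefts⁻ φ sel
      ...     | refl with gen-sound d j (proj₁ (sel-lefts φ)) (Clean.pairs c)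
      ...       | C , s , ins = C , s , λ x k → merge-∈⁺ (lefts φ) (subst (Any (x ∈_)) (sym (lefts-items φ)) (ins k))
      snd i | φ , j , inj₂ (e , refl) with sat-sound R (rights φ) e
      ...   | τ , sel , c with sel-rights⁻ φ sel
      ...     | refl with gen-sound d j (proj₁ (sel-rights φ)) (Clean.pairs c)
      ...       | C , s , ins = C , s , λ x k → merge-∈⁺ (rights φ) (subst (Any (x ∈_)) (sym (rights-items φ)) (ins k))
      pull-in : ∀ {C σ} → All (_⊆ᵥ C) σ → ∀ {x} → Any (x ∈_) σ → x ∈ C
      pull-in (h ∷ _) (here i)  = h _ i
      pull-in (_ ∷ h) (there a) = pull-in h a
      cov : ∀ {C} → Sol R (node v ts) C (M + length d) → Any (λ o → o ⊆ᵥ C) (options R F)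
      cov s with find (gen-cover d lb s)
      ... | φ , j , σ , sel , com , ins with proj₁ (covered j)
      ...   | _ , nt , j≤ with nt≤1-sel nt j≤ sel
      ...     | inj₁ refl = lose (options-lefts R F j (sat-true R (lefts φ) (proj₂ (sel-lefts φ)) (clean⁺ {R} com)))
                  (λ x k → pull-in ins (subst (Any (x ∈_)) (lefts-items φ) (merge-∈ (lefts φ) k)))
      ...     | inj₂ refl = lose (options-rights R F j (sat-true R (rights φ) (proj₂ (sel-rights φ)) (clean⁺ {R} com)))
                  (λ x k → pull-in ins (subst (Any (x ∈_)) (rights-items φ) (merge-∈ (rights φ) k)))

  data Looped (n : ℕ) : Num × List Family → Set where
    searching : ∀ {d} → LB d → length d ≡ n → Looped n (d , [])
    found     : ∀ {d φ φs} → LB d → gen R v rs d ≡ φ ∷ φs → Looped n (d , φ ∷ φs)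

  loop-ok : LB [] → ∀ l → Looped (length l) (loop R v rs l)
  loop-ok lb [] = searching lb refl
  loop-ok lb (_ ∷ l) with loop R v rs l | loop-ok lb l
  ... | _ | found lb′ e = found lb′ e
  ... | d , [] | searching lb′ e = go (gen R v rs d) refl
    where
    go : ∀ F → gen R v rs d ≡ F → Looped (suc (length l)) (caseL F (tt ∷ d , []) (λ φ φs → d , φ ∷ φs))
    go [] e′ = searching (λ {C} {n} s → ℕₚ.≤-trans (ℕₚ.≤-reflexive (ℕₚ.+-suc M (length d))) (more s)) (cong suc e)
      where
      more : ∀ {C n} → Sol R (node v ts) C n → M + length d <ₙ n
      more {n = n} s with ℕₚ.m≤n⇒m<n∨m≡n (lb′ s)
      ... | inj₁ lt = lt
      ... | inj₂ refl with subst (Any _) e′ (gen-cover d lb′ s)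
      ...   | ()
    go (φ ∷ φs) e′ = found lb′ e′

  strong-gen : ∀ d → 3 ≤ₙ M + length d → Strong (M + length d) (length (gen R v rs d))
  strong-gen d three with mixture kids
  ... | has-complex _ s = up (budget≤ d kids) (strong-mono (complexes rs + length (c₀ d)) (gen≤ d) (s (length (c₀ d))))
    where
    up : ∀ {m k} → m ≤ₙ M + length d → Strong m k → Strong (M + length d) k
    up {m} {k} le h = subst (λ x → Strong x k) (ℕₚ.m∸n+n≡m le) (strong-+ m (M + length d ∸ m) h)
  ... | all-simple _ _ t = strong-mono (M + length d) (ℕₚ.≤-trans (gen≤ d) (ℕₚ.≤-trans (ℕₚ.≤-reflexive (cong (λ g → g (length (c₀ d))) (t f)))
          (f-mono (ℕₚ.≤-trans (ℕₚ.m≤n+m _ (complexes rs)) (budget≤ d kids)))))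
          (subst (λ x → Strong x (f x)) (trans (ℕₚ.+-comm 3 _) (ℕₚ.m∸n+n≡m three)) (f-strong (M + length d ∸ 3)))

  gen-ok : ∀ d {φ φs} → LB d → gen R v rs d ≡ φ ∷ φs → Ok R (node v ts) (pack R (appB (total rs) d) (gen R v rs d))
  gen-ok d {φ} lb e = go (simpleB m F) (simple-spec m F)
    where
    m = appB (total rs) d
    F = gen R v rs d
    m≡ : length m ≡ M + length d
    m≡ = trans (cong length (foldr-∷ (total rs) d)) (Listₚ.length-++ (total rs))
    φ∈ : φ ∈ F
    φ∈ = subst (φ ∈_) (sym e) (here refl)
    att : ∃[ C ] Sol R (node v ts) C (M + length d)
    att with sat-sound R φ (gen-sat R v rs d φ∈)
    ... | τ , sel , c with gen-sound d φ∈ sel (Clean.pairs c)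
    ...   | C , s , _ = C , s
    lower′ : ∀ {C n} → Sol R (node v ts) C n → length m ≤ₙ n
    lower′ s = subst (_≤ₙ _) (sym m≡) (lb s)
    simple-case : M + length d ≤ₙ 2 → M + length d ≤ₙ 1 ⊎ 2 ≤ₙ length F → Ok R (node v ts) (m , options R F , [])
    simple-case le h = record { lower = lower′ ; attained = subst (λ x → ∃[ C ] Sol R (node v ts) C x) (sym m≡) att
                              ; kind = subst (λ x → Kind R (node v ts) x (options R F) []) (sym m≡) (mk (options R F) (options-ok d lb le (few-gen d le h))) }
      where
      mk : ∀ os → SimpleOk R (node v ts) (M + length d) os → Kind R (node v ts) (M + length d) os []
      mk [] sk with SimpleOk.cover sk (proj₂ att)
      ... | ()
      mk (o ∷ os) sk = simple sk
    complex-case : 2 ≤ₙ M + length d → Strong (M + length d) (length F) → Ok R (node v ts) (m , [] , F)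
    complex-case le s = record { lower = lower′ ; attained = subst (λ x → ∃[ C ] Sol R (node v ts) C x) (sym m≡) att
                              ; kind = subst (λ x → Kind R (node v ts) x [] F) (sym m≡) (complex (record
                                  { two≤ = le ; strong = s
                                  ; sound = All.tabulate (λ i sel com → gen-sound d i sel com)
                                  ; cover = gen-cover d lb })) }
    go : ∀ b → SimpleSpec m F b → Ok R (node v ts) (if b then (m , options R F , []) else (m , [] , F))
    go true (yes₁ h) = simple-case (ℕₚ.m≤n⇒m≤1+n (subst (_≤ₙ 1) m≡ h)) (inj₁ (subst (_≤ₙ 1) m≡ h))
    go true (yes₂ h h′) = simple-case (ℕₚ.≤-reflexive (trans (sym m≡) h)) (inj₂ h′)
    go false (no₂ h h′) = complex-case (ℕₚ.≤-reflexive (sym (trans (sym m≡) h)))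
      (subst (λ x → Strong x (length F)) (sym (trans (sym m≡) h)) (strong-mono 2 h′ strong₂-one))
    go false (no₃ h) = complex-case (ℕₚ.≤-trans (ℕₚ.n≤1+n 2) (subst (3 ≤ₙ_) m≡ h)) (strong-gen d (subst (3 ≤ₙ_) m≡ h))

-- Results under the bound k

-- The lower bound holds for every subtree and suffices to reject; the full description is available
-- only for minima within the bound, and only those are needed to accept.
Good : Req → Num → Rose → Res → Set
Good R k t r = (∀ {C n} → Sol R t C n → length (size# r) ≤ₙ n) × (length (size# r) ≤ₙ length k → Ok R t r)

data Goods (R : Req) (k : Num) : List Rose → List Res → Set where
  []  : Goods R k [] []
  _∷_ : ∀ {t r ts rs} → Good R k t r → Goods R k ts rs → Goods R k (t ∷ ts) (r ∷ rs)

goods-kids : ∀ {R k ts rs} → Goods R k ts rs → length (total rs) ≤ₙ length k → Kids R ts rs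
goods-kids [] le = []
goods-kids {rs = r ∷ rs} ((_ , g) ∷ gs) le =
  let le′ = ℕₚ.≤-trans (ℕₚ.≤-reflexive (sym (total-∷ r rs))) le in
  g (ℕₚ.≤-trans (ℕₚ.m≤m+n _ _) le′) ∷ goods-kids gs (ℕₚ.≤-trans (ℕₚ.m≤n+m _ _) le′)

goods-lower : ∀ {R k ts rs} → Goods R k ts rs → ∀ {C n} → SolF R ts C n → length (total rs) ≤ₙ n
goods-lower [] [] = z≤n
goods-lower {rs = r ∷ rs} ((l , _) ∷ gs) (join s ss) = ℕₚ.≤-trans (ℕₚ.≤-reflexive (total-∷ r rs)) (ℕₚ.+-mono-≤ (l s) (goods-lower gs ss))
goods-lower {rs = r ∷ rs} ((l , _) ∷ gs) (cut s ss) = ℕₚ.≤-trans (ℕₚ.≤-reflexive (total-∷ r rs)) (ℕₚ.m≤n⇒m≤1+n (ℕₚ.+-mono-≤ (l s) (goods-lower gs ss)))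

pack-size : ∀ R m F → size# (pack R m F) ≡ m
pack-size R m F with simpleB m F
... | true  = refl
... | false = refl

finish-good : ∀ {R k v ts rs} → Goods R k ts rs → Unique (v ∷ vertsF ts) → ¬ (v , v) ∈ R →
              Good R k (node v ts) (finish R k v rs)
finish-good {R} {k} {v} {ts} {rs} gs uniq irr with length (total rs) ℕₚ.≤? length k
... | no ≰ = (λ s → ℕₚ.≤-trans (ℕₚ.≤-reflexive size≡) (lb s)) , (λ le → ⊥-elim (≰ (ℕₚ.≤-trans (ℕₚ.≤-reflexive (sym size≡)) le)))
  where
  lb : ∀ {C n} → Sol R (node v ts) C n → length (total rs) ≤ₙ n
  lb (sol ss _) = goods-lower gs ss
  no-tries : ∀ (l : Num) → length l ≡ 0 → l ≡ []
  no-tries [] _ = refl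
  size≡ : length (size# (finish R k v rs)) ≡ length (total rs)
  size≡ rewrite no-tries (dropB (tt ∷ k) (total rs)) (trans (length-drop (tt ∷ k) (total rs)) (ℕₚ.m≤n⇒m∸n≡0 (ℕₚ.≰⇒> ≰))) =
    trans (cong length (trans (pack-size R (appB (total rs) []) []) (foldr-∷ (total rs) [])))
      (trans (Listₚ.length-++ (total rs)) (ℕₚ.+-identityʳ _))
... | yes le = go (loop R v rs l) (loop-ok lb l)
  where
  l = dropB (tt ∷ k) (total rs)
  kids = goods-kids gs le
  open NodeResult R v ts rs kids uniq irr
  lb : LB []
  lb (sol ss _) = ℕₚ.≤-trans (ℕₚ.≤-reflexive (ℕₚ.+-identityʳ _)) (goods-lower gs ss)
  m≡ : ∀ d → length (appB (total rs) d) ≡ length (total rs) + length d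
  m≡ d = trans (cong length (foldr-∷ (total rs) d)) (Listₚ.length-++ (total rs))
  go : ∀ s → Looped (length l) s → Good R k (node v ts) (pack R (appB (total rs) (proj₁ s)) (proj₂ s))
  go (d , []) (searching lb′ e) = (λ s → ℕₚ.≤-trans (ℕₚ.≤-reflexive size≡) (lb′ s)) ,
      (λ le′ → ⊥-elim (ℕₚ.<⇒≱ (ℕₚ.n<1+n (length k)) (ℕₚ.≤-trans (ℕₚ.≤-reflexive (sym big)) le′)))
    where
    size≡ : length (size# (pack R (appB (total rs) d) [])) ≡ length (total rs) + length d
    size≡ = trans (cong length (pack-size R (appB (total rs) d) [])) (m≡ d)
    big : length (size# (pack R (appB (total rs) d) [])) ≡ suc (length k)
    big = trans size≡ (trans (cong (length (total rs) +_) (trans e (length-drop (tt ∷ k) (total rs)))) (ℕₚ.m+[n∸m]≡n (ℕₚ.m≤n⇒m≤1+n le)))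
  go (d , φ ∷ φs) (found lb′ e) = subst (λ F → Good R k (node v ts) (pack R (appB (total rs) d) F)) e
    (Ok.lower ok , (λ _ → ok))
    where
    ok = gen-ok d lb′ e

mutual
  result : Req → Num → Rose → Res
  result R k (node v ts) = finish R k v (results R k ts)

  results : Req → Num → List Rose → List Res
  results R k []       = []
  results R k (t ∷ ts) = result R k t ∷ results R k ts

mutual
  result-good : ∀ {R} k t → (∀ x → ¬ (x , x) ∈ R) → Unique (verts t) → Good R k t (result R k t)
  result-good k (node v ts) irr u = finish-good (results-good k ts irr (AllPairs.tail u)) u (irr v)

  results-good : ∀ {R} k ts → (∀ x → ¬ (x , x) ∈ R) → Unique (vertsF ts) → Goods R k ts (results R k ts)
  results-good k []       irr u = []
  results-good k (t ∷ ts) irr u = let u₁ , u₂ , _ = allPairs-++⁻ (verts t) u in result-good k t irr u₁ ∷ results-good k ts irr u₂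

result-correct : ∀ {R} k t → (∀ x → ¬ (x , x) ∈ R) → Unique (verts t) → length (size# (result R k t)) ≤ₙ length k →
                 ∃[ C ] ∃[ n ] (Sol R t C n × n ≤ₙ length k)
result-correct {R} k t irr u le with Ok.attained (proj₂ (result-good {R} k t irr u) le)
... | C , s = C , _ , s , le

-- Rooting the tree

-- The tree is rooted at the vertex 0, whose label is nil. It is represented by
-- the pairs (child , parent) in an order in which parents precede children.

Pairs : Set
Pairs = List (Val × Val)

seen : Val → Pairs → Bool
seen v o = if eqb {val} v nil then true else anyB (λ e → eqb {val} v (proj₁ e)) o

addEdge : Val × Val → Pairs → Pairs
addEdge e o = if seen (proj₁ e) o
  then (if seen (proj₂ e) o then o else appB o ((proj₂ e , proj₁ e) ∷ []))
  else (if seen (proj₂ e) o then appB o ((proj₁ e , proj₂ e) ∷ []) else o)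

pass : Pairs → Pairs → Pairs
pass E o = foldr addEdge o E

-- One pass per step of a walk: every pass reaches at least one more edge along each path to the
-- root. A path has at most twice as many steps as there are edges, hence the doubled list as fuel.
rootOrder : Pairs → Pairs
rootOrder E = foldr (λ _ o → pass E o) [] (appB E E)

seenₚ : Poly (val ⊗ list (val ⊗ val)) bool
seenₚ = ifₚ (eqₚ v₀ emptyₚ) (boolₚ true) (anyₚ sndₚ (eqₚ v₁ (fstₚ ⊙ v₀)))

addEdgeₚ : Poly ((val ⊗ val) ⊗ list (val ⊗ val)) (list (val ⊗ val))
addEdgeₚ = ifₚ (seenₚ ⊙ ⟨ fstₚ ⊙ fstₚ , sndₚ ⟩ₚ)
  (ifₚ (seenₚ ⊙ ⟨ sndₚ ⊙ fstₚ , sndₚ ⟩ₚ) sndₚ (appendₚ sndₚ (consₚ ⟨ sndₚ ⊙ fstₚ , fstₚ ⊙ fstₚ ⟩ₚ nilₚ)))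
  (ifₚ (seenₚ ⊙ ⟨ sndₚ ⊙ fstₚ , sndₚ ⟩ₚ) (appendₚ sndₚ (consₚ ⟨ fstₚ ⊙ fstₚ , sndₚ ⊙ fstₚ ⟩ₚ nilₚ)) sndₚ)

reqsz : Pairs → ℕ
reqsz = sz (list (val ⊗ val))

addEdge-sz : ∀ e o → reqsz (addEdge e o) ≤ₙ (2 + sz (val ⊗ val) e) + reqsz o
addEdge-sz e o with seen (proj₁ e) o | seen (proj₂ e) o
... | true  | true  = ℕₚ.m≤n+m _ _
... | true  | false = ℕₚ.≤-trans (sz-append {val ⊗ val} o _) (ℕₚ.≤-reflexive (eq (reqsz o) ‖ proj₁ e ‖ ‖ proj₂ e ‖))
  where
  eq : ∀ o a b → o + (1 + (1 + (b + a) + 1)) ≡ 2 + (1 + (a + b)) + o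
  eq = solve-∀
... | false | true  = ℕₚ.≤-trans (sz-append {val ⊗ val} o _) (ℕₚ.≤-reflexive (eq (reqsz o) ‖ proj₁ e ‖ ‖ proj₂ e ‖))
  where
  eq : ∀ o a b → o + (1 + (1 + (a + b) + 1)) ≡ 2 + (1 + (a + b)) + o
  eq = solve-∀
... | false | false = ℕₚ.m≤n+m _ _

passₚ : Poly (list (val ⊗ val) ⊗ list (val ⊗ val)) (list (val ⊗ val))
passₚ = foldAddₚ fstₚ sndₚ (addEdgeₚ ⊙ ⟨ v₀ , v₁ ⟩ₚ) (pb-+ (pb-const 2) (space fstₚ))
  (λ x u acc le → ℕₚ.≤-trans (addEdge-sz u acc) (ℕₚ.+-monoˡ-≤ (reqsz acc) (ℕₚ.+-monoʳ-≤ 2 le)))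

pass-sz : ∀ E o → reqsz (pass E o) ≤ₙ 2 * reqsz E + reqsz o
pass-sz [] o = ℕₚ.m≤n+m _ _
pass-sz (e ∷ E) o = ℕₚ.≤-trans (addEdge-sz e (pass E o)) (ℕₚ.≤-trans (ℕₚ.+-monoʳ-≤ (2 + sz (val ⊗ val) e) (pass-sz E o))
  (ℕₚ.≤-trans (ℕₚ.m≤m+n _ (sz (val ⊗ val) e)) (ℕₚ.≤-reflexive (eq (sz (val ⊗ val) e) (reqsz E) (reqsz o)))))
  where
  eq : ∀ a b c → 2 + a + (2 * b + c) + a ≡ 2 * (1 + (a + b)) + c
  eq = solve-∀

rootOrderₚ : Poly (list (val ⊗ val)) (list (val ⊗ val))
rootOrderₚ = foldAddₚ (appendₚ idₚ idₚ) nilₚ (passₚ ⊙ ⟨ sndₚ ⊙ sndₚ , v₁ ⟩ₚ) (pb-* (pb-const 2) pb-sz)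
  (λ x u acc le → pass-sz x acc)

rootOrder-≡ : ∀ E → ⟦ rootOrderₚ ⟧ₚ E ≡ rootOrder E
rootOrder-≡ E = refl

Known : Pairs → List Val
Known o = nil ∷ List.map proj₁ o

data Order : Pairs → Set where
  []   : Order []
  snoc : ∀ {o c p} → Order o → p ∈ Known o → ¬ c ∈ Known o → Order (o ++ (c , p) ∷ [])

seen-true : ∀ v o → seen v o ≡ true → v ∈ Known o
seen-true v o e with eqb {val} v nil in e₁
... | true  = here (eqb-true val e₁)
... | false = let x , i , h = anyB-true o e in there (subst (_∈ List.map proj₁ o) (sym (eqb-true val h)) (∈ₚ.∈-map⁺ proj₁ i))

seen-false : ∀ v o → seen v o ≡ false → ¬ v ∈ Known o
seen-false v o e i with eqb {val} v nil in e₁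
seen-false v o e (here refl) | false = true≢false (eqb-refl val v) e₁
seen-false v o e (there i)   | false with ∈ₚ.∈-map⁻ proj₁ i
... | x , j , refl = true≢false (eqb-refl val v) (anyB-false {l = o} e j)

Links : Pairs → Pairs → Set
Links E = All (λ d → d ∈ E ⊎ (proj₂ d , proj₁ d) ∈ E)

known-++ : ∀ {o o′ v} → v ∈ Known o → v ∈ Known (o ++ o′)
known-++ (here e) = here e
known-++ {o} {o′} (there i) = there (subst (_ ∈_) (sym (Listₚ.map-++ proj₁ o o′)) (∈ₚ.∈-++⁺ˡ i))

known-last : ∀ o {c p} → c ∈ Known (o ++ (c , p) ∷ [])
known-last o {c} {p} = there (subst (c ∈_) (sym (Listₚ.map-++ proj₁ o ((c , p) ∷ []))) (∈ₚ.∈-++⁺ʳ (List.map proj₁ o) (here refl)))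

record Step (E : Pairs) (e : Val × Val) (o o′ : Pairs) : Set where
  field
    ordered′ : Order o′
    links    : Links E o′
    mono     : ∀ {v} → v ∈ Known o → v ∈ Known o′
    both     : proj₁ e ∈ Known o ⊎ proj₂ e ∈ Known o → proj₁ e ∈ Known o′ × proj₂ e ∈ Known o′

addEdge-step : ∀ {E e o} → e ∈ E → Order o → Links E o → Step E e o (addEdge e o)
addEdge-step {E} {u , w} {o} e∈ ord lk with seen u o in e₁ | seen w o in e₂
... | true | true = record { ordered′ = ord ; links = lk ; mono = λ i → i ; both = λ _ → seen-true u o e₁ , seen-true w o e₂ }
... | true | false rewrite foldr-∷ o ((w , u) ∷ []) = record
      { ordered′ = snoc ord (seen-true u o e₁) (seen-false w o e₂) ; links = Allₚ.++⁺ lk (inj₂ e∈ ∷ []) ; mono = known-++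
      ; both = λ _ → known-++ (seen-true u o e₁) , known-last o }
... | false | true rewrite foldr-∷ o ((u , w) ∷ []) = record
      { ordered′ = snoc ord (seen-true w o e₂) (seen-false u o e₁) ; links = Allₚ.++⁺ lk (inj₁ e∈ ∷ []) ; mono = known-++
      ; both = λ _ → known-last o , known-++ (seen-true w o e₂) }
... | false | false = record { ordered′ = ord ; links = lk ; mono = λ i → i
      ; both = λ { (inj₁ i) → ⊥-elim (seen-false u o e₁ i) ; (inj₂ i) → ⊥-elim (seen-false w o e₂ i) } }

record PassOk (E F o : Pairs) : Set where
  field
    orderₒ : Order (pass F o)
    linksₒ : Links E (pass F o)
    monoₒ  : ∀ {v} → v ∈ Known o → v ∈ Known (pass F o)
    bothₒ  : ∀ {e} → e ∈ F → proj₁ e ∈ Known o ⊎ proj₂ e ∈ Known o → proj₁ e ∈ Known (pass F o) × proj₂ e ∈ Known (pass F o)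

open PassOk
open Step

pass-ok : ∀ {E o} F → (∀ {e} → e ∈ F → e ∈ E) → Order o → Links E o → PassOk E F o
pass-ok [] h ord lk = record { orderₒ = ord ; linksₒ = lk ; monoₒ = λ i → i ; bothₒ = λ () }
pass-ok {E} {o} (e ∷ F) h ord lk = record
  { orderₒ = ordered′ s ; linksₒ = links s ; monoₒ = λ i → mono s (monoₒ r i)
  ; bothₒ = λ { (here refl) k → both s (later k) ; (there i) k → let a , b = bothₒ r i k in mono s a , mono s b } }
  where
  r : PassOk E F o
  r = pass-ok F (λ i → h (there i)) ord lk
  s : Step E e (pass F o) (addEdge e (pass F o))
  s = addEdge-step (h (here refl)) (orderₒ r) (linksₒ r)
  later : proj₁ e ∈ Known o ⊎ proj₂ e ∈ Known o → proj₁ e ∈ Known (pass F o) ⊎ proj₂ e ∈ Known (pass F o)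
  later (inj₁ i) = inj₁ (monoₒ r i)
  later (inj₂ i) = inj₂ (monoₒ r i)

passes : Pairs → Pairs → Pairs
passes E fuel = foldr (λ _ o → pass E o) [] fuel

passes-ok : ∀ E fuel → Order (passes E fuel) × Links E (passes E fuel)
passes-ok E [] = [] , []
passes-ok E (_ ∷ fuel) = let a , b = passes-ok E fuel ; r = pass-ok E (λ i → i) a b in orderₒ r , linksₒ r

-- The same fold as `process`, building the subtrees instead of their results.

kidsOf : Val → List (Val × Rose) → List Rose
kidsOf v = foldr (λ e acc → if eqb {val} v (proj₁ e) then proj₂ e ∷ acc else acc) []

restOf : Val → List (Val × Rose) → List (Val × Rose)
restOf v = foldr (λ e acc → if eqb {val} v (proj₁ e) then acc else e ∷ acc) []

hang : Val × Val → List (Val × Rose) → List (Val × Rose)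
hang e st = (proj₂ e , node (proj₁ e) (kidsOf (proj₁ e) st)) ∷ restOf (proj₁ e) st

rose : Pairs → Rose
rose o = node nil (kidsOf nil (foldr hang [] o))

module _ (R : Req) (k : Num) where

  solved : List (Val × Rose) → List (Val × Res)
  solved = List.map (λ e → proj₁ e , result R k (proj₂ e))

  childrenOf-solved : ∀ v st → childrenOf v (solved st) ≡ results R k (kidsOf v st)
  childrenOf-solved v [] = refl
  childrenOf-solved v (e ∷ st) with eqb {val} v (proj₁ e)
  ... | true  = cong (result R k (proj₂ e) ∷_) (childrenOf-solved v st)
  ... | false = childrenOf-solved v st

  othersOf-solved : ∀ v st → othersOf v (solved st) ≡ solved (restOf v st)
  othersOf-solved v [] = refl
  othersOf-solved v (e ∷ st) with eqb {val} v (proj₁ e)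
  ... | true  = othersOf-solved v st
  ... | false = cong (_ ∷_) (othersOf-solved v st)

  process-solved : ∀ o → process R k o ≡ solved (foldr hang [] o)
  process-solved [] = refl
  process-solved (e ∷ o) rewrite process-solved o = cong₂ _∷_
    (cong (λ rs → proj₂ e , finish R k (proj₁ e) rs) (childrenOf-solved (proj₁ e) (foldr hang [] o)))
    (othersOf-solved (proj₁ e) (foldr hang [] o))

-- Vertices and edges of the rooted tree

mutual
  edgesR : Rose → Pairs
  edgesR (node v ts) = edgesF v ts

  edgesF : Val → List Rose → Pairs
  edgesF v []       = []
  edgesF v (t ∷ ts) = (root t , v) ∷ edgesR t ++ edgesF v ts

vertsS : List (Val × Rose) → List Val
vertsS = concatMap (λ e → verts (proj₂ e))

edgesS : List (Val × Rose) → Pairs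
edgesS = concatMap (λ e → (root (proj₂ e) , proj₁ e) ∷ edgesR (proj₂ e))

hang-verts : ∀ v st → vertsF (kidsOf v st) ++ vertsS (restOf v st) ↭ vertsS st
hang-verts v [] = ↭-refl
hang-verts v (e ∷ st) with eqb {val} v (proj₁ e)
... | true  = ↭-trans (↭-reflexive (Listₚ.++-assoc (verts (proj₂ e)) _ _)) (Permₚ.++⁺ˡ (verts (proj₂ e)) (hang-verts v st))
... | false = ↭-trans (Permₚ.shifts (vertsF (kidsOf v st)) (verts (proj₂ e))) (Permₚ.++⁺ˡ (verts (proj₂ e)) (hang-verts v st))

hang-edges : ∀ v st → edgesF v (kidsOf v st) ++ edgesS (restOf v st) ↭ edgesS st
hang-edges v [] = ↭-refl
hang-edges v (e ∷ st) with eqb {val} v (proj₁ e) in eq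
... | true rewrite eqb-true val {v} {proj₁ e} eq = prep _ (↭-trans (↭-reflexive (Listₚ.++-assoc (edgesR (proj₂ e)) _ _)) (Permₚ.++⁺ˡ (edgesR (proj₂ e)) (hang-edges (proj₁ e) st)))
... | false = ↭-trans (Permₚ.shifts (edgesF v (kidsOf v st)) ((root (proj₂ e) , proj₁ e) ∷ edgesR (proj₂ e)))
  (Permₚ.++⁺ˡ ((root (proj₂ e) , proj₁ e) ∷ edgesR (proj₂ e)) (hang-edges v st))

restOf-parents : ∀ v {st} {P : Val → Set} → All (λ e → P (proj₁ e)) st → All (λ e → proj₁ e ≢ v × P (proj₁ e)) (restOf v st)
restOf-parents v [] = []
restOf-parents v {e ∷ st} (h ∷ hs) with eqb {val} v (proj₁ e) in eq
... | true  = restOf-parents v hs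
... | false = ((λ { refl → true≢false (eqb-refl val v) eq }) , h) ∷ restOf-parents v hs

record Spans (o : Pairs) (st : List (Val × Rose)) : Set where
  field
    vs : verts (node nil (kidsOf nil (foldr hang st o))) ↭ Known o ++ vertsS st
    es : edgesR (node nil (kidsOf nil (foldr hang st o))) ↭ o ++ edgesS st

open Spans

-- The order grows at its end whereas the right fold starts there. So the statement is generalised
-- to an arbitrary stock of finished subtrees whose parents are known, and the last pair is moved
-- into the stock.
spans : ∀ {o} → Order o → ∀ st → All (λ e → proj₁ e ∈ Known o) st → Spans o st
spans [] st h = record { vs = prep nil (proj₁ (all-nil st h)) ; es = proj₂ (all-nil st h) }
  where
  all-nil : ∀ st → All (λ e → proj₁ e ∈ nil ∷ []) st → vertsF (kidsOf nil st) ↭ vertsS st × edgesF nil (kidsOf nil st) ↭ edgesS st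
  all-nil [] [] = ↭-refl , ↭-refl
  all-nil ((.nil , t) ∷ st) (here refl ∷ h) = let a , b = all-nil st h in
    Permₚ.++⁺ˡ (verts t) a , prep _ (Permₚ.++⁺ˡ (edgesR t) b)
spans (snoc {o} {c} {p} ord p∈ c∉) st h = record
  { vs = subst (λ s → verts (node nil (kidsOf nil s)) ↭ Known (o ++ (c , p) ∷ []) ++ vertsS st) (sym (Listₚ.foldr-++ hang st o ((c , p) ∷ [])))
         (↭-trans (vs r) (↭-trans (Permₚ.++⁺ˡ (Known o) (prep c (hang-verts c st)))
           (prep nil (↭-reflexive (trans (sym (Listₚ.++-assoc (List.map proj₁ o) (c ∷ []) (vertsS st))) (cong (_++ vertsS st) (sym (Listₚ.map-++ proj₁ o ((c , p) ∷ [])))))))))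
  ; es = subst (λ s → edgesR (node nil (kidsOf nil s)) ↭ (o ++ (c , p) ∷ []) ++ edgesS st) (sym (Listₚ.foldr-++ hang st o ((c , p) ∷ [])))
         (↭-trans (es r) (↭-trans (Permₚ.++⁺ˡ o (prep (c , p) (hang-edges c st)))
           (↭-reflexive (sym (Listₚ.++-assoc o ((c , p) ∷ []) (edgesS st)))))) }
  where
  older : ∀ {v} → v ≢ c × v ∈ Known (o ++ (c , p) ∷ []) → v ∈ Known o
  older (ne , here e) = here e
  older (ne , there i) with ∈ₚ.∈-++⁻ (List.map proj₁ o) (subst (_ ∈_) (Listₚ.map-++ proj₁ o ((c , p) ∷ [])) i)
  ... | inj₁ j = there j
  ... | inj₂ (here e) = ⊥-elim (ne e)
  r : Spans o (hang (c , p) st)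
  r = spans ord (hang (c , p) st) (p∈ ∷ All.map older (restOf-parents c h))

rose-verts : ∀ {o} → Order o → verts (rose o) ↭ Known o
rose-verts {o} ord = ↭-trans (vs (spans ord [] [])) (↭-reflexive (Listₚ.++-identityʳ (Known o)))

rose-edges : ∀ {o} → Order o → edgesR (rose o) ↭ o
rose-edges {o} ord = ↭-trans (es (spans ord [] [])) (↭-reflexive (Listₚ.++-identityʳ o))

order-unique : ∀ {o} → Order o → Unique (Known o)
order-unique [] = [] ∷ []
order-unique (snoc {o} {c} {p} ord p∈ c∉) = subst Unique (cong (nil ∷_) (sym (Listₚ.map-++ proj₁ o ((c , p) ∷ []))))
  (allPairs-++⁺ (order-unique ord) ([] ∷ []) (All.tabulate (λ i → (λ { refl → c∉ i }) ∷ [])))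

order-parents : ∀ {o} → Order o → All (λ d → proj₂ d ∈ Known o) o
order-parents [] = []
order-parents (snoc {o} ord p∈ c∉) = Allₚ.++⁺ (All.map known-++ (order-parents ord)) (known-++ p∈ ∷ [])

-- Solutions of the rooted tree and sets of edges

Joined : List (List Val) → Val × Val → Set
Joined Ks e = Any (λ K → proj₁ e ∈ K × proj₂ e ∈ K) Ks

-- Besides the component of `v`, which is still open upwards, the forest falls into the closed parts
-- `Ks`. The field `kept` says that an edge outside of D never leaves its part.
record PartsF (R : Req) (v : Val) (ts : List Rose) (C : List Val) (n : ℕ) : Set where
  field
    {Ks}    : List (List Val)
    {D}     : Pairs
    covers  : C ++ concat Ks ↭ vertsF ts
    quiets  : All (λ K → Quiet R K) Ks
    size≡   : length D ≡ n
    removed : ∀ {e} → e ∈ D → e ∈ edgesF v ts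
    kept    : ∀ {e} → e ∈ edgesF v ts → e ∈ D ⊎ Joined ((v ∷ C) ∷ Ks) e

open PartsF

partsF : ∀ {R ts C n} v → SolF R ts C n → PartsF R v ts C n
partsF v [] = record { Ks = [] ; D = [] ; covers = ↭-refl ; quiets = [] ; size≡ = refl ; removed = λ () ; kept = λ () }
partsF v (join {t = t@(node w us)} {ts} {D = C₂} (sol {C = C₁} s q) ss) = record
  { Ks = Ks q₁ ++ Ks q₂ ; D = D q₁ ++ D q₂
  ; covers = ↭-trans (↭-reflexive (cong (((w ∷ C₁) ++ C₂) ++_) (sym (Listₚ.concat-++ (Ks q₁) (Ks q₂)))))
      (↭-trans (↭-reflexive (Listₚ.++-assoc (w ∷ C₁) C₂ _)) (↭-trans (Permₚ.++⁺ˡ (w ∷ C₁) (Permₚ.shifts C₂ (concat (Ks q₁))))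
        (↭-trans (↭-reflexive (sym (Listₚ.++-assoc (w ∷ C₁) (concat (Ks q₁)) _))) (Permₚ.++⁺ (prep w (covers q₁)) (covers q₂)))))
  ; quiets = Allₚ.++⁺ (quiets q₁) (quiets q₂)
  ; size≡ = trans (Listₚ.length-++ (D q₁)) (cong₂ _+_ (size≡ q₁) (size≡ q₂))
  ; removed = λ i → rem (∈ₚ.∈-++⁻ (D q₁) i)
  ; kept = kep }
  where
  q₁ = partsF w s
  q₂ = partsF v ss
  rem : ∀ {e} → e ∈ D q₁ ⊎ e ∈ D q₂ → e ∈ edgesF v (t ∷ ts)
  rem (inj₁ i) = there (∈ₚ.∈-++⁺ˡ (removed q₁ i))
  rem (inj₂ i) = there (∈ₚ.∈-++⁺ʳ (edgesR t) (removed q₂ i))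
  kep : ∀ {e} → e ∈ edgesF v (t ∷ ts) → e ∈ D q₁ ++ D q₂ ⊎ Joined ((v ∷ (w ∷ C₁) ++ C₂) ∷ Ks q₁ ++ Ks q₂) e
  kep (here refl) = inj₂ (here (there (here refl) , here refl))
  kep (there i) with ∈ₚ.∈-++⁻ (edgesR t) i
  ... | inj₁ j with kept q₁ j
  ...   | inj₁ k = inj₁ (∈ₚ.∈-++⁺ˡ k)
  ...   | inj₂ (here (a , b)) = inj₂ (here (there (∈ₚ.∈-++⁺ˡ a) , there (∈ₚ.∈-++⁺ˡ b)))
  ...   | inj₂ (there k) = inj₂ (there (Anyₚ.++⁺ˡ k))
  kep (there i) | inj₂ j with kept q₂ j
  ...   | inj₁ k = inj₁ (∈ₚ.∈-++⁺ʳ (D q₁) k)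
  ...   | inj₂ (here (a , b)) = inj₂ (here (up a , up b))
    where
    up : ∀ {x} → x ∈ v ∷ C₂ → x ∈ v ∷ (w ∷ C₁) ++ C₂
    up (here e)  = here e
    up (there l) = there (∈ₚ.∈-++⁺ʳ (w ∷ C₁) l)
  ...   | inj₂ (there k) = inj₂ (there (Anyₚ.++⁺ʳ (Ks q₁) k))
partsF v (cut {t = t@(node w us)} {ts} {D = C₂} (sol {C = C₁} s q) ss) = record
  { Ks = (w ∷ C₁) ∷ Ks q₁ ++ Ks q₂ ; D = (w , v) ∷ D q₁ ++ D q₂
  ; covers = ↭-trans (Permₚ.shifts C₂ (w ∷ C₁))
      (↭-trans (Permₚ.++⁺ˡ (w ∷ C₁) (↭-trans (Permₚ.++⁺ˡ C₂ (↭-reflexive (sym (Listₚ.concat-++ (Ks q₁) (Ks q₂))))) (Permₚ.shifts C₂ (concat (Ks q₁)))))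
        (↭-trans (↭-reflexive (sym (Listₚ.++-assoc (w ∷ C₁) (concat (Ks q₁)) _))) (Permₚ.++⁺ (prep w (covers q₁)) (covers q₂))))
  ; quiets = (λ {x} {y} → q {x} {y}) ∷ Allₚ.++⁺ (quiets q₁) (quiets q₂)
  ; size≡ = cong suc (trans (Listₚ.length-++ (D q₁)) (cong₂ _+_ (size≡ q₁) (size≡ q₂)))
  ; removed = λ { (here e) → here e ; (there i) → rem (∈ₚ.∈-++⁻ (D q₁) i) }
  ; kept = kep }
  where
  q₁ = partsF w s
  q₂ = partsF v ss
  rem : ∀ {e} → e ∈ D q₁ ⊎ e ∈ D q₂ → e ∈ edgesF v (t ∷ ts)
  rem (inj₁ i) = there (∈ₚ.∈-++⁺ˡ (removed q₁ i))
  rem (inj₂ i) = there (∈ₚ.∈-++⁺ʳ (edgesR t) (removed q₂ i))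
  kep : ∀ {e} → e ∈ edgesF v (t ∷ ts) → e ∈ (w , v) ∷ D q₁ ++ D q₂ ⊎ Joined ((v ∷ C₂) ∷ (w ∷ C₁) ∷ Ks q₁ ++ Ks q₂) e
  kep (here e) = inj₁ (here e)
  kep (there i) with ∈ₚ.∈-++⁻ (edgesR t) i
  ... | inj₁ j with kept q₁ j
  ...   | inj₁ k = inj₁ (there (∈ₚ.∈-++⁺ˡ k))
  ...   | inj₂ (here ab) = inj₂ (there (here ab))
  ...   | inj₂ (there k) = inj₂ (there (there (Anyₚ.++⁺ˡ k)))
  kep (there i) | inj₂ j with kept q₂ j
  ...   | inj₁ k = inj₁ (there (∈ₚ.∈-++⁺ʳ (D q₁) k))
  ...   | inj₂ (here ab) = inj₂ (here ab)
  ...   | inj₂ (there k) = inj₂ (there (there (Anyₚ.++⁺ʳ (Ks q₁) k)))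

module FromEdges (R : Req) (δ : Val × Val → Bool) where

  mutual
    comp : Rose → List Val
    comp (node v ts) = v ∷ compF v ts

    compF : Val → List Rose → List Val
    compF v []       = []
    compF v (t ∷ ts) = if δ (root t , v) then compF v ts else comp t ++ compF v ts

  module _ (Conn : Val → Val → Set) (conn-refl : ∀ v → Conn v v) (conn-trans : ∀ {x y z} → Conn x y → Conn y z → Conn x z)
           (conn-sym : ∀ {x y} → Conn x y → Conn y x) (quiet : ∀ {x y} → Conn x y → ¬ (x , y) ∈ R) where

    Linked : Pairs → Set
    Linked es = ∀ {e} → e ∈ es → δ e ≡ false → Conn (proj₁ e) (proj₂ e)

    mutual
      comp-conn : ∀ t → Linked (edgesR t) → ∀ {x} → x ∈ comp t → Conn x (root t)
      comp-conn (node v ts) h (here refl) = conn-refl v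
      comp-conn (node v ts) h (there i)   = compF-conn v ts h i

      compF-conn : ∀ v ts → Linked (edgesF v ts) → ∀ {x} → x ∈ compF v ts → Conn x v
      compF-conn v (t ∷ ts) h i with δ (root t , v) in e
      ... | true = compF-conn v ts (λ j → h (there (∈ₚ.∈-++⁺ʳ (edgesR t) j))) i
      ... | false with ∈ₚ.∈-++⁻ (comp t) i
      ...   | inj₁ j = conn-trans (comp-conn t (λ k → h (there (∈ₚ.∈-++⁺ˡ k))) j) (h (here refl) e)
      ...   | inj₂ j = compF-conn v ts (λ k → h (there (∈ₚ.∈-++⁺ʳ (edgesR t) k))) j

    mutual
      -- Reachability enters abstractly, as an equivalence relation that contains the surviving
      -- edges and no request. So graphs and rooted trees need not be compared here.
      sol-of : ∀ t → Linked (edgesR t) → Sol R t (comp t) (length (filterB δ (edgesR t)))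
      sol-of (node v ts) h = sol (solF-of v ts h) (λ i j → quiet (conn-trans (conn-of i) (conn-sym (conn-of j))))
        where
        conn-of : ∀ {x} → x ∈ comp (node v ts) → Conn x v
        conn-of = comp-conn (node v ts) h

      solF-of : ∀ v ts → Linked (edgesF v ts) → SolF R ts (compF v ts) (length (filterB δ (edgesF v ts)))
      solF-of v [] h = []
      solF-of v (t ∷ ts) h with δ (root t , v) | sol-of t (λ k → h (there (∈ₚ.∈-++⁺ˡ k))) | solF-of v ts (λ k → h (there (∈ₚ.∈-++⁺ʳ (edgesR t) k)))
      ... | true  | s | ss = subst (SolF R (t ∷ ts) _) (cong suc (sym (len (edgesR t)))) (cut s ss)
        where
        len : ∀ es → length (filterB δ (es ++ edgesF v ts)) ≡ length (filterB δ es) + length (filterB δ (edgesF v ts))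
        len [] = refl
        len (e ∷ es) with δ e
        ... | true  = cong suc (len es)
        ... | false = len es
      ... | false | s | ss = subst (SolF R (t ∷ ts) _) (sym (len (edgesR t))) (join s ss)
        where
        len : ∀ es → length (filterB δ (es ++ edgesF v ts)) ≡ length (filterB δ es) + length (filterB δ (edgesF v ts))
        len [] = refl
        len (e ∷ es) with δ e
        ... | true  = cong suc (len es)
        ... | false = len es

module Walks (G : Graph) where

  adj-sym : ∀ {u v} → Adj G u v → Adj G v u
  adj-sym (inj₁ i) = inj₂ i
  adj-sym (inj₂ i) = inj₁ i

  _◅◅_ : ∀ {u v w} → Walk G u v → Walk G v w → Walk G u w
  stop     ◅◅ q = q
  step a p ◅◅ q = step a (p ◅◅ q)

  reverse : ∀ {u v} → Walk G u v → Walk G v u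
  reverse stop       = stop
  reverse (step a p) = reverse p ◅◅ step (adj-sym a) stop

  open DecMembership (Finₚ._≟_ {order G}) using (_∈?_)

  suffix : ∀ {u v w} (p : Walk G v w) → Unique (vertices p) → u ∈ vertices p → Path G u w
  suffix stop u (here refl) = stop , u
  suffix (step a p) u (here refl) = step a p , u
  suffix (step a p) (_ ∷ u) (there i) = suffix p u i

  -- Loop erasure: if the new first vertex occurs later on, the path from that occurrence is used.
  path : ∀ {u v} → Walk G u v → Path G u v
  path stop = stop , [] ∷ []
  path {u} (step a p) with path p
  ... | q , uq with u ∈? vertices q
  ...   | yes i = suffix q uq i
  ...   | no ∉ = step a q , All.tabulate (λ i e → ∉ (subst (_∈ vertices q) (sym e) i)) ∷ uq

-- A relation instead of a function, since a pair of labels may match an edge in either orientation.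
pigeon : ∀ {A B : Set} {M : A → B → Set} {xs : List A} {ys : List B} → AllPairs (λ x x′ → ∀ {y} → M x y → M x′ y → ⊥) xs →
         All (λ x → ∃[ y ] (y ∈ ys × M x y)) xs → length xs ≤ₙ length ys
pigeon [] _ = z≤n
pigeon {M = M} {x ∷ xs} {ys} (ne ∷ ap) ((y , y∈ , m) ∷ h) with ∈ₚ.∈-∃++ y∈
... | as , bs , refl = ℕₚ.≤-trans (s≤s (pigeon ap (All.zipWith other (ne , h))))
      (ℕₚ.≤-reflexive (trans (cong suc (Listₚ.length-++ as)) (trans (sym (ℕₚ.+-suc (length as) (length bs))) (sym (Listₚ.length-++ as)))))
  where
  other : ∀ {x′} → (∀ {y} → M x y → M x′ y → ⊥) × (∃[ y′ ] (y′ ∈ as ++ y ∷ bs × M x′ y′)) → ∃[ y′ ] (y′ ∈ as ++ bs × M x′ y′)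
  other (clash , y′ , i , m′) with ∈ₚ.∈-++⁻ as i
  ... | inj₁ j = y′ , ∈ₚ.∈-++⁺ˡ j , m′
  ... | inj₂ (here refl) = ⊥-elim (clash m m′)
  ... | inj₂ (there j) = y′ , ∈ₚ.∈-++⁺ʳ as j , m′

encodeℕᵇ-inj : ∀ x y → encodeℕᵇ x ≡ encodeℕᵇ y → x ≡ y
encodeℕᵇ-inj ℕᵇ.zero ℕᵇ.zero e = refl
encodeℕᵇ-inj ℕᵇ.2[1+ x ] ℕᵇ.2[1+ y ] e = cong ℕᵇ.2[1+_] (encodeℕᵇ-inj x y (proj₂ (∙-inj e)))
encodeℕᵇ-inj ℕᵇ.1+[2 x ] ℕᵇ.1+[2 y ] e = cong ℕᵇ.1+[2_] (encodeℕᵇ-inj x y (proj₂ (∙-inj e)))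
encodeℕᵇ-inj ℕᵇ.2[1+ x ] ℕᵇ.1+[2 y ] e with () ← proj₁ (∙-inj e)
encodeℕᵇ-inj ℕᵇ.1+[2 x ] ℕᵇ.2[1+ y ] e with () ← proj₁ (∙-inj e)

lab : ∀ {n} → Fin n → Val
lab u = encodeℕ (toℕ u)

lab-inj : ∀ {n} {u v : Fin n} → lab u ≡ lab v → u ≡ v
lab-inj e = Finₚ.toℕ-injective (ℕᵇₚ.fromℕ-injective (encodeℕᵇ-inj _ _ e))

labs : ∀ {n} → Fin n × Fin n → Val × Val
labs (u , v) = lab u , lab v

labels : ∀ {n} → List (Fin n × Fin n) → Pairs
labels = List.map labs

unique-part : ∀ {Ks : List (List Val)} {K K′ x} → Unique (concat Ks) → K ∈ Ks → K′ ∈ Ks → x ∈ K → x ∈ K′ → K ≡ K′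
unique-part {K ∷ Ks} u (here refl) (here refl) i j = refl
unique-part {K ∷ Ks} u (here refl) (there k) i j = ⊥-elim (disjoint′ i (∈ₚ.∈-concat⁺′ j k))
  where
  disjoint′ : ∀ {x} → x ∈ K → x ∈ concat Ks → ⊥
  disjoint′ i j = All.lookup (All.lookup (proj₂ (proj₂ (allPairs-++⁻ K u))) i) j refl
unique-part {K ∷ Ks} u (there k) (here refl) i j = ⊥-elim (disjoint′ j (∈ₚ.∈-concat⁺′ i k))
  where
  disjoint′ : ∀ {x} → x ∈ K → x ∈ concat Ks → ⊥
  disjoint′ i j = All.lookup (All.lookup (proj₂ (proj₂ (allPairs-++⁻ K u))) i) j refl
unique-part {K ∷ Ks} u (there k) (there k′) i j = unique-part (proj₁ (proj₂ (allPairs-++⁻ K u))) k k′ i j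

allPairs-filterB : ∀ {A : Set} {P : A → A → Set} (p : A → Bool) {xs} → AllPairs P xs → AllPairs P (filterB p xs)
allPairs-filterB p [] = []
allPairs-filterB p {x ∷ xs} (a ∷ q) with p x
... | true  = All.tabulate (λ i → All.lookup a (filterB-⊆ p xs i)) ∷ allPairs-filterB p q
... | false = allPairs-filterB p q

flip : ∀ {A B : Set} → A × B → B × A
flip (x , y) = y , x

zeroᶠ : ∀ n → NonZero n → Fin n
zeroᶠ (suc n) _ = Fin.zero

lab-zeroᶠ : ∀ n nz → lab (zeroᶠ n nz) ≡ nil
lab-zeroᶠ (suc n) _ = refl

vertices-step : ∀ {G u v} (p : Walk G u v) → ∀ {x} → x ∈ vertices p → x ≡ v ⊎ x ∈ List.map proj₁ (edges G) ++ List.map proj₂ (edges G)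
vertices-step stop (here e) = inj₁ e
vertices-step (step (inj₁ a) p) (here refl) = inj₂ (∈ₚ.∈-++⁺ˡ (∈ₚ.∈-map⁺ proj₁ a))
vertices-step {G} (step (inj₂ a) p) (here refl) = inj₂ (∈ₚ.∈-++⁺ʳ (List.map proj₁ (edges G)) (∈ₚ.∈-map⁺ proj₂ a))
vertices-step (step a p) (there i) = vertices-step p i

steps : ∀ {G u v} → Walk G u v → ℕ
steps stop       = 0
steps (step _ p) = suc (steps p)

steps-vertices : ∀ {G u v} (p : Walk G u v) → length (vertices p) ≡ suc (steps p)
steps-vertices stop       = refl
steps-vertices (step a p) = cong suc (steps-vertices p)

path-short : ∀ {G u v} (p : Walk G u v) → Unique (vertices p) → steps p ≤ₙ length (edges G) + length (edges G)
path-short {G} {v = v} p u = ℕₚ.≤-pred (ℕₚ.≤-trans (ℕₚ.≤-reflexive (sym (steps-vertices p)))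
  (ℕₚ.≤-trans (unique-⊆-length {ys = v ∷ List.map proj₁ (edges G) ++ List.map proj₂ (edges G)} u (λ i → sub (vertices-step p i)))
    (s≤s (ℕₚ.≤-reflexive (trans (Listₚ.length-++ (List.map proj₁ (edges G))) (cong₂ _+_ (Listₚ.length-map proj₁ (edges G)) (Listₚ.length-map proj₂ (edges G))))))))
  where
  sub : ∀ {x ys} → x ≡ v ⊎ x ∈ ys → x ∈ v ∷ ys
  sub (inj₁ e) = here e
  sub (inj₂ i) = there i

-- Comparing the graph with its rooted tree

module Rooted (G : Graph) (tree : IsTree G) where

  open IsTree tree

  r : Vertex G
  r = zeroᶠ (order G) (proj₁ connected)

  lab-r : lab r ≡ nil
  lab-r = lab-zeroᶠ (order G) (proj₁ connected)

  E : Pairs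
  E = labels (edges G)

  o : Pairs
  o = rootOrder E

  order-o : Order o
  order-o = proj₁ (passes-ok E (appB E E))

  links-o : Links E o
  links-o = proj₂ (passes-ok E (appB E E))

  adj-labels : ∀ {u v} → Adj G u v → labs (u , v) ∈ E ⊎ labs (v , u) ∈ E
  adj-labels (inj₁ i) = inj₁ (∈ₚ.∈-map⁺ labs i)
  adj-labels (inj₂ i) = inj₂ (∈ₚ.∈-map⁺ labs i)

  known-walk : ∀ {v} (p : Walk G v r) fuel → steps p ≤ₙ length fuel → lab v ∈ Known (passes E fuel)
  known-walk stop fuel le = here lab-r
  known-walk (step a p) (x ∷ fuel) (s≤s le) = go (adj-labels a)
    where
    ok : PassOk E E (passes E fuel)
    ok = pass-ok E (λ i → i) (proj₁ (passes-ok E fuel)) (proj₂ (passes-ok E fuel))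
    go : _ → _
    go (inj₁ i) = proj₁ (PassOk.bothₒ ok i (inj₂ (known-walk p fuel le)))
    go (inj₂ i) = proj₂ (PassOk.bothₒ ok i (inj₁ (known-walk p fuel le)))

  known : ∀ v → lab v ∈ Known o
  known v = let p , u = proj₂ connected v r in known-walk p (appB E E) (ℕₚ.≤-trans (path-short p u) (ℕₚ.≤-reflexive (sym
    (trans (cong length (foldr-∷ E E)) (trans (Listₚ.length-++ E) (cong₂ _+_ (Listₚ.length-map labs (edges G)) (Listₚ.length-map labs (edges G))))))))

  Match : Val × Val → Edge (order G) → Set
  Match d e = d ≡ labs e ⊎ d ≡ flip (labs e)

  labs-inj : ∀ {e e′ : Edge (order G)} → labs e ≡ labs e′ → e ≡ e′
  labs-inj h = cong₂ _,_ (lab-inj (cong proj₁ h)) (lab-inj (cong proj₂ h))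

  ascending : ∀ {e} → e ∈ edges G → uncurry Fin._<_ e
  ascending = All.lookup (ordered G)

  -- Edges are listed in ascending form only, so no listed edge is the reversal of another.
  match-inj : ∀ {d e e′} → e ∈ edges G → e′ ∈ edges G → Match d e → Match d e′ → e ≡ e′
  match-inj i j (inj₁ a) (inj₁ b) = labs-inj (trans (sym a) b)
  match-inj i j (inj₂ a) (inj₂ b) = labs-inj (cong flip (trans (sym a) b))
  match-inj {e = e} {e′} i j (inj₁ a) (inj₂ b) = ⊥-elim (ℕₚ.<-asym (ascending i) (subst (uncurry Fin._<_) (cong flip (labs-inj {flip e′} {e} (trans (sym b) a))) (ascending j)))
  match-inj {e = e} {e′} i j (inj₂ a) (inj₁ b) = ⊥-elim (ℕₚ.<-asym (ascending i) (subst (uncurry Fin._<_) (labs-inj {e′} {flip e} (trans (sym b) a)) (ascending j)))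

  link-match : ∀ {d} → d ∈ E ⊎ flip d ∈ E → ∃[ e ] (e ∈ edges G × Match d e)
  link-match (inj₁ i) = let e , j , h = ∈ₚ.∈-map⁻ labs i in e , j , inj₁ h
  link-match (inj₂ i) = let e , j , h = ∈ₚ.∈-map⁻ labs i in e , j , inj₂ (cong flip h)

  module _ (H : List (Edge (order G))) where

    order-walk : ∀ {o} → Order o → All (λ d → ∃[ a ] ∃[ b ] (d ≡ labs (a , b) × Adj (G − H) a b)) o →
                 ∀ {x} → lab x ∈ Known o → Walk (G − H) x r
    order-walk [] h (here e) = subst (λ x → Walk (G − H) x r) (lab-inj (trans lab-r (sym e))) stop
    order-walk (snoc {o} {c} {p} ord p∈ c∉) h {x} i = go (Allₚ.++⁻ o h) i
      where
      go : _ → lab x ∈ Known (o ++ (c , p) ∷ []) → Walk (G − H) x r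
      go (hs , _) (here e) = order-walk ord hs (here e)
      go (hs , ((a , b , refl , ab) ∷ [])) (there i) with ∈ₚ.∈-++⁻ (List.map proj₁ o) (subst (lab x ∈_) (Listₚ.map-++ proj₁ o ((c , p) ∷ [])) i)
      ... | inj₁ j = order-walk ord hs (there j)
      ... | inj₂ (here e) = subst (λ x → Walk (G − H) x r) (lab-inj (sym e)) (step ab (order-walk ord hs p∈))

  open DecMembership (_≟ᵉ_ {order G}) using (_∈?_)

  kept⁺ : ∀ {e H} → e ∈ edges G → ¬ e ∈ H → e ∈ edges (G − H)
  kept⁺ {H = H} i h = ∈ₚ.∈-filter⁺ (λ e → ¬? (e ∈? H)) i h

  kept⁻ : ∀ {e H} → e ∈ edges (G − H) → e ∈ edges G × ¬ e ∈ H
  kept⁻ {H = H} i = ∈ₚ.∈-filter⁻ (λ e → ¬? (e ∈? H)) i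

  link-adj : ∀ {d H} → d ∈ E ⊎ flip d ∈ E → (∀ {e} → Match d e → ¬ e ∈ H) → ∃[ a ] ∃[ b ] (d ≡ labs (a , b) × Adj (G − H) a b)
  link-adj l h with link-match l
  ... | e , i , inj₁ m = proj₁ e , proj₂ e , m , inj₁ (kept⁺ i (h (inj₁ m)))
  ... | e , i , inj₂ m = proj₂ e , proj₁ e , m , inj₂ (kept⁺ i (h (inj₂ m)))

  -- An edge that is not in the order would close a cycle with the path in the
  -- rest of the graph.

  listed : ∀ {e} → e ∈ edges G → labs e ∈ o ⊎ flip (labs e) ∈ o
  listed {e = e@(u , w)} i with memB (val ⊗ val) (labs e) o in h₁ | memB (val ⊗ val) (flip (labs e)) o in h₂
  ... | true  | _     = inj₁ (memB-true (val ⊗ val) o h₁)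
  ... | false | true  = inj₂ (memB-true (val ⊗ val) o h₂)
  ... | false | false = ⊥-elim (acyclic (u , w , closing (path (order-walk H order-o listed-adj (known u) ◅◅ reverse (order-walk H order-o listed-adj (known w))))))
    where
    H : List (Edge (order G))
    H = e ∷ []
    open Walks (G − H)
    listed-adj : All (λ d → ∃[ a ] ∃[ b ] (d ≡ labs (a , b) × Adj (G − H) a b)) o
    listed-adj = All.tabulate (λ j → link-adj (All.lookup links-o j) (λ { (inj₁ refl) (here refl) → memB-false (val ⊗ val) {l = o} h₁ j
                                                                  ; (inj₂ refl) (here refl) → memB-false (val ⊗ val) {l = o} h₂ j }))
    whole : ∀ {a b} → Adj (G − H) a b → Adj G a b
    whole (inj₁ j) = inj₁ (proj₁ (kept⁻ j))
    whole (inj₂ j) = inj₂ (proj₁ (kept⁻ j))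
    liftW : ∀ {a b} → Walk (G − H) a b → Walk G a b
    liftW stop       = stop
    liftW (step a p) = step (whole a) (liftW p)
    liftW-vertices : ∀ {a b} (p : Walk (G − H) a b) → vertices (liftW p) ≡ vertices p
    liftW-vertices stop       = refl
    liftW-vertices (step a p) = cong (_ ∷_) (liftW-vertices p)
    long : ∀ (p : Walk (G − H) u w) → 3 ≤ₙ length (vertices p)
    long stop = ⊥-elim (ℕₚ.<-irrefl refl (ascending i))
    long (step (inj₁ j) stop) = ⊥-elim (proj₂ (kept⁻ j) (here refl))
    long (step (inj₂ j) stop) = ⊥-elim (ℕₚ.<-asym (ascending i) (ascending (proj₁ (kept⁻ j))))
    long (step a (step b stop)) = s≤s (s≤s (s≤s z≤n))
    long (step a (step b (step c p))) = s≤s (s≤s (s≤s z≤n))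
    closing : Path (G − H) u w → _
    closing (p , q) = liftW p , subst Unique (sym (liftW-vertices p)) q , subst (λ l → 3 ≤ₙ length l) (sym (liftW-vertices p)) (long p) , inj₂ i

  Clash : Val × Val → Val × Val → Set
  Clash d d′ = ∀ {e} → Match d e → Match d′ e → ⊥

  -- The child of a later pair is new, so it is neither the child nor the parent in an earlier pair;
  -- hence no edge is listed twice, in whatever orientation.
  order-clash : ∀ {o} → Order o → AllPairs Clash o
  order-clash [] = []
  order-clash (snoc {o} {c} {p} ord p∈ c∉) = allPairs-++⁺ (order-clash ord) ([] ∷ []) (All.tabulate (λ i → (λ {e} → clash i {e}) ∷ []))
    where
    clash : ∀ {d} → d ∈ o → Clash d (c , p)
    clash i (inj₁ refl) (inj₁ refl) = c∉ (there (∈ₚ.∈-map⁺ proj₁ i))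
    clash i (inj₁ refl) (inj₂ refl) = c∉ (All.lookup (order-parents ord) i)
    clash i (inj₂ refl) (inj₁ refl) = c∉ (All.lookup (order-parents ord) i)
    clash i (inj₂ refl) (inj₂ refl) = c∉ (there (∈ₚ.∈-map⁺ proj₁ i))

  module _ (R : List (Vertex G × Vertex G)) where

    Separates : List (Edge (order G)) → Set
    Separates E' = ∀ u v → (u , v) ∈ R → ¬ Path (G − E') u v

    request : ∀ {x y} → (x , y) ∈ labels R → ∃[ u ] ∃[ v ] ((u , v) ∈ R × x ≡ lab u × y ≡ lab v)
    request i with ∈ₚ.∈-map⁻ labs i
    ... | (u , v) , j , refl = u , v , j , refl , refl

    module _ {E' : List (Edge (order G))} (sep : Separates E') where

      open Walks (G − E')

      removed? : Val × Val → Bool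
      removed? d = if memB (val ⊗ val) d (labels E') then true else memB (val ⊗ val) (flip d) (labels E')

      -- Equality is added so that the relation is reflexive on all labels, also on those that
      -- belong to no vertex.
      Conn : Val → Val → Set
      Conn x y = x ≡ y ⊎ ∃[ u ] ∃[ v ] (x ≡ lab u × y ≡ lab v × Walk (G − E') u v)

      conn-trans : ∀ {x y z} → Conn x y → Conn y z → Conn x z
      conn-trans (inj₁ refl) c = c
      conn-trans (inj₂ c) (inj₁ refl) = inj₂ c
      conn-trans (inj₂ (u , v , a , b , p)) (inj₂ (v′ , w , c , d , q)) =
        inj₂ (u , w , a , d , p ◅◅ subst (λ v → Walk (G − E') v w) (lab-inj (trans (sym c) b)) q)

      conn-sym : ∀ {x y} → Conn x y → Conn y x
      conn-sym (inj₁ e) = inj₁ (sym e)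
      conn-sym (inj₂ (u , v , a , b , p)) = inj₂ (v , u , b , a , reverse p)

      conn-quiet : ∀ {x y} → Conn x y → ¬ (x , y) ∈ labels R
      conn-quiet c i with request i
      conn-quiet (inj₁ h) i | u , v , j , a , b with lab-inj {u = u} {v} (trans (sym a) (trans h b))
      ... | refl = sep u u j (path stop)
      conn-quiet (inj₂ (u′ , v′ , a′ , b′ , p)) i | u , v , j , a , b with lab-inj {u = u′} {u} (trans (sym a′) a) | lab-inj {u = v′} {v} (trans (sym b′) b)
      ... | refl | refl = sep u v j (path p)

      removed-match : ∀ {d} → removed? d ≡ true → ∃[ e ] (e ∈ E' × Match d e)
      removed-match {d} h with memB (val ⊗ val) d (labels E') in h₁
      ... | true  = let e , i , q = ∈ₚ.∈-map⁻ labs (memB-true (val ⊗ val) (labels E') h₁) in e , i , inj₁ q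
      ... | false = let e , i , q = ∈ₚ.∈-map⁻ labs (memB-true (val ⊗ val) (labels E') h) in e , i , inj₂ (cong flip q)

      unremoved : ∀ {d} → removed? d ≡ false → ∀ {e} → Match d e → ¬ e ∈ E'
      unremoved {d} h m i with memB (val ⊗ val) d (labels E') in h₁
      unremoved {d} h (inj₁ refl) i | false = memB-false (val ⊗ val) {l = labels E'} h₁ (∈ₚ.∈-map⁺ labs i)
      unremoved {d} h (inj₂ refl) i | false = memB-false (val ⊗ val) {l = labels E'} h (∈ₚ.∈-map⁺ labs i)

      open FromEdges (labels R) removed?

      -- The tree edges cut are those of the order that match an edge of `E'`. Different ones match
      -- different edges, so there are at most `length E'` of them.
      separated-sol : ∃[ C ] ∃[ n ] (Sol (labels R) (rose o) C n × n ≤ₙ length E')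
      separated-sol = comp (rose o) , _ , sol-of Conn (λ _ → inj₁ refl) conn-trans conn-sym conn-quiet (rose o) linked , cost
        where
        linked : ∀ {d} → d ∈ edgesR (rose o) → removed? d ≡ false → Conn (proj₁ d) (proj₂ d)
        linked i h with link-adj (All.lookup links-o (Permₚ.∈-resp-↭ (rose-edges order-o) i)) (unremoved h)
        ... | a , b , refl , ab = inj₂ (a , b , refl , refl , step ab stop)
        cost : length (filterB removed? (edgesR (rose o))) ≤ₙ length E'
        cost = pigeon {M = Match} (allPairs-filterB removed? (allPairs-↭ (λ c {e} a b → c {e} b a) (↭-sym (rose-edges order-o)) (order-clash order-o)))
          (All.map removed-match (filterB-all removed? (edgesR (rose o))))

    Chosen : Pairs → Set
    Chosen = All (λ d → ∃[ e ] (e ∈ edges G × Match d e))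

    cut-edges : ∀ {D} → (∀ {d} → d ∈ D → d ∈ edgesR (rose o)) → Chosen D
    cut-edges h = All.tabulate (λ i → link-match (All.lookup links-o (Permₚ.∈-resp-↭ (rose-edges order-o) (h i))))

    chosen : ∀ {D} → Chosen D → List (Edge (order G))
    chosen = All.reduce proj₁

    chosen-length : ∀ {D} (h : Chosen D) → length (chosen h) ≡ length D
    chosen-length []      = refl
    chosen-length (_ ∷ h) = cong suc (chosen-length h)

    chosen-∈ : ∀ {D d} (h : Chosen D) → d ∈ D → ∃[ e ] (e ∈ chosen h × e ∈ edges G × Match d e)
    chosen-∈ ((e , i , m) ∷ h) (here refl) = e , here refl , i , m
    chosen-∈ (_ ∷ h) (there j) = let e , i , m = chosen-∈ h j in e , there i , m

    -- A walk in the remaining graph never leaves its part, and no part contains a request.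
    -- Filtering the edge list by the chosen edges makes `E'` a duplicate-free subset.
    sol-separates : ∀ {C n} → Sol (labels R) (rose o) C n → ∃[ E' ] (Unique E' × (∀ {e} → e ∈ E' → e ∈ edges G) × length E' ≤ₙ n × Separates E')
    sol-separates {n = n} (sol {C = C} ss q) = E' , Uniqueₚ.filter⁺ (_∈? chosen cs) (unique G) , (λ i → proj₁ (∈ₚ.∈-filter⁻ (_∈? chosen cs) i)) ,
      ℕₚ.≤-trans (unique-⊆-length (Uniqueₚ.filter⁺ (_∈? chosen cs) (unique G)) (λ i → proj₂ (∈ₚ.∈-filter⁻ (_∈? chosen cs) {xs = edges G} i)))
        (ℕₚ.≤-reflexive (trans (chosen-length cs) (PartsF.size≡ parts))) ,
      separates
      where
      ts : List Rose
      ts = kidsOf nil (foldr hang [] o)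
      parts : PartsF (labels R) nil ts C n
      parts = partsF nil ss
      cuts : Pairs
      cuts = PartsF.D parts
      cs : Chosen cuts
      cs = cut-edges (PartsF.removed parts)
      E' : List (Edge (order G))
      E' = List.filter (_∈? chosen cs) (edges G)
      Qs : List (List Val)
      Qs = (nil ∷ C) ∷ PartsF.Ks parts
      all-verts : concat Qs ↭ Known o
      all-verts = ↭-trans (prep nil (PartsF.covers parts)) (rose-verts order-o)
      quiet : All (Quiet (labels R)) Qs
      quiet = (λ {x} {y} → q {x} {y}) ∷ PartsF.quiets parts
      uniq : Unique (concat Qs)
      uniq = allPairs-↭ (λ ne e → ne (sym e)) (↭-sym all-verts) (order-unique order-o)
      kept-joined : ∀ {d} → d ∈ o → (∀ {e} → e ∈ edges G → Match d e → ¬ e ∈ E') → Joined Qs d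
      kept-joined i h with PartsF.kept parts (Permₚ.∈-resp-↭ (↭-sym (rose-edges order-o)) i)
      ... | inj₁ j = let e , k , l , m = chosen-∈ cs j in ⊥-elim (h l m (∈ₚ.∈-filter⁺ (_∈? chosen cs) l k))
      ... | inj₂ j = j
      listed-joined : ∀ {e} → e ∈ edges G → ¬ e ∈ E' → labs e ∈ o ⊎ flip (labs e) ∈ o → Joined Qs (labs e) ⊎ Joined Qs (flip (labs e))
      listed-joined j j∉ (inj₁ l) = inj₁ (kept-joined l (λ k m k∈ → j∉ (subst (_∈ E') (match-inj k j m (inj₁ refl)) k∈)))
      listed-joined j j∉ (inj₂ l) = inj₂ (kept-joined l (λ k m k∈ → j∉ (subst (_∈ E') (match-inj k j m (inj₂ refl)) k∈)))
      edge-joined : ∀ {e} → e ∈ edges (G − E') → Joined Qs (labs e) ⊎ Joined Qs (flip (labs e))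
      edge-joined i = listed-joined (proj₁ (kept⁻ i)) (proj₂ (kept⁻ i)) (listed (proj₁ (kept⁻ i)))
      joined-moves : ∀ {x y K} → Joined Qs (x , y) ⊎ Joined Qs (y , x) → K ∈ Qs → x ∈ K → y ∈ K
      joined-moves (inj₁ a) k i with find a
      ... | K′ , k′ , i′ , j′ = subst (_ ∈_) (unique-part uniq k′ k i′ i) j′
      joined-moves (inj₂ a) k i with find a
      ... | K′ , k′ , j′ , i′ = subst (_ ∈_) (unique-part uniq k′ k i′ i) j′
      adj-joined : ∀ {u v} → Adj (G − E') u v → Joined Qs (labs (u , v)) ⊎ Joined Qs (labs (v , u))
      adj-joined (inj₁ i) = edge-joined i
      adj-joined (inj₂ i) = swap (edge-joined i)
      stays : ∀ {u v K} → Walk (G − E') u v → K ∈ Qs → lab u ∈ K → lab v ∈ K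
      stays stop       k i = i
      stays (step a p) k i = stays p k (joined-moves (adj-joined a) k i)
      separates : Separates E'
      separates u v i (p , _) = let K , j , k = ∈ₚ.∈-concat⁻′ Qs (Permₚ.∈-resp-↭ (↭-sym all-verts) (known u)) in
        All.lookup quiet k j (stays p k j) (∈ₚ.∈-map⁺ labs i)

-- Sizes of the intermediate results

sel-length : ∀ {φ σ} → Sel φ σ → length σ ≡ length φ
sel-length []        = refl
sel-length (left s)  = cong suc (sel-length s)
sel-length (right s) = cong suc (sel-length s)

loop-result : ∀ R v rs l → length (proj₁ (loop R v rs l)) ≤ₙ length l
              × (proj₂ (loop R v rs l) ≡ [] ⊎ (length (proj₁ (loop R v rs l)) <ₙ length l × proj₂ (loop R v rs l) ≡ gen R v rs (proj₁ (loop R v rs l))))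
loop-result R v rs [] = z≤n , inj₁ refl
loop-result R v rs (_ ∷ l) with loop R v rs l | loop-result R v rs l
... | d , φ ∷ φs | le , inj₂ (lt , e) = ℕₚ.m≤n⇒m≤1+n le , inj₂ (ℕₚ.m≤n⇒m≤1+n lt , e)
... | d , []     | le , _ = go (gen R v rs d) refl
  where
  result′ : List Family → Num × List Family
  result′ F = caseL F (tt ∷ d , []) (λ φ φs → d , φ ∷ φs)
  go : ∀ F → gen R v rs d ≡ F → length (proj₁ (result′ F)) ≤ₙ suc (length l)
       × (proj₂ (result′ F) ≡ [] ⊎ (length (proj₁ (result′ F)) <ₙ suc (length l) × proj₂ (result′ F) ≡ gen R v rs (proj₁ (result′ F))))
  go []       e = s≤s le , inj₁ refl
  go (φ ∷ φs) e = ℕₚ.m≤n⇒m≤1+n le , inj₂ (s≤s le , sym e)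

drop-room : ∀ {x} k m → x <ₙ length (dropB (tt ∷ k) m) → length m + x ≤ₙ length k
drop-room {x} k m lt = ℕₚ.≤-pred (go (suc (length k)) (length m) (subst (x <ₙ_) (length-drop (tt ∷ k) m) lt))
  where
  go : ∀ a b → x <ₙ a ∸ b → b + x <ₙ a
  go a zero h = h
  go (suc a) (suc b) h = s≤s (go a b h)

weak-two : ∀ m {n} → m ≤ₙ 2 → Weak m n → n ≤ₙ 2
-- 961 = 31² is less than 1200 = 20² · 3.
weak-two m {n} le h = ℕₚ.≮⇒≥ λ 2<n → ℕₚ.<⇒≱ (ℕₚ.≤ᵇ⇒≤ 962 1200 _)
  (weak-elim 2 (weak-mono 2 2<n (subst (λ x → Weak x n) (ℕₚ.m∸n+n≡m le) (weak-+ m (2 ∸ m) h))))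

simple-few : ∀ m F → simpleB m F ≡ true → F ≡ [] ⊎ Weak (length m) (length F) → length F ≤ₙ 2
simple-few m F e (inj₁ refl) = z≤n
simple-few m F e (inj₂ h) = go (simpleB m F) e (simple-spec m F)
  where
  go : ∀ b → b ≡ true → SimpleSpec m F b → length F ≤ₙ 2
  go _ refl (yes₁ le)  = weak-two (length m) (ℕₚ.m≤n⇒m≤1+n le) h
  go _ refl (yes₂ e _) = weak-two (length m) (ℕₚ.≤-reflexive e) h

options-count : ∀ R F → length (options R F) ≤ₙ length F + length F
options-count R F = ℕₚ.≤-trans (unique-⊆-length (options-unique R F) sub)
  (ℕₚ.≤-reflexive (trans (Listₚ.length-++ (List.map (λ φ → merge (lefts φ)) F)) (cong₂ _+_ (Listₚ.length-map _ F) (Listₚ.length-map _ F))))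
  where
  sub : ∀ {o} → o ∈ options R F → o ∈ List.map (λ φ → merge (lefts φ)) F ++ List.map (λ φ → merge (rights φ)) F
  sub i with options-∈⁻ R F i
  ... | φ , j , inj₁ (_ , refl) = ∈ₚ.∈-++⁺ˡ (∈ₚ.∈-map⁺ _ j)
  ... | φ , j , inj₂ (_ , refl) = ∈ₚ.∈-++⁺ʳ _ (∈ₚ.∈-map⁺ _ j)

-- Pieces are duplicate-free lists of vertices, hence they are short.

module Pieces (Vs : List Val) where

  Fine : Item → Set
  Fine o = Unique o × (∀ {x} → x ∈ o → x ∈ Vs)

  Fine₂ : Family → Set
  Fine₂ = All (λ p → Fine (proj₁ p) × Fine (proj₂ p))

  fine-merge : ∀ {φ} → All Fine (List.map proj₁ φ) → Fine (merge φ)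
  fine-merge {φ} h = nub-unique val (concatMapB proj₁ φ) , λ i → let c , j , k = find (merge-∈ φ i) in proj₂ (All.lookup h j) k

  fine-fst : ∀ {φ} → Fine₂ φ → All Fine (List.map proj₁ φ)
  fine-fst h = Allₚ.map⁺ (All.map proj₁ h)

  fine-snd : ∀ {φ} → Fine₂ φ → All Fine (List.map proj₂ φ)
  fine-snd h = Allₚ.map⁺ (All.map proj₂ h)

  fine-sel : ∀ {φ σ} → Fine₂ φ → Sel φ σ → All Fine σ
  fine-sel [] [] = []
  fine-sel (h ∷ hs) (left s)  = proj₁ h ∷ fine-sel hs s
  fine-sel (h ∷ hs) (right s) = proj₂ h ∷ fine-sel hs s

  fine-options : ∀ {R F} → All Fine₂ F → All Fine (options R F)
  fine-options {R} {F} h = All.tabulate λ i → go (options-∈⁻ R F i)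
    where
    go : ∀ {o} → _ → Fine o
    go (φ , j , inj₁ (_ , refl)) = fine-merge (subst (All Fine) (sym (lefts-items φ)) (fine-fst (All.lookup h j)))
    go (φ , j , inj₂ (_ , refl)) = fine-merge (subst (All Fine) (sym (rights-items φ)) (fine-snd (All.lookup h j)))

  record Fits (n m : ℕ) (κ : Config) : Set where
    constructor fits
    field
      todo-fine : All Fine (todoₖ κ)
      out-fine  : Fine₂ (outₖ κ)
      few-items : length (outₖ κ) + length (todoₖ κ) ≤ₙ n
      few-cuts  : cutsₖ κ ≤ₙ m

  -- Pulling back with nothing cut from the open items shows that all items of the later
  -- configuration come from the earlier one. The all-left and the all-right selection together
  -- reach both sides of every pair.
  origin-fits : ∀ {n m κ κ′} → Origin κ κ′ → Fits n m κ → Fits n m κ′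
  origin-fits {n} {m} {κ} {κ′} o (fits tf of fi fc) = fits (Allₚ.++⁻ʳ (List.map proj₁ (outₖ κ′)) from-left)
    (zip-fine (outₖ κ′) (Allₚ.++⁻ˡ (List.map proj₁ (outₖ κ′)) from-left) (Allₚ.++⁻ˡ (List.map proj₂ (outₖ κ′)) from-right))
    counts cuts
    where
    todo↭ : todoₖ κ′ ↭ todoₖ κ′ ++ []
    todo↭ = ↭-reflexive (sym (Listₚ.++-identityʳ (todoₖ κ′)))
    all-fine : ∀ {τ′} → Sel (outₖ κ′) τ′ → All Fine (τ′ ++ todoₖ κ′)
    all-fine s′ = let τ , U , K , s , p , q , e = pull o {U′ = todoₖ κ′} {K′ = []} s′ todo↭ in
      Permₚ.All-resp-↭ q (Allₚ.++⁺ (fine-sel of s) (Allₚ.++⁻ˡ U (Permₚ.All-resp-↭ p tf)))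
    from-left : All Fine (List.map proj₁ (outₖ κ′) ++ todoₖ κ′)
    from-left = all-fine (proj₁ (sel-lefts (outₖ κ′)))
    from-right : All Fine (List.map proj₂ (outₖ κ′) ++ todoₖ κ′)
    from-right = all-fine (proj₁ (sel-rights (outₖ κ′)))
    zip-fine : ∀ φ → All Fine (List.map proj₁ φ) → All Fine (List.map proj₂ φ) → Fine₂ φ
    zip-fine [] _ _ = []
    zip-fine (p ∷ φ) (a ∷ as) (b ∷ bs) = (a , b) ∷ zip-fine φ as bs
    counts : length (outₖ κ′) + length (todoₖ κ′) ≤ₙ n
    counts = let τ , U , K , s , p , q , e = pull o {U′ = todoₖ κ′} {K′ = []} (proj₁ (sel-lefts (outₖ κ′))) todo↭ in
      ℕₚ.≤-trans (ℕₚ.≤-reflexive (trans (cong (_+ length (todoₖ κ′)) (sym (Listₚ.length-map proj₁ (outₖ κ′))))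
        (trans (sym (Listₚ.length-++ (List.map proj₁ (outₖ κ′)))) (trans (sym (Permₚ.↭-length q)) (trans (Listₚ.length-++ τ) (cong (_+ length U) (sel-length s)))))))
      (ℕₚ.≤-trans (ℕₚ.+-monoʳ-≤ (length (outₖ κ)) (ℕₚ.≤-trans (ℕₚ.m≤m+n (length U) (length K))
        (ℕₚ.≤-reflexive (trans (sym (Listₚ.length-++ U)) (sym (Permₚ.↭-length p)))))) fi)
    cuts : cutsₖ κ′ ≤ₙ m
    cuts = let τ , U , K , s , p , q , e = pull o {U′ = todoₖ κ′} {K′ = []} (proj₁ (sel-lefts (outₖ κ′))) todo↭ in
      ℕₚ.≤-trans (ℕₚ.m≤n+m (cutsₖ κ′) (length K)) (ℕₚ.≤-trans (ℕₚ.≤-reflexive e) fc)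

  rounds-fit : ∀ {n m} R φ {κ} l → Fits n m κ → All (Fits n m) (rounds (look (table R φ (todoₖ κ))) l (κ ∷ []))
  rounds-fit R φ {κ} l h = All.map (λ r → origin-fits (proj₁ r) h)
    (Rounds.rounds-reached (look (table R φ (todoₖ κ))) (look-sym R (universe φ (todoₖ κ)) (here refl) (within-universe φ (todoₖ κ))) κ l)

  -- At a node a family gets one new pair and, from each child, at most 4 options
  -- or the pairs of a family, so length + 4 ≤ 5 · (number of vertices) is preserved.

  record Lean (n m : ℕ) (r : Res) : Set where
    field
      opts-fine : All Fine (opts r)
      opts-few  : length (opts r) ≤ₙ 4
      fams-fine : All (λ φ → Fine₂ φ × length φ + 4 ≤ₙ n) (fams r)
      size-few  : length (size# r) ≤ₙ m

  open Lean public

  data Leans (K : ℕ) : List Rose → List Res → Set where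
    []  : Leans K [] []
    _∷_ : ∀ {t r ts rs} → Lean (5 * length (verts t)) (length (verts t) * K) r → Leans K ts rs → Leans K (t ∷ ts) (r ∷ rs)

  verts-pos : ∀ t → 1 ≤ₙ length (verts t)
  verts-pos (node v ts) = s≤s z≤n

  leans-total : ∀ {K ts rs} → Leans K ts rs → length (total rs) ≤ₙ length (vertsF ts) * K
  leans-total [] = z≤n
  leans-total {K} {t ∷ ts} {r ∷ rs} (h ∷ hs) = ℕₚ.≤-trans (ℕₚ.≤-reflexive (total-∷ r rs)) (ℕₚ.≤-trans (ℕₚ.+-mono-≤ (size-few h) (leans-total hs))
    (ℕₚ.≤-reflexive (trans (sym (ℕₚ.*-distribʳ-+ K (length (verts t)) (length (vertsF ts)))) (cong (_* K) (sym (Listₚ.length-++ (verts t)))))))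

  leans-items : ∀ {K ts rs} → Leans K ts rs → All Fine (itemsOf rs) × length (itemsOf rs) ≤ₙ 4 * length rs
  leans-items [] = [] , z≤n
  leans-items {rs = r ∷ rs} (h ∷ hs) = let a , b = leans-items hs in
    subst (All Fine) (sym (foldr-∷ (opts r) (itemsOf rs))) (Allₚ.++⁺ (opts-fine h) a) ,
    ℕₚ.≤-trans (ℕₚ.≤-reflexive (trans (cong length (foldr-∷ (opts r) (itemsOf rs))) (Listₚ.length-++ (opts r))))
      (ℕₚ.≤-trans (ℕₚ.+-mono-≤ (opts-few h) b) (ℕₚ.≤-reflexive (sym (ℕₚ.*-suc 4 (length rs)))))

  record Based (x n m : ℕ) (κ : Num × Family) : Set where
    constructor based
    field
      out-fine : Fine₂ (proj₂ κ)
      few-out  : length (proj₂ κ) + x ≤ₙ n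
      few-cuts : length (proj₁ κ) ≤ₙ m

  private
    step-few : ∀ {a b p q x} n → a + b ≤ₙ n + q → 4 + x ≤ₙ p + a → x + (4 + b) ≤ₙ n + (p + q)
    step-few {a} {b} {p} {q} {x} n h h′ = ℕₚ.+-cancelʳ-≤ a _ _ (ℕₚ.≤-trans (ℕₚ.≤-reflexive (eq₁ a b x 4))
      (ℕₚ.≤-trans (ℕₚ.+-mono-≤ h′ h) (ℕₚ.≤-reflexive (eq₂ a p q n))))
      where
      eq₁ : ∀ a b x k → x + (k + b) + a ≡ k + x + (a + b)
      eq₁ = solve-∀
      eq₂ : ∀ a p q n → p + a + (n + q) ≡ n + (p + q) + a
      eq₂ = solve-∀

  bases-fine : ∀ {K ts rs} c out → Leans K ts rs → Fine₂ out →
               ∀ {κ} → κ ∈ bases c out rs → Based (4 * length rs) (length out + 5 * length (vertsF ts)) (length c) κ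
  bases-fine c out [] h (here refl) = based h ℕₚ.≤-refl ℕₚ.≤-refl
  bases-fine {ts = t ∷ ts} {rs = r@(m , os , F) ∷ rs} c out (l ∷ ls) h i = go os i
    where
    n : ℕ
    n = length out + 5 * length (vertsF (t ∷ ts))
    wider : ∀ x {a} → a + 4 * length rs ≤ₙ length out + 5 * length (vertsF ts) → 4 + x ≤ₙ 5 * length (verts t) + a → x + 4 * length (r ∷ rs) ≤ₙ n
    wider x {a} h₁ h₂ = ℕₚ.≤-trans (ℕₚ.≤-reflexive (cong (x +_) (ℕₚ.*-suc 4 (length rs)))) (ℕₚ.≤-trans (step-few {a} {4 * length rs} (length out) h₁ h₂)
      (ℕₚ.≤-reflexive (cong (length out +_) (trans (sym (ℕₚ.*-distribˡ-+ 5 (length (verts t)) _)) (cong (5 *_) (sym (Listₚ.length-++ (verts t))))))))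
    big : ∀ x → 4 + x ≤ₙ 5 * length (verts t) + x
    big x = ℕₚ.+-monoˡ-≤ x (ℕₚ.≤-trans (ℕₚ.n≤1+n 4) (ℕₚ.≤-trans (ℕₚ.≤-reflexive (sym (ℕₚ.*-identityʳ 5))) (ℕₚ.*-monoʳ-≤ 5 (verts-pos t))))
    same : ∀ {κ} → κ ∈ bases c out rs → Based (4 * length (r ∷ rs)) n (length c) κ
    same {κ} j with bases-fine c out ls h j
    ... | based a b d = based a (wider (length (proj₂ κ)) b (big (length (proj₂ κ)))) d
    go : ∀ os {κ} → κ ∈ caseL os (extend F (bases c out rs)) (λ _ _ → bases c out rs) → Based (4 * length (r ∷ rs)) n (length c) κ
    go (_ ∷ _) j = same j
    go [] {c′ , out′} j with extend-∈⁻ (bases c out rs) j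
    ... | inj₁ k with same k
    ...   | based a b d = based a b (ℕₚ.≤-trans (ℕₚ.n≤1+n _) d)
    go [] {c′ , out′} j | inj₂ (φ , out″ , k , k′ , refl) with bases-fine c out ls h k′
    ...   | based a b d = based (Allₚ.++⁺ (proj₁ (All.lookup (fams-fine l) k)) a)
              (wider (length (φ ++ out″)) b (ℕₚ.≤-trans (ℕₚ.≤-reflexive (trans (cong (4 +_) (Listₚ.length-++ φ)) (trans (sym (ℕₚ.+-assoc 4 (length φ) _)) (cong (_+ length out″) (ℕₚ.+-comm 4 (length φ))))))
                (ℕₚ.+-monoˡ-≤ (length out″) (proj₂ (All.lookup (fams-fine l) k))))) d

  leans-gen : ∀ {K ts rs} R v d → v ∈ Vs → Leans K ts rs → ∀ {φ} → φ ∈ gen R v rs d → Fine₂ φ × length φ + 4 ≤ₙ 5 * length (verts (node v ts))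
  leans-gen {K} {ts} {rs} R v d v∈ ls {φ} i with gen-∈⁻ R v rs d i
  ... | c , out , j , k with bases-fine (budget d rs) _ ls ((([] ∷ [] , λ { (here refl) → v∈ }) , ([] ∷ [] , λ { (here refl) → v∈ })) ∷ []) j
  ...   | based of few≤ _ = Fits.out-fine reached , ℕₚ.≤-trans (ℕₚ.+-monoˡ-≤ 4 (ℕₚ.≤-trans (ℕₚ.m≤m+n _ _) (Fits.few-items reached))) (ℕₚ.≤-trans (ℕₚ.+-monoˡ-≤ 4 few≤)
            (ℕₚ.≤-reflexive (trans (ℕₚ.+-comm _ 4) (sym (ℕₚ.*-suc 5 (length (vertsF ts)))))))
    where
    L = itemsOf rs
    start : Fits (length out + 4 * length rs) (length c) (L , out , c)
    start = fits (proj₁ (leans-items ls)) of (ℕₚ.+-monoʳ-≤ (length out) (proj₂ (leans-items ls))) ℕₚ.≤-refl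
    reached : Fits (length out + 4 * length rs) (length c) ([] , φ , [])
    reached = All.lookup (rounds-fit R out L start) (proj₁ (searchT-∈⁻ R L (c , out) (table R out L) k))

  kids-bases : ∀ {R ts rs} (k d : Num) out → length (total rs) + length d ≤ₙ length k → Kids R ts rs →
               Weak (length k) (sumOver f (bases (budget d rs) out rs))
  kids-bases {rs = rs} k d out le kids = subst (λ x → Weak x (sumOver f (bases (budget d rs) out rs))) (ℕₚ.m∸n+n≡m le)
    (weak-+ (length (total rs) + length d) (length k ∸ (length (total rs) + length d)) (base-weak d out kids))

  -- Options are formed for minima of at most 2 only, where the weak bound allows two families; this
  -- yields the limit of four options per child.
  loop-lean : ∀ {R k v ts rs} → v ∈ Vs → Goods R k ts rs → Leans (suc (length k)) ts rs →
              let s = loop R v rs (dropB (tt ∷ k) (total rs)) in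
              All (λ φ → Fine₂ φ × length φ + 4 ≤ₙ 5 * length (verts (node v ts))) (proj₂ s)
              × (simpleB (appB (total rs) (proj₁ s)) (proj₂ s) ≡ true → length (proj₂ s) ≤ₙ 2)
  loop-lean {R} {k} {v} {ts} {rs} v∈ gs ls = go (loop R v rs l) (loop-result R v rs l)
    where
    l : Num
    l = dropB (tt ∷ k) (total rs)
    go : ∀ s → length (proj₁ s) ≤ₙ length l × (proj₂ s ≡ [] ⊎ (length (proj₁ s) <ₙ length l × proj₂ s ≡ gen R v rs (proj₁ s))) →
         All (λ φ → Fine₂ φ × length φ + 4 ≤ₙ 5 * length (verts (node v ts))) (proj₂ s)
         × (simpleB (appB (total rs) (proj₁ s)) (proj₂ s) ≡ true → length (proj₂ s) ≤ₙ 2)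
    go (d , .[]) (le , inj₁ refl) = [] , λ _ → z≤n
    go (d , F) (le , inj₂ (lt , refl)) = All.tabulate (leans-gen R v d v∈ ls) ,
      λ e → simple-few (appB (total rs) d) F e (inj₂ (subst (λ x → Weak x (length F)) (sym (trans (cong length (foldr-∷ (total rs) d)) (Listₚ.length-++ (total rs)))) weak))
      where
      within : length (total rs) + length d ≤ₙ length k
      within = drop-room k (total rs) lt
      weak : Weak (length (total rs) + length d) (length F)
      weak = weak-mono (length (total rs) + length d) (ℕₚ.≤-trans (ℕₚ.≤-reflexive (cong length (gen-def R v rs d))) (gen-length R (itemsOf rs) (bases (budget d rs) ((v ∷ [] , v ∷ []) ∷ []) rs)))
        (base-weak d ((v ∷ [] , v ∷ []) ∷ []) (goods-kids gs (ℕₚ.≤-trans (ℕₚ.m≤m+n _ _) within)))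

  finish-lean : ∀ {R k v ts rs} → v ∈ Vs → Goods R k ts rs → Leans (suc (length k)) ts rs →
                Lean (5 * length (verts (node v ts))) (length (verts (node v ts)) * suc (length k)) (finish R k v rs)
  finish-lean {R} {k} {v} {ts} {rs} v∈ gs ls = let h , h′ = loop-lean v∈ gs ls in
    packed (proj₁ (loop R v rs l)) (proj₂ (loop R v rs l)) _ (proj₁ (loop-result R v rs l)) h h′
    where
    l : Num
    l = dropB (tt ∷ k) (total rs)
    n m : ℕ
    n = 5 * length (verts (node v ts))
    m = length (verts (node v ts)) * suc (length k)
    grown : ∀ d → length d ≤ₙ length l → length (appB (total rs) d) ≤ₙ m
    grown d le = ℕₚ.≤-trans (ℕₚ.≤-reflexive (trans (trans (cong length (foldr-∷ (total rs) d)) (Listₚ.length-++ (total rs))) (ℕₚ.+-comm (length (total rs)) _)))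
      (ℕₚ.+-mono-≤ (ℕₚ.≤-trans le (ℕₚ.≤-trans (ℕₚ.≤-reflexive (length-drop (tt ∷ k) (total rs))) (ℕₚ.m∸n≤m (suc (length k)) (length (total rs))))) (leans-total ls))
    packed : ∀ d F b → length d ≤ₙ length l → All (λ φ → Fine₂ φ × length φ + 4 ≤ₙ n) F → (b ≡ true → length F ≤ₙ 2) →
             Lean n m (if b then (appB (total rs) d , options R F , []) else (appB (total rs) d , [] , F))
    packed d F true le h at-most = record { opts-fine = fine-options {R} (All.map proj₁ h) ; fams-fine = [] ; size-few = grown d le
      ; opts-few = ℕₚ.≤-trans (options-count R F) (ℕₚ.+-mono-≤ (at-most refl) (at-most refl)) }
    packed d F false le h at-most = record { opts-fine = [] ; opts-few = z≤n ; fams-fine = h ; size-few = grown d le }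

  mutual
    result-lean : ∀ {R} k t → (∀ x → ¬ (x , x) ∈ R) → Unique (verts t) → (∀ {x} → x ∈ verts t → x ∈ Vs) →
                  Lean (5 * length (verts t)) (length (verts t) * suc (length k)) (result R k t)
    result-lean k (node v ts) irr u h = finish-lean (h (here refl)) (results-good k ts irr (AllPairs.tail u))
      (results-lean k ts irr (AllPairs.tail u) (λ i → h (there i)))

    results-lean : ∀ {R} k ts → (∀ x → ¬ (x , x) ∈ R) → Unique (vertsF ts) → (∀ {x} → x ∈ vertsF ts → x ∈ Vs) →
                   Leans (suc (length k)) ts (results R k ts)
    results-lean k []       irr u h = []
    results-lean k (t ∷ ts) irr u h = let u₁ , u₂ , _ = allPairs-++⁻ (verts t) u in
      result-lean k t irr u₁ (λ i → h (∈ₚ.∈-++⁺ˡ i)) ∷ results-lean k ts irr u₂ (λ i → h (∈ₚ.∈-++⁺ʳ (verts t) i))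

-- Running times up to polynomial factors

-- Costs are measured up to a polynomial in s and linearly in W.

record Scale : Set₁ where
  field
    Ctx : Set
    W s : Ctx → ℕ
    W≥1 : ∀ c → 1 ≤ₙ W c
    s≥2 : ∀ c → 2 ≤ₙ s c

open Scale public

infixr 4 _#_ _#ˡ_

record O (S : Scale) (g : Ctx S → ℕ) : Set where
  constructor _#_
  field
    degree : ℕ
    bound  : ∀ c → g c ≤ₙ W S c * s S c ** degree

record L (S : Scale) (g : Ctx S → ℕ) : Set where
  constructor _#ˡ_
  field
    degree : ℕ
    bound  : ∀ c → g c ≤ₙ s S c ** degree

record HT (S : Scale) {a b : Ty} (t : Tm a b) (x : Ctx S → El a) : Set where
  constructor ht
  field
    time-O : O S (λ c → bd t (x c))

open HT public

module _ {S : Scale} where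

  private
    s≥1 : ∀ c → 1 ≤ₙ s S c
    s≥1 c = ≤-trans (s≤s z≤n) (s≥2 S c)

    sum≤ : ∀ c d e → s S c ** d + s S c ** e ≤ₙ s S c ** suc (d + e)
    sum≤ c d e = ≤-trans (+-mono-≤ (up (m≤m+n d e)) (up (m≤n+m e d)))
      (≤-trans (ℕₚ.≤-reflexive (cong (s S c ** (d + e) +_) (sym (ℕₚ.+-identityʳ _)))) (ℕₚ.*-monoˡ-≤ (s S c ** (d + e)) (s≥2 S c)))
      where
      up : ∀ {i j} → i ≤ₙ j → s S c ** i ≤ₙ s S c ** j
      up = ℕₚ.^-monoʳ-≤ (s S c) {{>-nonZero (s≥1 c)}}

  o-mono : ∀ {g h : Ctx S → ℕ} → (∀ c → g c ≤ₙ h c) → O S h → O S g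
  o-mono le (e # b) = e # λ c → ≤-trans (le c) (b c)

  l-mono : ∀ {g h : Ctx S → ℕ} → (∀ c → g c ≤ₙ h c) → L S h → L S g
  l-mono le (e #ˡ b) = e #ˡ λ c → ≤-trans (le c) (b c)

  l⇒o : ∀ {g} → L S g → O S g
  l⇒o (e #ˡ b) = e # λ c → ≤-trans (b c) (≤-trans (ℕₚ.≤-reflexive (sym (ℕₚ.*-identityˡ _))) (ℕₚ.*-monoˡ-≤ (s S c ** e) (W≥1 S c)))

  l-const : ∀ k → L S (λ _ → k)
  l-const k = k #ˡ λ c → ≤-trans (n≤2^n k) (ℕₚ.^-monoˡ-≤ k (s≥2 S c))

  o-const : ∀ k → O S (λ _ → k)
  o-const k = l⇒o (l-const k)

  l-s : L S (s S)
  l-s = 1 #ˡ λ c → ℕₚ.≤-reflexive (sym (ℕₚ.*-identityʳ _))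

  o-W : O S (W S)
  o-W = 0 # λ c → ℕₚ.≤-reflexive (sym (ℕₚ.*-identityʳ _))

  o-+ : ∀ {g h} → O S g → O S h → O S (λ c → g c + h c)
  o-+ (d # p) (e # q) = suc (d + e) # λ c → ≤-trans (+-mono-≤ (p c) (q c))
    (≤-trans (ℕₚ.≤-reflexive (sym (ℕₚ.*-distribˡ-+ (W S c) _ _))) (ℕₚ.*-monoʳ-≤ (W S c) (sum≤ c d e)))

  l-+ : ∀ {g h} → L S g → L S h → L S (λ c → g c + h c)
  l-+ (d #ˡ p) (e #ˡ q) = suc (d + e) #ˡ λ c → ≤-trans (+-mono-≤ (p c) (q c)) (sum≤ c d e)

  l-* : ∀ {g h} → L S g → L S h → L S (λ c → g c * h c)
  l-* (d #ˡ p) (e #ˡ q) = d + e #ˡ λ c → ≤-trans (*-mono-≤ (p c) (q c)) (ℕₚ.≤-reflexive (sym (ℕₚ.^-distribˡ-+-* (s S c) d e)))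

  l-^ : ∀ {g} → L S g → ∀ e → L S (λ c → g c ** e)
  l-^ (d #ˡ p) e = d * e #ˡ λ c → ≤-trans (ℕₚ.^-monoˡ-≤ e (p c)) (ℕₚ.≤-reflexive (ℕₚ.^-*-assoc (s S c) d e))

  o*l : ∀ {g h} → O S g → L S h → O S (λ c → g c * h c)
  o*l (d # p) (e #ˡ q) = d + e # λ c → ≤-trans (*-mono-≤ (p c) (q c)) (ℕₚ.≤-reflexive (trans (ℕₚ.*-assoc (W S c) _ _)
    (cong (W S c *_) (sym (ℕₚ.^-distribˡ-+-* (s S c) d e)))))

  l-pb : ∀ {a g} {x : Ctx S → El a} → PB a g → L S (λ c → sz a (x c)) → L S (λ c → g (x c))
  l-pb {x = x} (e , h) p = l-mono (λ c → h (x c)) (l-^ (l-+ (l-const 1) p) e)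

infixl 5 _▹_

-- Enlarges the context by what is known inside of a branch or a fold; the yardsticks remain those
-- of the outer context.
_▹_ : (S : Scale) → (Ctx S → Set) → Scale
S ▹ D = record { Ctx = Σ[ c ∈ Ctx S ] D c ; W = λ c → W S (proj₁ c) ; s = λ c → s S (proj₁ c) ; W≥1 = λ c → W≥1 S (proj₁ c) ; s≥2 = λ c → s≥2 S (proj₁ c) }

weigh : (S : Scale) (V : Ctx S → ℕ) → (∀ c → 1 ≤ₙ V c) → Scale
weigh S V pos = record { Ctx = Ctx S ; W = V ; s = s S ; W≥1 = pos ; s≥2 = s≥2 S }

o▹ : ∀ {S D g} → O S g → O (S ▹ D) (λ c → g (proj₁ c))
o▹ (e # h) = e # λ c → h (proj₁ c)

l▹ : ∀ {S D g} → L S g → L (S ▹ D) (λ c → g (proj₁ c))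
l▹ (e #ˡ h) = e #ˡ λ c → h (proj₁ c)

sumBy : ∀ {A : Set} → (A → ℕ) → List A → ℕ
sumBy w []      = 0
sumBy w (x ∷ l) = w x + sumBy w l

sumBy-const : ∀ {A : Set} k (l : List A) → sumBy (λ _ → k) l ≡ k * length l
sumBy-const k []      = sym (ℕₚ.*-zeroʳ k)
sumBy-const k (x ∷ l) = trans (cong (k +_) (sumBy-const k l)) (sym (ℕₚ.*-suc k (length l)))

-- A position in a list. The suffix determines the accumulator that the fold holds when it arrives
-- there, so costs of steps can refer to actual accumulators.
At : ∀ {A : Set} → List A → Set
At {A} l = Σ[ u ∈ A ] Σ[ l′ ∈ List A ] Σ[ pre ∈ List A ] (l ≡ pre ++ u ∷ l′)

at-∈ : ∀ {A : Set} {l : List A} (i : At l) → proj₁ i ∈ l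
at-∈ (u , l′ , pre , refl) = ∈ₚ.∈-++⁺ʳ pre (here refl)

-- Individual weights matter: the bases at a node have different budgets, and only the sum of their
-- weights meets the exponential bound, not their number times the maximum.
fold-bd-sum : ∀ {a b c} (t : Tm (b ⊗ c ⊗ a) c) (z : El c) (x : El a) (l : List (El b)) (w : El b → ℕ) k →
              (∀ u → 1 ≤ₙ w u) →
              (∀ (i : At l) → bd t (proj₁ i , foldr (λ v acc → ⟦ t ⟧ (v , acc , x)) z (proj₁ (proj₂ i)) , x) ≤ₙ w (proj₁ i) * k) →
              fold-bd t z x l ≤ₙ 60 + sumBy w l * (60 + k)
fold-bd-sum t z x [] w k w≥1 h = ≤-refl
fold-bd-sum t z x (u ∷ l) w k w≥1 h = ≤-trans
  (ℕₚ.+-monoʳ-≤ 60 (+-mono-≤ (fold-bd-sum t z x l w k w≥1 (λ (v , l′ , pre , e) → h (v , l′ , u ∷ pre , cong (u ∷_) e))) (h (u , l , [] , refl))))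
  (ℕₚ.+-monoʳ-≤ 60 (≤-trans (ℕₚ.+-monoˡ-≤ (w u * k) (ℕₚ.+-monoˡ-≤ (sumBy w l * (60 + k)) (≤-trans (ℕₚ.≤-reflexive (sym (ℕₚ.*-identityˡ 60))) (ℕₚ.*-monoˡ-≤ 60 (w≥1 u)))))
    (ℕₚ.≤-reflexive (eq (w u) 60 (sumBy w l) k))))
  where
  eq : ∀ w c S k → w * c + S * (c + k) + w * k ≡ (w + S) * (c + k)
  eq = solve-∀

-- With weight 1 the cost has to be polynomial; this is the demand on steps that are repeated
-- exponentially often.
light : Scale → Scale
light S = weigh S (λ _ → 1) (λ _ → ≤-refl)

l-via : ∀ {S S′ : Scale} (h : Ctx S′ → Ctx S) {g} → (∀ c → s S (h c) ≤ₙ s S′ c) → L S g → L S′ (λ c → g (h c))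
l-via h le (e #ˡ b) = e #ˡ λ c → ≤-trans (b (h c)) (ℕₚ.^-monoˡ-≤ e (le c))

o-via : ∀ {S S′ : Scale} (h : Ctx S′ → Ctx S) {g} → (∀ c → W S (h c) ≤ₙ W S′ c) → (∀ c → s S (h c) ≤ₙ s S′ c) → O S g → O S′ (λ c → g (h c))
o-via {S} {S′} h V le (e # b) = e # λ c → ≤-trans (b (h c)) (*-mono-≤ (V c) (ℕₚ.^-monoˡ-≤ e (le c)))

ht-via : ∀ {S S′ : Scale} (h : Ctx S′ → Ctx S) {a b} {t : Tm a b} {x} → (∀ c → W S (h c) ≤ₙ W S′ c) → (∀ c → s S (h c) ≤ₙ s S′ c) →
         HT S t x → HT S′ t (λ c → x (h c))
ht-via h V le (ht p) = ht (o-via h V le p)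

FoldScale : (S : Scale) {A : Set} (w : Ctx S → A → ℕ) → (∀ c u → 1 ≤ₙ w c u) → (Ctx S → List A) → Scale
FoldScale S w pos l = weigh (S ▹ λ c → At (l c)) (λ (c , i) → w c (proj₁ i)) (λ (c , i) → pos c (proj₁ i))

-- Terms without branching, equality tests and folds cost the same on every input, so their bounds
-- can be computed.
flatCost : ∀ {a b} → Tm a b → Maybe ℕ
flatCost idₜ       = just 60
flatCost (g ∘ₜ f)  = zipWith (λ m n → 60 + (m + n)) (flatCost f) (flatCost g)
flatCost ⟪ f , g ⟫ = zipWith (λ m n → 60 + (m + n)) (flatCost f) (flatCost g)
flatCost fstₜ      = just 60
flatCost sndₜ      = just 60
flatCost unitₜ     = just 60
flatCost (boolₜ _) = just 180
flatCost nilₜ      = just 60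
flatCost emptyₜ    = just 60
flatCost (consₜ f g) = zipWith (λ m n → 60 + (m + n)) (flatCost f) (flatCost g)
flatCost _         = nothing

flat-zip : ∀ {p q : Maybe ℕ} {n} → zipWith (λ m n → 60 + (m + n)) p q ≡ just n → ∃[ i ] ∃[ j ] (p ≡ just i × q ≡ just j × n ≡ 60 + (i + j))
flat-zip {just i} {just j} refl = i , j , refl , refl , refl

flat-bd : ∀ {a b n} (t : Tm a b) → flatCost t ≡ just n → ∀ x → bd t x ≡ n
flat-bd idₜ refl x = refl
flat-bd (g ∘ₜ f) e x with flat-zip {flatCost f} {flatCost g} e
... | i , j , p , q , refl = cong (60 +_) (cong₂ _+_ (flat-bd f p x) (flat-bd g q _))
flat-bd ⟪ f , g ⟫ e x with flat-zip {flatCost f} {flatCost g} e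
... | i , j , p , q , refl = cong (60 +_) (cong₂ _+_ (flat-bd f p x) (flat-bd g q _))
flat-bd fstₜ refl x = refl
flat-bd sndₜ refl x = refl
flat-bd unitₜ refl x = refl
flat-bd (boolₜ _) refl x = refl
flat-bd nilₜ refl x = refl
flat-bd emptyₜ refl x = refl
flat-bd (consₜ f g) e x with flat-zip {flatCost f} {flatCost g} e
... | i , j , p , q , refl = cong (60 +_) (cong₂ _+_ (flat-bd f p x) (flat-bd g q _))

ht-flat : ∀ {S a b n} (t : Tm a b) → flatCost t ≡ just n → ∀ {x} → HT S t x
ht-flat {n = n} t e {x} = ht (o-mono (λ c → ℕₚ.≤-reflexive (flat-bd t e (x c))) (o-const n))

module _ {S : Scale} where

  ht-∘ : ∀ {a b d} {f : Tm a b} {g : Tm b d} {x} → HT S f x → HT S g (λ c → ⟦ f ⟧ (x c)) → HT S (g ∘ₜ f) x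
  ht-∘ (ht p) (ht q) = ht (o-+ (o-const 60) (o-+ p q))

  ht-pair : ∀ {a b d} {f : Tm a b} {g : Tm a d} {x} → HT S f x → HT S g x → HT S ⟪ f , g ⟫ x
  ht-pair (ht p) (ht q) = ht (o-+ (o-const 60) (o-+ p q))

  ht-cons : ∀ {a b} {f : Tm a b} {g : Tm a (list b)} {x} → HT S f x → HT S g x → HT S (consₜ f g) x
  ht-cons (ht p) (ht q) = ht (o-+ (o-const 60) (o-+ p q))

  ht-eq : ∀ {a b} {f g : Tm a b} {x} → HT S f x → HT S g x → L S (λ c → sz b (⟦ f ⟧ (x c))) → HT S (eqₜ f g) x
  ht-eq (ht p) (ht q) l = ht (o-+ (o-const 180) (o-+ (o-+ p q) (l⇒o (l-* (l-const 20) l))))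

  ht-poly : ∀ {a b} (p : Poly a b) {x} → L S (λ c → sz a (x c)) → HT S (tm p) x
  ht-poly p l = ht (l⇒o (l-pb (time p) l))

  l-space : ∀ {a b} (p : Poly a b) {x : Ctx S → El a} → L S (λ c → sz a (x c)) → L S (λ c → sz b (⟦ p ⟧ₚ (x c)))
  l-space p l = l-pb (space p) l

  -- The outcome of the test enters the context of the branches, since some of their bounds hold
  -- only in that case.
  ht-case : ∀ {a b d} {l : Tm a (list b)} {z : Tm a d} {t : Tm (b ⊗ list b ⊗ a) d} {x} → HT S l x →
            HT (S ▹ λ c → ⟦ l ⟧ (x c) ≡ []) z (λ c → x (proj₁ c)) →
            HT (S ▹ λ c → Σ[ u ∈ El b ] Σ[ us ∈ List (El b) ] (⟦ l ⟧ (x c) ≡ u ∷ us)) t (λ (c , u , us , _) → u , us , x c) →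
            HT S (caseₜ l z t) x
  ht-case {a} {b} {d} {l} {z} {t} {x} (ht p) (ht (e₁ # h₁)) (ht (e₂ # h₂)) = ht (o-+ (o-const 60) (o-+ p (e₁ + e₂ # λ c → go c (⟦ l ⟧ (x c)) refl)))
    where
    go : ∀ c m → ⟦ l ⟧ (x c) ≡ m → case-bd z t (x c) m ≤ₙ W S c * s S c ** (e₁ + e₂)
    go c [] eq = ≤-trans (h₁ (c , eq)) (ℕₚ.*-monoʳ-≤ (W S c) (ℕₚ.^-monoʳ-≤ (s S c) {{>-nonZero (≤-trans (s≤s z≤n) (s≥2 S c))}} (m≤m+n e₁ e₂)))
    go c (u ∷ us) eq = ≤-trans (h₂ (c , u , us , eq)) (ℕₚ.*-monoʳ-≤ (W S c) (ℕₚ.^-monoʳ-≤ (s S c) {{>-nonZero (≤-trans (s≤s z≤n) (s≥2 S c))}} (m≤n+m e₂ e₁)))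

  ht-if : ∀ {a d} {t : Tm a bool} {f g : Tm a d} {x} → HT S t x →
          HT (S ▹ λ c → ⟦ t ⟧ (x c) ≡ true) f (λ c → x (proj₁ c)) →
          HT (S ▹ λ c → ⟦ t ⟧ (x c) ≡ false) g (λ c → x (proj₁ c)) →
          HT S (ifₜ t f g) x
  ht-if {a} {d} {t} {f} {g} {x} (ht p) (ht (e₁ # h₁)) (ht (e₂ # h₂)) = ht (o-+ (o-const 240) (o-+ p (e₁ + e₂ # λ c → go c (⟦ t ⟧ (x c)) refl)))
    where
    go : ∀ c m → ⟦ t ⟧ (x c) ≡ m → (if m then bd f (x c) else bd g (x c)) ≤ₙ W S c * s S c ** (e₁ + e₂)
    go c true eq = ≤-trans (h₁ (c , eq)) (ℕₚ.*-monoʳ-≤ (W S c) (ℕₚ.^-monoʳ-≤ (s S c) {{>-nonZero (≤-trans (s≤s z≤n) (s≥2 S c))}} (m≤m+n e₁ e₂)))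
    go c false eq = ≤-trans (h₂ (c , eq)) (ℕₚ.*-monoʳ-≤ (W S c) (ℕₚ.^-monoʳ-≤ (s S c) {{>-nonZero (≤-trans (s≤s z≤n) (s≥2 S c))}} (m≤n+m e₂ e₁)))

  ht-fold : ∀ {a b d} {l : Tm a (list b)} {z : Tm a d} {t : Tm (b ⊗ d ⊗ a) d} {x} (w : Ctx S → El b → ℕ) (pos : ∀ c u → 1 ≤ₙ w c u) →
            HT S l x → HT S z x → O S (λ c → sumBy (w c) (⟦ l ⟧ (x c))) →
            HT (FoldScale S w pos (λ c → ⟦ l ⟧ (x c))) t
               (λ (c , u , l′ , _) → u , foldr (λ v acc → ⟦ t ⟧ (v , acc , x c)) (⟦ z ⟧ (x c)) l′ , x c) →
            HT S (foldₜ l z t) x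
  ht-fold {l = l} {z} {t} {x} w pos (ht p) (ht q) total (ht (e # h)) = ht (o-+ (o-const 60) (o-+ (o-+ p q)
    (o-mono (λ c → fold-bd-sum t (⟦ z ⟧ (x c)) (x c) (⟦ l ⟧ (x c)) (w c) (s S c ** e) (pos c) (λ i → h (c , i)))
      (o-+ (o-const 60) (o*l total (l-+ (l-const 60) (l-^ l-s e)))))))

  -- For polynomially many steps, each of which may be exponential.
  ht-foldˡ : ∀ {a b d} {l : Tm a (list b)} {z : Tm a d} {t : Tm (b ⊗ d ⊗ a) d} {x} →
            HT S l x → HT S z x → L S (λ c → length (⟦ l ⟧ (x c))) →
            HT (S ▹ λ c → At (⟦ l ⟧ (x c))) t
               (λ (c , u , l′ , _) → u , foldr (λ v acc → ⟦ t ⟧ (v , acc , x c)) (⟦ z ⟧ (x c)) l′ , x c) →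
            HT S (foldₜ l z t) x
  ht-foldˡ {l = l} {z} {t} {x} p q short h = ht-fold {l = l} {z} {t} {x} (λ c _ → W S c) (λ c _ → W≥1 S c) p q
    (o-mono (λ c → ℕₚ.≤-reflexive (sumBy-const (W S c) (⟦ l ⟧ (x c)))) (o*l o-W short)) h

  -- For exponentially many steps, each of which must be polynomial.
  ht-foldʳ : ∀ {a b d} {l : Tm a (list b)} {z : Tm a d} {t : Tm (b ⊗ d ⊗ a) d} {x} →
            HT S l x → HT S z x → O S (λ c → length (⟦ l ⟧ (x c))) →
            HT (light (S ▹ λ c → At (⟦ l ⟧ (x c)))) t
               (λ (c , u , l′ , _) → u , foldr (λ v acc → ⟦ t ⟧ (v , acc , x c)) (⟦ z ⟧ (x c)) l′ , x c) →
            HT S (foldₜ l z t) x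
  ht-foldʳ {l = l} {z} {t} {x} p q count (ht (e # h)) = ht-fold {l = l} {z} {t} {x} (λ _ _ → 1) (λ _ _ → ≤-refl) p q
    (o-mono (λ c → ℕₚ.≤-reflexive (trans (sumBy-const 1 (⟦ l ⟧ (x c))) (ℕₚ.*-identityˡ _))) count)
    (ht (e # h))

  ht-append : ∀ {a b} {f g : Tm a (list b)} {x} → HT S f x → HT S g x → O S (λ c → length (⟦ f ⟧ (x c))) → HT S (appendₜ f g) x
  ht-append {f = f} {g} {x} p q count = ht-foldʳ {l = f} {g} {x = x} p q count (ht-flat (consₜ fstₜ (fstₜ ∘ₜ sndₜ)) refl)

  l-list : ∀ {a} {l : Ctx S → List (El a)} → L S (λ c → length (l c)) →
           L (S ▹ λ c → Σ[ u ∈ El a ] (u ∈ l c)) (λ (c , u , _) → sz a u) → L S (λ c → sz (list a) (l c))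
  l-list {a} {l} short (e #ˡ h) = l-mono (λ c → go c (l c) (λ i → h (c , _ , i)))
    (l-+ (l-const 1) (l-* short (l-+ (l-const 1) (l-^ l-s e))))
    where
    go : ∀ c m → (∀ {u} → u ∈ m → sz a u ≤ₙ s S c ** e) → sz (list a) m ≤ₙ 1 + length m * (1 + s S c ** e)
    go c [] h = ≤-refl
    go c (u ∷ m) h = s≤s (≤-trans (+-mono-≤ (h (here refl)) (go c m (λ i → h (there i)))) (ℕₚ.≤-reflexive (ℕₚ.+-suc (s S c ** e) _)))

  l-num : ∀ {l : Ctx S → List ⊤} → L S (λ c → length (l c)) → L S (λ c → sz (list unit) (l c))
  l-num {l} short = l-list {a = unit} {l} short (l-const 1)

ht-cong : ∀ {S a b} {t : Tm a b} {x y : Ctx S → El a} → (∀ c → x c ≡ y c) → HT S t x → HT S t y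
ht-cong {t = t} e (ht p) = ht (o-mono (λ c → ℕₚ.≤-reflexive (cong (bd t) (sym (e c)))) p)

ht-cmap : ∀ {S a b e d} (g : Poly (b ⊗ e) (list d)) {l : Tm a (list b)} {t : Tm a e} {x} → HT S l x → O S (λ c → length (⟦ l ⟧ (x c))) →
          L (S ▹ λ c → Σ[ u ∈ El b ] (u ∈ ⟦ l ⟧ (x c))) (λ (c , u , _) → sz b u) →
          HT (light S) t x → L S (λ c → sz e (⟦ t ⟧ (x c))) → HT S (cmapₜ g l t) x
ht-cmap {S} {a} {b} {e} {d} g {l} {t} {x} hl count l-elem ht-t l-env = ht-foldʳ {l = l} hl (ht-flat nilₜ refl) count
  (ht-append (ht-∘ (ht-pair (ht-flat fstₜ refl) (ht-∘ (ht-∘ (ht-flat sndₜ refl) (ht-flat sndₜ refl)) lifted)) (ht-poly g arg)) (ht-flat (fstₜ ∘ₜ sndₜ) refl)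
    (l⇒o (l-mono (λ c → length≤sz {d} (⟦ g ⟧ₚ (proj₁ (proj₂ c) , ⟦ t ⟧ (x (proj₁ c))))) (l-space g {x = λ c → proj₁ (proj₂ c) , ⟦ t ⟧ (x (proj₁ c))} arg))))
  where
  S′ : Scale
  S′ = light (S ▹ λ c → At (⟦ l ⟧ (x c)))
  lifted : HT S′ t (λ (c , _) → x c)
  lifted = ht-via proj₁ (λ _ → ≤-refl) (λ _ → ≤-refl) ht-t
  arg : L S′ (λ (c , i) → sz (b ⊗ e) (proj₁ i , ⟦ t ⟧ (x c)))
  arg = l-+ (l-const 1) (l-+ (l-via (λ (c , i) → c , proj₁ i , at-∈ i) (λ _ → ≤-refl) l-elem) (l-via proj₁ (λ _ → ≤-refl) l-env))

-- Cost of the searches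

rounds-count : ∀ R l c out l′ → length (rounds (look (table R out l)) l′ ((l , out , c) ∷ [])) ≤ₙ f (length c)
rounds-count R l c out l′ = ≤-trans (length≤weight (rounds (look (table R out l)) l′ ((l , out , c) ∷ [])))
  (Rounds.rounds-weight (look (table R out l)) (look-sym R (universe out l) (here refl) (within-universe out l)) (l , out , c) l′)

opaque
  unfolding step₀

  stageₜ : ∀ {x} → Tm (itemT ⊗ list cfgT ⊗ list (itemT ⊗ itemT) ⊗ x) (list cfgT)
  stageₜ = cmapₜ step₀ₚ p₁ (p₀ ∘ₜ tl₂)

  stage-≡ : ∀ {a} {x : El a} t K l → foldr (λ v acc → ⟦ stageₜ ⟧ (v , acc , t , x)) K l ≡ roundsT t l K
  stage-≡ t K l = refl

  stage-ht : ∀ {S a} {y : Ctx S → El (itemT ⊗ list cfgT ⊗ list (itemT ⊗ itemT) ⊗ a)} →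
             O S (λ c → length (proj₁ (proj₂ (y c)))) → L (S ▹ λ c → Σ[ κ ∈ Config ] (κ ∈ proj₁ (proj₂ (y c)))) (λ (c , κ , _) → sz cfgT κ) →
             L S (λ c → sz famT (proj₁ (proj₂ (proj₂ (y c))))) → HT S stageₜ y
  stage-ht count l-elem l-t = ht-cmap step₀ₚ {l = p₁} {t = p₀ ∘ₜ tl₂} (ht-flat p₁ refl) count l-elem (ht-flat (p₀ ∘ₜ tl₂) refl) l-t

open Pieces using (Fine; Fine₂; Fits; fits)

-- A piece without repetitions has at most as many members as there are vertices, and each label is
-- a part of the vertex list.
l-fine : ∀ {S} (Vs : Ctx S → List Val) → L S (λ c → sz itemT (Vs c)) → {o : Ctx S → Item} → (∀ c → Fine (Vs c) (o c)) → L S (λ c → sz itemT (o c))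
l-fine Vs lVs {o} h = l-list {a = val} {o} (l-mono (λ c → unique-⊆-length (proj₁ (h c)) (proj₂ (h c))) (l-mono (λ c → length≤sz {val} (Vs c)) lVs))
  (l-mono (λ (c , u , i) → ∈-sz (proj₂ (h c) i)) (l▹ lVs))
  where
  ∈-sz : ∀ {u l} → u ∈ l → ‖ u ‖ ≤ₙ sz itemT l
  ∈-sz (here refl) = ℕₚ.m≤n⇒m≤1+n (ℕₚ.m≤m+n _ _)
  ∈-sz {l = v ∷ l} (there i) = ≤-trans (∈-sz i) (ℕₚ.m≤n⇒m≤1+n (ℕₚ.m≤n+m _ ‖ v ‖))

l-items : ∀ {S} (Vs : Ctx S → List Val) → L S (λ c → sz itemT (Vs c)) → {l : Ctx S → List Item} → (∀ c → All (Fine (Vs c)) (l c)) →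
          L S (λ c → length (l c)) → L S (λ c → sz (list itemT) (l c))
l-items Vs lVs {l} h short = l-list {a = itemT} {l} short (l-fine (λ c → Vs (proj₁ c)) (l▹ lVs) (λ (c , u , i) → All.lookup (h c) i))

l-fam : ∀ {S} (Vs : Ctx S → List Val) → L S (λ c → sz itemT (Vs c)) → {φ : Ctx S → Family} → (∀ c → Fine₂ (Vs c) (φ c)) →
        L S (λ c → length (φ c)) → L S (λ c → sz famT (φ c))
l-fam Vs lVs {φ} h short = l-list {a = pairT} {φ} short (l-+ (l-const 1) (l-+
  (l-fine (λ c → Vs (proj₁ c)) (l▹ lVs) (λ (c , u , i) → proj₁ (All.lookup (h c) i)))
  (l-fine (λ c → Vs (proj₁ c)) (l▹ lVs) (λ (c , u , i) → proj₂ (All.lookup (h c) i)))))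

l-fits : ∀ {S} (Vs : Ctx S → List Val) → L S (λ c → sz itemT (Vs c)) → {n : Ctx S → ℕ} {κ : Ctx S → Config} → L S n →
         (∀ c → Fits (Vs c) (n c) (n c) (κ c)) → L S (λ c → sz cfgT (κ c))
l-fits Vs lVs {n} {κ} ln h = l-+ (l-const 1) (l-+
  (l-items Vs lVs (λ c → Fits.todo-fine (h c)) (l-mono (λ c → ≤-trans (ℕₚ.m≤n+m _ _) (Fits.few-items (h c))) ln))
  (l-+ (l-const 1) (l-+ (l-fam Vs lVs (λ c → Fits.out-fine (h c)) (l-mono (λ c → ≤-trans (ℕₚ.m≤m+n _ _) (Fits.few-items (h c))) ln))
    (l-num {l = λ c → proj₂ (proj₂ (κ c))} (l-mono (λ c → Fits.few-cuts (h c)) ln)))))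

module Searching {S : Scale} (Vs : Ctx S → List Val) (lVs : L S (λ c → sz itemT (Vs c))) (R : Ctx S → Req) (lR : L S (λ c → sz reqT (R c)))
                 (n : Ctx S → ℕ) (ln : L S n) (l : Ctx S → List Item) (κ : Ctx S → Num × Family)
                 (start : ∀ c → Fits (Vs c) (n c) (n c) (l c , proj₂ (κ c) , proj₁ (κ c)))
                 (heavy : ∀ c → f (length (proj₁ (κ c))) ≤ₙ W S c) where

  t : Ctx S → List (Item × Item)
  t c = table (R c) (proj₂ (κ c)) (l c)

  reached : Ctx S → List Item → List Config
  reached c l′ = roundsT (t c) l′ ((l c , proj₂ (κ c) , proj₁ (κ c)) ∷ [])

  reached-fits : ∀ c l′ {κ′} → κ′ ∈ reached c l′ → Fits (Vs c) (n c) (n c) κ′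
  reached-fits c l′ = All.lookup (Pieces.rounds-fit (Vs c) (R c) (proj₂ (κ c)) l′ (start c))

  reached-count : ∀ c l′ → length (reached c l′) ≤ₙ W S c
  reached-count c l′ = ≤-trans (rounds-count (R c) (l c) (proj₁ (κ c)) (proj₂ (κ c)) l′) (heavy c)

  l-l : L S (λ c → sz (list itemT) (l c))
  l-l = l-items Vs lVs (λ c → Fits.todo-fine (start c)) (l-mono (λ c → ≤-trans (ℕₚ.m≤n+m _ _) (Fits.few-items (start c))) ln)

  l-out : L S (λ c → sz famT (proj₂ (κ c)))
  l-out = l-fam Vs lVs (λ c → Fits.out-fine (start c)) (l-mono (λ c → ≤-trans (ℕₚ.m≤m+n _ _) (Fits.few-items (start c))) ln)

  arg : Ctx S → El (famT ⊗ list itemT ⊗ reqT)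
  arg c = proj₂ (κ c) , l c , R c

  l-arg : L S (λ c → sz (famT ⊗ list itemT ⊗ reqT) (arg c))
  l-arg = l-+ (l-const 1) (l-+ l-out (l-+ (l-const 1) (l-+ l-l lR)))

  l-table : L S (λ c → sz famT (t c))
  l-table = l-mono (λ c → ℕₚ.≤-reflexive (cong (sz famT) (sym (table-≡ (R c) (proj₂ (κ c)) (l c))))) (l-space tableₚ {x = arg} l-arg)

  x : Ctx S → El (famT ⊗ baseT ⊗ list itemT ⊗ reqT)
  x c = t c , κ c , l c , R c

  initₜ : Tm (famT ⊗ baseT ⊗ list itemT ⊗ reqT) (list cfgT)
  initₜ = consₜ ⟪ p₂ , ⟪ sndₜ ∘ₜ p₁ , fstₜ ∘ₜ p₁ ⟫ ⟫ nilₜ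

  rounds-ht : HT S (foldₜ p₂ initₜ stageₜ) x
  rounds-ht = ht-foldˡ {l = p₂} {initₜ} {stageₜ} {x} (ht-flat p₂ refl) (ht-flat initₜ refl)
    (l-mono (λ c → length≤sz {itemT} (l c)) l-l)
    (stage-ht (o-mono (λ (c , u , l′ , _) → ≤-trans (ℕₚ.≤-reflexive (cong length (stage-≡ (t c) ((l c , proj₂ (κ c) , proj₁ (κ c)) ∷ []) l′))) (reached-count c l′)) (o-W))
      (l-fits (λ c → Vs (proj₁ (proj₁ c))) (l▹ (l▹ lVs)) (l▹ (l▹ ln))
        (λ ((c , u , l′ , _) , κ′ , i) → reached-fits c l′ (subst (κ′ ∈_) (stage-≡ (t c) ((l c , proj₂ (κ c) , proj₁ (κ c)) ∷ []) l′) i)))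
      (l▹ l-table))

  all-rounds-≡ : ∀ c → ⟦ foldₜ p₂ initₜ stageₜ ⟧ (x c) ≡ reached c (l c)
  all-rounds-≡ c = stage-≡ (t c) ((l c , proj₂ (κ c) , proj₁ (κ c)) ∷ []) (l c)

  opaque
    unfolding stageₜ

    searchT-ht : HT S searchTₜ x
    searchT-ht = ht-cmap finalₚ {l = foldₜ p₂ initₜ stageₜ} {t = tl₃} rounds-ht
      (o-mono (λ c → ≤-trans (ℕₚ.≤-reflexive (cong length (all-rounds-≡ c))) (reached-count c (l c))) o-W)
      (l-fits (λ c → Vs (proj₁ c)) (l▹ lVs) (l▹ ln) (λ (c , κ′ , i) → reached-fits c (l c) (subst (κ′ ∈_) (all-rounds-≡ c) i)))
      (ht-flat tl₃ refl) lR

  searchFrom-ht : HT S searchFromₜ (λ c → κ c , l c , R c)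
  searchFrom-ht = ht-∘ (ht-pair (ht-∘ (ht-flat _ refl) (ht-poly tableₚ l-arg)) (ht-flat idₜ refl))
    (ht-cong (λ c → cong (_, κ c , l c , R c) (sym (table-≡ (R c) (proj₂ (κ c)) (l c)))) searchT-ht)

opaque
  unfolding searchT tableOn sat step₀

  searchFrom-≡ : ∀ R l κ → ⟦ searchFromₜ ⟧ (κ , l , R) ≡ searchFrom R l κ
  searchFrom-≡ R l κ = refl

module Generating {S : Scale} (Vs : Ctx S → List Val) (lVs : L S (λ c → sz itemT (Vs c))) (R : Ctx S → Req) (lR : L S (λ c → sz reqT (R c)))
                  (n : Ctx S → ℕ) (ln : L S n) (l : Ctx S → List Item) (K : Ctx S → List (Num × Family))
                  (start : ∀ c {κ} → κ ∈ K c → Fits (Vs c) (n c) (n c) (l c , proj₂ κ , proj₁ κ))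
                  (count : ∀ c → sumOver f (K c) ≤ₙ W S c) where

  S′ : Scale
  S′ = FoldScale S (λ c κ → f (length (proj₁ κ))) (λ c κ → f-pos (length (proj₁ κ))) K

  open Searching {S′} (λ c → Vs (proj₁ c)) (l-via proj₁ (λ _ → ≤-refl) lVs) (λ c → R (proj₁ c)) (l-via proj₁ (λ _ → ≤-refl) lR)
    (λ c → n (proj₁ c)) (l-via proj₁ (λ _ → ≤-refl) ln) (λ c → l (proj₁ c)) (λ c → proj₁ (proj₂ c))
    (λ (c , i) → start c (at-∈ i)) (λ _ → ≤-refl)

  sum≡ : ∀ K′ → sumBy (λ κ → f (length (proj₁ κ))) K′ ≡ sumOver f K′
  sum≡ []       = refl
  sum≡ (κ ∷ K′) = cong (f (length (proj₁ κ)) +_) (sum≡ K′)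

  genFrom-ht : HT S genFromₜ (λ c → K c , l c , R c)
  genFrom-ht = ht-fold {l = p₀} {nilₜ} {appendₜ (searchFromₜ ∘ₜ ⟪ p₀ , tl₁ ∘ₜ tl₂ ⟫) p₁} _ _ (ht-flat p₀ refl) (ht-flat nilₜ refl)
    (o-mono (λ c → ≤-trans (ℕₚ.≤-reflexive (sum≡ (K c))) (count c)) o-W)
    (ht-append {S = S′} {f = searchFromₜ ∘ₜ ⟪ p₀ , tl₁ ∘ₜ tl₂ ⟫} {p₁} (ht-∘ (ht-flat _ refl) searchFrom-ht) (ht-flat p₁ refl)
      (o-mono (λ (c , κ , _) → ≤-trans (ℕₚ.≤-reflexive (cong length (searchFrom-≡ (R c) (l c) κ))) (search-length (R c) (l c) (proj₁ κ) (proj₂ κ))) o-W))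

-- Cost of combining the children

length-extend : ∀ F K → length F * length K ≤ₙ length (extend F K)
length-extend F K = ≤-trans (go K) (ℕₚ.≤-reflexive (trans (sym (sumOver-extend (λ _ → 1) F K)) (ones (extend F K))))
  where
  ones : ∀ K → sumOver (λ _ → 1) K ≡ length K
  ones []      = refl
  ones (κ ∷ K) = cong suc (ones K)
  at-least : ∀ n → length F ≤ₙ lift (length F) (λ _ → 1) n
  at-least zero    = ℕₚ.≤-reflexive (sym (ℕₚ.*-identityʳ _))
  at-least (suc n) = ≤-trans (ℕₚ.≤-reflexive (sym (ℕₚ.*-identityʳ _))) (ℕₚ.m≤m+n _ 1)
  go : ∀ K → length F * length K ≤ₙ sumOver (lift (length F) (λ _ → 1)) K
  go []      = ℕₚ.≤-reflexive (ℕₚ.*-zeroʳ (length F))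
  go (κ ∷ K) = ≤-trans (ℕₚ.≤-reflexive (ℕₚ.*-suc (length F) (length K))) (ℕₚ.+-mono-≤ (at-least (length (proj₁ κ))) (go K))

Nonempty : Res → Set
Nonempty r = opts r ≡ [] → 1 ≤ₙ length (fams r)

bases-grow : ∀ {c out r rs} → Nonempty r → length (bases c out rs) ≤ₙ length (bases c out (r ∷ rs))
bases-grow {c} {out} {m , [] , F} {rs} h = ≤-trans (ℕₚ.≤-reflexive (sym (ℕₚ.*-identityˡ _)))
  (≤-trans (ℕₚ.*-monoˡ-≤ (length (bases c out rs)) (h refl)) (length-extend F (bases c out rs)))
bases-grow {r = m , _ ∷ _ , F} h = ≤-refl

-- The intermediate lists of the fold must not outgrow the final one, the only one whose length is
-- bounded by counting. They do not, since a child with families has at least one; the factor 1 +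
-- |F| is the work per base, hence twice the final length.
bases-within : ∀ {c out r rs} pre → All Nonempty (pre ++ r ∷ rs) → opts r ≡ [] →
               suc (length (fams r)) * length (bases c out rs) ≤ₙ length (bases c out (pre ++ r ∷ rs)) + length (bases c out (pre ++ r ∷ rs))
bases-within {c} {out} {m , .[] , F} {rs} [] (h ∷ _) refl = ℕₚ.+-mono-≤ (bases-grow {c} {out} {m , [] , F} {rs} h) (length-extend F (bases c out rs))
bases-within {c} {out} {r} {rs} (r′ ∷ pre) (h ∷ hs) e = ≤-trans (bases-within {c} {out} {r} {rs} pre hs e) (ℕₚ.+-mono-≤ (bases-grow {c} {out} {r′} {pre ++ r ∷ rs} h) (bases-grow {c} {out} {r′} {pre ++ r ∷ rs} h))

decr-count : ∀ {A : Set} (c : Num) {y : Num → A} → length (caseL c [] (λ _ c′ → y c′ ∷ [])) ≤ₙ 1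
decr-count []      = z≤n
decr-count (_ ∷ _) = ≤-refl

extend-ht : ∀ {S} {F : Ctx S → List Family} {K : Ctx S → List (Num × Family)} → O S (λ c → suc (length (F c)) * length (K c)) →
            L (S ▹ λ c → Σ[ φ ∈ Family ] (φ ∈ F c)) (λ (c , φ , _) → length φ) → HT S extendₜ (λ c → F c , K c)
extend-ht {S} {F} {K} count l-φ = ht-fold {l = tl₁} {nilₜ} {appendₜ Aₜ Bₜ} (λ c _ → suc (length (F c))) (λ _ _ → s≤s z≤n) (ht-flat tl₁ refl) (ht-flat nilₜ refl)
  (o-mono (λ c → ℕₚ.≤-reflexive (sumBy-const (suc (length (F c))) (K c))) count)
  (ht-append {f = Aₜ} {Bₜ} (ht-case (ht-flat _ refl) (ht-flat nilₜ refl) (ht-flat _ refl)) ht-B (o-mono (λ (c , κ , _) → decr-count (proj₁ κ)) (o-const 1)))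
  where
  Aₜ : Tm (baseT ⊗ list baseT ⊗ list famT ⊗ list baseT) (list baseT)
  Aₜ = caseₜ (fstₜ ∘ₜ p₀) nilₜ (consₜ ⟪ p₁ , sndₜ ∘ₜ p₀ ∘ₜ tl₂ ⟫ nilₜ)
  Bₜ : Tm (baseT ⊗ list baseT ⊗ list famT ⊗ list baseT) (list baseT)
  Bₜ = foldₜ (fstₜ ∘ₜ tl₂) p₁ (consₜ ⟪ fstₜ ∘ₜ p₀ ∘ₜ tl₂ , appendₜ p₀ (sndₜ ∘ₜ p₀ ∘ₜ tl₂) ⟫ p₁)
  ht-B : HT (FoldScale S (λ c _ → suc (length (F c))) (λ _ _ → s≤s z≤n) K) Bₜ _
  ht-B = ht-foldʳ {l = fstₜ ∘ₜ tl₂} (ht-flat _ refl) (ht-flat p₁ refl) (o-mono (λ (c , _) → ℕₚ.n≤1+n (length (F c))) o-W)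
    (ht-cons (ht-pair (ht-flat _ refl) (ht-append {f = p₀} (ht-flat _ refl) (ht-flat _ refl)
      (l⇒o (l-via (λ ((c , _) , i) → c , proj₁ i , at-∈ i) (λ _ → ≤-refl) l-φ)))) (ht-flat _ refl))

open Pieces using (Fine; Fine₂; Fits; fits; Lean; Leans; Based; based)

leans-∈ : ∀ {Vs K ts rs} → Leans Vs K ts rs → ∀ {r} → r ∈ rs → ∃[ t ] (Lean Vs (5 * length (verts t)) (length (verts t) * K) r × length (verts t) ≤ₙ length (vertsF ts))
leans-∈ (Pieces._∷_ {t = t} h hs) (here refl) = t , h , ≤-trans (ℕₚ.m≤m+n _ _) (ℕₚ.≤-reflexive (sym (Listₚ.length-++ (verts t))))
leans-∈ (Pieces._∷_ {t = t} h hs) (there i) = let t′ , h′ , le = leans-∈ hs i in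
  t′ , h′ , ≤-trans le (≤-trans (ℕₚ.m≤n+m _ _) (ℕₚ.≤-reflexive (sym (Listₚ.length-++ (verts t)))))

leans-length : ∀ {Vs K ts rs} → Leans Vs K ts rs → length rs ≤ₙ length (vertsF ts)
leans-length Pieces.[] = z≤n
leans-length (Pieces._∷_ {t = node v us} h hs) = s≤s (≤-trans (leans-length hs) (≤-trans (ℕₚ.m≤n+m _ _) (ℕₚ.≤-reflexive (sym (Listₚ.length-++ (vertsF us))))))

kids-nonempty : ∀ {R ts rs} → Kids R ts rs → All Nonempty rs
kids-nonempty [] = []
kids-nonempty {rs = r ∷ rs} (ok ∷ kids) = some (Ok.kind ok) ∷ kids-nonempty kids
  where
  some : Kind _ _ _ (opts r) (fams r) → Nonempty r
  some k e with opts r | fams r | k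
  ... | [] | F | complex ck = fams-pos (Ok.attained ok) ck

module NodeCost {S : Scale} (Vs : Ctx S → List Val) (lVs : L S (λ c → sz itemT (Vs c))) (R : Ctx S → Req) (lR : L S (λ c → sz reqT (R c)))
                (k : Ctx S → Num) (lk : L S (λ c → length (k c))) (v : Ctx S → Val) (v∈ : ∀ c → v c ∈ Vs c) (ts : Ctx S → List Rose) (rs : Ctx S → List Res)
                (leans : ∀ c → Leans (Vs c) (suc (length (k c))) (ts c) (rs c)) (lts : L S (λ c → length (vertsF (ts c)))) where

  l-rs : L S (λ c → length (rs c))
  l-rs = l-mono (λ c → leans-length (leans c)) lts

  opts≤4 : ∀ c (i : At (rs c)) → length (opts (proj₁ i)) ≤ₙ 4
  opts≤4 c i = Lean.opts-few (proj₁ (proj₂ (leans-∈ (leans c) (at-∈ i))))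

  itemsOf-ht : HT S itemsOfₜ rs
  itemsOf-ht = ht-foldˡ {l = idₜ} {nilₜ} {appendₜ (fstₜ ∘ₜ sndₜ ∘ₜ p₀) p₁} (ht-flat idₜ refl) (ht-flat nilₜ refl) l-rs
    (ht-append {f = fstₜ ∘ₜ sndₜ ∘ₜ p₀} (ht-flat _ refl) (ht-flat p₁ refl) (o-mono (λ (c , i) → opts≤4 c i) (o-const 4)))

  total-ht : HT S totalₜ rs
  total-ht = ht-foldˡ {l = idₜ} {nilₜ} {appendₜ (fstₜ ∘ₜ p₀) p₁} (ht-flat idₜ refl) (ht-flat nilₜ refl) l-rs
    (ht-append {f = fstₜ ∘ₜ p₀} (ht-flat _ refl) (ht-flat p₁ refl) (l⇒o
      (l-mono (λ (c , i) → let t , h , le = leans-∈ (leans c) (at-∈ i) in ≤-trans (Lean.size-few h) (ℕₚ.*-monoˡ-≤ (suc (length (k c))) le))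
        (l▹ (l-* lts (l-+ (l-const 1) lk))))))

  budget-ht : (d : Ctx S → Num) → HT S budgetₜ (λ c → d c , rs c)
  budget-ht d = ht-foldˡ {l = tl₁} {p₀} {stepₜ} (ht-flat tl₁ refl) (ht-flat p₀ refl) l-rs
    (ht-case (ht-flat (fstₜ ∘ₜ sndₜ ∘ₜ p₀) refl) (ht-flat p₁ refl) (ht-foldˡ {l = p₁} {p₁ ∘ₜ tl₂} (ht-flat p₁ refl) (ht-flat _ refl)
      (l-mono (λ ((c , i) , u , us , e) → ≤-trans (ℕₚ.n≤1+n _) (≤-trans (ℕₚ.≤-reflexive (cong length (sym e))) (opts≤4 c i))) (l-const 4))
      (ht-flat _ refl)))
    where
    stepₜ : Tm (resT ⊗ numT ⊗ numT ⊗ list resT) numT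
    stepₜ = caseₜ (fstₜ ∘ₜ sndₜ ∘ₜ p₀) p₁ (foldₜ p₁ (p₁ ∘ₜ tl₂) (consₜ unitₜ p₁))

  module Try (d : Ctx S → Num) (room : ∀ c → length (total (rs c)) + length (d c) ≤ₙ length (k c)) (kids : ∀ c → Kids (R c) (ts c) (rs c))
             (heavy : ∀ c m → Weak (length (k c)) m → m ≤ₙ W S c) where

    out₀ : Ctx S → Family
    out₀ c = (v c ∷ [] , v c ∷ []) ∷ []

    K : Ctx S → List (Num × Family)
    K c = bases (budget (d c) (rs c)) (out₀ c) (rs c)

    count : ∀ c → sumOver f (K c) ≤ₙ W S c
    count c = heavy c _ (Pieces.kids-bases (Vs c) (k c) (d c) (out₀ c) (room c) (kids c))

    length-K : ∀ c → length (K c) ≤ₙ W S c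
    length-K c = ≤-trans (go (K c)) (count c)
      where
      go : ∀ K → length K ≤ₙ sumOver f K
      go []      = z≤n
      go (κ ∷ K) = ℕₚ.+-mono-≤ (f-pos (length (proj₁ κ))) (go K)

    n : Ctx S → ℕ
    n c = 1 + 5 * length (vertsF (ts c)) + length (k c)

    ln : L S n
    ln = l-+ (l-+ (l-const 1) (l-* (l-const 5) lts)) lk

    start : ∀ c {κ} → κ ∈ K c → Fits (Vs c) (n c) (n c) (itemsOf (rs c) , proj₂ κ , proj₁ κ)
    start c {κ} i with Pieces.bases-fine (Vs c) (budget (d c) (rs c)) (out₀ c) (leans c) ((([] ∷ [] , λ { (here refl) → v∈ c }) , ([] ∷ [] , λ { (here refl) → v∈ c })) ∷ []) i
    ... | based of few≤ cuts≤ = fits (proj₁ (Pieces.leans-items (Vs c) (leans c))) of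
      (≤-trans (ℕₚ.+-monoʳ-≤ (length (proj₂ κ)) (proj₂ (Pieces.leans-items (Vs c) (leans c)))) (≤-trans few≤ (ℕₚ.m≤m+n _ _)))
      (≤-trans cuts≤ (≤-trans (≤-trans (ℕₚ.m≤n+m _ (complexes (rs c))) (≤-trans (budget≤ (d c) (kids c)) (room c))) (ℕₚ.m≤n+m _ _)))

    bases-ht : HT S basesₜ (λ c → (budget (d c) (rs c) , out₀ c) , rs c)
    bases-ht = ht-foldˡ {l = tl₁} {consₜ p₀ nilₜ} {stepₜ} (ht-flat tl₁ refl) (ht-flat _ refl) l-rs
      (ht-case (ht-flat (fstₜ ∘ₜ sndₜ ∘ₜ p₀) refl)
        (ht-∘ (ht-pair (ht-flat _ refl) (ht-flat _ refl)) (extend-ht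
          (o-mono (λ ((c , r , rs′ , pre , eq) , e) → subst (λ l → suc (length (fams r)) * length (bases (budget (d c) (rs c)) (out₀ c) rs′) ≤ₙ
                     length (bases (budget (d c) (rs c)) (out₀ c) l) + length (bases (budget (d c) (rs c)) (out₀ c) l)) (sym eq)
                     (bases-within pre (subst (All Nonempty) eq (kids-nonempty (kids c))) e))
            (o▹ (o▹ (o-+ (o-mono length-K o-W) (o-mono length-K o-W)))))
          (l-mono (λ (((c , i) , e) , φ , j) → let t , h , le = leans-∈ (leans c) (at-∈ i) in
              ≤-trans (ℕₚ.m≤m+n _ 4) (≤-trans (proj₂ (All.lookup (Lean.fams-fine h) j)) (ℕₚ.*-monoʳ-≤ 5 le)))
            (l▹ (l▹ (l▹ (l-* (l-const 5) lts)))))))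
        (ht-flat _ refl))
      where
      stepₜ : Tm (resT ⊗ list baseT ⊗ baseT ⊗ list resT) (list baseT)
      stepₜ = caseₜ (fstₜ ∘ₜ sndₜ ∘ₜ p₀) (extendₜ ∘ₜ ⟪ sndₜ ∘ₜ sndₜ ∘ₜ p₀ , p₁ ⟫) (p₁ ∘ₜ tl₂)

    gen-ht : HT S genₜ (λ c → d c , v c , rs c , R c)
    gen-ht = ht-∘ (ht-pair (ht-∘ (ht-pair (ht-pair (ht-∘ (ht-flat _ refl) (budget-ht d)) (ht-flat _ refl)) (ht-flat p₂ refl)) bases-ht)
                           (ht-pair (ht-∘ (ht-flat p₂ refl) itemsOf-ht) (ht-flat tl₃ refl)))
      (Generating.genFrom-ht Vs lVs R lR n ln (λ c → itemsOf (rs c)) K start count)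

opaque
  unfolding gen searchT tableOn sat options step₀

  loop-≡ : ∀ {a} {x : El a} R v rs l → foldr (λ u acc → ⟦ loopStepₜ ∘ₜ ⟪ p₁ , tl₁ ∘ₜ tl₂ ⟫ ⟧ (u , acc , x , v , rs , R)) ([] , []) l ≡ loop R v rs l
  loop-≡ R v rs l = refl

drop-ht : ∀ {S} {m n : Ctx S → Num} → L S (λ c → length (m c)) → HT S dropₜ (λ c → n c , m c)
drop-ht short = ht-foldˡ {l = tl₁} {p₀} {caseₜ p₁ nilₜ p₁} (ht-flat tl₁ refl) (ht-flat p₀ refl) short
  (ht-case (ht-flat p₁ refl) (ht-flat nilₜ refl) (ht-flat p₁ refl))

simple-ht : ∀ {S x} → HT S simpleₜ x
simple-ht = ht-case (ht-flat p₀ refl) (ht-flat _ refl) (ht-case (ht-flat p₁ refl) (ht-flat _ refl) (ht-case (ht-flat p₁ refl)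
  (ht-case (ht-flat _ refl) (ht-flat _ refl) (ht-case (ht-flat p₁ refl) (ht-flat _ refl) (ht-flat _ refl))) (ht-flat _ refl)))

module FinishCost {S : Scale} (Vs : Ctx S → List Val) (lVs : L S (λ c → sz itemT (Vs c))) (R : Ctx S → Req) (lR : L S (λ c → sz reqT (R c)))
                  (k : Ctx S → Num) (lk : L S (λ c → length (k c))) (v : Ctx S → Val) (v∈ : ∀ c → v c ∈ Vs c) (ts : Ctx S → List Rose) (rs : Ctx S → List Res)
                  (leans : ∀ c → Leans (Vs c) (suc (length (k c))) (ts c) (rs c)) (goods : ∀ c → Goods (R c) (k c) (ts c) (rs c))
                  (lts : L S (λ c → length (vertsF (ts c)))) (heavy : ∀ c m → Weak (length (k c)) m → m ≤ₙ W S c) where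

  open NodeCost Vs lVs R lR k lk v v∈ ts rs leans lts using (total-ht)

  l : Ctx S → Num
  l c = dropB (tt ∷ k c) (total (rs c))

  l-l : L S (λ c → length (l c))
  l-l = l-mono (λ c → ≤-trans (ℕₚ.≤-reflexive (length-drop (tt ∷ k c) (total (rs c)))) (ℕₚ.m∸n≤m (suc (length (k c))) (length (total (rs c))))) (l-+ (l-const 1) lk)

  l-total : L S (λ c → length (total (rs c)))
  l-total = l-mono (λ c → Pieces.leans-total (Vs c) (leans c)) (l-* lts (l-+ (l-const 1) lk))

  loop-ht : HT S loopₜ (λ c → l c , v c , rs c , R c)
  loop-ht = ht-foldˡ {l = p₀} {⟪ nilₜ , nilₜ ⟫} {loopStepₜ ∘ₜ ⟪ p₁ , tl₁ ∘ₜ tl₂ ⟫} (ht-flat p₀ refl) (ht-flat _ refl) l-l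
    (ht-∘ (ht-flat ⟪ p₁ , tl₁ ∘ₜ tl₂ ⟫ refl) (ht-case (ht-flat _ refl)
      (ht-case (ht-∘ (ht-pair (ht-flat _ refl) (ht-flat _ refl)) tries) (ht-flat _ refl) (ht-flat _ refl))
      (ht-flat _ refl)))
    where
    state : (c : Σ[ c ∈ Ctx S ] At (l c)) → Num × List Family
    state (c , u , l′ , _) = foldr (λ u acc → ⟦ loopStepₜ ∘ₜ ⟪ p₁ , tl₁ ∘ₜ tl₂ ⟫ ⟧ (u , acc , l c , v c , rs c , R c)) ([] , []) l′
    room : ∀ c → length (total (rs (proj₁ c))) + length (proj₁ (state c)) ≤ₙ length (k (proj₁ c))
    room c@(c₀ , u , l′ , pre , eq) = drop-room (k c₀) (total (rs c₀)) (≤-trans (s≤s (≤-trans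
        (ℕₚ.≤-reflexive (cong (λ s → length (proj₁ s)) (loop-≡ {numT} {l c₀} (R c₀) (v c₀) (rs c₀) l′))) (proj₁ (loop-result (R c₀) (v c₀) (rs c₀) l′))))
      (≤-trans (ℕₚ.m≤n+m _ (length pre)) (ℕₚ.≤-reflexive (trans (sym (Listₚ.length-++ pre)) (cong length (sym eq))))))
    tries : HT (S ▹ (λ c → At (l c)) ▹ (λ c → proj₂ (state c) ≡ [])) genₜ (λ (c , _) → proj₁ (state c) , v (proj₁ c) , rs (proj₁ c) , R (proj₁ c))
    tries = NodeCost.Try.gen-ht (λ c → Vs (proj₁ (proj₁ c))) (l▹ (l▹ lVs)) (λ c → R (proj₁ (proj₁ c))) (l▹ (l▹ lR)) (λ c → k (proj₁ (proj₁ c))) (l▹ (l▹ lk))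
      (λ c → v (proj₁ (proj₁ c))) (λ c → v∈ (proj₁ (proj₁ c))) (λ c → ts (proj₁ (proj₁ c))) (λ c → rs (proj₁ (proj₁ c))) (λ c → leans (proj₁ (proj₁ c))) (l▹ (l▹ lts))
      (λ c → proj₁ (state (proj₁ c))) (λ c → room (proj₁ c))
      (λ c → goods-kids (goods (proj₁ (proj₁ c))) (≤-trans (ℕₚ.m≤m+n _ _) (room (proj₁ c)))) (λ c → heavy (proj₁ (proj₁ c)))

  s′ : Ctx S → Num × List Family
  s′ c = loop (R c) (v c) (rs c) (l c)

  pack-ht : HT S packₜ (λ c → appB (total (rs c)) (proj₁ (s′ c)) , proj₂ (s′ c) , R c)
  pack-ht = ht-if {t = simpleₜ ∘ₜ ⟪ p₀ , p₁ ⟫} (ht-∘ (ht-flat ⟪ p₀ , p₁ ⟫ refl) simple-ht)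
    (ht-pair (ht-flat p₀ refl) (ht-pair (ht-∘ (ht-flat _ refl) (ht-poly optionsₚ (l-+ (l-const 1) (l-+
      (l-list {a = famT} {λ c → proj₂ (s′ (proj₁ c))} (l-mono (λ (c , e) → proj₂ (Pieces.loop-lean (Vs c) (v∈ c) (goods c) (leans c)) e) (l-const 2))
        (l-fam (λ c → Vs (proj₁ (proj₁ c))) (l▹ (l▹ lVs)) (λ ((c , e) , φ , i) → proj₁ (All.lookup (proj₁ (Pieces.loop-lean (Vs c) (v∈ c) (goods c) (leans c))) i))
          (l-mono (λ ((c , e) , φ , i) → ≤-trans (ℕₚ.m≤m+n _ 4) (proj₂ (All.lookup (proj₁ (Pieces.loop-lean (Vs c) (v∈ c) (goods c) (leans c))) i)))
            (l▹ (l▹ (l-* (l-const 5) (l-+ (l-const 1) lts)))))))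
      (l▹ lR))))) (ht-flat nilₜ refl)))
    (ht-flat _ refl)

  finish-ht : HT S finishₜ (λ c → v c , rs c , k c , R c)
  finish-ht = ht-∘ (ht-pair (ht-∘ (ht-pair (ht-∘ (ht-pair (ht-flat _ refl) (ht-∘ (ht-flat p₁ refl) total-ht)) (drop-ht {m = λ c → total (rs c)} {λ c → tt ∷ k c} l-total)) (ht-flat _ refl)) loop-ht) (ht-flat idₜ refl))
    (ht-∘ (ht-pair (ht-append {f = totalₜ ∘ₜ p₁ ∘ₜ tl₁} (ht-∘ (ht-flat _ refl) total-ht) (ht-flat _ refl) (l⇒o l-total)) (ht-flat _ refl))
      (ht-cong (λ c → cong (λ s → appB (total (rs c)) (proj₁ s) , proj₂ s , R c) (sym (loop-≡ {numT} {l c} (R c) (v c) (rs c) (l c)))) pack-ht))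

-- Cost of the traversal

hung-verts : ∀ o → vertsS (foldr hang [] o) ↭ List.map proj₁ o
hung-verts [] = ↭-refl
hung-verts (e ∷ o) = prep (proj₁ e) (↭-trans (hang-verts (proj₁ e) (foldr hang [] o)) (hung-verts o))

record Hung (o : Pairs) (ts : List Rose) : Set where
  constructor hung
  field
    hung-unique : Unique (vertsF ts)
    hung-known  : ∀ {x} → x ∈ vertsF ts → x ∈ Known o
    hung-length : length (vertsF ts) ≤ₙ length o

open Hung

-- Subtrees built from a suffix contain the children of that suffix only, which are distinct, so
-- every intermediate state is covered by the correctness results for trees.
hung-kids : ∀ {o} pre o′ → Order o → o ≡ pre ++ o′ → ∀ v → Hung o (kidsOf v (foldr hang [] o′))
hung-kids pre o′ ord refl v = hung
  (proj₁ (allPairs-++⁻ (vertsF ts) unique-all))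
  (λ i → there (subst (_ ∈_) (sym (Listₚ.map-++ proj₁ pre o′)) (∈ₚ.∈-++⁺ʳ (List.map proj₁ pre) (Permₚ.∈-resp-↭ all↭ (∈ₚ.∈-++⁺ˡ i)))))
  (≤-trans (ℕₚ.m≤m+n _ _) (≤-trans (ℕₚ.≤-reflexive (trans (sym (Listₚ.length-++ (vertsF ts))) (trans (Permₚ.↭-length all↭) (Listₚ.length-map proj₁ o′))))
    (≤-trans (ℕₚ.m≤n+m _ (length pre)) (ℕₚ.≤-reflexive (sym (Listₚ.length-++ pre))))))
  where
  ts : List Rose
  ts = kidsOf v (foldr hang [] o′)
  all↭ : vertsF ts ++ vertsS (restOf v (foldr hang [] o′)) ↭ List.map proj₁ o′
  all↭ = ↭-trans (hang-verts v (foldr hang [] o′)) (hung-verts o′)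
  unique-all : Unique (vertsF ts ++ vertsS (restOf v (foldr hang [] o′)))
  unique-all = allPairs-↭ (λ ne e → ne (sym e)) (↭-sym all↭)
    (proj₁ (proj₂ (allPairs-++⁻ (List.map proj₁ pre) (subst Unique (Listₚ.map-++ proj₁ pre o′) (AllPairs.tail (order-unique ord))))))

hang-length : ∀ o → length (foldr hang [] o) ≤ₙ length o
hang-length [] = z≤n
hang-length (e ∷ o) = s≤s (≤-trans (rest≤ (foldr hang [] o)) (hang-length o))
  where
  rest≤ : ∀ st → length (restOf (proj₁ e) st) ≤ₙ length st
  rest≤ [] = z≤n
  rest≤ (x ∷ st) with eqb {val} (proj₁ e) (proj₁ x)
  ... | true  = ℕₚ.m≤n⇒m≤1+n (rest≤ st)
  ... | false = s≤s (rest≤ st)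

known-sz : ∀ o → sz itemT (Known o) ≤ₙ 2 + sz (list (val ⊗ val)) o
known-sz o = s≤s (s≤s (go o))
  where
  go : ∀ o → sz itemT (List.map proj₁ o) ≤ₙ sz (list (val ⊗ val)) o
  go [] = ≤-refl
  go (e ∷ o) = s≤s (ℕₚ.+-mono-≤ (ℕₚ.m≤n⇒m≤1+n (ℕₚ.m≤m+n _ _)) (go o))

label-sz : ∀ {o e} → e ∈ o → ‖ proj₁ e ‖ ≤ₙ sz (list (val ⊗ val)) o
label-sz (here refl) = ℕₚ.m≤n⇒m≤1+n (≤-trans (ℕₚ.m≤n⇒m≤1+n (ℕₚ.m≤m+n _ _)) (ℕₚ.m≤m+n _ _))
label-sz {e′ ∷ o} (there i) = ≤-trans (label-sz i) (ℕₚ.m≤n⇒m≤1+n (ℕₚ.m≤n+m _ (sz (val ⊗ val) e′)))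

children-ht : ∀ {S} {v : Ctx S → Val} {st : Ctx S → List (Val × Res)} → L S (λ c → ‖ v c ‖) → L S (λ c → length (st c)) →
              HT S childrenOfₜ (λ c → v c , st c) × HT S othersOfₜ (λ c → v c , st c)
children-ht {S} {v} {st} lv lst =
  ht-foldˡ {l = tl₁} {nilₜ} {ifₜ sameₜ (consₜ (sndₜ ∘ₜ p₀) p₁) p₁} (ht-flat tl₁ refl) (ht-flat nilₜ refl) lst
    (ht-if {t = sameₜ} (ht-eq {f = p₀ ∘ₜ tl₂} {fstₜ ∘ₜ p₀} (ht-flat _ refl) (ht-flat _ refl) (l▹ lv)) (ht-flat _ refl) (ht-flat p₁ refl)) ,
  ht-foldˡ {l = tl₁} {nilₜ} {ifₜ sameₜ p₁ (consₜ p₀ p₁)} (ht-flat tl₁ refl) (ht-flat nilₜ refl) lst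
    (ht-if {t = sameₜ} (ht-eq {f = p₀ ∘ₜ tl₂} {fstₜ ∘ₜ p₀} (ht-flat _ refl) (ht-flat _ refl) (l▹ lv)) (ht-flat p₁ refl) (ht-flat _ refl))
  where
  sameₜ : ∀ {d} → Tm ((val ⊗ resT) ⊗ d ⊗ val ⊗ list (val ⊗ resT)) bool
  sameₜ = eqₜ (p₀ ∘ₜ tl₂) (fstₜ ∘ₜ p₀)

processStepₜ : Tm ((val ⊗ val) ⊗ list (val ⊗ resT) ⊗ list (val ⊗ val) ⊗ numT ⊗ reqT) (list (val ⊗ resT))
processStepₜ = consₜ ⟪ sndₜ ∘ₜ p₀ ,
  finishₜ ∘ₜ ⟪ fstₜ ∘ₜ p₀ , ⟪ childrenOfₜ ∘ₜ ⟪ fstₜ ∘ₜ p₀ , p₁ ⟫ , tl₁ ∘ₜ tl₂ ⟫ ⟫ ⟫ (othersOfₜ ∘ₜ ⟪ fstₜ ∘ₜ p₀ , p₁ ⟫)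

opaque
  unfolding gen searchT tableOn sat options step₀

  process-state : ∀ {o} R k o′ → foldr (λ u acc → ⟦ processStepₜ ⟧ (u , acc , o , k , R)) [] o′ ≡ process R k o′
  process-state R k o′ = refl

module ProcessCost {S : Scale} (o : Ctx S → Pairs) (order : ∀ c → Order (o c)) (lo : L S (λ c → sz (list (val ⊗ val)) (o c)))
                   (R : Ctx S → Req) (lR : L S (λ c → sz reqT (R c))) (irr : ∀ c x → ¬ (x , x) ∈ R c)
                   (k : Ctx S → Num) (lk : L S (λ c → length (k c))) (heavy : ∀ c m → Weak (length (k c)) m → m ≤ₙ W S c) where

  l-length : L S (λ c → length (o c))
  l-length = l-mono (λ c → length≤sz {val ⊗ val} (o c)) lo

  solved-at : ∀ c → Pairs → List (Val × Res)
  solved-at c o′ = solved (R c) (k c) (foldr hang [] o′)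

  finish-at : (v : Ctx S → Val) → (∀ c → v c ∈ Known (o c)) → (o′ : Ctx S → Pairs) → (∀ c → ∃[ pre ] o c ≡ pre ++ o′ c) →
              HT S finishₜ (λ c → v c , childrenOf (v c) (solved-at c (o′ c)) , k c , R c)
  finish-at v v∈ o′ suf = ht-cong (λ c → cong (λ rs → v c , rs , k c , R c) (sym (childrenOf-solved (R c) (k c) (v c) (foldr hang [] (o′ c)))))
    (FinishCost.finish-ht (λ c → Known (o c)) (l-mono (λ c → known-sz (o c)) (l-+ (l-const 2) lo)) R lR k lk v v∈ ts (λ c → results (R c) (k c) (ts c))
      (λ c → Pieces.results-lean (Known (o c)) (k c) (ts c) (irr c) (hung-unique (h c)) (hung-known (h c)))
      (λ c → results-good (k c) (ts c) (irr c) (hung-unique (h c)))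
      (l-mono (λ c → hung-length (h c)) l-length) heavy)
    where
    ts : Ctx S → List Rose
    ts c = kidsOf (v c) (foldr hang [] (o′ c))
    h : ∀ c → Hung (o c) (ts c)
    h c = hung-kids (proj₁ (suf c)) (o′ c) (order c) (proj₂ (suf c)) (v c)

appendix : ∀ {A : Set} {l : List A} (i : At l) → ∃[ pre ] l ≡ pre ++ proj₁ (proj₂ i)
appendix (u , l′ , pre , e) = pre ++ u ∷ [] , trans e (sym (Listₚ.++-assoc pre (u ∷ []) l′))

module _ (g : Tm (val ⊗ list resT ⊗ numT ⊗ reqT) resT) (h : Tm (list (val ⊗ val) ⊗ numT ⊗ reqT) (list (val ⊗ resT))) where

  sizeWith : Tm (list (val ⊗ val) ⊗ numT ⊗ reqT) numT
  sizeWith = fstₜ ∘ₜ g ∘ₜ ⟪ emptyₜ , ⟪ childrenOfₜ ∘ₜ ⟪ emptyₜ , h ⟫ , tl₁ ⟫ ⟫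

  solveWith : Tm (list (val ⊗ val) ⊗ numT ⊗ reqT) bool
  solveWith = caseₜ (dropₜ ∘ₜ ⟪ sizeWith , p₁ ⟫) (boolₜ true) (boolₜ false)

sizeₜ : Tm (list (val ⊗ val) ⊗ numT ⊗ reqT) numT
sizeₜ = sizeWith finishₜ processₜ

solveₜ : Tm (list (val ⊗ val) ⊗ numT ⊗ reqT) bool
solveₜ = solveWith finishₜ processₜ

module RunCost {S : Scale} (o : Ctx S → Pairs) (order : ∀ c → Order (o c)) (lo : L S (λ c → sz (list (val ⊗ val)) (o c)))
               (R : Ctx S → Req) (lR : L S (λ c → sz reqT (R c))) (irr : ∀ c x → ¬ (x , x) ∈ R c)
               (k : Ctx S → Num) (lk : L S (λ c → length (k c))) (heavy : ∀ c m → Weak (length (k c)) m → m ≤ₙ W S c) where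

  module Each = ProcessCost {S ▹ λ c → At (o c)} (λ c → o (proj₁ c)) (λ c → order (proj₁ c)) (l▹ lo) (λ c → R (proj₁ c)) (l▹ lR) (λ c → irr (proj₁ c))
    (λ c → k (proj₁ c)) (l▹ lk) (λ c → heavy (proj₁ c))

  open ProcessCost o order lo R lR irr k lk heavy using (l-length; finish-at; solved-at)

  state : (c : Σ[ c ∈ Ctx S ] At (o c)) → List (Val × Res)
  state (c , _ , o′ , _) = foldr (λ u acc → ⟦ processStepₜ ⟧ (u , acc , o c , k c , R c)) [] o′

  state-≡ : ∀ c → state c ≡ Each.solved-at c (proj₁ (proj₂ (proj₂ c)))
  state-≡ (c , _ , o′ , _) = trans (process-state {o c} (R c) (k c) o′) (process-solved (R c) (k c) o′)

  solved-short : ∀ c o′ → length (solved-at c o′) ≤ₙ length o′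
  solved-short c o′ = ≤-trans (ℕₚ.≤-reflexive (Listₚ.length-map _ (foldr hang [] o′))) (hang-length o′)

  l-state : L (S ▹ λ c → At (o c)) (λ c → length (state c))
  l-state = l-mono short (l▹ l-length)
    where
    short : ∀ c → length (state c) ≤ₙ length (o (proj₁ c))
    short c@(c₀ , i) = ≤-trans (ℕₚ.≤-reflexive (cong length (state-≡ c))) (≤-trans (solved-short c₀ (proj₁ (proj₂ i)))
      (≤-trans (ℕₚ.m≤n+m _ (length (proj₁ (appendix i)))) (ℕₚ.≤-reflexive (trans (sym (Listₚ.length-++ (proj₁ (appendix i)))) (cong length (sym (proj₂ (appendix i))))))))

  l-label : L (S ▹ λ c → At (o c)) (λ c → ‖ proj₁ (proj₁ (proj₂ c)) ‖)
  l-label = l-mono (λ (c , i) → label-sz (at-∈ i)) (l▹ lo)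

  process-ht : HT S processₜ (λ c → o c , k c , R c)
  process-ht = ht-foldˡ {l = p₀} {nilₜ} {processStepₜ} (ht-flat p₀ refl) (ht-flat nilₜ refl) l-length
    (ht-cons (ht-pair (ht-flat _ refl)
        (ht-∘ (ht-pair (ht-flat _ refl) (ht-pair (ht-∘ (ht-flat ⟪ fstₜ ∘ₜ p₀ , p₁ ⟫ refl) (proj₁ (children-ht l-label l-state))) (ht-flat _ refl)))
          (ht-cong (λ (c , e , o′ , i) → cong (λ st → proj₁ e , childrenOf (proj₁ e) st , k c , R c) (sym (state-≡ (c , e , o′ , i))))
            (Each.finish-at (λ (c , e , _) → proj₁ e) (λ (c , i) → there (∈ₚ.∈-map⁺ proj₁ (at-∈ i))) (λ (c , _ , o′ , _) → o′) (λ (c , i) → appendix i)))))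
      (ht-∘ (ht-flat ⟪ fstₜ ∘ₜ p₀ , p₁ ⟫ refl) (proj₂ (children-ht l-label l-state))))

  rooted : Ctx S → Res
  rooted c = finish (R c) (k c) nil (childrenOf nil (process (R c) (k c) (o c)))

  size-ht : HT S sizeₜ (λ c → o c , k c , R c)
  size-ht = ht-∘ (ht-∘ (ht-pair (ht-flat emptyₜ refl) (ht-pair (ht-∘ (ht-pair (ht-flat emptyₜ refl) process-ht)
      (proj₁ (children-ht (l-const 1) (l-mono (λ c → ≤-trans (ℕₚ.≤-reflexive (cong length (run-≡ c))) (solved-short c (o c))) l-length)))) (ht-flat tl₁ refl)))
      (ht-cong (λ c → cong (λ st → nil , childrenOf nil st , k c , R c) (sym (run-≡ c))) (finish-at (λ _ → nil) (λ _ → here refl) o (λ c → [] , refl))))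
    (ht-flat fstₜ refl)
    where
    run-≡ : ∀ c → ⟦ processₜ ⟧ (o c , k c , R c) ≡ solved-at c (o c)
    run-≡ c = trans (process-≡ (R c) (k c) (o c)) (process-solved (R c) (k c) (o c))

  solve-ht : HT S solveₜ (λ c → o c , k c , R c)
  solve-ht = ht-case (ht-∘ (ht-pair size-ht (ht-flat p₁ refl)) (drop-ht {m = k} {λ c → ⟦ sizeₜ ⟧ (o c , k c , R c)} lk)) (ht-flat _ refl) (ht-flat _ refl)

-- The whole algorithm

-- The parameter is converted to unary notation; it is truncated at the number
-- of edges because it may be exponential in the size of the input.

takeStep : Num × Num → Num × Num
takeStep s = caseL (proj₁ s) s (λ _ t → t , tt ∷ proj₂ s)

takeB : ∀ {A : Set} → List A → Num → Num
takeB fuel l = proj₂ (foldr (λ _ → takeStep) (l , []) fuel)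

takeₚ : ∀ {a} → Poly (list a ⊗ numT) numT
takeₚ = sndₚ ⊙ foldAddₚ {b = _} {numT ⊗ numT} fstₚ ⟨ sndₚ , nilₚ ⟩ₚ (caseₚ (fstₚ ⊙ v₁) v₁ ⟨ v₁ , consₚ unitₚ (sndₚ ⊙ fstₚ ⊙ sndₚ ⊙ sndₚ ⊙ sndₚ) ⟩ₚ) (pb-const 0)
  (λ x u acc _ → smaller acc)
  where
  smaller : ∀ s → sz (numT ⊗ numT) (takeStep s) ≤ₙ sz (numT ⊗ numT) s
  smaller ([] , out)    = ≤-refl
  smaller (_ ∷ l , out) = ℕₚ.≤-reflexive (eq (sz numT l) (sz numT out))
    where
    eq : ∀ a b → suc (a + suc (1 + b)) ≡ suc (suc (1 + a) + b)
    eq = solve-∀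

take-length : ∀ {A : Set} (fuel : List A) l → length (takeB fuel l) ≡ length fuel ⊓ length l
take-length fuel l = proj₂ (go fuel)
  where
  go : ∀ {A : Set} (fuel : List A) → length (proj₁ (foldr (λ _ → takeStep) (l , []) fuel)) ≡ length l ∸ length fuel
       × length (proj₂ (foldr (λ _ → takeStep) (l , []) fuel)) ≡ length fuel ⊓ length l
  go [] = refl , refl
  go (_ ∷ fuel) with foldr (λ _ → takeStep) (l , []) fuel | go fuel
  ... | [] , out | e , e′ = trans (sym (ℕₚ.m≤n⇒m∸n≡0 (ℕₚ.m≤n⇒m≤1+n le))) refl , trans e′ (trans (ℕₚ.m≥n⇒m⊓n≡n le) (sym (ℕₚ.m≥n⇒m⊓n≡n (ℕₚ.m≤n⇒m≤1+n le))))
    where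
    le : length l ≤ₙ length fuel
    le = ℕₚ.m∸n≡0⇒m≤n (sym e)
  ... | _ ∷ rem , out | e , e′ = trans (cong Data.Nat.Base.pred e) (ℕₚ.pred[m∸n]≡m∸[1+n] (length l) (length fuel)) ,
        trans (cong suc (trans e′ (ℕₚ.m≤n⇒m⊓n≡m (ℕₚ.<⇒≤ lt)))) (sym (ℕₚ.m≤n⇒m⊓n≡m lt))
    where
    lt : length fuel <ₙ length l
    lt = ℕₚ.≰⇒> (λ le → ℕₚ.1+n≢0 (trans e (ℕₚ.m≤n⇒m∸n≡0 le)))

clampStep : Pairs → Bool → Num → Num
clampStep E b acc = takeB E (if b then tt ∷ appB acc acc else tt ∷ tt ∷ appB acc acc)

clamp : Pairs → List Bool → Num
clamp E = foldr (clampStep E) []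

bits : ℕᵇ.ℕᵇ → List Bool
bits ℕᵇ.zero     = []
bits ℕᵇ.2[1+ x ] = false ∷ bits x
bits ℕᵇ.1+[2 x ] = true ∷ bits x

enc-bits : ∀ x → enc (list bool) (bits x) ≡ encodeℕᵇ x
enc-bits ℕᵇ.zero     = refl
enc-bits ℕᵇ.2[1+ x ] = cong (nil ∙_) (enc-bits x)
enc-bits ℕᵇ.1+[2 x ] = cong ((nil ∙ nil) ∙_) (enc-bits x)

-- Truncating before doubling does not change the truncated result, so k can be read digit by digit
-- without large intermediate numbers.
clamp-twice : ∀ e n j → e ⊓ (j + (e ⊓ n + e ⊓ n)) ≡ e ⊓ (j + (n + n))
clamp-twice e n j with ℕₚ.≤-total e n
... | inj₁ le rewrite ℕₚ.m≤n⇒m⊓n≡m le = trans (ℕₚ.m≤n⇒m⊓n≡m (≤-trans (ℕₚ.m≤m+n e e) (ℕₚ.m≤n+m _ j)))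
      (sym (ℕₚ.m≤n⇒m⊓n≡m (≤-trans (≤-trans le (ℕₚ.m≤m+n n n)) (ℕₚ.m≤n+m _ j))))
... | inj₂ le rewrite ℕₚ.m≥n⇒m⊓n≡n le = refl

clamp-length : ∀ E x → length (clamp E (bits x)) ≡ length E ⊓ ℕᵇ.toℕ x
clamp-length E ℕᵇ.zero = sym (ℕₚ.⊓-zeroʳ (length E))
clamp-length E ℕᵇ.2[1+ x ] = trans (take-length E (tt ∷ tt ∷ appB K K)) (trans (cong (λ i → length E ⊓ (2 + i)) (twice x))
  (trans (clamp-twice (length E) (ℕᵇ.toℕ x) 2) (cong (length E ⊓_) (eq (ℕᵇ.toℕ x)))))
  where
  K : Num
  K = clamp E (bits x)
  twice : ∀ x → length (appB (clamp E (bits x)) (clamp E (bits x))) ≡ length E ⊓ ℕᵇ.toℕ x + length E ⊓ ℕᵇ.toℕ x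
  twice x = trans (cong length (foldr-∷ (clamp E (bits x)) _)) (trans (Listₚ.length-++ (clamp E (bits x))) (cong₂ _+_ (clamp-length E x) (clamp-length E x)))
  eq : ∀ n → 2 + (n + n) ≡ 2 * (1 + n)
  eq = solve-∀
clamp-length E ℕᵇ.1+[2 x ] = trans (take-length E (tt ∷ appB K K)) (trans (cong (λ i → length E ⊓ (1 + i)) (twice x))
  (trans (clamp-twice (length E) (ℕᵇ.toℕ x) 1) (cong (length E ⊓_) (eq (ℕᵇ.toℕ x)))))
  where
  K : Num
  K = clamp E (bits x)
  twice : ∀ x → length (appB (clamp E (bits x)) (clamp E (bits x))) ≡ length E ⊓ ℕᵇ.toℕ x + length E ⊓ ℕᵇ.toℕ x
  twice x = trans (cong length (foldr-∷ (clamp E (bits x)) _)) (trans (Listₚ.length-++ (clamp E (bits x))) (cong₂ _+_ (clamp-length E x) (clamp-length E x)))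
  eq : ∀ n → 1 + (n + n) ≡ 1 + 2 * n
  eq = solve-∀

num-sz : ∀ (l : Num) → sz numT l ≡ 1 + (length l + length l)
num-sz [] = refl
num-sz (_ ∷ l) = cong suc (trans (cong suc (num-sz l)) (sym (cong suc (ℕₚ.+-suc (length l) (length l)))))

clampₚ : Poly (list (val ⊗ val) ⊗ list bool) numT
clampₚ = foldₚ sndₚ nilₚ
  (takeₚ ⊙ ⟨ fstₚ ⊙ sndₚ ⊙ sndₚ , ifₚ v₀ (consₚ unitₚ (appendₚ v₁ v₁)) (consₚ unitₚ (consₚ unitₚ (appendₚ v₁ v₁))) ⟩ₚ)
  (pb-+ (pb-const 1) (pb-+ (space fstₚ) (space fstₚ))) (λ x l _ → small′ (proj₁ x) l)
  where
  small′ : ∀ E l → sz numT (clamp E l) ≤ₙ 1 + (sz (list (val ⊗ val)) E + sz (list (val ⊗ val)) E)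
  small′ E [] = s≤s z≤n
  small′ E (b ∷ l) = ≤-trans (ℕₚ.≤-reflexive (num-sz (clamp E (b ∷ l)))) (s≤s (ℕₚ.+-mono-≤ short short))
    where
    short : length (clamp E (b ∷ l)) ≤ₙ sz (list (val ⊗ val)) E
    short = ≤-trans (ℕₚ.≤-reflexive (take-length E (if b then tt ∷ appB (clamp E l) (clamp E l) else tt ∷ tt ∷ appB (clamp E l) (clamp E l))))
      (≤-trans (ℕₚ.m⊓n≤m (length E) _) (length≤sz {val ⊗ val} E))

inT : Ty
inT = val ⊗ list (val ⊗ val) ⊗ list (val ⊗ val) ⊗ list bool

input : Instance → El inT
input I = encodeℕ (order (T I)) , labels (edges (T I)) , labels (Instance.R I) , bits (ℕᵇ.fromℕ (Instance.k I))

enc-labels : ∀ {n} (es : List (Fin n × Fin n)) → enc (list (val ⊗ val)) (labels es) ≡ encodePairs es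
enc-labels []       = refl
enc-labels (e ∷ es) = cong (encodePair e ∙_) (enc-labels es)

enc-input : ∀ I → enc inT (input I) ≡ encode I
enc-input I = cong (encodeℕ (order (T I)) ∙_) (cong₂ _∙_ (enc-labels (edges (T I))) (cong₂ _∙_ (enc-labels (Instance.R I)) (enc-bits (ℕᵇ.fromℕ (Instance.k I)))))

-- A request between a vertex and itself can never be separated. It is tested beforehand, since the
-- argument on trees assumes that singletons are quiet.
selfₚ : Poly inT bool
selfₚ = anyₚ (fstₚ ⊙ sndₚ ⊙ sndₚ) (eqₚ (fstₚ ⊙ v₀) (sndₚ ⊙ v₀))

setupₚ : Poly inT (list (val ⊗ val) ⊗ numT ⊗ reqT)
setupₚ = ⟨ rootOrderₚ ⊙ fstₚ ⊙ sndₚ , ⟨ clampₚ ⊙ ⟨ fstₚ ⊙ sndₚ , sndₚ ⊙ sndₚ ⊙ sndₚ ⟩ₚ , fstₚ ⊙ sndₚ ⊙ sndₚ ⟩ₚ ⟩ₚ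

mainWith : ∀ {a} → Tm inT bool → Tm a bool → Tm inT a → Tm inT bool
mainWith t g h = ifₜ t (boolₜ false) (g ∘ₜ h)

mainₜ : Tm inT bool
mainₜ = mainWith (tm selfₚ) solveₜ (tm setupₚ)

self : Req → Bool
self R = anyB (λ e → eqb {val} (proj₁ e) (proj₂ e)) R

decide : Num → Num → Bool
decide k m = caseL (dropB m k) true (λ _ _ → false)

rooted : Req → Num → Pairs → Res
rooted R k o = finish R k nil (childrenOf nil (process R k o))

self-≡ : ∀ x → ⟦ selfₚ ⟧ₚ x ≡ self (proj₁ (proj₂ (proj₂ x)))
self-≡ x = refl

clamp-≡ : ∀ E b → ⟦ clampₚ ⟧ₚ (E , b) ≡ clamp E b
clamp-≡ E b = refl

prepared : El inT → El (list (val ⊗ val) ⊗ numT ⊗ reqT)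
prepared (_ , E , R , b) = rootOrder E , clamp E b , R

setup-≡ : ∀ x → ⟦ setupₚ ⟧ₚ x ≡ prepared x
setup-≡ (_ , E , R , b) = cong₂ _,_ (rootOrder-≡ E) (cong (_, R) (clamp-≡ E b))

-- Stated for arbitrary terms to keep the type checker from unfolding them.

solve-with-≡ : ∀ (g : Tm (val ⊗ list resT ⊗ numT ⊗ reqT) resT) (h : Tm (list (val ⊗ val) ⊗ numT ⊗ reqT) (list (val ⊗ resT))) o k R →
               ⟦ solveWith g h ⟧ (o , k , R) ≡ decide k (size# (⟦ g ⟧ (nil , childrenOf nil (⟦ h ⟧ (o , k , R)) , k , R)))
solve-with-≡ g h o k R = refl

unsolvedKids : Req → Num → Pairs → List Res
unsolvedKids R k o = childrenOf nil (⟦ processₜ ⟧ (o , k , R))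

kids-≡ : ∀ R k o → unsolvedKids R k o ≡ childrenOf nil (process R k o)
kids-≡ R k o = cong (childrenOf nil) (process-≡ R k o)

root-≡ : ∀ R k o → ⟦ finishₜ ⟧ (nil , unsolvedKids R k o , k , R) ≡ finish R k nil (unsolvedKids R k o)
root-≡ R k o = finish-≡ R k nil (unsolvedKids R k o)

solve-root-≡ : ∀ o k R → ⟦ solveₜ ⟧ (o , k , R) ≡ decide k (size# (⟦ finishₜ ⟧ (nil , unsolvedKids R k o , k , R)))
solve-root-≡ o k R = solve-with-≡ finishₜ processₜ o k R

solve-≡ : ∀ o k R → ⟦ solveₜ ⟧ (o , k , R) ≡ decide k (size# (rooted R k o))
solve-≡ o k R = trans (solve-root-≡ o k R) (trans (cong (λ r → decide k (size# r)) (root-≡ R k o)) (cong (λ rs → decide k (size# (finish R k nil rs))) (kids-≡ R k o)))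

verdict : El (list (val ⊗ val) ⊗ numT ⊗ reqT) → Bool
verdict (o , k , R) = decide k (size# (rooted R k o))

verdict-≡ : ∀ y → ⟦ solveₜ ⟧ y ≡ verdict y
verdict-≡ (o , k , R) = solve-≡ o k R

answerOf : El inT → Bool
answerOf x = if self (proj₁ (proj₂ (proj₂ x))) then false else verdict (prepared x)

main-with-≡ : ∀ {a} (t : Tm inT bool) (g : Tm a bool) (h : Tm inT a) x {b y} → ⟦ t ⟧ x ≡ b → ⟦ h ⟧ x ≡ y → ⟦ mainWith t g h ⟧ x ≡ (if b then false else ⟦ g ⟧ y)
main-with-≡ t g h x refl refl = refl

main-step-≡ : ∀ x → ⟦ mainₜ ⟧ x ≡ (if self (proj₁ (proj₂ (proj₂ x))) then false else ⟦ solveₜ ⟧ (prepared x))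
main-step-≡ x = main-with-≡ (tm selfₚ) solveₜ (tm setupₚ) x {self (proj₁ (proj₂ (proj₂ x)))} {prepared x} (self-≡ x) (setup-≡ x)

main-≡ : ∀ x → ⟦ mainₜ ⟧ x ≡ answerOf x
main-≡ x = trans (main-step-≡ x) (cong (λ c → if self (proj₁ (proj₂ (proj₂ x))) then false else c) (verdict-≡ (prepared x)))

rooted-result : ∀ R k o → rooted R k o ≡ result R k (rose o)
rooted-result R k o = cong (finish R k nil) (trans (cong (childrenOf nil) (process-solved R k o)) (childrenOf-solved R k nil (foldr hang [] o)))

decide-reflects : ∀ k m → Reflects (length m ≤ₙ length k) (decide k m)
decide-reflects k m with dropB m k | length-drop m k
... | []    | e = ofʸ (ℕₚ.m∸n≡0⇒m≤n (sym e))
... | _ ∷ l | e = ofⁿ (λ le → ℕₚ.1+n≢0 (trans e (ℕₚ.m≤n⇒m∸n≡0 le)))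

-- Correctness of the answer

module Correct (I : Instance) where

  open Rooted (T I) (isTree I)

  requests : Req
  requests = labels (Instance.R I)

  kU : Num
  kU = clamp E (bits (ℕᵇ.fromℕ (Instance.k I)))

  kU-length : length kU ≡ length E ⊓ Instance.k I
  kU-length = trans (clamp-length E (ℕᵇ.fromℕ (Instance.k I))) (cong (length E ⊓_) (ℕᵇₚ.toℕ-fromℕ (Instance.k I)))

  self-no : self requests ≡ true → ¬ YesInstance I
  self-no e (E' , _ , _ , _ , sep) with anyB-true requests e
  ... | d , i , h with ∈ₚ.∈-map⁻ labs i
  ...   | (u , w) , j , refl with lab-inj {u = u} {w} (eqb-true val h)
  ...     | refl = sep u u j (stop , [] ∷ [])

  irreflexive : self requests ≡ false → ∀ x → ¬ (x , x) ∈ requests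
  irreflexive e x i = true≢false (eqb-refl val x) (anyB-false {l = requests} e i)

  rose-unique : Unique (verts (rose o))
  rose-unique = allPairs-↭ (λ ne e → ne (sym e)) (↭-sym (rose-verts order-o)) (order-unique order-o)

  answer : Bool
  answer = answerOf (input I)

  solved-reflects : self requests ≡ false → Reflects (YesInstance I) (decide kU (size# (rooted requests kU o)))
  solved-reflects e = subst (λ q → Reflects (YesInstance I) (decide kU (size# q))) (sym (rooted-result requests kU o)) (go (decide-reflects kU (size# res)))
    where
    res : Res
    res = result requests kU (rose o)
    go : ∀ {b} → Reflects (length (size# res) ≤ₙ length kU) b → Reflects (YesInstance I) b
    go (ofʸ le) = ofʸ (let C , n , s , n≤ = result-correct kU (rose o) (irreflexive e) rose-unique le
                           E' , u , sub , le′ , sep = sol-separates (Instance.R I) s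
                       in E' , u , sub , ≤-trans le′ (≤-trans n≤ (≤-trans (ℕₚ.≤-reflexive kU-length) (ℕₚ.m⊓n≤n (length E) (Instance.k I)))) , sep)
    go (ofⁿ gt) = ofⁿ (λ (E' , u , sub , le , sep) → let C , n , s , n≤ = separated-sol (Instance.R I) sep in
      gt (≤-trans (proj₁ (result-good kU (rose o) (irreflexive e) rose-unique) s) (≤-trans n≤ (≤-trans
        -- A multicut is a subset of the edges, so truncating k at their number excludes none.
        (ℕₚ.⊓-glb (≤-trans (unique-⊆-length u sub) (ℕₚ.≤-reflexive (sym (Listₚ.length-map labs (edges (T I)))))) le) (ℕₚ.≤-reflexive (sym kU-length))))))

  answer-reflects : Reflects (YesInstance I) answer
  answer-reflects = go (self requests) refl
    where
    go : ∀ b → self requests ≡ b → Reflects (YesInstance I) (if b then false else decide kU (size# (rooted requests kU o)))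
    go true  e = ofⁿ (self-no e)
    go false e = solved-reflects e

  main-answer : ⟦ mainₜ ⟧ (input I) ≡ answer
  main-answer = main-≡ (input I)

abstract
  cap : ℕ → ℕ
  cap m = _/_ (31 ** m) (20 ** m) {{ℕₚ.m^n≢0 20 m}}

  cap-weak : ∀ m → 20 ** m * cap m ≤ₙ 31 ** m
  cap-weak m = ≤-trans (ℕₚ.≤-reflexive (ℕₚ.*-comm (20 ** m) (cap m))) (m/n*n≤m (31 ** m) (20 ** m) {{ℕₚ.m^n≢0 20 m}})

  cap-max : ∀ m n → Weak m n → n ≤ₙ cap m
  cap-max m n h = ≤-trans (ℕₚ.≤-reflexive (sym (m*n/n≡m n (20 ** m) {{ℕₚ.m^n≢0 20 m}})))
    (/-monoˡ-≤ (20 ** m) {{ℕₚ.m^n≢0 20 m}} (≤-trans (ℕₚ.≤-reflexive (ℕₚ.*-comm n (20 ** m))) (weak-elim m h)))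

cap-pos : ∀ m → 1 ≤ₙ cap m
cap-pos m = cap-max m 1 (subst (λ i → Weak i 1) (ℕₚ.+-identityʳ m) (weak-+ 0 m (weak-zero ≤-refl)))

-- Multiplying 20^j W ≤ 31^j by 20^(k-j) ≤ 31^(k-j).

cap-later : ∀ {j k} → j ≤ₙ k → 20 ** k * cap j ≤ₙ 31 ** k
cap-later {j} {k} le = subst (λ i → 20 ** i * cap j ≤ₙ 31 ** i) (ℕₚ.m∸n+n≡m le) (go (k ∸ j))
  where
  go : ∀ d → 20 ** (d + j) * cap j ≤ₙ 31 ** (d + j)
  go zero    = cap-weak j
  go (suc d) = ≤-trans (ℕₚ.≤-reflexive (ℕₚ.*-assoc 20 (20 ** (d + j)) (cap j))) (ℕₚ.*-mono-≤ (ℕₚ.m≤m+n 20 11) (go d))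

instances : Scale
instances = record { Ctx = Instance ; W = λ I → cap (length (Correct.kU I)) ; s = λ I → suc (size I) ; W≥1 = λ I → cap-pos _
  ; s≥2 = λ I → s≤s (1≤‖‖ (encode I)) }

l-input : L instances (λ I → sz inT (input I))
l-input = l-mono (λ I → ≤-trans (ℕₚ.≤-reflexive (cong ‖_‖ (enc-input I))) (ℕₚ.n≤1+n (size I))) l-s

edgesₚ : Poly inT (list (val ⊗ val))
edgesₚ = fstₚ ⊙ sndₚ

requestsₚ : Poly inT reqT
requestsₚ = fstₚ ⊙ sndₚ ⊙ sndₚ

abstract
  main-ht : HT instances mainₜ input
  main-ht = ht-if (ht-poly selfₚ l-input) (ht-flat _ refl) (ht-∘ (ht-poly setupₚ (l▹ l-input)) (ht-cong (λ (I , _) → sym (setup-≡ (input I))) (RunCost.solve-ht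
    (λ (I , _) → Rooted.o (T I) (isTree I)) (λ (I , _) → Rooted.order-o (T I) (isTree I))
    (l▹ (l-space (rootOrderₚ ⊙ edgesₚ) {x = input} l-input))
    (λ (I , _) → Correct.requests I) (l▹ (l-space requestsₚ {x = input} l-input)) (λ (I , e) → Correct.irreflexive I e)
    (λ (I , _) → Correct.kU I) (l-mono (λ (I , _) → ≤-trans (ℕₚ.≤-reflexive (Correct.kU-length I)) (≤-trans (ℕₚ.m⊓n≤m _ _) (length≤sz {val ⊗ val} (proj₁ (proj₂ (input I))))))
      (l▹ (l-space edgesₚ {x = input} l-input)))
    (λ (I , _) → cap-max (length (Correct.kU I))))))

module _ where

  open import Data.Vec.Base using (Vec; []; _∷_)

  quote-run : ∀ {n} (P : Val) (γ : Vec Val n) v → Σ[ t ∈ ℕ ] Evaluation._⊢_⇓_⟨_⟩ (interpreter P) γ (quoteV v) v t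
  quote-run P γ nil     = 1 , Evaluation.nil
  quote-run P γ (a ∙ b) = _ , Evaluation.cons (proj₂ (quote-run P γ a)) (proj₂ (quote-run P γ b))

  quoteCost : Val → ℕ
  quoteCost nil     = 1
  quoteCost (a ∙ b) = suc (quoteCost a + quoteCost b)

  quote-cost : ∀ {n} P (γ : Vec Val n) v → proj₁ (quote-run P γ v) ≡ quoteCost v
  quote-cost P γ nil     = refl
  quote-cost P γ (a ∙ b) = cong suc (cong₂ _+_ (quote-cost P γ a) (quote-cost P γ b))

  program-run : ∀ {a b} (t : Tm a b) (x : El a) →
                Σ[ n ∈ ℕ ] (Runs (interpreter ⌜ t ⌝) (enc a x) (enc b (⟦ t ⟧ x)) n × n ≤ₙ 2 + quoteCost ⌜ t ⌝ + bd t x)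
  program-run {a} t x = _ , Evaluation.call (proj₂ (quote-run ⌜ t ⌝ (enc a x ∷ []) ⌜ t ⌝) Evaluation.∷ (Evaluation.var _ Evaluation.∷ Evaluation.[]))
                                        (proj₂ (Simulation.run ⌜ t ⌝ t x)) ,
    ≤-trans (ℕₚ.≤-reflexive (trans (cong (λ n → suc (n + 1 + Simulation.cost ⌜ t ⌝ t x)) (quote-cost ⌜ t ⌝ (enc a x ∷ []) ⌜ t ⌝)) (eq (quoteCost ⌜ t ⌝) _)))
      (ℕₚ.+-monoʳ-≤ (2 + quoteCost ⌜ t ⌝) (cost≤bd ⌜ t ⌝ t x))
    where
    eq : ∀ n c → suc (n + 1 + c) ≡ 2 + n + c
    eq = solve-∀

monomial : ℕ → Polynomial
monomial zero    = 1 ∷ []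
monomial (suc e) = 0 ∷ monomial e

eval-monomial : ∀ e n → eval (monomial e) n ≡ n ** e
eval-monomial zero n    = cong suc (ℕₚ.*-zeroʳ n)
eval-monomial (suc e) n = cong (n *_) (eval-monomial e n)

suc-power : ∀ e {n} → 1 ≤ₙ n → suc n ** e ≤ₙ 2 ** e * n ** e
suc-power zero pos = ≤-refl
suc-power (suc e) {n} pos = ≤-trans (ℕₚ.*-mono-≤ (ℕₚ.+-monoˡ-≤ n pos) (suc-power e pos)) (ℕₚ.≤-reflexive (eq n (2 ** e) (n ** e)))
  where
  eq : ∀ n a b → (n + n) * (a * b) ≡ 2 * a * (n * b)
  eq = solve-∀

Solvable : Set
Solvable = Σ[ P ∈ Program ] Σ[ C ∈ ℕ ] Σ[ p ∈ Polynomial ]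
    ((I : Instance) → Σ[ b ∈ Bool ] Σ[ t ∈ ℕ ]
      ( Runs P (encode I) (encodeBool b) t
      × Reflects (YesInstance I) b
      × t ≤ ρ ↑ k I · (C * eval p (size I)) ))

-- Stated for an arbitrary term t to keep the type checker from unfolding mainₜ.

module _ (t : Tm inT bool) (fast : HT instances t input) (correct : ∀ I → Reflects (YesInstance I) (⟦ t ⟧ (input I))) where

  total-time : O instances (λ I → 2 + quoteCost ⌜ t ⌝ + bd t (input I))
  total-time = o-+ (o-const (2 + quoteCost ⌜ t ⌝)) (time-O fast)

  degree : ℕ
  degree = O.degree total-time

  -- The run is weighted by the truncated parameter; `cap-later` passes to k itself, and 1 + size is
  -- replaced by the size at the price of the constant 2 ** degree.
  weighted : ∀ I {n} → n ≤ₙ 2 + quoteCost ⌜ t ⌝ + bd t (input I) → 20 ** k I * n ≤ₙ 31 ** k I * (2 ** degree * eval (monomial degree) (size I))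
  weighted I n≤ = ≤-trans (ℕₚ.*-monoʳ-≤ (20 ** k I) (≤-trans n≤ (≤-trans (O.bound total-time I)
      (ℕₚ.*-monoʳ-≤ (cap j) (≤-trans (suc-power degree (1≤‖‖ (encode I))) (ℕₚ.≤-reflexive (cong (2 ** degree *_) (sym (eval-monomial degree (size I))))))))))
    (≤-trans (ℕₚ.≤-reflexive (sym (ℕₚ.*-assoc (20 ** k I) (cap j) _))) (ℕₚ.*-monoˡ-≤ _
      (cap-later (≤-trans (ℕₚ.≤-reflexive (Correct.kU-length I)) (ℕₚ.m⊓n≤n _ (k I))))))
    where
    j : ℕ
    j = length (Correct.kU I)

  solvable : Solvable
  solvable = interpreter ⌜ t ⌝ , 2 ** degree , monomial degree , λ I →
    let n , run , n≤ = program-run t (input I) in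
    ⟦ t ⟧ (input I) , n ,
    subst (λ v → Runs (interpreter ⌜ t ⌝) v (encodeBool (⟦ t ⟧ (input I))) n) (enc-input I) run ,
    correct I ,
    λ q above → power-bound (ℚₚ.<⇒≤ (proj₁ above)) (ρ-lower above) (k I) (weighted I n≤)

main-reflects : ∀ I → Reflects (YesInstance I) (⟦ mainₜ ⟧ (input I))
main-reflects I = subst (Reflects (YesInstance I)) (sym (Correct.main-answer I)) (Correct.answer-reflects I)

theorem4p30 : Σ[ P ∈ Program ] Σ[ C ∈ ℕ ] Σ[ p ∈ Polynomial ]
    ((I : Instance) → Σ[ b ∈ Bool ] Σ[ t ∈ ℕ ]
      ( Runs P (encode I) (encodeBool b) t
      × Reflects (YesInstance I) b
      × t ≤ ρ ↑ k I · (C * eval p (size I)) ))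
theorem4p30 = solvable mainₜ main-ht main-reflects
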